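{- Let $x=(x_1,x_2,x_3,\dots)$ be countably many variables. Then, as identities of formal power series in $x$ (with coefficients that are rational functions of $q$; equivalently for complex $|q|<1$), \[ \sum_{\substack{\lambda\\ \text{2-core}(\lambda)=0}} q^{b(\lambda)}\frac{\prod_{h\in\mathcal{H}^{\mathrm{o}}_\lambda}(1-q^h)}{\prod_{h\in\mathcal{H}^{\mathrm{e}}_\lambda}(1-q^h)} s_\lambda(x)=\prod_{i\geq 1}\frac{(qx_i^2;q^2)_\infty}{(x_i^2;q^2)_\infty} \prod_{i<j}\frac{1}{1-x_ix_j}, \] and \[ \sum_{\substack{\lambda\\ \text{2-core}(\lambda)=0}} q^{b(\lambda')} \frac{\prod_{h\in\mathcal{H}^{\mathrm{o}}_\lambda}(1-q^h)}{\prod_{h\in\mathcal{H}^{\mathrm{e}}_\lambda}(1-q^h)}s_\lambda(x)= \prod_{i\geq 1}\frac{(q^2x_i^2;q^2)_\infty}{(qx_i^2;q^2)_\infty} \prod_{i<j}\frac{1}{1-x_ix_j}. \] Both sums run over all partitions $\lambda$ with empty $2$-core.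
   Context: A partition $\lambda=(\lambda_1\ge\lambda_2\ge\cdots)$ is identified with its Young diagram $\{(i,j): 1\le j\le\lambda_i\}$; $\lambda'$ is the conjugate partition. For a box $s=(i,j)\in\lambda$ the hook length is $h(s)=\lambda_i-j+\lambda'_j-i+1$. $\mathcal{H}_\lambda$ is the multiset of hook lengths of $\lambda$, and $\mathcal{H}^{\mathrm{e}}_\lambda$, $\mathcal{H}^{\mathrm{o}}_\lambda$ are its submultisets of even, resp. odd, hook lengths. A partition has empty $2$-core, written $\text{2-core}(\lambda)=0$, if its Young diagram can be tiled by dominoes ($1\times 2$ or $2\times1$ rectangles). The statistic $b$ is \[ b(\lambda):=\sum_{(i,j)\in\lambda}(-1)^{\lambda_i+\lambda_j'-i-j+1}(\lambda_i-i). \] $(a;q)_\infty:=\prod_{k\ge0}(1-aq^k)$. $s_\lambda(x)$ denotes the Schur function in the variables $x_1,x_2,\dots$. -}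

module Defs where

-- Conventions:
--  * A formal power series in m commuting variables with integer
--    coefficients is represented by its coefficient function
--    Ser m = Vec ℕ m → ℤ (exponent vector ↦ coefficient).
--  * For the theorem we use m = suc n variables: variable 0 is q and
--    variables 1..n are x₁..xₙ.
--  * Partitions are lists of positive integers in weakly decreasing
--    order (λ₁ ≥ λ₂ ≥ …), cells are 1-indexed (i , j), 1 ≤ j ≤ λᵢ.

open import Data.Nat as ℕ using (ℕ; zero; suc; _∸_)
open import Data.Integer as ℤ using (ℤ; +_; -[1+_])
open import Data.Bool using (Bool; true; false; if_then_else_; _∧_; not)
open import Data.Fin as Fin using (Fin)
open import Data.List as L using (List; []; _∷_; map; concat; concatMap; foldr; filter; upTo; length; allFin)
open import Data.Vec as V using (Vec; []; _∷_)
import Data.Vec.Properties as VP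
open import Data.Product using (_×_; _,_; Σ; ∃)
open import Relation.Nullary using (Dec; does; yes; no; T?)
open import Data.Bool.ListAction using (all)
open import Relation.Binary.PropositionalEquality using (_≡_)
open import Data.List.Relation.Binary.Permutation.Propositional using (_↭_)

Ser : ℕ → Set
Ser m = Vec ℕ m → ℤ

sumℤ : List ℤ → ℤ
sumℤ = foldr ℤ._+_ (+ 0)

below : ∀ {m} → Vec ℕ m → List (Vec ℕ m)
below [] = [] ∷ []
below (a ∷ e) = concatMap (λ d → map (d ∷_) (below e)) (upTo (suc a))

_∸ᵥ_ : ∀ {m} → Vec ℕ m → Vec ℕ m → Vec ℕ m
_∸ᵥ_ = V.zipWith _∸_

deg : ∀ {m} → Vec ℕ m → ℕ
deg = V.sum

_≡ᵇᵥ_ : ∀ {m} → Vec ℕ m → Vec ℕ m → Bool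
d ≡ᵇᵥ e = does (VP.≡-dec ℕ._≟_ d e)

monomial : ∀ {m} → ℤ → Vec ℕ m → Ser m
monomial c d e = if d ≡ᵇᵥ e then c else + 0

1ₛ : ∀ {m} → Ser m
1ₛ {m} = monomial (+ 1) (V.replicate m 0)

var : ∀ {m} → Fin m → Ser m
var {m} i = monomial (+ 1) (V.tabulate (λ j → if does (i Fin.≟ j) then 1 else 0))

_+ₛ_ : ∀ {m} → Ser m → Ser m → Ser m
(f +ₛ g) e = f e ℤ.+ g e

_-ₛ_ : ∀ {m} → Ser m → Ser m → Ser m
(f -ₛ g) e = f e ℤ.- g e

_*ₛ_ : ∀ {m} → Ser m → Ser m → Ser m
(f *ₛ g) e = sumℤ (map (λ d → f d ℤ.* g (e ∸ᵥ d)) (below e))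

infixl 6 _+ₛ_ _-ₛ_
infixl 7 _*ₛ_

_^ₛ_ : ∀ {m} → Ser m → ℕ → Ser m
f ^ₛ zero = 1ₛ
f ^ₛ suc r = f *ₛ (f ^ₛ r)

Σₛ : ∀ {m} → List (Ser m) → Ser m
Σₛ = foldr _+ₛ_ (λ _ → + 0)

Πₛ : ∀ {m} → List (Ser m) → Ser m
Πₛ = foldr _*ₛ_ 1ₛ

-- multiplicative inverse of a series f with constant term 1:
-- 1/f = Σ_{r ≥ 0} (1 - f)^r ; the coefficient of x^e only involves
-- r ≤ deg e since (1 - f)^r has no terms of degree < r.
invₛ : ∀ {m} → Ser m → Ser m
invₛ f e = sumℤ (map (λ r → ((1ₛ -ₛ f) ^ₛ r) e) (upTo (suc (deg e))))

-- infinite product Π_{k ≥ 0} F k, for factors with F k - 1 having no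
-- terms of degree ≤ k; the coefficient of x^e only involves the
-- factors k ≤ deg e.
Π∞ : ∀ {m} → (ℕ → Ser m) → Ser m
Π∞ F e = Πₛ (map F (upTo (suc (deg e)))) e

-- q-Pochhammer symbol (a ; t)_∞ = Π_{k ≥ 0} (1 - a t^k)
-- (used with a, t without constant term)
qPoch : ∀ {m} → Ser m → Ser m → Ser m
qPoch a t = Π∞ (λ k → 1ₛ -ₛ a *ₛ (t ^ₛ k))

-- coefficient of q^k x^e in q^s · f, for a series f in (q, x) and
-- integers s, k (Laurent shift)
shiftCoeff : ∀ {n} → ℤ → Ser (suc n) → ℤ → Vec ℕ n → ℤ
shiftCoeff s f k e with k ℤ.- s
... | + j = f (j ∷ e)
... | -[1+ _ ] = + 0

Partition : Set
Partition = List ℕ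

-- parts f s mx : all partitions of size s with all parts ≤ mx
-- (f is recursion fuel; f ≥ s suffices since every part is ≥ 1)
parts : ℕ → ℕ → ℕ → List Partition
parts _ zero _ = [] ∷ []
parts zero (suc _) _ = []
parts (suc f) s mx =
  concatMap (λ k → map (suc k ∷_) (parts f (s ∸ suc k) (suc k)))
            (upTo (ℕ._⊓_ mx s))

partitionsOf : ℕ → List Partition
partitionsOf s = parts s s s

partitionsUpTo : ℕ → List Partition
partitionsUpTo N = concatMap partitionsOf (upTo (suc N))

-- λᵢ (1-indexed; 0 beyond the length)
row : Partition → ℕ → ℕ
row [] _ = 0
row (a ∷ p) zero = 0
row (a ∷ p) (suc zero) = a
row (a ∷ p) (suc (suc i)) = row p (suc i)

col : Partition → ℕ → ℕ
col p j = length (filter (λ a → j ℕ.≤? a) p)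

range1 : ℕ → List ℕ
range1 k = map suc (upTo k)

conj : Partition → Partition
conj p = map (col p) (range1 (row p 1))

Cell : Set
Cell = ℕ × ℕ

cells : Partition → List Cell
cells p = concatMap (λ i → map (λ j → (i , j)) (range1 (row p i))) (range1 (length p))

hook : Partition → Cell → ℕ
hook p (i , j) = (row p i ∸ j) ℕ.+ (col p j ∸ i) ℕ.+ 1

hooks : Partition → List ℕ
hooks p = map (hook p) (cells p)

hooksOdd hooksEven : Partition → List ℕ
hooksOdd p = filter (λ h → h ℕ.% 2 ℕ.≟ 1) (hooks p)
hooksEven p = filter (λ h → h ℕ.% 2 ℕ.≟ 0) (hooks p)

signPow : ℤ → ℤ
signPow m = if does (ℤ.∣ m ∣ ℕ.% 2 ℕ.≟ 0) then + 1 else ℤ.- (+ 1)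

bstat : Partition → ℤ
bstat p = sumℤ (map term (cells p))
  where
  term : Cell → ℤ
  term (i , j) =
    signPow (+ row p i ℤ.+ + col p j ℤ.- + i ℤ.- + j ℤ.+ + 1)
    ℤ.* (+ row p i ℤ.- + i)

-- Empty 2-core: the Young diagram can be tiled by dominoes

data Domino : Set where
  horiz : ℕ → ℕ → Domino
  vert  : ℕ → ℕ → Domino

dominoCells : Domino → List Cell
dominoCells (horiz i j) = (i , j) ∷ (i , suc j) ∷ []
dominoCells (vert i j) = (i , j) ∷ (suc i , j) ∷ []

Tileable : Partition → Set
Tileable p = Σ (List Domino) (λ ds → concatMap dominoCells ds ↭ cells p)

words : ℕ → ℕ → List (List ℕ)
words zero n = [] ∷ []
words (suc len) n = concatMap (λ a → map (a ∷_) (words len n)) (range1 n)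

fillings : Partition → ℕ → List (List (List ℕ))
fillings p n = foldr (λ a acc → concatMap (λ w → map (w ∷_) acc) (words a n)) ([] ∷ []) p

entry : List (List ℕ) → Cell → ℕ
entry T (i , j) = row (row′ T i) j
  where
  row′ : List (List ℕ) → ℕ → List ℕ
  row′ [] _ = []
  row′ (r ∷ T) zero = []
  row′ (r ∷ T) (suc zero) = r
  row′ (r ∷ T) (suc (suc i)) = row′ T (suc i)

isSSYT : Partition → List (List ℕ) → Bool
isSSYT p T = all ok (cells p)
  where
  ok : Cell → Bool
  ok (i , j) =
    (if does (suc j ℕ.≤? row p i)
       then does (entry T (i , j) ℕ.≤? entry T (i , suc j)) else true)
    ∧ (if does (suc i ℕ.≤? col p j)
       then does (entry T (i , j) ℕ.<? entry T (suc i , j)) else true)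

content : (n : ℕ) → List (List ℕ) → Vec ℕ n
content n T = V.tabulate {n = n}
  (λ k → length (filter (λ a → a ℕ.≟ suc (Fin.toℕ k)) (concat T)))

schur : (n : ℕ) → Partition → Ser (suc n)
schur n p = Σₛ (map (λ T → monomial (+ 1) (0 ∷ content n T))
                    (filter (λ T → T? (isSSYT p T)) (fillings p n)))

qv : ∀ {n} → Ser (suc n)
qv = var Fin.zero

xv : ∀ {n} → Fin n → Ser (suc n)
xv i = var (Fin.suc i)

hookFactor : (n : ℕ) → Partition → Ser (suc n)
hookFactor n p =
  Πₛ (map (λ h → 1ₛ -ₛ qv ^ₛ h) (hooksOdd p))
  *ₛ invₛ (Πₛ (map (λ h → 1ₛ -ₛ qv ^ₛ h) (hooksEven p)))

-- coefficient of q^k x^e (k ∈ ℤ, e ∈ ℕⁿ) in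
--   Σ_{λ, 2-core(λ)=0} q^{β(λ)} hookFactor(λ) s_λ(x₁,…,xₙ).
-- Only partitions with |λ| = deg e contribute (s_λ is homogeneous of
-- degree |λ|); the sum is taken over all λ with |λ| ≤ deg e.
-- The empty-2-core condition is decided by an arbitrary decision
-- procedure for Tileable.
lhsCoeff : (tile? : (p : Partition) → Dec (Tileable p)) →
           (Partition → ℤ) → (n : ℕ) → ℤ → Vec ℕ n → ℤ
lhsCoeff tile? β n k e =
  sumℤ (map (λ p → shiftCoeff (β p) (hookFactor n p *ₛ schur n p) k e)
            (filter tile? (partitionsUpTo (deg e))))

pairs : (n : ℕ) → List (Fin n × Fin n)
pairs n = concatMap (λ i → map (i ,_) (filter (λ j → i Fin.<? j) (allFin n))) (allFin n)

crossProd : (n : ℕ) → Ser (suc n)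
crossProd n = Πₛ (map (λ { (i , j) → invₛ (1ₛ -ₛ xv i *ₛ xv j) }) (pairs n))

rhs₁ : (n : ℕ) → Ser (suc n)
rhs₁ n =
  Πₛ (map (λ i → qPoch (qv *ₛ xv i ^ₛ 2) (qv ^ₛ 2)
                 *ₛ invₛ (qPoch (xv i ^ₛ 2) (qv ^ₛ 2))) (allFin n))
  *ₛ crossProd n

rhs₂ : (n : ℕ) → Ser (suc n)
rhs₂ n =
  Πₛ (map (λ i → qPoch (qv ^ₛ 2 *ₛ xv i ^ₛ 2) (qv ^ₛ 2)
                 *ₛ invₛ (qPoch (qv *ₛ xv i ^ₛ 2) (qv ^ₛ 2))) (allFin n))
  *ₛ crossProd n

{-# OPTIONS --safe #-}
module Submission where

-- Take N = 2m variables, the last one possibly zero, and put l_i = λ_i + N - i.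
-- In terms of l the hook product and the power of q become
--   C(l) = Π_i G(l_i) Π_{i<j} κ(l_i, l_j),
-- with κ(a, b) = z_a - z_b if a ≡ b mod 2 and its inverse otherwise, where
-- z_l = q^(-l) for the first identity and z_l = - q^l for the second; moreover
-- λ is tileable iff as many l_i are even as odd. Extended by 0 to the other l,
-- C is a Cauchy determinant, hence expands like a Pfaffian:
--   C(a, l_2, …, l_N) = Σ_j ± C(a, l_j) C(l without a, l_j).
-- By the branching rule the Vandermonde V times Σ_λ C(λ + δ) s_λ is Σ_l C(l) x^l.
-- Schur's Pfaffian of (x_i - x_j) / (1 - x_i x_j) gives the same kind of
-- expansion for V Π_i f(x_i) Π_{i<j} 1 / (1 - x_i x_j), so it suffices to treat
-- two variables, where the claim is
--   C(a + 1, b + 1) - C(a, b) = f_a f_{b+1} - f_{a+1} f_b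
-- for f_l = G(l) with l even and 0 otherwise. The q-binomial theorem
-- recognises f as the quotient of q-Pochhammer symbols, and V is cancelled.

open import Algebra.Bundles using (CommutativeMonoid; CommutativeRing)
import Algebra.Properties.AbelianGroup
import Algebra.Properties.Ring
import Algebra.Properties.Semiring.Mult.TCOptimised
import Algebra.Solver.Ring
import Algebra.Solver.Ring.AlmostCommutativeRing as ACR
open import Data.Bool using (Bool; true; false; if_then_else_; _∧_; not)
open import Data.Bool.ListAction using (all)
import Data.Bool.Properties as Boolₚ
open import Data.Empty using (⊥; ⊥-elim)
open import Data.Fin as Fin using (Fin; zero; suc)
import Data.Fin.Properties as Finₚ
open import Data.Integer as ℤ using (ℤ; -[1+_])
import Data.Integer.Properties as ℤₚ
open import Data.List as L using (List; []; _∷_; _++_; map; concatMap; upTo; length)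
import Data.List.Properties as Lₚ
open import Data.List.Relation.Binary.Permutation.Propositional as Perm using (_↭_)
import Data.List.Relation.Binary.Permutation.Propositional.Properties as Permₚ
open import Data.List.Relation.Unary.All as All using (All; []; _∷_)
import Data.List.Relation.Unary.All.Properties as Allₚ
open import Data.Maybe using (Maybe; just; nothing)
open import Data.Nat as ℕ using (ℕ; zero; suc; _∸_; _≤_; _<_; z≤n; s≤s)
import Data.Nat.DivMod as DM
import Data.Nat.Properties as ℕₚ
open import Data.Product using (_×_; _,_; proj₁; proj₂; Σ)
open import Data.Sum using (_⊎_; inj₁; inj₂)
open import Data.Unit using (⊤; tt)
open import Data.Vec as Vec using (Vec; []; _∷_)
import Data.Vec.Properties as Vecₚ
open import Defs
open import Function using (_∘_; id)
open import Function.Bundles using (Equivalence)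
open import Level using (0ℓ)
open import Relation.Binary.PropositionalEquality as ≡ using (_≡_)
import Relation.Binary.Reasoning.Setoid as SetoidR
open import Relation.Nullary using (¬_; Dec; yes; no; does; T?)
open import Relation.Nullary.Decidable using (dec-true; dec-false)

-- The product over i < j comes from the hook formula: the hooks of row i and the differences l_i -
-- l_j with j > i are together 1, ..., l_i. Dividing by the factors of the differences moves 1 - q^h
-- to the other side of the fraction; with its power of q this is z_a - z_b for even h = a - b and
-- the inverse for odd h. The exponent of q depends on l alone because a tileable shape has as many
-- even as odd hooks, so that the shift by N in λ_i - i = l_i - N contributes nothing. The power q^b
-- may be negative, so the coefficients are Laurent series over ℤ. These do not form a field, hence
-- the interpolation identities are proved with denominators cleared, inverses are explicit, and V
-- is cancelled as a non-zero-divisor.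

Ring₀ : Set₁
Ring₀ = CommutativeRing 0ℓ 0ℓ

-- Commutative rings: a solver with integer coefficients, and finite sums

module Kit (R : Ring₀) where
  open CommutativeRing R public renaming (Carrier to A; zero to *-zero)
  open Algebra.Properties.Ring ring public using (-‿distribˡ-*; -‿distribʳ-*)
  open Algebra.Properties.AbelianGroup +-abelianGroup public
    using () renaming (⁻¹-involutive to -‿involutive; ⁻¹-∙-comm to -‿+-comm; ε⁻¹≈ε to -0≈0)
  open SetoidR setoid public
  private module M = Algebra.Properties.Semiring.Mult.TCOptimised semiring

  almost : ACR.AlmostCommutativeRing 0ℓ 0ℓ
  almost = ACR.fromCommutativeRing R

  private
    -- With integer coefficients the solver can cancel terms although equality in the ring is
    -- undecidable. The multiple `M.×` is the variant for which `1 M.× x` reduces to `x`, so `:0`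
    -- and `:1` denote `0#` and `1#` on the nose.
    ⟦_⟧ᶻ : ℤ → A
    ⟦ ℤ.+ n ⟧ᶻ = n M.× 1#
    ⟦ -[1+ n ] ⟧ᶻ = - (suc n M.× 1#)

    cancel : ∀ x y → (1# + x) - (1# + y) ≈ x - y
    cancel x y = begin
      (1# + x) + - (1# + y)      ≈⟨ +-cong (+-comm _ _) (sym (-‿+-comm _ _)) ⟩
      (x + 1#) + (- 1# + - y)    ≈⟨ +-assoc _ _ _ ⟩
      x + (1# + (- 1# + - y))    ≈⟨ +-congˡ (sym (+-assoc _ _ _)) ⟩
      x + ((1# + - 1#) + - y)    ≈⟨ +-congˡ (trans (+-congʳ (-‿inverseʳ _)) (+-identityˡ _)) ⟩
      x - y                      ∎

    ⊖-homo : ∀ m n → ⟦ m ℤ.⊖ n ⟧ᶻ ≈ m M.× 1# - n M.× 1#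
    ⊖-homo zero zero = sym (-‿inverseʳ _)
    ⊖-homo zero (suc n) = sym (+-identityˡ _)
    ⊖-homo (suc m) zero = sym (trans (+-congˡ -0≈0) (+-identityʳ _))
    ⊖-homo (suc m) (suc n) = begin
      ⟦ suc m ℤ.⊖ suc n ⟧ᶻ                    ≡⟨ ≡.cong ⟦_⟧ᶻ (ℤₚ.[1+m]⊖[1+n]≡m⊖n m n) ⟩
      ⟦ m ℤ.⊖ n ⟧ᶻ                            ≈⟨ ⊖-homo m n ⟩
      m M.× 1# - n M.× 1#                     ≈⟨ cancel _ _ ⟨
      (1# + m M.× 1#) - (1# + n M.× 1#)       ≈⟨ +-cong (M.1+× m 1#) (-‿cong (M.1+× n 1#)) ⟨
      suc m M.× 1# - suc n M.× 1#             ∎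

    neg-homo : ∀ i → ⟦ ℤ.- i ⟧ᶻ ≈ - ⟦ i ⟧ᶻ
    neg-homo (ℤ.+ zero) = sym -0≈0
    neg-homo (ℤ.+ suc n) = refl
    neg-homo -[1+ n ] = sym (-‿involutive _)

    +-homo : ∀ i j → ⟦ i ℤ.+ j ⟧ᶻ ≈ ⟦ i ⟧ᶻ + ⟦ j ⟧ᶻ
    +-homo (ℤ.+ m) (ℤ.+ n) = M.×-homo-+ 1# m n
    +-homo (ℤ.+ m) -[1+ n ] = ⊖-homo m (suc n)
    +-homo -[1+ m ] (ℤ.+ n) = trans (⊖-homo n (suc m)) (+-comm _ _)
    +-homo -[1+ m ] -[1+ n ] = begin
      - (suc (suc (m ℕ.+ n)) M.× 1#)          ≡⟨ ≡.cong (λ k → - (k M.× 1#)) (≡.cong suc (≡.sym (ℕₚ.+-suc m n))) ⟩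
      - ((suc m ℕ.+ suc n) M.× 1#)            ≈⟨ -‿cong (M.×-homo-+ 1# (suc m) (suc n)) ⟩
      - (suc m M.× 1# + suc n M.× 1#)         ≈⟨ -‿+-comm _ _ ⟨
      - (suc m M.× 1#) + - (suc n M.× 1#)     ∎

    *-homo⁺ : ∀ m j → ⟦ ℤ.+ m ℤ.* j ⟧ᶻ ≈ m M.× 1# * ⟦ j ⟧ᶻ
    *-homo⁺ m (ℤ.+ n) = trans (reflexive (≡.cong ⟦_⟧ᶻ (≡.sym (ℤₚ.pos-* m n)))) (M.×1-homo-* m n)
    *-homo⁺ m -[1+ n ] = begin
      ⟦ ℤ.+ m ℤ.* (ℤ.- (ℤ.+ suc n)) ⟧ᶻ  ≡⟨ ≡.cong ⟦_⟧ᶻ (≡.sym (ℤₚ.neg-distribʳ-* (ℤ.+ m) (ℤ.+ suc n))) ⟩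
      ⟦ ℤ.- (ℤ.+ m ℤ.* ℤ.+ suc n) ⟧ᶻ    ≈⟨ neg-homo (ℤ.+ m ℤ.* ℤ.+ suc n) ⟩
      - ⟦ ℤ.+ m ℤ.* ℤ.+ suc n ⟧ᶻ        ≈⟨ -‿cong (*-homo⁺ m (ℤ.+ suc n)) ⟩
      - (m M.× 1# * suc n M.× 1#)       ≈⟨ -‿distribʳ-* _ _ ⟩
      m M.× 1# * - (suc n M.× 1#)       ∎

    *-homo : ∀ i j → ⟦ i ℤ.* j ⟧ᶻ ≈ ⟦ i ⟧ᶻ * ⟦ j ⟧ᶻ
    *-homo (ℤ.+ m) j = *-homo⁺ m j
    *-homo -[1+ m ] j = begin
      ⟦ ℤ.- (ℤ.+ suc m) ℤ.* j ⟧ᶻ     ≡⟨ ≡.cong ⟦_⟧ᶻ (≡.sym (ℤₚ.neg-distribˡ-* (ℤ.+ suc m) j)) ⟩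
      ⟦ ℤ.- (ℤ.+ suc m ℤ.* j) ⟧ᶻ     ≈⟨ neg-homo (ℤ.+ suc m ℤ.* j) ⟩
      - ⟦ ℤ.+ suc m ℤ.* j ⟧ᶻ         ≈⟨ -‿cong (*-homo⁺ (suc m) j) ⟩
      - (suc m M.× 1# * ⟦ j ⟧ᶻ)      ≈⟨ -‿distribˡ-* _ _ ⟩
      - (suc m M.× 1#) * ⟦ j ⟧ᶻ      ∎

    ℤ⟶R : CommutativeRing.rawRing ℤₚ.+-*-commutativeRing ACR.-Raw-AlmostCommutative⟶ almost
    ℤ⟶R = record { ⟦_⟧ = ⟦_⟧ᶻ ; +-homo = +-homo ; *-homo = *-homo ; -‿homo = neg-homo ; 0-homo = refl ; 1-homo = refl }

    weak≟ : ∀ i j → Maybe (⟦ i ⟧ᶻ ≈ ⟦ j ⟧ᶻ)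
    weak≟ i j with i ℤ.≟ j
    ... | yes p = just (reflexive (≡.cong ⟦_⟧ᶻ p))
    ... | no _ = nothing

  open Algebra.Solver.Ring (CommutativeRing.rawRing ℤₚ.+-*-commutativeRing) almost ℤ⟶R weak≟ public
    using (Polynomial; solve; _:+_; _:*_; _:-_; :-_; _:=_; con)

  :0 :1 : ∀ {m} → Polynomial m
  :0 = con (ℤ.+ 0)
  :1 = con (ℤ.+ 1)

  zeroʳ′ : ∀ {x y} → y ≈ 0# → x * y ≈ 0#
  zeroʳ′ p = trans (*-congˡ p) (zeroʳ _)

  zeroˡ′ : ∀ {x y} → x ≈ 0# → x * y ≈ 0#
  zeroˡ′ p = trans (*-congʳ p) (zeroˡ _)

  0+0 : ∀ {x y} → x ≈ 0# → y ≈ 0# → x + y ≈ 0#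
  0+0 p r = trans (+-cong p r) (+-identityˡ _)

  x-y≈0⇒x≈y : ∀ {x y} → x - y ≈ 0# → x ≈ y
  x-y≈0⇒x≈y {x} {y} p = begin
    x            ≈⟨ solve 2 (λ x y → x := (x :- y) :+ y) refl x y ⟩
    (x - y) + y  ≈⟨ +-congʳ p ⟩
    0# + y       ≈⟨ +-identityˡ y ⟩
    y            ∎

  inverse-unique : ∀ {x y z} → x * y ≈ 1# → x * z ≈ 1# → y ≈ z
  inverse-unique {x} {y} {z} p r = begin
    y            ≈⟨ *-identityʳ y ⟨
    y * 1#       ≈⟨ *-congˡ r ⟨
    y * (x * z)  ≈⟨ solve 3 (λ x y z → y :* (x :* z) := (x :* y) :* z) refl x y z ⟩
    (x * y) * z  ≈⟨ *-congʳ p ⟩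
    1# * z       ≈⟨ *-identityˡ z ⟩
    z            ∎

  unit-cancel : ∀ {u v} → u * v ≈ 1# → ∀ {x y} → u * x ≈ u * y → x ≈ y
  unit-cancel {u} {v} uv {x} {y} p = begin
    x            ≈⟨ *-identityˡ x ⟨
    1# * x       ≈⟨ *-congʳ uv ⟨
    (u * v) * x  ≈⟨ solve 3 (λ u v x → (u :* v) :* x := v :* (u :* x)) refl u v x ⟩
    v * (u * x)  ≈⟨ *-congˡ p ⟩
    v * (u * y)  ≈⟨ solve 3 (λ u v x → v :* (u :* x) := (u :* v) :* x) refl u v y ⟩
    (u * v) * y  ≈⟨ *-congʳ uv ⟩
    1# * y       ≈⟨ *-identityˡ y ⟩
    y            ∎

  pow : A → ℕ → A
  pow x zero = 1#
  pow x (suc n) = x * pow x n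

  pow-cong : ∀ {x y} n → x ≈ y → pow x n ≈ pow y n
  pow-cong zero p = refl
  pow-cong (suc n) p = *-cong p (pow-cong n p)

  pow-+ : ∀ x m n → pow x (m ℕ.+ n) ≈ pow x m * pow x n
  pow-+ x zero n = sym (*-identityˡ _)
  pow-+ x (suc m) n = trans (*-congˡ (pow-+ x m n)) (sym (*-assoc _ _ _))

  pow-* : ∀ x y n → pow (x * y) n ≈ pow x n * pow y n
  pow-* x y zero = sym (*-identityˡ _)
  pow-* x y (suc n) = trans (*-congˡ (pow-* x y n))
    (solve 4 (λ x y a b → (x :* y) :* (a :* b) := (x :* a) :* (y :* b)) refl x y _ _)

  pow-1 : ∀ n → pow 1# n ≈ 1#
  pow-1 zero = refl
  pow-1 (suc n) = trans (*-identityˡ _) (pow-1 n)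

  infixr 8 _▹_
  -- The Iverson bracket. Side conditions of sums are kept as such factors and not as changed
  -- ranges, so that sums can be interchanged before the conditions are used.
  _▹_ : Bool → A → A
  true ▹ x = x
  false ▹ x = 0#

  ▹-cong : ∀ b {x y} → (b ≡ true → x ≈ y) → b ▹ x ≈ b ▹ y
  ▹-cong true p = p ≡.refl
  ▹-cong false p = refl

  ▹-0 : ∀ b {x} → (b ≡ true → x ≈ 0#) → b ▹ x ≈ 0#
  ▹-0 true p = p ≡.refl
  ▹-0 false p = refl

  ▹-∧ : ∀ b c {x} → (b ∧ c) ▹ x ≈ b ▹ c ▹ x
  ▹-∧ true c = refl
  ▹-∧ false c = refl

  ▹-*ˡ : ∀ b c x → c * b ▹ x ≈ b ▹ (c * x)
  ▹-*ˡ true c x = refl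
  ▹-*ˡ false c x = zeroʳ c

  ▹-*ʳ : ∀ b x c → (b ▹ x) * c ≈ b ▹ (x * c)
  ▹-*ʳ true x c = refl
  ▹-*ʳ false x c = zeroˡ c

  ▹-neg : ∀ b x → - (b ▹ x) ≈ b ▹ (- x)
  ▹-neg true x = refl
  ▹-neg false x = -0≈0

  ▹-comm : ∀ b c x → b ▹ c ▹ x ≈ c ▹ b ▹ x
  ▹-comm true c x = refl
  ▹-comm false true x = refl
  ▹-comm false false x = refl

  -- Σ_{i + j = n} f i j
  tri : (ℕ → ℕ → A) → ℕ → A
  tri f zero = f 0 0
  tri f (suc n) = f 0 (suc n) + tri (λ i j → f (suc i) j) n

  tri-cong′ : ∀ {f g} n → (∀ i j → i ℕ.+ j ≡ n → f i j ≈ g i j) → tri f n ≈ tri g n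
  tri-cong′ zero p = p 0 0 ≡.refl
  tri-cong′ (suc n) p = +-cong (p 0 (suc n) ≡.refl) (tri-cong′ n (λ i j e → p (suc i) j (≡.cong suc e)))

  tri-cong : ∀ {f g} → (∀ i j → f i j ≈ g i j) → ∀ n → tri f n ≈ tri g n
  tri-cong p n = tri-cong′ n (λ i j _ → p i j)

  tri-0′ : ∀ {f} n → (∀ i j → i ℕ.+ j ≡ n → f i j ≈ 0#) → tri f n ≈ 0#
  tri-0′ zero p = p 0 0 ≡.refl
  tri-0′ (suc n) p = 0+0 (p 0 (suc n) ≡.refl) (tri-0′ n (λ i j e → p (suc i) j (≡.cong suc e)))

  tri-+ : ∀ f g n → tri (λ i j → f i j + g i j) n ≈ tri f n + tri g n
  tri-+ f g zero = refl
  tri-+ f g (suc n) = trans (+-congˡ (tri-+ (f ∘ suc) (g ∘ suc) n))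
    (solve 4 (λ a b c d → (a :+ b) :+ (c :+ d) := (a :+ c) :+ (b :+ d)) refl _ _ _ _)

  tri-neg : ∀ f n → tri (λ i j → - f i j) n ≈ - tri f n
  tri-neg f zero = refl
  tri-neg f (suc n) = trans (+-congˡ (tri-neg (f ∘ suc) n)) (-‿+-comm _ _)

  tri-*ˡ : ∀ c f n → c * tri f n ≈ tri (λ i j → c * f i j) n
  tri-*ˡ c f zero = refl
  tri-*ˡ c f (suc n) = trans (distribˡ _ _ _) (+-congˡ (tri-*ˡ c (f ∘ suc) n))

  tri-*ʳ : ∀ c f n → tri f n * c ≈ tri (λ i j → f i j * c) n
  tri-*ʳ c f zero = refl
  tri-*ʳ c f (suc n) = trans (distribʳ _ _ _) (+-congˡ (tri-*ʳ c (f ∘ suc) n))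

  tri-last : ∀ f n → tri f (suc n) ≈ tri (λ i j → f i (suc j)) n + f (suc n) 0
  tri-last f zero = refl
  tri-last f (suc n) = trans (+-congˡ (tri-last (f ∘ suc) n)) (sym (+-assoc _ _ _))

  tri-swap : ∀ f n → tri f n ≈ tri (λ i j → f j i) n
  tri-swap f zero = refl
  tri-swap f (suc n) = begin
    f 0 (suc n) + tri (λ i j → f (suc i) j) n   ≈⟨ +-comm _ _ ⟩
    tri (λ i j → f (suc i) j) n + f 0 (suc n)   ≈⟨ +-congʳ (tri-swap (f ∘ suc) n) ⟩
    tri (λ i j → f (suc j) i) n + f 0 (suc n)   ≈⟨ tri-last (λ i j → f j i) n ⟨
    tri (λ i j → f j i) (suc n)                 ∎

  -- Both sides run over i + j + k = n.
  tri-assoc : ∀ (g : ℕ → ℕ → ℕ → A) n →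
    tri (λ i r → tri (g i) r) n ≈ tri (λ r k → tri (λ i j → g i j k) r) n
  tri-assoc g zero = refl
  tri-assoc g (suc n) = begin
    tri (g 0) (suc n) + tri (λ i r → tri (g (suc i)) r) n
      ≈⟨ +-congˡ (tri-assoc (g ∘ suc) n) ⟩
    (g 0 0 (suc n) + tri (λ j k → g 0 (suc j) k) n) + tri (λ r k → tri (λ i j → g (suc i) j k) r) n
      ≈⟨ +-assoc _ _ _ ⟩
    g 0 0 (suc n) + (tri (λ j k → g 0 (suc j) k) n + tri (λ r k → tri (λ i j → g (suc i) j k) r) n)
      ≈⟨ +-congˡ (tri-+ (λ j k → g 0 (suc j) k) (λ r k → tri (λ i j → g (suc i) j k) r) n) ⟨
    tri (λ r k → tri (λ i j → g i j k) r) (suc n) ∎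

  tri-exchange : ∀ (g : ℕ → ℕ → ℕ → A) n →
    tri (λ i r → tri (λ j k → g i j k) r) n ≈ tri (λ j r → tri (λ i k → g i j k) r) n
  tri-exchange g n = begin
    tri (λ i r → tri (g i) r) n                 ≈⟨ tri-assoc g n ⟩
    tri (λ r k → tri (λ i j → g i j k) r) n     ≈⟨ tri-cong (λ r k → tri-swap (λ i j → g i j k) r) n ⟩
    tri (λ r k → tri (λ j i → g i j k) r) n     ≈⟨ tri-assoc (λ j i k → g i j k) n ⟨
    tri (λ j r → tri (λ i k → g i j k) r) n     ∎

  -- The two end terms cancel and the rest is antisymmetric again. The diagonal is a separate
  -- hypothesis because 2x = 0 need not give x = 0.
  tri-anti : ∀ f → (∀ i j → f i j ≈ - f j i) → (∀ i → f i i ≈ 0#) → ∀ n → tri f n ≈ 0#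
  tri-anti f sw di zero = di 0
  tri-anti f sw di (suc zero) = trans (+-congʳ (sw 0 1)) (-‿inverseˡ _)
  tri-anti f sw di (suc (suc n)) = begin
    f 0 (2 ℕ.+ n) + tri (λ i j → f (suc i) j) (suc n)
      ≈⟨ +-congˡ (tri-last (λ i j → f (suc i) j) n) ⟩
    f 0 (2 ℕ.+ n) + (tri (λ i j → f (suc i) (suc j)) n + f (2 ℕ.+ n) 0)
      ≈⟨ +-cong (sw 0 (2 ℕ.+ n)) (+-congʳ (tri-anti (λ i j → f (suc i) (suc j)) (λ i j → sw (suc i) (suc j)) (λ i → di (suc i)) n)) ⟩
    - f (2 ℕ.+ n) 0 + (0# + f (2 ℕ.+ n) 0)
      ≈⟨ +-congˡ (+-identityˡ _) ⟩
    - f (2 ℕ.+ n) 0 + f (2 ℕ.+ n) 0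
      ≈⟨ -‿inverseˡ _ ⟩
    0# ∎

  tri-head : ∀ f n → (∀ i j → suc i ℕ.+ j ≡ n → f (suc i) j ≈ 0#) → tri f n ≈ f 0 n
  tri-head f zero p = refl
  tri-head f (suc n) p = trans (+-congˡ (tri-0′ n (λ i j e → p i j (≡.cong suc e)))) (+-identityʳ _)

  sumL : ∀ {I : Set} → (I → A) → List I → A
  sumL f [] = 0#
  sumL f (x ∷ xs) = f x + sumL f xs

  prodL : ∀ {I : Set} → (I → A) → List I → A
  prodL f [] = 1#
  prodL f (x ∷ xs) = f x * prodL f xs

  prodL-cong : ∀ {I : Set} {f g : I → A} → (∀ i → f i ≈ g i) → ∀ xs → prodL f xs ≈ prodL g xs
  prodL-cong p [] = refl
  prodL-cong p (x ∷ xs) = *-cong (p x) (prodL-cong p xs)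

  prodL-* : ∀ {I : Set} (f g : I → A) xs → prodL (λ i → f i * g i) xs ≈ prodL f xs * prodL g xs
  prodL-* f g [] = sym (*-identityˡ _)
  prodL-* f g (x ∷ xs) = trans (*-congˡ (prodL-* f g xs))
    (solve 4 (λ a b c d → (a :* b) :* (c :* d) := (a :* c) :* (b :* d)) refl _ _ _ _)

  prodL-1 : ∀ {I : Set} {f : I → A} → (∀ i → f i ≈ 1#) → ∀ xs → prodL f xs ≈ 1#
  prodL-1 p [] = refl
  prodL-1 p (x ∷ xs) = trans (*-cong (p x) (prodL-1 p xs)) (*-identityˡ _)

  prodL-map : ∀ {I J : Set} (f : J → A) (h : I → J) xs → prodL f (map h xs) ≡ prodL (f ∘ h) xs
  prodL-map f h [] = ≡.refl
  prodL-map f h (x ∷ xs) = ≡.cong (f (h x) *_) (prodL-map f h xs)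

-- Formal power series, iterated one variable at a time

module _ (R : Ring₀) where
  private module K = Kit R
  open K using (A; _≈_; tri)

  PS : Ring₀
  PS = record
    { Carrier = ℕ → A
    ; _≈_ = λ f g → ∀ n → f n ≈ g n
    ; _+_ = λ f g n → f n K.+ g n
    ; _*_ = λ f g → tri (λ i j → f i K.* g j)
    ; -_ = λ f n → K.- f n
    ; 0# = λ _ → K.0#
    ; 1# = one
    ; isCommutativeRing = record
      { isRing = record
        { +-isAbelianGroup = record
          { isGroup = record
            { isMonoid = record
              { isSemigroup = record
                { isMagma = record
                  { isEquivalence = record
                    { refl = λ n → K.refl
                    ; sym = λ p n → K.sym (p n)
                    ; trans = λ p r n → K.trans (p n) (r n) }
                  ; ∙-cong = λ p r n → K.+-cong (p n) (r n) }
                ; assoc = λ f g h n → K.+-assoc _ _ _ }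
              ; identity = (λ f n → K.+-identityˡ _) , (λ f n → K.+-identityʳ _) }
            ; inverse = (λ f n → K.-‿inverseˡ _) , (λ f n → K.-‿inverseʳ _)
            ; ⁻¹-cong = λ p n → K.-‿cong (p n) }
          ; comm = λ f g n → K.+-comm _ _ }
        ; *-cong = λ p r → K.tri-cong (λ i j → K.*-cong (p i) (r j))
        ; *-assoc = assoc
        ; *-identity = idˡ , (λ f n → K.trans (comm f one n) (idˡ f n))
        ; distrib = (λ f g h n → K.trans (K.tri-cong (λ i j → K.distribˡ _ _ _) n) (K.tri-+ _ _ n))
                  , (λ f g h n → K.trans (K.tri-cong (λ i j → K.distribʳ _ _ _) n) (K.tri-+ _ _ n)) }
      ; *-comm = comm } }
    where
    one : ℕ → A
    one zero = K.1#
    one (suc _) = K.0#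

    _⊛_ : (ℕ → A) → (ℕ → A) → ℕ → A
    (f ⊛ g) = tri (λ i j → f i K.* g j)

    comm : ∀ f g n → (f ⊛ g) n ≈ (g ⊛ f) n
    comm f g n = K.trans (K.tri-swap _ n) (K.tri-cong (λ i j → K.*-comm _ _) n)

    idˡ : ∀ f n → (one ⊛ f) n ≈ f n
    idˡ f n = K.trans (K.tri-head _ n (λ i j _ → K.zeroˡ _)) (K.*-identityˡ _)

    assoc : ∀ f g h n → ((f ⊛ g) ⊛ h) n ≈ (f ⊛ (g ⊛ h)) n
    assoc f g h n = K.begin
      tri (λ r k → tri (λ i j → f i K.* g j) r K.* h k) n
        K.≈⟨ K.tri-cong (λ r k → K.tri-*ʳ (h k) (λ i j → f i K.* g j) r) n ⟩
      tri (λ r k → tri (λ i j → (f i K.* g j) K.* h k) r) n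
        K.≈⟨ K.tri-assoc (λ i j k → (f i K.* g j) K.* h k) n ⟨
      tri (λ i r → tri (λ j k → (f i K.* g j) K.* h k) r) n
        K.≈⟨ K.tri-cong (λ i r → K.tri-cong (λ j k → K.*-assoc _ _ _) r) n ⟩
      tri (λ i r → tri (λ j k → f i K.* (g j K.* h k)) r) n
        K.≈⟨ K.tri-cong (λ i r → K.tri-*ˡ (f i) (λ j k → g j K.* h k) r) n ⟨
      tri (λ i r → f i K.* tri (λ j k → g j K.* h k) r) n K.∎

record Hom (R S : Ring₀) : Set where
  private
    module R = CommutativeRing R
    module S = CommutativeRing S
  field
    ap : R.Carrier → S.Carrier
    ap-cong : ∀ {x y} → x R.≈ y → ap x S.≈ ap y
    ap-+ : ∀ x y → ap (x R.+ y) S.≈ ap x S.+ ap y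
    ap-* : ∀ x y → ap (x R.* y) S.≈ ap x S.* ap y
    ap-1 : ap R.1# S.≈ S.1#
    ap-neg : ∀ x → ap (R.- x) S.≈ S.- ap x
    ap-0 : ap R.0# S.≈ S.0#

  ap-- : ∀ x y → ap (x R.- y) S.≈ ap x S.- ap y
  ap-- x y = S.trans (ap-+ x (R.- y)) (S.+-congˡ (ap-neg y))

  ap-prodL : ∀ {I : Set} (f : I → R.Carrier) xs → ap (Kit.prodL R f xs) S.≈ Kit.prodL S (ap ∘ f) xs
  ap-prodL f [] = ap-1
  ap-prodL f (x ∷ xs) = S.trans (ap-* _ _) (S.*-congˡ (ap-prodL f xs))

  ap-pow : ∀ x n → ap (Kit.pow R x n) S.≈ Kit.pow S (ap x) n
  ap-pow x zero = ap-1
  ap-pow x (suc n) = S.trans (ap-* _ _) (S.*-congˡ (ap-pow x n))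

open Hom using (ap) public

module _ {R S : Ring₀} (h : Hom R S) where
  private
    module S = Kit S
    module R = Kit R

  ap-tri : ∀ f n → ap h (R.tri f n) S.≈ S.tri (λ i j → ap h (f i j)) n
  ap-tri f zero = S.refl
  ap-tri f (suc n) = S.trans (Hom.ap-+ h _ _) (S.+-congˡ (ap-tri (λ i j → f (suc i) j) n))

  mapPS : Hom (PS R) (PS S)
  mapPS = record
    { ap = λ f n → ap h (f n)
    ; ap-cong = λ p n → Hom.ap-cong h (p n)
    ; ap-+ = λ f g n → Hom.ap-+ h _ _
    ; ap-* = λ f g n → S.trans (ap-tri _ n) (S.tri-cong (λ i j → Hom.ap-* h _ _) n)
    ; ap-1 = λ { zero → Hom.ap-1 h ; (suc n) → Hom.ap-0 h }
    ; ap-neg = λ f n → Hom.ap-neg h _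
    ; ap-0 = λ n → Hom.ap-0 h }

module _ (R : Ring₀) where
  private
    module K = Kit R
    module P = Kit (PS R)

  const : K.A → P.A
  const c zero = c
  const c (suc _) = K.0#

  X : P.A
  X zero = K.0#
  X (suc zero) = K.1#
  X (suc (suc _)) = K.0#

  const-* : ∀ c g n → (const c P.* g) n K.≈ c K.* g n
  const-* c g n = K.tri-head _ n (λ i j _ → K.zeroˡ _)

  X-*-zero : ∀ g → (X P.* g) 0 K.≈ K.0#
  X-*-zero g = K.zeroˡ _

  X-*-suc : ∀ g n → (X P.* g) (suc n) K.≈ g n
  X-*-suc g n = K.begin
    K.0# K.* g (suc n) K.+ K.tri (λ i j → X (suc i) K.* g j) n
      K.≈⟨ K.+-cong (K.zeroˡ _) (K.tri-head (λ i j → X (suc i) K.* g j) n (λ i j _ → K.zeroˡ _)) ⟩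
    K.0# K.+ K.1# K.* g n K.≈⟨ K.trans (K.+-identityˡ _) (K.*-identityˡ _) ⟩
    g n K.∎

  constHom : Hom R (PS R)
  constHom = record
    { ap = const
    ; ap-cong = λ { p zero → p ; p (suc n) → K.refl }
    ; ap-+ = λ { x y zero → K.refl ; x y (suc n) → K.sym (K.+-identityˡ _) }
    ; ap-* = λ { x y zero → K.refl ; x y (suc n) → K.sym (K.trans (const-* x (const y) (suc n)) (K.zeroʳ _)) }
    ; ap-1 = λ { zero → K.refl ; (suc n) → K.refl }
    ; ap-neg = λ { x zero → K.refl ; x (suc n) → K.sym K.-0≈0 }
    ; ap-0 = λ { zero → K.refl ; (suc n) → K.refl } }

  ev₀ : Hom (PS R) R
  ev₀ = record
    { ap = λ f → f 0
    ; ap-cong = λ p → p 0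
    ; ap-+ = λ f g → K.refl
    ; ap-* = λ f g → K.refl
    ; ap-1 = K.refl
    ; ap-neg = λ f → K.refl
    ; ap-0 = K.refl }

-- The outermost variable of MPS R (suc n) has index zero.
MPS : Ring₀ → ℕ → Ring₀
MPS R zero = R
MPS R (suc n) = PS (MPS R n)

-- Pfaffian expansions

module Pick (R : Ring₀) {I : Set} where
  open Kit R

  -- Σ_j (-1)^j f x_j (xs without x_j)
  pick : (I → List I → A) → List I → A
  pick f [] = 0#
  pick f (x ∷ xs) = f x xs - pick (λ y ys → f y (x ∷ ys)) xs

  pick-cong : ∀ {f g} → (∀ y ys → f y ys ≈ g y ys) → ∀ xs → pick f xs ≈ pick g xs
  pick-cong p [] = refl
  pick-cong p (x ∷ xs) = +-cong (p x xs) (-‿cong (pick-cong (λ y ys → p y (x ∷ ys)) xs))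

  pick-0 : ∀ {f} → (∀ y ys → f y ys ≈ 0#) → ∀ xs → pick f xs ≈ 0#
  pick-0 p [] = refl
  pick-0 p (x ∷ xs) = 0+0 (p x xs) (trans (-‿cong (pick-0 (λ y ys → p y (x ∷ ys)) xs)) -0≈0)

  pick-+ : ∀ f g xs → pick (λ y ys → f y ys + g y ys) xs ≈ pick f xs + pick g xs
  pick-+ f g [] = sym (+-identityˡ _)
  pick-+ f g (x ∷ xs) = trans (+-congˡ (-‿cong (pick-+ (λ y ys → f y (x ∷ ys)) (λ y ys → g y (x ∷ ys)) xs)))
    (solve 4 (λ a b c d → (a :+ b) :- (c :+ d) := (a :- c) :+ (b :- d)) refl _ _ _ _)

  pick-*ˡ : ∀ c f xs → pick (λ y ys → c * f y ys) xs ≈ c * pick f xs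
  pick-*ˡ c f [] = sym (zeroʳ c)
  pick-*ˡ c f (x ∷ xs) = trans (+-congˡ (-‿cong (pick-*ˡ c (λ y ys → f y (x ∷ ys)) xs)))
    (solve 3 (λ a b c → c :* a :- c :* b := c :* (a :- b)) refl _ _ c)

  pick-neg : ∀ f xs → pick (λ y ys → - f y ys) xs ≈ - pick f xs
  pick-neg f [] = sym -0≈0
  pick-neg f (x ∷ xs) = trans (+-congˡ (-‿cong (pick-neg (λ y ys → f y (x ∷ ys)) xs))) (-‿+-comm _ _)

  -- The removed `y` and the remaining `ys` make up `xs`, so the last factor is the same in every
  -- term.
  pick-prod : ∀ φ f xs → pick (λ y ys → f y ys * (φ y * prodL φ ys)) xs ≈ pick f xs * prodL φ xs
  pick-prod φ f [] = sym (zeroˡ _)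
  pick-prod φ f (x ∷ xs) = begin
    f x xs * (φ x * prodL φ xs) - pick (λ y ys → f y (x ∷ ys) * (φ y * (φ x * prodL φ ys))) xs
      ≈⟨ +-congˡ (-‿cong (trans (pick-cong (λ y ys → solve 4 (λ f a b c → f :* (a :* (b :* c)) := b :* (f :* (a :* c))) refl _ _ _ _) xs)
                                (trans (pick-*ˡ (φ x) _ xs) (*-congˡ (pick-prod φ (λ y ys → f y (x ∷ ys)) xs))))) ⟩
    f x xs * (φ x * prodL φ xs) - φ x * (pick (λ y ys → f y (x ∷ ys)) xs * prodL φ xs)
      ≈⟨ solve 4 (λ f a p b → f :* (a :* p) :- a :* (b :* p) := (f :- b) :* (a :* p)) refl _ _ _ _ ⟩
    (f x xs - pick (λ y ys → f y (x ∷ ys)) xs) * (φ x * prodL φ xs) ∎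

  pairProd : (I → I → A) → List I → A
  pairProd i [] = 1#
  pairProd i (x ∷ xs) = prodL (i x) xs * pairProd i xs

  -- As for `pick-prod`: `y ∷ ys` is a rearrangement of `xs`, and a product of a symmetric `i` over
  -- pairs does not depend on the order.
  pick-pairProd : ∀ i → (∀ x y → i x y ≈ i y x) → ∀ f xs →
    pick (λ y ys → f y ys * pairProd i (y ∷ ys)) xs ≈ pick f xs * pairProd i xs
  pick-pairProd i i-sym f [] = sym (zeroˡ _)
  pick-pairProd i i-sym f (x ∷ xs) = begin
    f x xs * (prodL (i x) xs * pairProd i xs) - pick (λ y ys → f y (x ∷ ys) * pairProd i (y ∷ x ∷ ys)) xs
      ≈⟨ +-congˡ (-‿cong (begin
           pick (λ y ys → f y (x ∷ ys) * ((i y x * prodL (i y) ys) * (prodL (i x) ys * pairProd i ys))) xs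
             ≈⟨ pick-cong (λ y ys → trans (*-congˡ (*-congʳ (*-congʳ (i-sym y x))))
                  (solve 5 (λ f a b c d → f :* ((a :* b) :* (c :* d)) := (f :* (a :* c)) :* (b :* d)) refl _ _ _ _ _)) xs ⟩
           pick (λ y ys → (f y (x ∷ ys) * (i x y * prodL (i x) ys)) * pairProd i (y ∷ ys)) xs
             ≈⟨ pick-pairProd i i-sym (λ y ys → f y (x ∷ ys) * (i x y * prodL (i x) ys)) xs ⟩
           pick (λ y ys → f y (x ∷ ys) * (i x y * prodL (i x) ys)) xs * pairProd i xs
             ≈⟨ *-congʳ (pick-prod (i x) (λ y ys → f y (x ∷ ys)) xs) ⟩
           (pick (λ y ys → f y (x ∷ ys)) xs * prodL (i x) xs) * pairProd i xs ∎)) ⟩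
    f x xs * (prodL (i x) xs * pairProd i xs) - (pick (λ y ys → f y (x ∷ ys)) xs * prodL (i x) xs) * pairProd i xs
      ≈⟨ solve 4 (λ f p q b → f :* (p :* q) :- (b :* p) :* q := (f :- b) :* (p :* q)) refl _ _ _ _ ⟩
    (f x xs - pick (λ y ys → f y (x ∷ ys)) xs) * (prodL (i x) xs * pairProd i xs) ∎

module Lagrange (R : Ring₀) {I : Set} (v : I → CommutativeRing.Carrier R) where
  open Kit R
  open Pick R {I}

  V : List I → A
  V = pairProd (λ x y → v x - v y)

  D : A → List I → A
  D t = prodL (λ k → t - v k)

  -- Writing t - v p = (t - v y) - (v p - v y) completes one of the two products `D` in each term.
  -- Both sums over `P` are then known by hypothesis, one at v p and one at t.
  lagrange-step : ∀ p P → (∀ t → pick (λ y ys → D t ys * V ys) P ≈ V P) →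
    ∀ t → pick (λ y ys → D t ys * V ys) (p ∷ P) ≈ V (p ∷ P)
  lagrange-step p P ih t = begin
    D t P * V P - pick (λ y ys → ((t - v p) * D t ys) * (D (v p) ys * V ys)) P
      ≈⟨ +-congˡ (-‿cong (begin
           pick (λ y ys → ((t - v p) * D t ys) * (D (v p) ys * V ys)) P
             ≈⟨ pick-cong (λ y ys → solve 6 (λ t p y d e w →
                  ((t :- p) :* d) :* (e :* w) := (e :* w) :* ((t :- y) :* d) :+ :- ((d :* w) :* ((p :- y) :* e)))
                  refl t (v p) (v y) _ _ _) P ⟩
           pick (λ y ys → (D (v p) ys * V ys) * ((t - v y) * D t ys) + - ((D t ys * V ys) * ((v p - v y) * D (v p) ys))) P
             ≈⟨ trans (pick-+ _ _ P) (+-cong (pick-prod _ _ P) (trans (pick-neg _ P) (-‿cong (pick-prod _ _ P)))) ⟩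
           pick (λ y ys → D (v p) ys * V ys) P * D t P + - (pick (λ y ys → D t ys * V ys) P * D (v p) P)
             ≈⟨ +-cong (*-congʳ (ih (v p))) (-‿cong (*-congʳ (ih t))) ⟩
           V P * D t P + - (V P * D (v p) P) ∎)) ⟩
    D t P * V P - (V P * D t P + - (V P * D (v p) P))
      ≈⟨ solve 3 (λ d w e → d :* w :- (w :* d :+ :- (w :* e)) := e :* w) refl _ _ _ ⟩
    D (v p) P * V P ∎

  -- Lagrange interpolation of the constant 1 at the nodes `v x`, multiplied by the Vandermonde
  -- product to clear denominators.
  lagrange : ∀ p P t → pick (λ y ys → D t ys * V ys) (p ∷ P) ≈ V (p ∷ P)
  lagrange p [] t = solve 0 (:1 :* :1 :- :0 := :1 :* :1) refl
  lagrange p (p′ ∷ P) = lagrange-step p (p′ ∷ P) (lagrange p′ P)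

  roots : List A → A → A
  roots Z y = prodL (λ z → y - z) Z

  -- Up to the factor `V`, the divided difference at the nodes `v x` of the monic polynomial with
  -- roots `Z`.
  altSum : List A → List I → A
  altSum Z = pick (λ y ys → roots Z (v y) * V ys)

  altSum-[] : ∀ p P → (∀ t → pick (λ y ys → D t ys * V ys) P ≈ V P) → altSum [] (p ∷ P) ≈ 0#
  altSum-[] p P lag = begin
    1# * V P - pick (λ y ys → 1# * (D (v p) ys * V ys)) P
      ≈⟨ +-cong (*-identityˡ _) (-‿cong (trans (pick-*ˡ 1# _ P) (trans (*-identityˡ _) (lag (v p))))) ⟩
    V P - V P ≈⟨ -‿inverseʳ _ ⟩
    0# ∎

  -- Since v y - z = (v p - z) - (v p - v y), the sum splits into a multiple of the one without `z`
  -- and one from which the node `p` is gone.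
  altSum-∷ : ∀ z Z p P → altSum Z P ≈ 0# → altSum Z (p ∷ P) ≈ 0# → altSum (z ∷ Z) (p ∷ P) ≈ 0#
  altSum-∷ z Z p P ih₁ ih₂ = begin
    ((v p - z) * g p) * V P - pick (λ y ys → ((v y - z) * g y) * (D (v p) ys * V ys)) P
      ≈⟨ +-congˡ (-‿cong (begin
           pick (λ y ys → ((v y - z) * g y) * (D (v p) ys * V ys)) P
             ≈⟨ pick-cong (λ y ys → solve 6 (λ y z p g d w →
                  ((y :- z) :* g) :* (d :* w) := (p :- z) :* (g :* (d :* w)) :+ :- ((g :* w) :* ((p :- y) :* d)))
                  refl (v y) z (v p) _ _ _) P ⟩
           pick (λ y ys → (v p - z) * (g y * (D (v p) ys * V ys)) + - ((g y * V ys) * ((v p - v y) * D (v p) ys))) P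
             ≈⟨ trans (pick-+ _ _ P) (+-cong (pick-*ˡ _ _ P) (trans (pick-neg _ P) (-‿cong (pick-prod _ _ P)))) ⟩
           (v p - z) * pick (λ y ys → g y * (D (v p) ys * V ys)) P + - (pick (λ y ys → g y * V ys) P * D (v p) P)
             ≈⟨ +-congˡ (-‿cong (zeroˡ′ ih₁)) ⟩
           (v p - z) * pick (λ y ys → g y * (D (v p) ys * V ys)) P + - 0# ∎)) ⟩
    ((v p - z) * g p) * V P - ((v p - z) * pick (λ y ys → g y * (D (v p) ys * V ys)) P + - 0#)
      ≈⟨ solve 4 (λ c g w q → (c :* g) :* w :- (c :* q :+ :- :0) := c :* (g :* w :- q)) refl _ _ _ _ ⟩
    (v p - z) * (g p * V P - pick (λ y ys → g y * (D (v p) ys * V ys)) P)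
      ≈⟨ zeroʳ′ ih₂ ⟩
    0# ∎
    where
    g : I → A
    g y = roots Z (v y)

  -- A divided difference kills polynomials of degree less than the number of nodes minus one; here
  -- the number of nodes is that of `P` plus one.
  altSum-vanishes : ∀ Z p P → length Z < length P → altSum Z (p ∷ P) ≈ 0#
  altSum-vanishes [] p (p′ ∷ P) lt = altSum-[] p (p′ ∷ P) (lagrange p′ P)
  altSum-vanishes (z ∷ Z) p (p′ ∷ P) (s≤s lt) =
    altSum-∷ z Z p (p′ ∷ P) (altSum-vanishes Z p′ P lt) (altSum-vanishes Z p (p′ ∷ P) (ℕₚ.m≤n⇒m≤1+n lt))

module SchurPfaffian (R : Ring₀) {I : Set} (v : I → CommutativeRing.Carrier R) where
  open Kit R
  open Pick R {I}
  open Lagrange R v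

  N : A → A → List I → A
  N t u = prodL (λ k → t - u * v k)

  N-1 : ∀ t xs → N t 1# xs ≈ D t xs
  N-1 t = prodL-cong (λ k → +-congˡ (-‿cong (*-identityˡ _)))

  B : I → List I → A
  B y ys = N 1# (v y) ys * V ys

  -- 1 for even and 0 for odd length, as ring elements, so that one formula covers both parities.
  σ : List I → A
  σ [] = 1#
  σ (x ∷ xs) = 1# - σ xs

  S₁ : I → List I → A
  S₁ p xs = pick (λ y ys → ((1# - v y * v p) * N 1# (v y) ys) * (D (v p) ys * V ys)) xs

  -- After division by V xs and N u t xs this is the partial fraction expansion of Π (t - u v_k) /
  -- (u - t v_k), whose coefficients are the products of (1 - v_j v_k) / (v_j - v_k) over k ≠ j. The
  -- form homogeneous in t and u admits the point (1, v p), which `S₁-value` needs. This lemma,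
  -- `S₁-value` and `ΣB` are proved by simultaneous induction on `xs`.
  partialFractions : ∀ xs t u →
    V xs * N t u xs ≈ σ xs * (V xs * N u t xs) + pick (λ y ys → ((t - u * v y) * N u t ys) * B y ys) xs

  S₁-value : ∀ p xs → S₁ p xs ≈ V xs * N 1# (v p) xs - σ xs * (V xs * D (v p) xs)
  S₁-value p xs = begin
    S₁ p xs
      ≈⟨ pick-cong (λ y ys → trans
           (solve 5 (λ y p e d w → ((:1 :- y :* p) :* e) :* (d :* w) := ((:1 :- p :* y) :* d) :* (e :* w)) refl (v y) (v p) _ _ _)
           (*-congʳ (*-congˡ (sym (N-1 (v p) ys))))) xs ⟩
    pick (λ y ys → ((1# - v p * v y) * N (v p) 1# ys) * B y ys) xs
      ≈⟨ solve 2 (λ a b → a := (b :+ a) :- b) refl _ (σ xs * (V xs * N (v p) 1# xs)) ⟩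
    (σ xs * (V xs * N (v p) 1# xs) + pick (λ y ys → ((1# - v p * v y) * N (v p) 1# ys) * B y ys) xs) - σ xs * (V xs * N (v p) 1# xs)
      ≈⟨ +-cong (sym (partialFractions xs 1# (v p))) (-‿cong (*-congˡ (*-congˡ (N-1 (v p) xs)))) ⟩
    V xs * N 1# (v p) xs - σ xs * (V xs * D (v p) xs) ∎

  -- In terms of `partialFractions` this is the comparison at t = u = 1, where every quotient is 1;
  -- the induction obtains it from `S₁-value` without dividing by factors 1 - v_k.
  ΣB : ∀ xs → pick B xs ≈ (1# - σ xs) * V xs
  ΣB [] = solve 0 (:0 := (:1 :- :1) :* :1) refl
  ΣB (p ∷ xs) = begin
    N 1# (v p) xs * V xs - S₁ p xs
      ≈⟨ +-congˡ (-‿cong (S₁-value p xs)) ⟩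
    N 1# (v p) xs * V xs - (V xs * N 1# (v p) xs - σ xs * (V xs * D (v p) xs))
      ≈⟨ solve 4 (λ n w s d → n :* w :- (w :* n :- s :* (w :* d)) := (:1 :- (:1 :- s)) :* (d :* w)) refl _ _ _ _ ⟩
    (1# - (1# - σ xs)) * (D (v p) xs * V xs) ∎

  partialFractions [] t u = solve 0 (:1 :* :1 := :1 :* (:1 :* :1) :+ :0) refl
  partialFractions (p ∷ xs) t u = begin
    (d * w) * (c * n)
      ≈⟨ solve 4 (λ d w c n → (d :* w) :* (c :* n) := (d :* c) :* (w :* n)) refl d w c n ⟩
    (d * c) * (w * n)
      ≈⟨ *-congˡ (partialFractions xs t u) ⟩
    (d * c) * (s * (w * n′) + Q)
      ≈⟨ distribˡ _ _ _ ⟩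
    (d * c) * (s * (w * n′)) + (d * c) * Q
      ≈⟨ +-congˡ expand ⟩
    (d * c) * (s * (w * n′)) + ((- P + (S₁ p xs * n′) * c) + ((pick B xs * d) * n′) * c′)
      ≈⟨ +-congˡ (+-cong (+-congˡ (*-congʳ (*-congʳ (S₁-value p xs)))) (*-congʳ (*-congʳ (*-congʳ (ΣB xs))))) ⟩
    (d * c) * (s * (w * n′)) + ((- P + ((w * e - s * (w * d)) * n′) * c) + ((((1# - s) * w) * d) * n′) * c′)
      ≈⟨ solve 8 (λ d w c c′ n′ s e P →
           (d :* c) :* (s :* (w :* n′)) :+ ((:- P :+ ((w :* e :- s :* (w :* d)) :* n′) :* c) :+ ((((:1 :- s) :* w) :* d) :* n′) :* c′)
           := (:1 :- s) :* ((d :* w) :* (c′ :* n′)) :+ ((c :* n′) :* (e :* w) :- P)) refl d w c c′ n′ s e P ⟩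
    (1# - s) * ((d * w) * (c′ * n′)) + ((c * n′) * (e * w) - P) ∎
    where
    d = D (v p) xs
    w = V xs
    c = t - u * v p
    c′ = u - t * v p
    n = N t u xs
    n′ = N u t xs
    s = σ xs
    e = N 1# (v p) xs
    Q = pick (λ y ys → ((t - u * v y) * N u t ys) * B y ys) xs
    P = pick (λ y ys → ((t - u * v y) * (c′ * N u t ys)) * (((1# - v y * v p) * N 1# (v y) ys) * (D (v p) ys * V ys))) xs

    expand : (d * c) * Q ≈ (- P + (S₁ p xs * n′) * c) + ((pick B xs * d) * n′) * c′
    expand = begin
      (d * c) * Q
        ≈⟨ solve 3 (λ d c q → (d :* c) :* q := c :* (q :* d)) refl d c Q ⟩
      c * (Q * d)
        ≈⟨ *-congˡ (pick-prod (λ k → v p - v k) _ xs) ⟨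
      c * pick (λ y ys → (((t - u * v y) * N u t ys) * B y ys) * ((v p - v y) * D (v p) ys)) xs
        ≈⟨ pick-*ˡ c _ xs ⟨
      pick (λ y ys → c * ((((t - u * v y) * N u t ys) * B y ys) * ((v p - v y) * D (v p) ys))) xs
        -- A three-term relation between t - u v, u - t v, v p - v y and 1 - v y * v p. Afterwards
        -- every product is either one that belongs to `p ∷ xs` or complete over `xs`, hence
        -- constant along the expansion.
        ≈⟨ pick-cong (λ y ys → solve 8 (λ t u p y n e w d →
             (t :- u :* p) :* ((((t :- u :* y) :* n) :* (e :* w)) :* ((p :- y) :* d)) :=
             (:- (((t :- u :* y) :* ((u :- t :* p) :* n)) :* (((:1 :- y :* p) :* e) :* (d :* w)))
               :+ ((((:1 :- y :* p) :* e) :* (d :* w)) :* ((u :- t :* y) :* n)) :* (t :- u :* p))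
             :+ (((e :* w) :* ((p :- y) :* d)) :* ((u :- t :* y) :* n)) :* (u :- t :* p))
             refl t u (v p) (v y) _ _ _ _) xs ⟩
      pick (λ y ys →
        (- (((t - u * v y) * (c′ * N u t ys)) * (((1# - v y * v p) * N 1# (v y) ys) * (D (v p) ys * V ys)))
          + ((((1# - v y * v p) * N 1# (v y) ys) * (D (v p) ys * V ys)) * ((u - t * v y) * N u t ys)) * c)
        + ((B y ys * ((v p - v y) * D (v p) ys)) * ((u - t * v y) * N u t ys)) * c′) xs
        ≈⟨ trans (pick-+ _ _ xs) (+-congʳ (pick-+ _ _ xs)) ⟩
      (pick (λ y ys → - (((t - u * v y) * (c′ * N u t ys)) * (((1# - v y * v p) * N 1# (v y) ys) * (D (v p) ys * V ys)))) xs
        + pick (λ y ys → ((((1# - v y * v p) * N 1# (v y) ys) * (D (v p) ys * V ys)) * ((u - t * v y) * N u t ys)) * c) xs)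
        + pick (λ y ys → ((B y ys * ((v p - v y) * D (v p) ys)) * ((u - t * v y) * N u t ys)) * c′) xs
        ≈⟨ +-cong (+-cong (pick-neg _ xs) (trans (pick-*ʳ _ c xs) (*-congʳ (pick-prod _ _ xs))))
                  (trans (pick-*ʳ _ c′ xs) (*-congʳ (trans (pick-prod _ _ xs) (*-congʳ (pick-prod _ _ xs))))) ⟩
      (- P + (S₁ p xs * n′) * c) + ((pick B xs * d) * n′) * c′ ∎
      where
      pick-*ʳ : ∀ f c xs → pick (λ y ys → f y ys * c) xs ≈ pick f xs * c
      pick-*ʳ f c xs = trans (pick-cong (λ y ys → *-comm _ _) xs) (trans (pick-*ˡ c f xs) (*-comm _ _))

  module _ (F : I → A) (i : I → I → A) (i-inv : ∀ x y → (1# - v x * v y) * i x y ≈ 1#) where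

    i-sym : ∀ x y → i x y ≈ i y x
    i-sym x y = inverse-unique (i-inv x y) (trans (*-congʳ (+-congˡ (-‿cong (*-comm _ _)))) (i-inv y x))

    kernel : I → I → A
    kernel a b = (F a * F b) * ((v a - v b) * i a b)

    S : List I → A
    S xs = prodL F xs * (V xs * pairProd i xs)

    prod-inv : ∀ a xs → N 1# (v a) xs * prodL (i a) xs ≈ 1#
    prod-inv a xs = trans (sym (prodL-* _ _ xs)) (prodL-1 (i-inv a) xs)

    -- `partialFractions` at t = v a, u = 1; the term with `σ` drops out because `bs` has odd
    -- length. The factors `N` belonging to `a` and `y` cancel against the inverses `i`, which
    -- leaves one kernel and the product over the remaining letters.
    schur-pfaffian : ∀ a bs → σ bs ≈ 0# → S (a ∷ bs) ≈ pick (λ b cs → kernel a b * S cs) bs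
    schur-pfaffian a bs odd = begin
      (F a * prodL F bs) * ((D (v a) bs * V bs) * (prodL (i a) bs * pairProd i bs))
        ≈⟨ solve 6 (λ f g d w p q → (f :* g) :* ((d :* w) :* (p :* q)) := (((f :* (w :* d)) :* p) :* q) :* g) refl _ _ _ _ _ _ ⟩
      (((F a * (V bs * D (v a) bs)) * prodL (i a) bs) * pairProd i bs) * prodL F bs
        ≈⟨ *-congʳ (*-congʳ (*-congʳ (*-congˡ (begin
             V bs * D (v a) bs       ≈⟨ *-congˡ (N-1 (v a) bs) ⟨
             V bs * N (v a) 1# bs    ≈⟨ partialFractions bs (v a) 1# ⟩
             σ bs * (V bs * N 1# (v a) bs) + pick T bs ≈⟨ +-congʳ (zeroˡ′ odd) ⟩
             0# + pick T bs          ≈⟨ +-identityˡ _ ⟩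
             pick T bs ∎)))) ⟩
      (((F a * pick T bs) * prodL (i a) bs) * pairProd i bs) * prodL F bs
        ≈⟨ *-congʳ (*-congʳ (*-congʳ (pick-*ˡ (F a) T bs))) ⟨
      ((pick (λ y ys → F a * T y ys) bs * prodL (i a) bs) * pairProd i bs) * prodL F bs
        ≈⟨ *-congʳ (*-congʳ (pick-prod (i a) _ bs)) ⟨
      (pick (λ y ys → (F a * T y ys) * (i a y * prodL (i a) ys)) bs * pairProd i bs) * prodL F bs
        ≈⟨ *-congʳ (pick-pairProd i i-sym _ bs) ⟨
      pick (λ y ys → ((F a * T y ys) * (i a y * prodL (i a) ys)) * (prodL (i y) ys * pairProd i ys)) bs * prodL F bs
        ≈⟨ pick-prod F _ bs ⟨
      pick (λ y ys → (((F a * T y ys) * (i a y * prodL (i a) ys)) * (prodL (i y) ys * pairProd i ys)) * (F y * prodL F ys)) bs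
        ≈⟨ pick-cong (λ y ys → begin
             (((F a * (((v a - 1# * v y) * N 1# (v a) ys) * (N 1# (v y) ys * V ys))) * (i a y * prodL (i a) ys)) * (prodL (i y) ys * pairProd i ys)) * (F y * prodL F ys)
               ≈⟨ solve 12 (λ fa va vy n m w i p q r fy g →
                    (((fa :* (((va :- :1 :* vy) :* n) :* (m :* w))) :* (i :* p)) :* (q :* r)) :* (fy :* g)
                    := ((n :* p) :* (m :* q)) :* (((fa :* fy) :* ((va :- vy) :* i)) :* (g :* (w :* r))))
                    refl (F a) (v a) (v y) _ _ _ _ _ _ _ _ _ ⟩
             ((N 1# (v a) ys * prodL (i a) ys) * (N 1# (v y) ys * prodL (i y) ys)) * (kernel a y * S ys)
               ≈⟨ *-congʳ (*-cong (prod-inv a ys) (prod-inv y ys)) ⟩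
             (1# * 1#) * (kernel a y * S ys)
               ≈⟨ solve 1 (λ x → (:1 :* :1) :* x := x) refl _ ⟩
             kernel a y * S ys ∎) bs ⟩
      pick (λ b cs → kernel a b * S cs) bs ∎
      where
      T : I → List I → A
      T y ys = ((v a - 1# * v y) * N 1# (v a) ys) * B y ys

-- `diag` is asked for separately, since 2 may be a zero divisor in `R`.
record Alt (R : Ring₀) {I : Set} (C : List I → CommutativeRing.Carrier R) : Set where
  open Kit R
  field
    swap : ∀ pre a b post → C (pre ++ a ∷ b ∷ post) ≈ - C (pre ++ b ∷ a ∷ post)
    diag : ∀ pre a post → C (pre ++ a ∷ a ∷ post) ≈ 0#

-- The Cauchy determinant with even letters as rows and odd letters as columns

δ : Bool → Bool → ℕ
δ true true = 1
δ false false = 1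
δ true false = 0
δ false true = 0

δ-refl : ∀ b → δ b b ≡ 1
δ-refl true = ≡.refl
δ-refl false = ≡.refl

δ-not : ∀ b → δ b (not b) ≡ 0
δ-not true = ≡.refl
δ-not false = ≡.refl

δ-complement : ∀ b t → δ (not b) t ℕ.+ δ b t ≡ 1
δ-complement true true = ≡.refl
δ-complement true false = ≡.refl
δ-complement false true = ≡.refl
δ-complement false false = ≡.refl

same-or-opp : ∀ b c → (b ≡ c) ⊎ (b ≡ not c)
same-or-opp true true = inj₁ ≡.refl
same-or-opp true false = inj₂ ≡.refl
same-or-opp false true = inj₂ ≡.refl
same-or-opp false false = inj₁ ≡.refl

module Cauchy (R : Ring₀) {I : Set} (v : I → CommutativeRing.Carrier R) (par : I → Bool)
  (κ : I → I → CommutativeRing.Carrier R) where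
  open Kit R
  open Pick R {I}
  open Lagrange R v

  cnt : Bool → List I → ℕ
  cnt t [] = 0
  cnt t (x ∷ xs) = δ (par x) t ℕ.+ cnt t xs

  pick-cong-cnt : ∀ {f g} xs → (∀ y ys → (∀ t → cnt t (y ∷ ys) ≡ cnt t xs) → f y ys ≈ g y ys) → pick f xs ≈ pick g xs
  pick-cong-cnt [] p = refl
  pick-cong-cnt (x ∷ xs) p = +-cong (p x xs (λ t → ≡.refl)) (-‿cong (pick-cong-cnt xs (λ y ys e → p y (x ∷ ys) (λ t →
    ≡.trans (≡.sym (ℕₚ.+-assoc (δ (par y) t) _ _)) (≡.trans (≡.cong (ℕ._+ cnt t ys) (ℕₚ.+-comm (δ (par y) t) _))
      (≡.trans (ℕₚ.+-assoc (δ (par x) t) _ _) (≡.cong (δ (par x) t ℕ.+_) (e t))))))))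

  Cc : List I → A
  Cc = pairProd κ

  module _ (κ-same : ∀ a b → par a ≡ par b → κ a b ≈ v a - v b)
           (κ-opp : ∀ a b → par a ≡ not (par b) → (v a - v b) * κ a b ≈ 1#) where

    κ-anti : ∀ a b → κ a b ≈ - κ b a
    κ-anti a b with same-or-opp (par a) (par b)
    ... | inj₁ e = trans (κ-same a b e) (trans (solve 2 (λ a b → a :- b := :- (b :- a)) refl _ _)
                     (-‿cong (sym (κ-same b a (≡.sym e)))))
    ... | inj₂ e = inverse-unique (κ-opp a b e)
          (trans (solve 3 (λ a b k → (a :- b) :* (:- k) := (b :- a) :* k) refl _ _ _)
             (κ-opp b a (≡.trans (≡.sym (Boolₚ.not-involutive _)) (≡.cong not (≡.sym e)))))

    κ-diag : ∀ a → κ a a ≈ 0#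
    κ-diag a = trans (κ-same a a ≡.refl) (-‿inverseʳ _)

    prodL-swap : ∀ (φ : I → A) pre a b post → prodL φ (pre ++ a ∷ b ∷ post) ≈ prodL φ (pre ++ b ∷ a ∷ post)
    prodL-swap φ [] a b post = solve 3 (λ a b c → a :* (b :* c) := b :* (a :* c)) refl _ _ _
    prodL-swap φ (x ∷ pre) a b post = *-congˡ (prodL-swap φ pre a b post)

    Cc-swap : ∀ pre a b post → Cc (pre ++ a ∷ b ∷ post) ≈ - Cc (pre ++ b ∷ a ∷ post)
    Cc-swap [] a b post = trans (*-congʳ (*-congʳ (κ-anti a b)))
      (solve 4 (λ k p q r → (:- k :* p) :* (q :* r) := :- ((k :* q) :* (p :* r))) refl _ _ _ _)
    Cc-swap (x ∷ pre) a b post = trans (*-cong (prodL-swap (κ x) pre a b post) (Cc-swap pre a b post)) (sym (-‿distribʳ-* _ _))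

    Cc-diag : ∀ pre a post → Cc (pre ++ a ∷ a ∷ post) ≈ 0#
    Cc-diag [] a post = zeroˡ′ (zeroˡ′ (κ-diag a))
    Cc-diag (x ∷ pre) a post = zeroʳ′ (Cc-diag pre a post)

    -- The expansion with a weight φ on the letters that stay. Passing a letter x turns its factors
    -- `κ x` into a part of φ, which makes induction along the list possible.
    W : (I → A) → (I → A) → List I → A
    W φ h = pick (λ y ys → h y * (prodL φ ys * Cc ys))

    W-cons : ∀ φ h x xs → W φ h (x ∷ xs) ≈ h x * (prodL φ xs * Cc xs) - φ x * W (λ k → φ k * κ x k) h xs
    W-cons φ h x xs = +-congˡ (-‿cong (trans (pick-cong (λ y ys → trans
      (solve 5 (λ h f p k c → h :* ((f :* p) :* (k :* c)) := f :* (h :* ((p :* k) :* c))) refl _ _ _ _ _)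
      (*-congˡ (*-congˡ (*-congʳ (sym (prodL-* φ (κ x) ys)))))) xs) (pick-*ˡ (φ x) _ xs)))

    W-cong : ∀ {φ ψ} h → (∀ k → φ k ≈ ψ k) → ∀ xs → W φ h xs ≈ W ψ h xs
    W-cong h p = pick-cong (λ y ys → *-congˡ (*-congʳ (prodL-cong p ys)))

    -- The two explicit terms change places when a and b do, and the last one contains `κ a b`;
    -- antisymmetry can be read off.
    W-two : ∀ φ h a b xs → W φ h (a ∷ b ∷ xs) ≈
      (h a * φ b * (prodL φ xs * prodL (κ b) xs * Cc xs) - h b * φ a * (prodL φ xs * prodL (κ a) xs * Cc xs))
      + φ a * φ b * κ a b * W (λ k → (φ k * κ a k) * κ b k) h xs
    W-two φ h a b xs = trans (W-cons φ h a (b ∷ xs)) (trans (+-congˡ (-‿cong (*-congˡ (W-cons (λ k → φ k * κ a k) h b xs))))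
      (trans (+-congˡ (-‿cong (*-congˡ (+-congʳ (*-congˡ (*-congʳ (prodL-* φ (κ a) xs)))))))
        (solve 10 (λ ha hb fa fb kab P ka kb c w →
          ha :* ((fb :* P) :* (kb :* c)) :- fa :* (hb :* ((P :* ka) :* c) :- (fb :* kab) :* w)
          := (ha :* fb :* (P :* kb :* c) :- hb :* fa :* (P :* ka :* c)) :+ fa :* fb :* kab :* w) refl _ _ _ _ _ _ _ _ _ _)))

    W-swap : ∀ φ h pre a b post → W φ h (pre ++ a ∷ b ∷ post) ≈ - W φ h (pre ++ b ∷ a ∷ post)
    W-swap φ h [] a b post = begin
      W φ h (a ∷ b ∷ post)
        ≈⟨ W-two φ h a b post ⟩
      (h a * φ b * Xb - h b * φ a * Xa) + φ a * φ b * κ a b * W (λ k → (φ k * κ a k) * κ b k) h post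
        ≈⟨ +-congˡ (*-cong (*-congˡ (κ-anti a b)) (W-cong h (λ k → solve 3 (λ f a b → (f :* a) :* b := (f :* b) :* a) refl _ _ _) post)) ⟩
      (h a * φ b * Xb - h b * φ a * Xa) + φ a * φ b * (- κ b a) * W (λ k → (φ k * κ b k) * κ a k) h post
        ≈⟨ solve 6 (λ x y fa fb k w → (x :- y) :+ fa :* fb :* (:- k) :* w := :- ((y :- x) :+ fb :* fa :* k :* w)) refl _ _ _ _ _ _ ⟩
      - ((h b * φ a * Xa - h a * φ b * Xb) + φ b * φ a * κ b a * W (λ k → (φ k * κ b k) * κ a k) h post)
        ≈⟨ -‿cong (W-two φ h b a post) ⟨
      - W φ h (b ∷ a ∷ post) ∎
      where
      Xa = prodL φ post * prodL (κ a) post * Cc post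
      Xb = prodL φ post * prodL (κ b) post * Cc post
    W-swap φ h (x ∷ pre) a b post = begin
      W φ h (x ∷ pre ++ a ∷ b ∷ post)
        ≈⟨ W-cons φ h x (pre ++ a ∷ b ∷ post) ⟩
      h x * (prodL φ (pre ++ a ∷ b ∷ post) * Cc (pre ++ a ∷ b ∷ post)) - φ x * W (λ k → φ k * κ x k) h (pre ++ a ∷ b ∷ post)
        ≈⟨ +-cong (*-congˡ (*-cong (prodL-swap φ pre a b post) (Cc-swap pre a b post))) (-‿cong (*-congˡ (W-swap _ h pre a b post))) ⟩
      h x * (prodL φ (pre ++ b ∷ a ∷ post) * - Cc (pre ++ b ∷ a ∷ post)) - φ x * - W (λ k → φ k * κ x k) h (pre ++ b ∷ a ∷ post)
        ≈⟨ solve 5 (λ h p c f w → h :* (p :* (:- c)) :- f :* (:- w) := :- (h :* (p :* c) :- f :* w)) refl _ _ _ _ _ ⟩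
      - (h x * (prodL φ (pre ++ b ∷ a ∷ post) * Cc (pre ++ b ∷ a ∷ post)) - φ x * W (λ k → φ k * κ x k) h (pre ++ b ∷ a ∷ post))
        ≈⟨ -‿cong (W-cons φ h x (pre ++ b ∷ a ∷ post)) ⟨
      - W φ h (x ∷ pre ++ b ∷ a ∷ post) ∎

    -- By antisymmetry it is enough to look at lists sorted by parity.
    module _ (p : Bool) (E : List I → A) (E-swap : ∀ pre a b post → E (pre ++ a ∷ b ∷ post) ≈ - E (pre ++ b ∷ a ∷ post))
      (sorted : ∀ Z P → All (λ z → par z ≡ p) Z → All (λ y → par y ≡ not p) P → length P ≡ suc (length Z) → E (Z ++ P) ≈ 0#) where

      move : ∀ pre P b post → E (pre ++ b ∷ (P ++ post)) ≈ 0# → E (pre ++ (P ++ b ∷ post)) ≈ 0#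
      move pre [] b post e = e
      move pre (x ∷ P) b post e = ≡.subst (λ l → E l ≈ 0#) (Lₚ.++-assoc pre (x ∷ []) (P ++ b ∷ post))
        (move (pre ++ x ∷ []) P b post (≡.subst (λ l → E l ≈ 0#) (≡.sym (Lₚ.++-assoc pre (x ∷ []) (b ∷ (P ++ post))))
          (trans (E-swap pre x b (P ++ post)) (trans (-‿cong e) -0≈0))))

      -- `Z` and `P` collect the letters of the two parities met so far. A letter for `Z` has to
      -- pass through `P`, which costs only signs.
      sort-vanishes : ∀ Z P bs → All (λ z → par z ≡ p) Z → All (λ y → par y ≡ not p) P →
        length P ℕ.+ cnt (not p) bs ≡ suc (length Z ℕ.+ cnt p bs) → E (Z ++ (P ++ bs)) ≈ 0#
      sort-vanishes Z P [] aZ aP e = ≡.subst (λ l → E (Z ++ l) ≈ 0#) (≡.sym (Lₚ.++-identityʳ P))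
        (sorted Z P aZ aP (≡.trans (≡.sym (ℕₚ.+-identityʳ _)) (≡.trans e (≡.cong suc (ℕₚ.+-identityʳ _)))))
      sort-vanishes Z P (b ∷ bs) aZ aP e with same-or-opp (par b) p
      ... | inj₂ o = ≡.subst (λ l → E (Z ++ l) ≈ 0#) (Lₚ.++-assoc P (b ∷ []) bs)
        (sort-vanishes Z (P ++ b ∷ []) bs aZ (Allₚ.++⁺ aP (o ∷ [])) (≡.trans (≡.cong (ℕ._+ cnt (not p) bs) (Lₚ.length-++ P))
          (≡.trans (ℕₚ.+-assoc (length P) 1 _)
          (≡.trans (≡.cong (λ k → length P ℕ.+ (k ℕ.+ cnt (not p) bs)) (≡.sym (≡.trans (≡.cong (λ t → δ t (not p)) o) (δ-refl (not p)))))
          (≡.trans e (≡.cong (λ k → suc (length Z ℕ.+ (k ℕ.+ cnt p bs))) (≡.trans (≡.cong₂ δ o (≡.sym (Boolₚ.not-involutive p))) (δ-not (not p)))))))))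
      ... | inj₁ s = move Z P b bs (≡.subst (λ l → E l ≈ 0#) (Lₚ.++-assoc Z (b ∷ []) (P ++ bs))
        (sort-vanishes (Z ++ b ∷ []) P bs (Allₚ.++⁺ aZ (s ∷ [])) aP
          (≡.trans (≡.cong (λ k → length P ℕ.+ (k ℕ.+ cnt (not p) bs)) (≡.sym (≡.trans (≡.cong (λ t → δ t (not p)) s) (δ-not p))))
          (≡.trans e (≡.cong suc (≡.trans (≡.cong (λ k → length Z ℕ.+ (k ℕ.+ cnt p bs)) (≡.trans (≡.cong (λ t → δ t p) s) (δ-refl p)))
            (≡.trans (≡.sym (ℕₚ.+-assoc (length Z) 1 _)) (≡.cong (ℕ._+ cnt p bs) (≡.sym (Lₚ.length-++ Z))))))))))

    module _ (a : I) where

      same opp : I → Set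
      same z = par z ≡ par a
      opp y = par y ≡ not (par a)

      ha : I → A
      ha y = does (par y Boolₚ.≟ not (par a)) ▹ κ a y

      ha-opp : ∀ {y} → opp y → ha y ≡ κ a y
      ha-opp {y} o = ≡.cong (_▹ κ a y) (dec-true (par y Boolₚ.≟ not (par a)) o)

      ha-same : ∀ {y} → same y → ha y ≡ 0#
      ha-same {y} s = ≡.cong (_▹ κ a y) (dec-false (par y Boolₚ.≟ not (par a)) (λ e → Boolₚ.not-¬ {par a} ≡.refl (≡.trans (≡.sym s) e)))

      pick-cong-All : ∀ {P : I → Set} {f g : I → List I → A} xs → All P xs →
        (∀ y ys → P y → All P ys → f y ys ≈ g y ys) → pick f xs ≈ pick g xs
      pick-cong-All [] [] e = refl
      pick-cong-All (x ∷ xs) (px ∷ pxs) e = +-cong (e x xs px pxs) (-‿cong (pick-cong-All xs pxs (λ y ys py pys → e y (x ∷ ys) py (px ∷ pys))))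

      Cc≈V : ∀ P → All opp P → Cc P ≈ V P
      Cc≈V [] [] = refl
      Cc≈V (x ∷ P) (o ∷ os) = *-cong (go P os) (Cc≈V P os)
        where
        go : ∀ P → All opp P → prodL (κ x) P ≈ prodL (λ y → v x - v y) P
        go [] [] = refl
        go (y ∷ P) (o′ ∷ os) = *-cong (κ-same x y (≡.trans o (≡.sym o′))) (go P os)

      opp′ : ∀ {y} → opp y → par a ≡ not (par y)
      opp′ o = ≡.trans (≡.sym (Boolₚ.not-involutive _)) (≡.cong not (≡.sym o))

      D-inv : ∀ P → All opp P → D (v a) P * prodL (κ a) P ≈ 1#
      D-inv [] [] = *-identityˡ _
      D-inv (y ∷ P) (o ∷ os) = trans (solve 4 (λ a b c d → (a :* b) :* (c :* d) := (a :* c) :* (b :* d)) refl _ _ _ _)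
        (trans (*-cong (κ-opp a y (opp′ o)) (D-inv P os)) (*-identityˡ _))

      -- With the nodes `a` and `P`, `altSum-vanishes` can be solved for the term of `a`; here
      -- `κ a y` is the inverse of v a - v y.
      lagrange-at-a : ∀ Z P → All opp P → length P ≡ suc (length Z) →
        pick (λ y ys → κ a y * (roots Z (v y) * V ys)) P ≈ roots Z (v a) * (prodL (κ a) P * V P)
      lagrange-at-a Z P os len = begin
        pick (λ y ys → κ a y * (roots Z (v y) * V ys)) P
          ≈⟨ pick-cong-All P os (λ y ys o os′ → trans (sym (*-identityˡ _)) (trans (*-congʳ (sym (D-inv ys os′)))
               (solve 5 (λ d p k r w → (d :* p) :* (k :* (r :* w)) := (r :* (d :* w)) :* (k :* p)) refl _ _ _ _ _))) ⟩
        pick (λ y ys → (roots Z (v y) * (D (v a) ys * V ys)) * (κ a y * prodL (κ a) ys)) P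
          ≈⟨ pick-prod (κ a) _ P ⟩
        pick (λ y ys → roots Z (v y) * (D (v a) ys * V ys)) P * prodL (κ a) P
          ≈⟨ *-congʳ (sym (x-y≈0⇒x≈y (altSum-vanishes Z a P (ℕₚ.≤-reflexive (≡.sym len))))) ⟩
        (roots Z (v a) * V P) * prodL (κ a) P
          ≈⟨ solve 3 (λ r w p → (r :* w) :* p := r :* (p :* w)) refl _ _ _ ⟩
        roots Z (v a) * (prodL (κ a) P * V P) ∎

      -- In the induction `Z′` consists of the letters already passed and φ of their factors `κ`. On
      -- the opposite parity φ therefore inverts the polynomial with roots `Z′`, up to the sign s =
      -- (-1)^|Z′|. When `Z` is used up, only letters of opposite parity are left and interpolation
      -- of this polynomial at `a` gives the value.
      expand-sorted : ∀ Z Z′ φ s P → All same Z → All opp P → s * s ≈ 1# → (∀ y → opp y → φ y * roots Z′ (v y) ≈ s) →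
        length P ≡ suc (length Z′ ℕ.+ length Z) →
        W φ ha (Z ++ P) ≈ s * (prodL φ (Z ++ P) * (Cc (Z ++ P) * (roots Z′ (v a) * prodL (κ a) (Z ++ P))))
      expand-sorted [] Z′ φ s P [] os ss φs len = begin
        W φ ha P
          ≈⟨ pick-cong-All P os (λ y ys o os′ → begin
               ha y * (prodL φ ys * Cc ys)
                 ≈⟨ *-cong (reflexive (ha-opp o)) (*-congˡ (Cc≈V ys os′)) ⟩
               κ a y * (prodL φ ys * V ys)
                 ≈⟨ trans (sym (*-identityˡ _)) (*-congʳ (trans (sym ss) (*-congˡ (sym (φs y o))))) ⟩
               (s * (φ y * roots Z′ (v y))) * (κ a y * (prodL φ ys * V ys))
                 ≈⟨ solve 6 (λ s f r k p w → (s :* (f :* r)) :* (k :* (p :* w)) := (s :* (k :* (r :* w))) :* (f :* p)) refl _ _ _ _ _ _ ⟩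
               (s * (κ a y * (roots Z′ (v y) * V ys))) * (φ y * prodL φ ys) ∎) ⟩
        pick (λ y ys → (s * (κ a y * (roots Z′ (v y) * V ys))) * (φ y * prodL φ ys)) P
          ≈⟨ trans (pick-prod φ _ P) (*-congʳ (pick-*ˡ s _ P)) ⟩
        (s * pick (λ y ys → κ a y * (roots Z′ (v y) * V ys)) P) * prodL φ P
          ≈⟨ *-congʳ (*-congˡ (lagrange-at-a Z′ P os (≡.trans len (≡.cong suc (ℕₚ.+-identityʳ _))))) ⟩
        (s * (roots Z′ (v a) * (prodL (κ a) P * V P))) * prodL φ P
          ≈⟨ solve 5 (λ s r k w f → (s :* (r :* (k :* w))) :* f := s :* (f :* (w :* (r :* k)))) refl _ _ _ _ _ ⟩
        s * (prodL φ P * (V P * (roots Z′ (v a) * prodL (κ a) P)))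
          ≈⟨ *-congˡ (*-congˡ (*-congʳ (Cc≈V P os))) ⟨
        s * (prodL φ P * (Cc P * (roots Z′ (v a) * prodL (κ a) P))) ∎
      expand-sorted (z ∷ Z) Z′ φ s P (sz ∷ sZ) os ss φs len = begin
        W φ ha (z ∷ Z ++ P)
          ≈⟨ W-cons φ ha z (Z ++ P) ⟩
        ha z * (prodL φ (Z ++ P) * Cc (Z ++ P)) - φ z * W φ′ ha (Z ++ P)
          ≈⟨ +-cong (zeroˡ′ (reflexive (ha-same sz))) (-‿cong (*-congˡ (expand-sorted Z (v z ∷ Z′) φ′ (- s) P sZ os
               (trans (solve 1 (λ s → (:- s) :* (:- s) := s :* s) refl s) ss) φ′s (≡.trans len (≡.cong suc (ℕₚ.+-suc _ _)))))) ⟩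
        0# - φ z * (- s * (prodL φ′ (Z ++ P) * (Cc (Z ++ P) * (((v a - v z) * roots Z′ (v a)) * prodL (κ a) (Z ++ P)))))
          ≈⟨ +-congˡ (-‿cong (*-congˡ (*-congˡ (*-cong (prodL-* φ (κ z) (Z ++ P)) (*-congˡ (*-congʳ (*-congʳ (sym (κ-same a z (≡.sym sz)))))))))) ⟩
        0# - φ z * (- s * ((prodL φ (Z ++ P) * prodL (κ z) (Z ++ P)) * (Cc (Z ++ P) * ((κ a z * roots Z′ (v a)) * prodL (κ a) (Z ++ P)))))
          ≈⟨ solve 8 (λ f s p k c az r ka → :0 :- f :* (:- s :* ((p :* k) :* (c :* ((az :* r) :* ka))))
               := s :* ((f :* p) :* ((k :* c) :* (r :* (az :* ka))))) refl _ _ _ _ _ _ _ _ ⟩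
        s * (prodL φ (z ∷ Z ++ P) * (Cc (z ∷ Z ++ P) * (roots Z′ (v a) * prodL (κ a) (z ∷ Z ++ P)))) ∎
        where
        φ′ : I → A
        φ′ k = φ k * κ z k
        φ′s : ∀ y → opp y → φ′ y * ((v y - v z) * roots Z′ (v y)) ≈ - s
        φ′s y o = trans (solve 5 (λ f k y z r → (f :* k) :* ((y :- z) :* r) := :- ((f :* r) :* ((z :- y) :* k))) refl _ _ _ _ _)
          (-‿cong (trans (*-cong (φs y o) (κ-opp z y (≡.trans sz (opp′ o)))) (*-identityʳ s)))

      -- The expansion of the Cauchy determinant along the row of `a`, whose entries belong to the
      -- letters of the other parity.
      cauchy-expansion : ∀ bs → cnt (not (par a)) bs ≡ suc (cnt (par a) bs) →
        Cc (a ∷ bs) ≈ pick (λ y ys → ha y * Cc ys) bs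
      cauchy-expansion bs e = trans (sym (x-y≈0⇒x≈y (sort-vanishes (par a) E E-swap sorted [] [] bs [] [] e)))
        (pick-cong (λ y ys → *-congˡ (trans (*-congʳ (prodL-1 (λ _ → refl) ys)) (*-identityˡ _))) bs)
        where
        E : List I → A
        E bs = W (λ _ → 1#) ha bs - Cc (a ∷ bs)
        E-swap : ∀ pre a b post → E (pre ++ a ∷ b ∷ post) ≈ - E (pre ++ b ∷ a ∷ post)
        E-swap pre b c post = trans (+-cong (W-swap _ ha pre b c post) (-‿cong (Cc-swap (a ∷ pre) b c post))) (-‿+-comm _ _)
        sorted : ∀ Z P → All same Z → All opp P → length P ≡ suc (length Z) → E (Z ++ P) ≈ 0#
        sorted Z P sZ oP len = trans (+-congʳ (trans (expand-sorted Z [] (λ _ → 1#) 1# P sZ oP (*-identityˡ _) (λ y _ → *-identityˡ _) len)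
          (trans (*-congˡ (*-congʳ (prodL-1 (λ _ → refl) (Z ++ P)))) (solve 2 (λ c k → :1 :* (:1 :* (c :* (:1 :* k))) := k :* c) refl _ _)))) (-‿inverseʳ _)

-- `true` stands for even.
par : ℕ → Bool
par zero = true
par (suc n) = not (par n)

module Coefficients (R : Ring₀) (z G : ℕ → CommutativeRing.Carrier R) (κ : ℕ → ℕ → CommutativeRing.Carrier R) where
  open Kit R
  open Pick R {ℕ}
  open Cauchy R z par κ public using (cnt; Cc)
  private module Cy = Cauchy R z par κ

  bal : List ℕ → Bool
  bal l = does (cnt true l ℕ.≟ cnt false l)

  bal-true : ∀ l → bal l ≡ true → cnt true l ≡ cnt false l
  bal-true l e = ℕₚ.≡ᵇ⇒≡ _ _ (Equivalence.from Boolₚ.T-≡ e)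

  C : List ℕ → A
  C l = bal l ▹ (prodL G l * Cc l)

  cnt-opp-pair : ∀ t a b l → par b ≡ not (par a) → cnt t (a ∷ b ∷ l) ≡ suc (cnt t l)
  cnt-opp-pair t a b l o = ≡.trans (≡.sym (ℕₚ.+-assoc (δ (par a) t) _ _)) (≡.cong (ℕ._+ cnt t l)
    (≡.trans (ℕₚ.+-comm (δ (par a) t) _) (≡.trans (≡.cong (λ p → δ p t ℕ.+ δ (par a) t) o) (δ-complement (par a) t))))

  bal-cong : ∀ {l m} → (∀ t → cnt t l ≡ cnt t m) → bal l ≡ bal m
  bal-cong {l} {m} e = ≡.cong₂ (λ x y → does (x ℕ.≟ y)) (e true) (e false)

  bal-suc : ∀ {l m} → (∀ t → cnt t l ≡ suc (cnt t m)) → bal l ≡ bal m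
  bal-suc {l} {m} e = ≡.cong₂ (λ x y → does (x ℕ.≟ y)) (e true) (e false)

  bal-same-pair : ∀ a b → par b ≡ par a → bal (a ∷ b ∷ []) ≡ false
  bal-same-pair a b e with par a | par b
  bal-same-pair a b ≡.refl | true | true = ≡.refl
  bal-same-pair a b ≡.refl | false | false = ≡.refl

  module _ (κ-same : ∀ a b → par a ≡ par b → κ a b ≈ z a - z b)
           (κ-opp : ∀ a b → par a ≡ not (par b) → (z a - z b) * κ a b ≈ 1#) where

    C-same-pair : ∀ a b → par b ≡ par a → C (a ∷ b ∷ []) ≡ 0#
    C-same-pair a b e = ≡.cong (_▹ (prodL G (a ∷ b ∷ []) * Cc (a ∷ b ∷ []))) (bal-same-pair a b e)

    C-opp-pair : ∀ a b → par b ≡ not (par a) → C (a ∷ b ∷ []) ≈ (G a * G b) * κ a b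
    C-opp-pair a b o = trans (reflexive (≡.cong (_▹ (prodL G (a ∷ b ∷ []) * Cc (a ∷ b ∷ []))) (bal-suc {a ∷ b ∷ []} {[]} (λ t → cnt-opp-pair t a b [] o))))
      (solve 3 (λ x y k → (x :* (y :* :1)) :* ((k :* :1) :* (:1 :* :1)) := (x :* y) :* k) refl _ _ _)

    -- No balance is assumed: removing two letters of opposite parity does not change it, so for
    -- unbalanced `a ∷ bs` every term is zero as well.
    C-pfaffian : ∀ a bs → C (a ∷ bs) ≈ pick (λ b cs → C (a ∷ b ∷ []) * C cs) bs
    C-pfaffian a bs = sym (trans (Cy.pick-cong-cnt bs term) (total (bal (a ∷ bs)) ≡.refl))
      where
      term : ∀ b cs → (∀ t → cnt t (b ∷ cs) ≡ cnt t bs) →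
        C (a ∷ b ∷ []) * C cs ≈ bal (a ∷ bs) ▹ ((G a * (Cy.ha κ-same κ-opp a b * Cc cs)) * (G b * prodL G cs))
      term b cs e with same-or-opp (par b) (par a)
      ... | inj₁ s = trans (zeroˡ′ (reflexive (C-same-pair a b s)))
              (sym (▹-0 (bal (a ∷ bs)) (λ _ → zeroˡ′ (zeroʳ′ (zeroˡ′ (reflexive (Cy.ha-same κ-same κ-opp a {b} s)))))))
      ... | inj₂ o = begin
        C (a ∷ b ∷ []) * C cs
          ≈⟨ *-cong (C-opp-pair a b o) (reflexive (≡.cong (_▹ (prodL G cs * Cc cs)) (≡.sym (bal-suc {a ∷ bs} {cs} (λ t →
               ≡.trans (≡.cong (δ (par a) t ℕ.+_) (≡.sym (e t))) (cnt-opp-pair t a b cs o)))))) ⟩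
        ((G a * G b) * κ a b) * bal (a ∷ bs) ▹ (prodL G cs * Cc cs)
          ≈⟨ ▹-*ˡ (bal (a ∷ bs)) _ _ ⟩
        bal (a ∷ bs) ▹ (((G a * G b) * κ a b) * (prodL G cs * Cc cs))
          ≈⟨ ▹-cong (bal (a ∷ bs)) (λ _ → trans (solve 5 (λ x y k p c → ((x :* y) :* k) :* (p :* c) := (x :* (k :* c)) :* (y :* p)) refl _ _ _ _ _)
               (*-congʳ (*-congˡ (*-congʳ (reflexive (≡.sym (Cy.ha-opp κ-same κ-opp a {b} o))))))) ⟩
        bal (a ∷ bs) ▹ ((G a * (Cy.ha κ-same κ-opp a b * Cc cs)) * (G b * prodL G cs)) ∎
      count : cnt true (a ∷ bs) ≡ cnt false (a ∷ bs) → cnt (not (par a)) bs ≡ suc (cnt (par a) bs)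
      count e with par a
      ... | true = ≡.sym e
      ... | false = e
      total : ∀ β → bal (a ∷ bs) ≡ β →
        pick (λ b cs → β ▹ ((G a * (Cy.ha κ-same κ-opp a b * Cc cs)) * (G b * prodL G cs))) bs ≈ β ▹ (prodL G (a ∷ bs) * Cc (a ∷ bs))
      total false e = pick-0 (λ _ _ → refl) bs
      total true e = begin
        pick (λ b cs → (G a * (Cy.ha κ-same κ-opp a b * Cc cs)) * (G b * prodL G cs)) bs
          ≈⟨ trans (pick-prod G _ bs) (*-congʳ (pick-*ˡ (G a) _ bs)) ⟩
        (G a * pick (λ b cs → Cy.ha κ-same κ-opp a b * Cc cs) bs) * prodL G bs
          ≈⟨ *-congʳ (*-congˡ (Cy.cauchy-expansion κ-same κ-opp a bs (count (bal-true (a ∷ bs) e)))) ⟨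
        (G a * Cc (a ∷ bs)) * prodL G bs
          ≈⟨ solve 3 (λ a c p → (a :* c) :* p := (a :* p) :* c) refl _ _ _ ⟩
        prodL G (a ∷ bs) * Cc (a ∷ bs) ∎

    C-alt : Alt R C
    C-alt = record
      { swap = λ pre a b post → trans (reflexive (≡.cong (_▹ (prodL G (pre ++ a ∷ b ∷ post) * Cc (pre ++ a ∷ b ∷ post)))
                 (bal-cong {pre ++ a ∷ b ∷ post} {pre ++ b ∷ a ∷ post} (λ t → cnt-swap t pre a b post))))
          (trans (▹-cong (bal (pre ++ b ∷ a ∷ post)) (λ _ → trans
            (*-cong (Cy.prodL-swap κ-same κ-opp G pre a b post) (Cy.Cc-swap κ-same κ-opp pre a b post)) (sym (-‿distribʳ-* _ _))))
          (sym (▹-neg (bal (pre ++ b ∷ a ∷ post)) _)))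
      ; diag = λ pre a post → ▹-0 (bal (pre ++ a ∷ a ∷ post)) (λ _ → zeroʳ′ (Cy.Cc-diag κ-same κ-opp pre a post)) }
      where
      cnt-swap : ∀ t pre a b post → cnt t (pre ++ a ∷ b ∷ post) ≡ cnt t (pre ++ b ∷ a ∷ post)
      cnt-swap t [] a b post = ≡.trans (≡.sym (ℕₚ.+-assoc (δ (par a) t) _ _)) (≡.trans (≡.cong (ℕ._+ cnt t post) (ℕₚ.+-comm (δ (par a) t) _)) (ℕₚ.+-assoc (δ (par b) t) _ _))
      cnt-swap t (x ∷ pre) a b post = ≡.cong (δ (par x) t ℕ.+_) (cnt-swap t pre a b post)

    module _ (τ : A) (f : ℕ → A) (z-suc : ∀ l → z (suc l) ≈ τ * z l)
      (f-odd : ∀ l → par l ≡ false → f l ≈ 0#)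
      (G-even : ∀ l → par l ≡ true → G l ≈ f l)
      (G-odd : ∀ l → par l ≡ true → G (suc l) ≈ f l * (z (suc l) - z 0))
      (G-step : ∀ l → par l ≡ false → τ * G l ≈ f (suc l) * (z (suc l) - z 0)) where

      κ-suc : ∀ a b → par a ≡ not (par b) → κ a b ≈ τ * κ (suc a) (suc b)
      κ-suc a b o = inverse-unique (κ-opp a b o) (trans (solve 4 (λ a b t k → (a :- b) :* (t :* k) := (t :* a :- t :* b) :* k) refl (z a) (z b) τ _)
        (trans (*-congʳ (sym (+-cong (z-suc a) (-‿cong (z-suc b))))) (κ-opp (suc a) (suc b) (≡.cong not o))))

      -- Comparison of coefficients in (1 - xy) Σ C(a, b) x^a y^b = (x - y) f(x) f(y). For opposite
      -- parities `κ-suc` gives both terms on the left the same factor κ. What remains beside it is,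
      -- up to sign and a product of values of f, the difference of z_(a+1) - z_0 and z_(b+1) - z_0,
      -- which cancels κ.
      C-suc-suc : ∀ a b → C (suc a ∷ suc b ∷ []) - C (a ∷ b ∷ []) ≈ f a * f (suc b) - f (suc a) * f b
      C-suc-suc a b with same-or-opp (par b) (par a)
      ... | inj₁ s = trans (trans (+-cong (reflexive (C-same-pair (suc a) (suc b) (≡.cong not s))) (-‿cong (reflexive (C-same-pair a b s)))) (-‿inverseʳ _))
                      (sym (zero-pair (par a) ≡.refl))
        where
        zero-pair : ∀ p → par a ≡ p → f a * f (suc b) - f (suc a) * f b ≈ 0#
        zero-pair true e = trans (+-cong (zeroʳ′ (f-odd (suc b) (≡.cong not (≡.trans s e)))) (-‿cong (zeroˡ′ (f-odd (suc a) (≡.cong not e))))) (-‿inverseʳ _)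
        zero-pair false e = trans (+-cong (zeroˡ′ (f-odd a e)) (-‿cong (zeroʳ′ (f-odd b (≡.trans s e))))) (-‿inverseʳ _)
      ... | inj₂ o = trans (+-cong (C-opp-pair (suc a) (suc b) (≡.cong not o)) (-‿cong (trans (C-opp-pair a b o) (*-congˡ (κ-suc a b o′))))) (main (par a) ≡.refl)
        where
        o′ : par a ≡ not (par b)
        o′ = ≡.trans (≡.sym (Boolₚ.not-involutive _)) (≡.cong not (≡.sym o))
        unit : (z (suc a) - z (suc b)) * κ (suc a) (suc b) ≈ 1#
        unit = κ-opp (suc a) (suc b) (≡.cong not o′)
        main : ∀ p → par a ≡ p → (G (suc a) * G (suc b)) * κ (suc a) (suc b) - (G a * G b) * (τ * κ (suc a) (suc b)) ≈ f a * f (suc b) - f (suc a) * f b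
        main true e = begin
          (G (suc a) * G (suc b)) * κ (suc a) (suc b) - (G a * G b) * (τ * κ (suc a) (suc b))
            ≈⟨ solve 6 (λ x y k u w t → (x :* y) :* k :- (u :* w) :* (t :* k) := (x :* y :- u :* (t :* w)) :* k) refl _ _ _ _ _ _ ⟩
          (G (suc a) * G (suc b) - G a * (τ * G b)) * κ (suc a) (suc b)
            ≈⟨ *-congʳ (+-cong (*-cong (G-odd a e) (G-even (suc b) (≡.cong not be))) (-‿cong (*-cong (G-even a e) (G-step b be)))) ⟩
          ((f a * (z (suc a) - z 0)) * f (suc b) - f a * (f (suc b) * (z (suc b) - z 0))) * κ (suc a) (suc b)
            ≈⟨ solve 6 (λ f g x y w k → ((f :* (x :- w)) :* g :- f :* (g :* (y :- w))) :* k := (f :* g) :* ((x :- y) :* k)) refl _ _ _ _ _ _ ⟩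
          (f a * f (suc b)) * ((z (suc a) - z (suc b)) * κ (suc a) (suc b))
            ≈⟨ *-congˡ unit ⟩
          (f a * f (suc b)) * 1#
            ≈⟨ solve 1 (λ x → x :* :1 := x :- :0) refl _ ⟩
          f a * f (suc b) - 0#
            ≈⟨ +-congˡ (-‿cong (zeroˡ′ (f-odd (suc a) (≡.cong not e)))) ⟨
          f a * f (suc b) - f (suc a) * f b ∎
          where
          be : par b ≡ false
          be = ≡.trans o (≡.cong not e)
        main false e = begin
          (G (suc a) * G (suc b)) * κ (suc a) (suc b) - (G a * G b) * (τ * κ (suc a) (suc b))
            ≈⟨ solve 6 (λ x y k u w t → (x :* y) :* k :- (u :* w) :* (t :* k) := (x :* y :- (t :* u) :* w) :* k) refl _ _ _ _ _ _ ⟩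
          (G (suc a) * G (suc b) - (τ * G a) * G b) * κ (suc a) (suc b)
            ≈⟨ *-congʳ (+-cong (*-cong (G-even (suc a) (≡.cong not e)) (G-odd b be)) (-‿cong (*-cong (G-step a e) (G-even b be)))) ⟩
          (f (suc a) * (f b * (z (suc b) - z 0)) - (f (suc a) * (z (suc a) - z 0)) * f b) * κ (suc a) (suc b)
            ≈⟨ solve 6 (λ f g x y w k → (f :* (g :* (y :- w)) :- (f :* (x :- w)) :* g) :* k := :- ((f :* g) :* ((x :- y) :* k))) refl _ _ _ _ _ _ ⟩
          - ((f (suc a) * f b) * ((z (suc a) - z (suc b)) * κ (suc a) (suc b)))
            ≈⟨ -‿cong (*-congˡ unit) ⟩
          - ((f (suc a) * f b) * 1#)
            ≈⟨ solve 1 (λ x → :- (x :* :1) := :0 :- x) refl _ ⟩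
          0# - f (suc a) * f b
            ≈⟨ +-congʳ (zeroˡ′ (f-odd a e)) ⟨
          f a * f (suc b) - f (suc a) * f b ∎
          where
          be : par b ≡ true
          be = ≡.trans o (≡.cong not e)

      -- The same comparison at a boundary exponent, where only one term remains on either side.
      C-zero-suc : ∀ b → C (0 ∷ suc b ∷ []) ≈ - (f 0 * f b)
      C-zero-suc b = go (par b) ≡.refl
       where
       go : ∀ p → par b ≡ p → C (0 ∷ suc b ∷ []) ≈ - (f 0 * f b)
       go false e = trans (reflexive (C-same-pair 0 (suc b) (≡.cong not e))) (sym (trans (-‿cong (zeroʳ′ (f-odd b e))) -0≈0))
       go true e = begin
        C (0 ∷ suc b ∷ [])                                  ≈⟨ C-opp-pair 0 (suc b) (≡.cong not e) ⟩
        (G 0 * G (suc b)) * κ 0 (suc b)                     ≈⟨ *-congʳ (*-cong (G-even 0 ≡.refl) (G-odd b e)) ⟩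
        (f 0 * (f b * (z (suc b) - z 0))) * κ 0 (suc b)     ≈⟨ solve 5 (λ f g x y k → (f :* (g :* (y :- x))) :* k := :- ((f :* g) :* ((x :- y) :* k))) refl _ _ _ _ _ ⟩
        - ((f 0 * f b) * ((z 0 - z (suc b)) * κ 0 (suc b))) ≈⟨ -‿cong (trans (*-congˡ (κ-opp 0 (suc b) (≡.cong not (≡.sym (≡.cong not e))))) (*-identityʳ _)) ⟩
        - (f 0 * f b) ∎

      C-zero-zero : C (0 ∷ 0 ∷ []) ≈ 0#
      C-zero-zero = reflexive (C-same-pair 0 0 ≡.refl)

      C-suc-zero : ∀ a → C (suc a ∷ 0 ∷ []) ≈ f a * f 0
      C-suc-zero a = trans (Alt.swap C-alt [] (suc a) 0 []) (trans (-‿cong (C-zero-suc a)) (trans (-‿involutive _) (*-comm _ _)))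

-- Substituting variables into series, and signed sums over variables or exponents

_∘ʰ_ : ∀ {R S T} → Hom S T → Hom R S → Hom R T
_∘ʰ_ {R} {S} {T} g h = record
  { ap = λ x → ap g (ap h x)
  ; ap-cong = λ p → Hom.ap-cong g (Hom.ap-cong h p)
  ; ap-+ = λ x y → T.trans (Hom.ap-cong g (Hom.ap-+ h x y)) (Hom.ap-+ g _ _)
  ; ap-* = λ x y → T.trans (Hom.ap-cong g (Hom.ap-* h x y)) (Hom.ap-* g _ _)
  ; ap-1 = T.trans (Hom.ap-cong g (Hom.ap-1 h)) (Hom.ap-1 g)
  ; ap-neg = λ x → T.trans (Hom.ap-cong g (Hom.ap-neg h x)) (Hom.ap-neg g _)
  ; ap-0 = T.trans (Hom.ap-cong g (Hom.ap-0 h)) (Hom.ap-0 g) }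
  where module T = CommutativeRing T

idʰ : ∀ {R} → Hom R R
idʰ {R} = record
  { ap = id ; ap-cong = id ; ap-+ = λ _ _ → R.refl ; ap-* = λ _ _ → R.refl
  ; ap-1 = R.refl ; ap-neg = λ _ → R.refl ; ap-0 = R.refl }
  where module R = CommutativeRing R

fins : ∀ n → List (Fin n)
fins zero = []
fins (suc n) = zero ∷ map suc (fins n)

module Variables (R : Ring₀) where
  private
    module K = Kit R
    module P = Kit (PS R)
    module M (n : ℕ) = Kit (MPS R n)

  Car : ℕ → Set
  Car n = M.A n

  cstʰ : ∀ n → Hom R (MPS R n)
  cstʰ zero = idʰ
  cstʰ (suc n) = constHom (MPS R n) ∘ʰ cstʰ n

  -- The substitution g ↦ g(x_i), kept as a homomorphism because products and inverses have to be
  -- moved through it.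
  serʰ : ∀ {n} → Fin n → Hom (PS R) (MPS R n)
  serʰ {suc n} zero = mapPS (cstʰ n)
  serʰ {suc n} (suc i) = constHom (MPS R n) ∘ʰ serʰ i

  ser : ∀ {n} → (ℕ → K.A) → Fin n → Car n
  ser g i = ap (serʰ i) g

  v : ∀ {n} → Fin n → Car n
  v {suc n} zero = X (MPS R n)
  v {suc n} (suc i) = const (MPS R n) (v i)

  ser-X : ∀ {n} (i : Fin n) → M._≈_ n (ser (X R) i) (v i)
  ser-X {suc n} zero zero = Hom.ap-0 (cstʰ n)
  ser-X {suc n} zero (suc zero) = Hom.ap-1 (cstʰ n)
  ser-X {suc n} zero (suc (suc a)) = Hom.ap-0 (cstʰ n)
  ser-X {suc n} (suc i) = Hom.ap-cong (constHom (MPS R n)) (ser-X i)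

  ser-const : ∀ {n} (i : Fin n) c → M._≈_ n (ser (const R c) i) (ap (cstʰ n) c)
  ser-const {suc n} zero c zero = M.refl n
  ser-const {suc n} zero c (suc a) = Hom.ap-0 (cstʰ n)
  ser-const {suc n} (suc i) c = Hom.ap-cong (constHom (MPS R n)) (ser-const i c)

  -- 1 / (1 - x_i x_j)
  geo : ∀ {n} → Fin n → Fin n → Car n
  geo {suc n} zero zero zero = M.1# n
  geo {suc n} zero zero (suc zero) = M.0# n
  geo {suc n} zero zero (suc (suc a)) = geo {suc n} zero zero a
  geo {suc n} zero (suc j) = M.pow n (v j)
  geo {suc n} (suc i) zero = M.pow n (v i)
  geo {suc n} (suc i) (suc j) = const (MPS R n) (geo i j)

  pow-inv : ∀ n c → M._≈_ (suc n) (M._*_ (suc n) (M._-_ (suc n) (M.1# (suc n)) (M._*_ (suc n) (X (MPS R n)) (const (MPS R n) c))) (M.pow n c)) (M.1# (suc n))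
  pow-inv n c = go
    where
    open Kit (MPS R n)
    module Q = Kit (PS (MPS R n))
    ex : (Q.1# Q.- X (MPS R n) Q.* const (MPS R n) c) Q.* pow c Q.≈ pow c Q.- X (MPS R n) Q.* (const (MPS R n) c Q.* pow c)
    ex = Q.solve 3 (λ x c p → (Q.:1 Q.:- x Q.:* c) Q.:* p Q.:= p Q.:- x Q.:* (c Q.:* p)) Q.refl (X (MPS R n)) (const (MPS R n) c) (pow c)
    go : (Q.1# Q.- X (MPS R n) Q.* const (MPS R n) c) Q.* pow c Q.≈ Q.1#
    go zero = trans (ex 0) (trans (+-congˡ (trans (-‿cong (X-*-zero (MPS R n) (const (MPS R n) c Q.* pow c))) -0≈0)) (+-identityʳ _))
    go (suc a) = trans (ex (suc a)) (trans (+-congˡ (-‿cong (trans (X-*-suc (MPS R n) _ a) (const-* (MPS R n) c (pow c) a)))) (-‿inverseʳ _))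

  geo-inv : ∀ {n} (i j : Fin n) → M._≈_ n (M._*_ n (M._-_ n (M.1# n) (M._*_ n (v i) (v j))) (geo i j)) (M.1# n)
  geo-inv {suc n} zero zero = go
    where
    open Kit (MPS R n)
    module Q = Kit (PS (MPS R n))
    x g : Q.A
    x = X (MPS R n)
    g = geo {suc n} zero zero
    ex : (Q.1# Q.- x Q.* x) Q.* g Q.≈ g Q.- x Q.* (x Q.* g)
    ex = Q.solve 2 (λ x p → (Q.:1 Q.:- x Q.:* x) Q.:* p Q.:= p Q.:- x Q.:* (x Q.:* p)) Q.refl x g
    go : (Q.1# Q.- x Q.* x) Q.* g Q.≈ Q.1#
    go zero = trans (ex 0) (trans (+-congˡ (trans (-‿cong (X-*-zero (MPS R n) (x Q.* g))) -0≈0)) (+-identityʳ _))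
    go (suc zero) = trans (ex 1) (trans (+-congˡ (-‿cong (trans (X-*-suc (MPS R n) (x Q.* g) 0) (X-*-zero (MPS R n) g)))) (-‿inverseʳ _))
    go (suc (suc a)) = trans (ex (2 ℕ.+ a)) (trans (+-congˡ (-‿cong (trans (X-*-suc (MPS R n) (x Q.* g) (suc a)) (X-*-suc (MPS R n) g a)))) (-‿inverseʳ _))
  geo-inv {suc n} zero (suc j) = pow-inv n (v j)
  geo-inv {suc n} (suc i) zero = M.trans (suc n) (M.*-congʳ (suc n) (M.+-congˡ (suc n) (M.-‿cong (suc n) (M.*-comm (suc n) _ _)))) (pow-inv n (v i))
  geo-inv {suc n} (suc i) (suc j) = M.trans (suc n) (M.sym (suc n) (M.trans (suc n) (c.ap-* _ _)
      (M.*-congʳ (suc n) (M.trans (suc n) (c.ap-- _ _) (M.+-cong (suc n) c.ap-1 (M.-‿cong (suc n) (c.ap-* _ _)))))))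
      (M.trans (suc n) (c.ap-cong (geo-inv i j)) c.ap-1)
    where module c = Hom (constHom (MPS R n))

  toCar : ∀ n → (List ℕ → K.A) → Car n
  toCar zero C = C []
  toCar (suc n) C a = toCar n (λ l → C (a ∷ l))

  toCar-cong : ∀ n {C D} → (∀ l → length l ≡ n → C l K.≈ D l) → M._≈_ n (toCar n C) (toCar n D)
  toCar-cong zero p = p [] ≡.refl
  toCar-cong (suc n) p a = toCar-cong n (λ l e → p (a ∷ l) (≡.cong suc e))

  toCar-neg : ∀ n C → M._≈_ n (toCar n (λ l → K.- C l)) (M.-_ n (toCar n C))
  toCar-neg zero C = K.refl
  toCar-neg (suc n) C a = toCar-neg n (λ l → C (a ∷ l))

  toCar-+ : ∀ n C D → M._≈_ n (toCar n (λ l → C l K.+ D l)) (M._+_ n (toCar n C) (toCar n D))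
  toCar-+ zero C D = K.refl
  toCar-+ (suc n) C D a = toCar-+ n (λ l → C (a ∷ l)) (λ l → D (a ∷ l))

  cst-toCar : ∀ n c C → M._≈_ n (M._*_ n (ap (cstʰ n) c) (toCar n C)) (toCar n (λ l → c K.* C l))
  cst-toCar zero c C = K.refl
  cst-toCar (suc n) c C a = M.trans n (const-* (MPS R n) _ _ a) (cst-toCar n c (λ l → C (a ∷ l)))

  -- ins j inserts a variable, on which the series does not depend, at position j.
  insʰ : ∀ {n} → Fin (suc n) → Hom (MPS R n) (MPS R (suc n))
  insʰ {n} zero = constHom (MPS R n)
  insʰ {suc n} (suc j) = mapPS (insʰ j)

  mapPS-const : ∀ {S T : Ring₀} (h : Hom S T) x → CommutativeRing._≈_ (PS T) (ap (mapPS h) (const S x)) (const T (ap h x))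
  mapPS-const {S} {T} h x zero = CommutativeRing.refl T
  mapPS-const h x (suc a) = Hom.ap-0 h

  mapPS-X : ∀ {S T : Ring₀} (h : Hom S T) → CommutativeRing._≈_ (PS T) (ap (mapPS h) (X S)) (X T)
  mapPS-X h zero = Hom.ap-0 h
  mapPS-X h (suc zero) = Hom.ap-1 h
  mapPS-X h (suc (suc a)) = Hom.ap-0 h

  ins-cst : ∀ {n} (j : Fin (suc n)) c → M._≈_ (suc n) (ap (insʰ j) (ap (cstʰ n) c)) (ap (cstʰ (suc n)) c)
  ins-cst {n} zero c = M.refl (suc n)
  ins-cst {suc n} (suc j) c = M.trans (2 ℕ.+ n) (mapPS-const (insʰ j) _) (Hom.ap-cong (constHom (MPS R (suc n))) (ins-cst j c))

  ins-v : ∀ {n} (j : Fin (suc n)) i → M._≈_ (suc n) (v (Fin.punchIn j i)) (ap (insʰ j) (v i))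
  ins-v {n} zero i = M.refl (suc n)
  ins-v {suc n} (suc j) zero = M.sym (2 ℕ.+ n) (mapPS-X (insʰ j))
  ins-v {suc n} (suc j) (suc i) = M.trans (2 ℕ.+ n) (Hom.ap-cong (constHom (MPS R (suc n))) (ins-v j i)) (M.sym (2 ℕ.+ n) (mapPS-const (insʰ j) (v i)))

  ins-ser : ∀ {n} g (j : Fin (suc n)) i → M._≈_ (suc n) (ser g (Fin.punchIn j i)) (ap (insʰ j) (ser g i))
  ins-ser {n} g zero i = M.refl (suc n)
  ins-ser {suc n} g (suc j) zero a = M.sym (suc n) (ins-cst j (g a))
  ins-ser {suc n} g (suc j) (suc i) = M.trans (2 ℕ.+ n) (Hom.ap-cong (constHom (MPS R (suc n))) (ins-ser g j i)) (M.sym (2 ℕ.+ n) (mapPS-const (insʰ j) _))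

  ins-geo : ∀ {n} (j : Fin (suc n)) i k → M._≈_ (suc n) (geo (Fin.punchIn j i) (Fin.punchIn j k)) (ap (insʰ j) (geo i k))
  ins-geo {n} j i k = M.inverse-unique (suc n) (geo-inv (Fin.punchIn j i) (Fin.punchIn j k))
    (M.trans (suc n) (M.*-congʳ (suc n) (M.trans (suc n) (M.+-cong (suc n) (M.sym (suc n) h.ap-1)
        (M.-‿cong (suc n) (M.trans (suc n) (M.*-cong (suc n) (ins-v j i) (ins-v j k)) (M.sym (suc n) (h.ap-* _ _)))))
        (M.sym (suc n) (h.ap-- _ _))))
      (M.trans (suc n) (M.sym (suc n) (h.ap-* _ _)) (M.trans (suc n) (h.ap-cong (geo-inv i k)) h.ap-1)))
    where module h = Hom (insʰ j)

  V : ∀ n → List (Fin n) → Car n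
  V n = Lagrange.V (MPS R n) v

  geoProd : ∀ n → List (Fin n) → Car n
  geoProd n = Pick.pairProd (MPS R n) geo

  module Naturality {m n} (h : Hom (MPS R m) (MPS R n)) (ρ : Fin m → Fin n) where
    open Kit (MPS R n)

    prodL-nat : ∀ (φ : Fin m → Car m) (ψ : Fin n → Car n) → (∀ i → ψ (ρ i) ≈ ap h (φ i)) → ∀ xs →
      prodL ψ (map ρ xs) ≈ ap h (Kit.prodL (MPS R m) φ xs)
    prodL-nat φ ψ e xs = trans (reflexive (prodL-map ψ ρ xs)) (trans (prodL-cong e xs) (sym (Hom.ap-prodL h φ xs)))

    pairProd-nat : ∀ (φ : Fin m → Fin m → Car m) (ψ : Fin n → Fin n → Car n) → (∀ i j → ψ (ρ i) (ρ j) ≈ ap h (φ i j)) → ∀ xs →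
      Pick.pairProd (MPS R n) ψ (map ρ xs) ≈ ap h (Pick.pairProd (MPS R m) φ xs)
    pairProd-nat φ ψ e [] = sym (Hom.ap-1 h)
    pairProd-nat φ ψ e (x ∷ xs) = trans (*-cong (prodL-nat (φ x) (ψ (ρ x)) (e x) xs) (pairProd-nat φ ψ e xs)) (sym (Hom.ap-* h _ _))

    V-nat : (∀ i → v (ρ i) ≈ ap h (v i)) → ∀ xs → V n (map ρ xs) ≈ ap h (V m xs)
    V-nat e = pairProd-nat _ _ (λ i j → trans (+-cong (e i) (-‿cong (e j))) (sym (Hom.ap-- h _ _)))

  module _ (f : ℕ → K.A) where

    S : ∀ {n} → List (Fin n) → Car n
    S {n} xs = SchurPfaffian.S (MPS R n) v (ser f) geo geo-inv xs

    S-ins : ∀ {n} (j : Fin (suc n)) xs → M._≈_ (suc n) (S (map (Fin.punchIn j) xs)) (ap (insʰ j) (S xs))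
    S-ins {n} j xs = trans (*-cong (prodL-nat _ _ (ins-ser f j) xs) (trans (*-cong (V-nat (ins-v j) xs) (pairProd-nat _ _ (ins-geo j) xs)) (sym (Hom.ap-* (insʰ j) _ _)))) (sym (Hom.ap-* (insʰ j) _ _))
      where
      open Kit (MPS R (suc n))
      open Naturality (insʰ j) (Fin.punchIn j)

  module _ (g : ℕ → K.A) where

    -- Σ_j (-1)^j g(x_j) s(the variables other than x_j), read coefficientwise in the outermost
    -- variable. It mediates between `pick` over variables (`pick-vars`) and `pick` over exponents
    -- (`pickCar-toCar`).
    pickCar : ∀ n → Car n → Car (suc n)
    pickCar zero s a = g a K.* s
    pickCar (suc n) s a = M._-_ (suc n) (M._*_ (suc n) (ap (cstʰ (suc n)) (g a)) s) (pickCar n (s a))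

    pickCar-cong : ∀ n {s t} → M._≈_ n s t → M._≈_ (suc n) (pickCar n s) (pickCar n t)
    pickCar-cong zero p a = K.*-congˡ p
    pickCar-cong (suc n) p a = M.+-cong (suc n) (M.*-congˡ (suc n) p) (M.-‿cong (suc n) (pickCar-cong n (p a)))

    pickCar-toCar : ∀ n D → M._≈_ (suc n) (pickCar n (toCar n D)) (toCar (suc n) (Pick.pick R (λ b cs → g b K.* D cs)))
    pickCar-toCar zero D a = K.sym (K.trans (K.+-congˡ K.-0≈0) (K.+-identityʳ _))
    pickCar-toCar (suc n) D a = M.trans (suc n)
      (M.+-cong (suc n) (cst-toCar (suc n) (g a) D) (M.-‿cong (suc n) (pickCar-toCar n (λ l → D (a ∷ l)))))
      (M.sym (suc n) (M.trans (suc n) (toCar-+ (suc n) (λ l → g a K.* D l) (λ l → K.- pa l)) (M.+-congˡ (suc n) (toCar-neg (suc n) pa))))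

      where
      pa : List ℕ → K.A
      pa = Pick.pick R (λ b cs → g b K.* D (a ∷ cs))

    -- Says that `T`, applied to all variables but any one, is `s` in those variables. It is
    -- unfolded along the coefficients of the outer variables to fit the recursion of `pickCar`.
    Del : ∀ n → (List (Fin (suc n)) → Car (suc n)) → Car n → Set
    Del zero T s = M._≈_ 1 (T []) (const R s)
    Del (suc n) T s = M._≈_ (2 ℕ.+ n) (T (map suc (fins (suc n)))) (const (MPS R (suc n)) s) ×
      (∀ a → Del n (λ cs → T (zero ∷ map suc cs) a) (s a))

    ins⇒Del : ∀ n T s → (∀ j → M._≈_ (suc n) (T (map (Fin.punchIn j) (fins n))) (ap (insʰ j) s)) → Del n T s
    ins⇒Del zero T s e = e zero
    ins⇒Del (suc n) T s e = e zero , λ a → ins⇒Del n _ (s a) (λ j → M.trans (suc n)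
      (M.reflexive (suc n) (≡.cong (λ l → T (zero ∷ l) a) (≡.trans (≡.sym (Lₚ.map-∘ (fins n))) (Lₚ.map-∘ (fins n))))) (e (suc j) a))

    pick-map : ∀ (S : Ring₀) {I J : Set} (F : J → List J → CommutativeRing.Carrier S) (h : I → J) xs →
      Pick.pick S F (map h xs) ≡ Pick.pick S (λ y ys → F (h y) (map h ys)) xs
    pick-map S F h [] = ≡.refl
    pick-map S F h (x ∷ xs) = ≡.cong (CommutativeRing._-_ S (F (h x) (map h xs))) (pick-map S (λ y ys → F y (h x ∷ ys)) h xs)

    pick-at : ∀ (S : Ring₀) {I : Set} (F : I → List I → CommutativeRing.Carrier (PS S)) xs a →
      Pick.pick (PS S) F xs a ≡ Pick.pick S (λ y ys → F y ys a) xs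
    pick-at S F [] a = ≡.refl
    pick-at S F (x ∷ xs) a = ≡.cong (CommutativeRing._-_ S (F x xs a)) (pick-at S (λ y ys → F y (x ∷ ys)) xs a)

    pick-vars : ∀ n T s → Del n T s → M._≈_ (suc n) (Pick.pick (MPS R (suc n)) (λ j cs → M._*_ (suc n) (ser g j) (T cs)) (fins (suc n))) (pickCar n s)
    pick-vars zero T s d a = K.trans (K.+-congˡ K.-0≈0) (K.trans (K.+-identityʳ _) (K.trans (M.*-congˡ 1 {ser {1} g zero} {T []} {const R s} d a)
      (K.trans (P.*-comm (ser {1} g zero) (const R s) a) (K.trans (const-* R s g a) (K.*-comm _ _)))))
    pick-vars (suc n) T s (d₀ , d) a = +-cong
      (trans (M.*-congˡ (2 ℕ.+ n) {ser {2 ℕ.+ n} g zero} {T (map suc (fins (suc n)))} {const (MPS R (suc n)) s} d₀ a) (trans (M.*-comm (2 ℕ.+ n) (ser {2 ℕ.+ n} g zero) (const (MPS R (suc n)) s) a) (trans (const-* (MPS R (suc n)) s (ser {2 ℕ.+ n} g zero) a) (*-comm _ _))))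
      (-‿cong (begin
        Pick.pick (MPS R (2 ℕ.+ n)) (λ j cs → M._*_ (2 ℕ.+ n) (ser g j) (T (zero ∷ cs))) (map suc (fins (suc n))) a
          ≡⟨ ≡.cong (λ t → t a) (pick-map (MPS R (2 ℕ.+ n)) (λ j cs → M._*_ (2 ℕ.+ n) (ser g j) (T (zero ∷ cs))) suc (fins (suc n))) ⟩
        Pick.pick (MPS R (2 ℕ.+ n)) (λ j cs → M._*_ (2 ℕ.+ n) (ser g (suc j)) (T (zero ∷ map suc cs))) (fins (suc n)) a
          ≡⟨ pick-at (MPS R (suc n)) (λ j cs → M._*_ (2 ℕ.+ n) (ser g (suc j)) (T (zero ∷ map suc cs))) (fins (suc n)) a ⟩
        Pick.pick (MPS R (suc n)) (λ j cs → M._*_ (2 ℕ.+ n) (ser g (suc j)) (T (zero ∷ map suc cs)) a) (fins (suc n))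
          ≈⟨ Pick.pick-cong (MPS R (suc n)) (λ j cs → const-* (MPS R (suc n)) (ser g j) (T (zero ∷ map suc cs)) a) (fins (suc n)) ⟩
        Pick.pick (MPS R (suc n)) (λ j cs → ser g j * T (zero ∷ map suc cs) a) (fins (suc n))
          ≈⟨ pick-vars n (λ cs → T (zero ∷ map suc cs) a) (s a) (d a) ⟩
        pickCar n (s a) ∎))
      where open Kit (MPS R (suc n))

-- All that the symmetric function argument needs to know of z, G and κ. Both identities are
-- instances, so that argument is carried out once.
record Coeffs (R : Ring₀) : Set where
  open Kit R
  field
    z G f : ℕ → A
    κ : ℕ → ℕ → A
    τ : A
    κ-same : ∀ a b → par a ≡ par b → κ a b ≈ z a - z b
    κ-opp : ∀ a b → par a ≡ not (par b) → (z a - z b) * κ a b ≈ 1#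
    z-suc : ∀ l → z (suc l) ≈ τ * z l
    f-odd : ∀ l → par l ≡ false → f l ≈ 0#
    f-0 : f 0 ≈ 1#
    G-even : ∀ l → par l ≡ true → G l ≈ f l
    G-odd : ∀ l → par l ≡ true → G (suc l) ≈ f l * (z (suc l) - z 0)
    G-step : ∀ l → par l ≡ false → τ * G l ≈ f (suc l) * (z (suc l) - z 0)
  open Coefficients R z G κ public using (C; Cc; bal; cnt)
  private module Co = Coefficients R z G κ
  C-alt : Alt R C
  C-alt = Co.C-alt κ-same κ-opp
  C-pfaffian : ∀ a bs → C (a ∷ bs) ≈ Pick.pick R (λ b cs → C (a ∷ b ∷ []) * C cs) bs
  C-pfaffian = Co.C-pfaffian κ-same κ-opp
  C-suc-suc : ∀ a b → C (suc a ∷ suc b ∷ []) - C (a ∷ b ∷ []) ≈ f a * f (suc b) - f (suc a) * f b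
  C-suc-suc = Co.C-suc-suc κ-same κ-opp τ f z-suc f-odd G-even G-odd G-step
  C-zero-suc : ∀ b → C (0 ∷ suc b ∷ []) ≈ - (f 0 * f b)
  C-zero-suc = Co.C-zero-suc κ-same κ-opp τ f z-suc f-odd G-even G-odd G-step
  C-suc-zero : ∀ a → C (suc a ∷ 0 ∷ []) ≈ f a * f 0
  C-suc-zero = Co.C-suc-zero κ-same κ-opp τ f z-suc f-odd G-even G-odd G-step
  C-zero-zero : C (0 ∷ 0 ∷ []) ≈ 0#
  C-zero-zero = Co.C-zero-zero κ-same κ-opp τ f z-suc f-odd G-even G-odd G-step

-- The coefficients of Schur's Pfaffian

dbl : ℕ → ℕ
dbl zero = 0
dbl (suc k) = suc (suc (dbl k))

module PfaffianCoefficients (R : Ring₀) (dat : Coeffs R) where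
  open Coeffs dat
  open Variables R
  private
    module K = Kit R
    module P = Kit (PS R)

  Q : ℕ → P.A
  Q a b = C (a ∷ b ∷ [])

  Q-zero : Q 0 P.≈ P.- (const R (f 0) P.* (X R P.* f))
  Q-zero zero = K.trans C-zero-zero (K.sym (K.trans (K.-‿cong (K.trans (const-* R (f 0) (X R P.* f) 0) (K.zeroʳ′ (X-*-zero R f)))) K.-0≈0))
  Q-zero (suc b) = K.trans (C-zero-suc b) (K.-‿cong (K.sym (K.trans (const-* R (f 0) (X R P.* f) (suc b)) (K.*-congˡ (X-*-suc R f b)))))

  Q-suc : ∀ a → Q (suc a) P.≈ X R P.* Q a P.+ (const R (f a) P.* f P.- const R (f (suc a)) P.* (X R P.* f))
  Q-suc a zero = K.trans (C-suc-zero a) (K.sym (K.trans (K.+-cong (X-*-zero R (Q a))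
      (K.+-cong (const-* R (f a) f 0) (K.-‿cong (K.trans (const-* R (f (suc a)) (X R P.* f) 0) (K.zeroʳ′ (X-*-zero R f))))))
      (K.solve 1 (λ x → K.:0 K.:+ (x K.:- K.:0) K.:= x) K.refl _)))
  Q-suc a (suc b) = K.trans (K.trans (K.solve 2 (λ x y → x K.:= y K.:+ (x K.:- y)) K.refl _ (C (a ∷ b ∷ []))) (K.+-congˡ (C-suc-suc a b)))
    (K.sym (K.+-cong (X-*-suc R (Q a) b) (K.+-cong (const-* R (f a) f (suc b)) (K.-‿cong (K.trans (const-* R (f (suc a)) (X R P.* f) (suc b)) (K.*-congˡ (X-*-suc R f b)))))))

  module _ {m : ℕ} (j : Fin m) where
    private
      B = MPS R m
      module N = Kit (PS B)
      module h = Hom (serʰ {m} j)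
    open Kit B

    Qx : N.A
    Qx a = ser (Q a) j

    s x : A
    s = ser f j
    x = v j

    kern : N.A
    kern = SchurPfaffian.kernel (PS B) {Fin (suc m)} v (ser f) geo geo-inv zero (suc j)

    F₀ : N.A
    F₀ = ser {suc m} f zero

    ser-cf : ∀ c g → ser (const R c P.* g) j ≈ ap (cstʰ m) c * ser g j
    ser-cf c g = trans (h.ap-* _ _) (*-congʳ (ser-const j c))

    ser-Xf : ∀ g → ser (X R P.* g) j ≈ x * ser g j
    ser-Xf g = trans (h.ap-* _ _) (*-congʳ (ser-X j))

    -- The two-variable identity (1 - X x) Σ C(a, b) X^a x^b = f(X) f(x) (X - x), put together from
    -- `Q-zero` and `Q-suc` one power of X at a time.
    Qx-eq : (N.1# N.- X B N.* const B x) N.* Qx N.≈ (F₀ N.* const B s) N.* (X B N.- const B x)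
    Qx-eq a = trans (N.solve 3 (λ X c q → (N.:1 N.:- X N.:* c) N.:* q N.:= q N.:- X N.:* (c N.:* q)) N.refl (X B) (const B x) Qx a)
      (trans (main a) (N.solve 4 (λ X c F s → X N.:* (s N.:* F) N.:- s N.:* (c N.:* F) N.:= (F N.:* s) N.:* (X N.:- c)) N.refl (X B) (const B x) F₀ (const B s) a))
      where
      main : Qx N.- X B N.* (const B x N.* Qx) N.≈ X B N.* (const B s N.* F₀) N.- const B s N.* (const B x N.* F₀)
      main zero = begin
        ser (Q 0) j - N._*_ (X B) (const B x N.* Qx) 0
          ≈⟨ +-cong (trans (h.ap-cong Q-zero) (trans (h.ap-neg _) (-‿cong (trans (ser-cf (f 0) _) (*-congˡ (ser-Xf f))))))
               (-‿cong (X-*-zero B (const B x N.* Qx))) ⟩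
        - (ap (cstʰ m) (f 0) * (x * s)) - 0#
          ≈⟨ solve 3 (λ c x s → :- (c :* (x :* s)) :- :0 := :0 :- s :* (x :* c)) refl _ _ _ ⟩
        0# - s * (x * ap (cstʰ m) (f 0))
          ≈⟨ +-cong (X-*-zero B (const B s N.* F₀)) (-‿cong (trans (const-* B s (const B x N.* F₀) 0) (*-congˡ (const-* B x F₀ 0)))) ⟨
        (X B N.* (const B s N.* F₀)) 0 - (const B s N.* (const B x N.* F₀)) 0 ∎
      main (suc a) = begin
        ser (Q (suc a)) j - (X B N.* (const B x N.* Qx)) (suc a)
          ≈⟨ +-cong (trans (h.ap-cong (Q-suc a)) (trans (h.ap-+ _ _) (+-cong (ser-Xf (Q a)) (trans (h.ap-- _ _)
                 (+-cong (ser-cf (f a) f) (-‿cong (trans (ser-cf (f (suc a)) _) (*-congˡ (ser-Xf f)))))))))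
               (-‿cong (trans (X-*-suc B (const B x N.* Qx) a) (const-* B x Qx a))) ⟩
        (x * ser (Q a) j + (ap (cstʰ m) (f a) * s - ap (cstʰ m) (f (suc a)) * (x * s))) - x * ser (Q a) j
          ≈⟨ solve 5 (λ x q c s d → (x :* q :+ (c :* s :- d :* (x :* s))) :- x :* q := s :* c :- s :* (x :* d)) refl _ _ _ _ _ ⟩
        s * ap (cstʰ m) (f a) - s * (x * ap (cstʰ m) (f (suc a)))
          ≈⟨ +-cong (trans (X-*-suc B (const B s N.* F₀) a) (const-* B s F₀ a)) (-‿cong (trans (const-* B s (const B x N.* F₀) (suc a)) (*-congˡ (const-* B x F₀ (suc a))))) ⟨
        (X B N.* (const B s N.* F₀)) (suc a) - (const B s N.* (const B x N.* F₀)) (suc a) ∎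

    kernel-coefficients : kern N.≈ Qx
    kernel-coefficients = N.unit-cancel (geo-inv {suc m} zero (suc j)) (N.trans
      (N.trans (N.solve 4 (λ u F d g → u N.:* (F N.:* (d N.:* g)) N.:= (F N.:* d) N.:* (u N.:* g)) N.refl
                 (N.1# N.- X B N.* const B x) (F₀ N.* const B s) (X B N.- const B x) (geo {suc m} zero (suc j)))
        (N.trans (N.*-congˡ (geo-inv {suc m} zero (suc j))) (N.*-identityʳ ((F₀ N.* const B s) N.* (X B N.- const B x)))))
      (N.sym Qx-eq))

  σ-fins : ∀ n {m} (ρ : Fin n → Fin m) → let open Kit (MPS R m) in
    (∀ k → n ≡ dbl k → SchurPfaffian.σ (MPS R m) v (map ρ (fins n)) ≈ 1#) ×
    (∀ k → n ≡ suc (dbl k) → SchurPfaffian.σ (MPS R m) v (map ρ (fins n)) ≈ 0#)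
  σ-fins zero {m} ρ = (λ k e → CommutativeRing.refl (MPS R m)) , (λ k ())
  σ-fins (suc n) {m} ρ rewrite ≡.sym (Lₚ.map-∘ {g = ρ} {f = suc} (fins n)) with σ-fins n (ρ ∘ suc)
  ... | e , o = (λ { zero () ; (suc k) ≡.refl → trans (+-congˡ (trans (-‿cong (o k ≡.refl)) -0≈0)) (+-identityʳ _) })
             , (λ { k ≡.refl → trans (+-congˡ (-‿cong (e k ≡.refl))) (-‿inverseʳ _) })
    where open Kit (MPS R m)

  -- Both sides obey the same expansion, on the left along the first variable and on the right along
  -- the first exponent. Each step uses up two of them, hence the even number.
  S-coefficients : ∀ k → CommutativeRing._≈_ (MPS R (dbl k)) (S f (fins (dbl k))) (toCar (dbl k) C)
  S-coefficients zero = K.*-congˡ (K.*-identityʳ _)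
  S-coefficients (suc k) a = begin
    S f (fins (2 ℕ.+ n)) a
      ≈⟨ SchurPfaffian.schur-pfaffian (PS B) v (ser f) geo geo-inv zero (map suc (fins (suc n))) (proj₂ (σ-fins (suc n) suc) k ≡.refl) a ⟩
    Pick.pick (PS B) (λ b cs → kernel₀ b N.* S f cs) (map suc (fins (suc n))) a
      ≡⟨ ≡.cong (λ t → t a) (pick-map (Q a) (PS B) (λ b cs → kernel₀ b N.* S f cs) suc (fins (suc n))) ⟩
    Pick.pick (PS B) (λ j cs → kernel₀ (suc j) N.* S f (map suc cs)) (fins (suc n)) a
      ≡⟨ pick-at (Q a) B (λ j cs → kernel₀ (suc j) N.* S f (map suc cs)) (fins (suc n)) a ⟩
    Pick.pick B (λ j cs → (kernel₀ (suc j) N.* S f (map suc cs)) a) (fins (suc n))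
      ≈⟨ Pick.pick-cong B (λ j cs → trans (N.*-cong {kernel₀ (suc j)} {Qx j} (kernel-coefficients j) (S-ins f zero cs) a)
           (trans (N.*-comm (Qx j) (const B (S f cs)) a) (trans (const-* B (S f cs) (Qx j) a) (*-comm _ _)))) (fins (suc n)) ⟩
    Pick.pick B (λ j cs → ser (Q a) j * S f cs) (fins (suc n))
      ≈⟨ pick-vars (Q a) n (S f) (S f (fins n)) (ins⇒Del (Q a) n (S f) (S f (fins n)) (λ j → S-ins f j (fins n))) ⟩
    pickCar (Q a) n (S f (fins n))
      ≈⟨ pickCar-cong (Q a) n (S-coefficients k) ⟩
    pickCar (Q a) n (toCar n C)
      ≈⟨ pickCar-toCar (Q a) n C ⟩
    toCar (suc n) (Pick.pick R (λ b cs → Q a b K.* C cs))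
      ≈⟨ toCar-cong (suc n) (λ l _ → C-pfaffian a l) ⟨
    toCar (suc n) (λ l → C (a ∷ l)) ∎
    where
    n = dbl k
    B = MPS R (suc n)
    open Kit B
    module N = Kit (PS B)
    kernel₀ = SchurPfaffian.kernel (PS B) {Fin (2 ℕ.+ n)} v (ser f) geo geo-inv zero

-- The least sum of the l_i under the conditions l_i > m_i; `U` counts degrees from here.
msum : List ℕ → ℕ
msum [] = 0
msum (m ∷ M) = suc m ℕ.+ msum M

-- Sums over λ + δ and the bialternant formula

data Strict : List ℕ → Set where
  []  : Strict []
  [_] : ∀ m → Strict (m ∷ [])
  _∷_ : ∀ {m m′ M} → m′ < m → Strict (m′ ∷ M) → Strict (m ∷ m′ ∷ M)

module FreeSums (R : Ring₀) where
  open Kit R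
  open Variables R using (Car; v; toCar; toCar-cong; toCar-neg; V)
  private module M (n : ℕ) = Kit (MPS R n)

  -- Σ C(l₁, …, l_k, l₀) over l_i > m_i and l₀ ≥ 0 with l₁ + … + l_k + l₀ = N
  Free : ℕ → List ℕ → (List ℕ → A) → A
  Free N [] C = C (N ∷ [])
  Free N (m ∷ M) C = tri (λ l r → (m ℕ.<ᵇ l) ▹ Free r M (λ k → C (l ∷ k))) N

  Free-cong : ∀ M {C D} → (∀ l → C l ≈ D l) → ∀ N → Free N M C ≈ Free N M D
  Free-cong [] p N = p _
  Free-cong (m ∷ M) p = tri-cong (λ l r → ▹-cong (m ℕ.<ᵇ l) (λ _ → Free-cong M (λ k → p (l ∷ k)) r))

  Free-neg : ∀ M C N → Free N M (λ l → - C l) ≈ - Free N M C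
  Free-neg [] C N = refl
  Free-neg (m ∷ M) C N = trans (tri-cong (λ l r → trans (▹-cong (m ℕ.<ᵇ l) (λ _ → Free-neg M (λ k → C (l ∷ k)) r)) (sym (▹-neg (m ℕ.<ᵇ l) _))) N) (tri-neg _ N)

  <ᵇ-true : ∀ {m n} → (m ℕ.<ᵇ n) ≡ true → m < n
  <ᵇ-true {m} {n} e = ℕₚ.<ᵇ⇒< m n (Equivalence.from Boolₚ.T-≡ e)

  Free-small : ∀ M C N → N < msum M → Free N M C ≈ 0#
  Free-small (m ∷ M) C N lt = tri-0′ N (λ l r e → ▹-0 (m ℕ.<ᵇ l) (λ p → Free-small M _ r (ℕₚ.+-cancelˡ-< (suc m) r (msum M)
    (ℕₚ.≤-<-trans (ℕₚ.+-monoˡ-≤ r (<ᵇ-true p)) (≡.subst (_< suc m ℕ.+ msum M) (≡.sym e) lt)))))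

  tail-alt : ∀ {C : List ℕ → A} a → Alt R C → Alt R (λ l → C (a ∷ l))
  tail-alt a alt = record { swap = λ pre → Alt.swap alt (a ∷ pre) ; diag = λ pre → Alt.diag alt (a ∷ pre) }

  -- When the first index is unrestricted too, it and the last index are both free and the sum is
  -- alternating in them. The induction moves a bounded index to the front.
  Free-total : ∀ M C → Alt R C → ∀ N → tri (λ l r → Free r M (λ k → C (l ∷ k))) N ≈ 0#
  Free-total [] C alt N = tri-anti (λ l r → C (l ∷ r ∷ [])) (λ i j → Alt.swap alt [] i j []) (λ i → Alt.diag alt [] i []) N
  Free-total (m ∷ M) C alt N = begin
    tri (λ l r → tri (λ l₂ r₂ → (m ℕ.<ᵇ l₂) ▹ Free r₂ M (λ k → C (l ∷ l₂ ∷ k))) r) N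
      ≈⟨ tri-exchange (λ l l₂ r₂ → (m ℕ.<ᵇ l₂) ▹ Free r₂ M (λ k → C (l ∷ l₂ ∷ k))) N ⟩
    tri (λ l₂ r → tri (λ l r₂ → (m ℕ.<ᵇ l₂) ▹ Free r₂ M (λ k → C (l ∷ l₂ ∷ k))) r) N
      ≈⟨ tri-0′ N (λ l₂ r _ → zero-for l₂ r (m ℕ.<ᵇ l₂)) ⟩
    0# ∎
    where
    zero-for : ∀ l₂ r b → tri (λ l r₂ → b ▹ Free r₂ M (λ k → C (l ∷ l₂ ∷ k))) r ≈ 0#
    zero-for l₂ r false = tri-0′ r (λ _ _ _ → refl)
    zero-for l₂ r true = begin
      tri (λ l r₂ → Free r₂ M (λ k → C (l ∷ l₂ ∷ k))) r
        ≈⟨ tri-cong (λ l r₂ → trans (Free-cong M (λ k → Alt.swap alt [] l l₂ k) r₂) (Free-neg M _ r₂)) r ⟩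
      tri (λ l r₂ → - Free r₂ M (λ k → C (l₂ ∷ l ∷ k))) r
        ≈⟨ trans (tri-neg _ r) (trans (-‿cong (Free-total M _ (tail-alt l₂ alt) r)) -0≈0) ⟩
      0# ∎

  -- For M = μ + δ this is the branching step with a cells removed. The interlacing bounds l_(i+1) ≤
  -- m_i are left out on purpose: the terms that violate them cancel (`Free≈Int`), and without them
  -- `U` makes sense and is alternating for all lists `M`, not only for decreasing ones.
  U : ℕ → (List ℕ → A) → List ℕ → A
  U a C M = Free (a ℕ.+ msum M) M C

  msum-swap : ∀ pre x y post → msum (pre ++ x ∷ y ∷ post) ≡ msum (pre ++ y ∷ x ∷ post)
  msum-swap [] x y post = ≡.trans (≡.sym (ℕₚ.+-assoc (suc x) (suc y) _)) (≡.trans (≡.cong (ℕ._+ msum post) (ℕₚ.+-comm (suc x) (suc y))) (ℕₚ.+-assoc (suc y) (suc x) _))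
  msum-swap (w ∷ pre) x y post = ≡.cong (suc w ℕ.+_) (msum-swap pre x y post)

  two-antisymmetric : ∀ (p : ℕ → Bool) (g : ℕ → ℕ → ℕ → A) → (∀ i j r → g i j r ≈ - g j i r) → (∀ i r → g i i r ≈ 0#) → ∀ N →
    tri (λ l r → p l ▹ tri (λ l₂ r₂ → p l₂ ▹ g l l₂ r₂) r) N ≈ 0#
  two-antisymmetric p g sw di N = begin
    tri (λ l r → p l ▹ tri (λ l₂ r₂ → p l₂ ▹ g l l₂ r₂) r) N
      ≈⟨ tri-cong (λ l r → push (p l) (λ l₂ r₂ → p l₂ ▹ g l l₂ r₂) r) N ⟩
    tri (λ l r → tri (λ l₂ r₂ → p l ▹ p l₂ ▹ g l l₂ r₂) r) N
      ≈⟨ tri-assoc (λ l l₂ r₂ → p l ▹ p l₂ ▹ g l l₂ r₂) N ⟩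
    tri (λ s r₂ → tri (λ l l₂ → p l ▹ p l₂ ▹ g l l₂ r₂) s) N
      ≈⟨ tri-0′ N (λ s r₂ _ → tri-anti _
           (λ i j → trans (▹-cong (p i) (λ _ → ▹-cong (p j) (λ _ → sw i j r₂))) (trans (▹-cong (p i) (λ _ → sym (▹-neg (p j) _))) (trans (sym (▹-neg (p i) _)) (-‿cong (▹-comm (p i) (p j) _)))))
           (λ i → ▹-0 (p i) (λ _ → ▹-0 (p i) (λ _ → di i r₂))) s) ⟩
    0# ∎
    where
    push : ∀ b (h : ℕ → ℕ → A) r → b ▹ tri h r ≈ tri (λ i j → b ▹ h i j) r
    push true h r = refl
    push false h r = sym (tri-0′ r (λ _ _ _ → refl))

  Free-swap : ∀ C → Alt R C → ∀ pre x y post N → Free N (pre ++ x ∷ y ∷ post) C ≈ - Free N (pre ++ y ∷ x ∷ post) C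
  Free-swap C alt [] x y post N = begin
    tri (λ l r → (x ℕ.<ᵇ l) ▹ tri (λ l₂ r₂ → (y ℕ.<ᵇ l₂) ▹ Free r₂ post (λ k → C (l ∷ l₂ ∷ k))) r) N
      ≈⟨ tri-cong (λ l r → push (x ℕ.<ᵇ l) _ r) N ⟩
    tri (λ l r → tri (λ l₂ r₂ → (x ℕ.<ᵇ l) ▹ (y ℕ.<ᵇ l₂) ▹ Free r₂ post (λ k → C (l ∷ l₂ ∷ k))) r) N
      ≈⟨ tri-exchange _ N ⟩
    tri (λ l₂ r → tri (λ l r₂ → (x ℕ.<ᵇ l) ▹ (y ℕ.<ᵇ l₂) ▹ Free r₂ post (λ k → C (l ∷ l₂ ∷ k))) r) N
      ≈⟨ tri-cong (λ l₂ r → trans (tri-cong (λ l r₂ → trans (▹-comm (x ℕ.<ᵇ l) (y ℕ.<ᵇ l₂) _)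
           (▹-cong (y ℕ.<ᵇ l₂) (λ _ → trans (▹-cong (x ℕ.<ᵇ l) (λ _ → trans (Free-cong post (λ k → Alt.swap alt [] l l₂ k) r₂) (Free-neg post _ r₂))) (sym (▹-neg (x ℕ.<ᵇ l) _))))) r)
           (trans (sym (push (y ℕ.<ᵇ l₂) _ r)) (trans (▹-cong (y ℕ.<ᵇ l₂) (λ _ → tri-neg _ r)) (sym (▹-neg (y ℕ.<ᵇ l₂) _))))) N ⟩
    tri (λ l₂ r → - ((y ℕ.<ᵇ l₂) ▹ tri (λ l r₂ → (x ℕ.<ᵇ l) ▹ Free r₂ post (λ k → C (l₂ ∷ l ∷ k))) r)) N
      ≈⟨ tri-neg _ N ⟩
    - tri (λ l r → (y ℕ.<ᵇ l) ▹ tri (λ l₂ r₂ → (x ℕ.<ᵇ l₂) ▹ Free r₂ post (λ k → C (l ∷ l₂ ∷ k))) r) N ∎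
    where
    push : ∀ b (h : ℕ → ℕ → A) r → b ▹ tri h r ≈ tri (λ i j → b ▹ h i j) r
    push true h r = refl
    push false h r = sym (tri-0′ r (λ _ _ _ → refl))
  Free-swap C alt (m ∷ pre) x y post N = trans (tri-cong (λ l r → trans (▹-cong (m ℕ.<ᵇ l) (λ _ → Free-swap _ (tail-alt l alt) pre x y post r)) (sym (▹-neg (m ℕ.<ᵇ l) _))) N) (tri-neg _ N)

  Free-diag : ∀ C → Alt R C → ∀ pre x post N → Free N (pre ++ x ∷ x ∷ post) C ≈ 0#
  Free-diag C alt [] x post N = two-antisymmetric (x ℕ.<ᵇ_) (λ l l₂ r₂ → Free r₂ post (λ k → C (l ∷ l₂ ∷ k)))
    (λ i j r → trans (Free-cong post (λ k → Alt.swap alt [] i j k) r) (Free-neg post _ r))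
    (λ i r → trans (Free-cong post (λ k → trans (Alt.diag alt [] i k) (sym -0≈0)) r) (trans (Free-neg post (λ _ → 0#) r) (trans (-‿cong (Free-0 post r)) -0≈0))) N
    where
    Free-0 : ∀ M N → Free N M (λ _ → 0#) ≈ 0#
    Free-0 [] N = refl
    Free-0 (m ∷ M) N = tri-0′ N (λ l r _ → ▹-0 (m ℕ.<ᵇ l) (λ _ → Free-0 M r))
  Free-diag C alt (m ∷ pre) x post N = tri-0′ N (λ l r _ → ▹-0 (m ℕ.<ᵇ l) (λ _ → Free-diag _ (tail-alt l alt) pre x post r))

  U-alt : ∀ a {C} → Alt R C → Alt R (U a C)
  U-alt a {C} alt = record
    { swap = λ pre x y post → trans (Free-swap C alt pre x y post _) (-‿cong (reflexive (≡.cong (λ N → Free (a ℕ.+ N) (pre ++ y ∷ x ∷ post) C) (msum-swap pre x y post))))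
    ; diag = λ pre x post → Free-diag C alt pre x post _ }

  -- Σ_λ C(λ + δ) s_λ by iterated branching, without tableaux; `F⇒bsum` makes the connection.
  F : ∀ n → (List ℕ → A) → Car n
  F zero C = C []
  F (suc n) C a = F n (U a C)

  ≤ᵇ-split : ∀ m l x → (m ℕ.≤ᵇ l) ▹ x ≈ (m ℕ.<ᵇ l) ▹ x + (l ℕ.≡ᵇ m) ▹ x
  ≤ᵇ-split zero zero x = sym (+-identityˡ x)
  ≤ᵇ-split zero (suc l) x = sym (+-identityʳ x)
  ≤ᵇ-split (suc m) zero x = sym (+-identityˡ _)
  ≤ᵇ-split (suc zero) (suc l) x = ≤ᵇ-split zero l x
  ≤ᵇ-split (suc (suc m)) (suc l) x = ≤ᵇ-split (suc m) l x

  tri-point : ∀ (φ : ℕ → ℕ → A) m r → tri (λ l k → (l ℕ.≡ᵇ m) ▹ φ l k) (m ℕ.+ r) ≈ φ m r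
  tri-point φ zero r = tri-head _ r (λ _ _ _ → refl)
  tri-point φ (suc m) r = trans (+-identityˡ _) (tri-point (φ ∘ suc) m r)

  -- Multiplication by x₀ - x₁ removes the summation over l₁.
  division : ∀ C → Alt R C → ∀ M m a →
    tri (λ l r → (m ℕ.<ᵇ l) ▹ Free r M (λ k → C (l ∷ k))) (m ℕ.+ (a ℕ.+ msum M))
    - tri (λ l r → (m ℕ.≤ᵇ l) ▹ Free r M (λ k → C (l ∷ k))) (m ℕ.+ (a ℕ.+ msum M)) ≈ - U a (λ k → C (m ∷ k)) M
  division C alt M m a = begin
    T - tri (λ l r → (m ℕ.≤ᵇ l) ▹ φ l r) N
      ≈⟨ +-congˡ (-‿cong (trans (tri-cong (λ l r → ≤ᵇ-split m l (φ l r)) N) (trans (tri-+ _ _ N) (+-congˡ (tri-point φ m (a ℕ.+ msum M)))))) ⟩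
    T - (T + φ m (a ℕ.+ msum M))
      ≈⟨ solve 2 (λ t p → t :- (t :+ p) := :- p) refl _ _ ⟩
    - φ m (a ℕ.+ msum M) ∎
    where
    φ : ℕ → ℕ → A
    φ l r = Free r M (λ k → C (l ∷ k))
    N = m ℕ.+ (a ℕ.+ msum M)
    T = tri (λ l r → (m ℕ.<ᵇ l) ▹ φ l r) N

  division-at : ∀ C → Alt R C → ∀ n a m (T : List ℕ → A) (W : List ℕ → A) →
    (∀ M → T M ≈ tri (λ l r → (m ℕ.<ᵇ l) ▹ Free r M (λ k → C (l ∷ k))) (m ℕ.+ (a ℕ.+ msum M))) →
    (∀ M → W M ≈ tri (λ l r → (m ℕ.≤ᵇ l) ▹ Free r M (λ k → C (l ∷ k))) (m ℕ.+ (a ℕ.+ msum M))) →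
    M._≈_ n (M._-_ n (toCar n T) (toCar n W)) (M.-_ n (toCar n (U a (λ k → C (m ∷ k)))))
  division-at C alt zero a m T W p r = trans (+-cong (p []) (-‿cong (r []))) (division C alt [] m a)
  division-at C alt (suc n) a m T W p r x = M.trans n (M.sym n (M.trans n (toCar-+′ n (λ l → T (x ∷ l)) (λ l → - W (x ∷ l))) (M.+-congˡ n (toCar-neg n _))))
      (M.trans n (toCar-cong n (λ l _ → trans (+-cong (p (x ∷ l)) (-‿cong (r (x ∷ l)))) (division C alt (x ∷ l) m a))) (toCar-neg n _))
    where
    toCar-+′ = Variables.toCar-+ R

  -- The same sum restricted to u l₁, l₂ ≤ m₁, l₃ ≤ m₂, …
  Int : (ℕ → Bool) → ℕ → List ℕ → (List ℕ → A) → A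
  Int u N [] C = u N ▹ C (N ∷ [])
  Int u N (m ∷ M) C = tri (λ l r → u l ▹ (m ℕ.<ᵇ l) ▹ Int (λ k → k ℕ.≤ᵇ m) r M (λ k → C (l ∷ k))) N

  Int-cong : ∀ u M {C D} → (∀ l → C l ≈ D l) → ∀ N → Int u N M C ≈ Int u N M D
  Int-cong u [] p N = ▹-cong (u N) (λ _ → p _)
  Int-cong u (m ∷ M) p = tri-cong (λ l r → ▹-cong (u l) (λ _ → ▹-cong (m ℕ.<ᵇ l) (λ _ → Int-cong _ M (λ k → p (l ∷ k)) r)))

  Int-neg : ∀ u M C N → Int u N M (λ l → - C l) ≈ - Int u N M C
  Int-neg u [] C N = sym (▹-neg (u N) _)
  Int-neg u (m ∷ M) C N = trans (tri-cong (λ l r → trans (▹-cong (u l) (λ _ → trans (▹-cong (m ℕ.<ᵇ l) (λ _ → Int-neg _ M (λ k → C (l ∷ k)) r)) (sym (▹-neg (m ℕ.<ᵇ l) _)))) (sym (▹-neg (u l) _))) N) (tri-neg _ N)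

  Int-split : ∀ m M C N → Int (λ _ → true) N M C ≈ Int (λ k → k ℕ.≤ᵇ m) N M C + Int (λ k → m ℕ.<ᵇ k) N M C
  Int-split m M C N = split M
    where
    bit : ∀ l m x → x ≈ (l ℕ.≤ᵇ m) ▹ x + (m ℕ.<ᵇ l) ▹ x
    bit zero zero x = sym (+-identityʳ x)
    bit zero (suc m) x = sym (+-identityʳ x)
    bit (suc l) zero x = sym (+-identityˡ x)
    bit (suc zero) (suc m) x = bit zero m x
    bit (suc (suc l)) (suc m) x = bit (suc l) m x
    split : ∀ M → Int (λ _ → true) N M C ≈ Int (λ k → k ℕ.≤ᵇ m) N M C + Int (λ k → m ℕ.<ᵇ k) N M C
    split [] = bit N m _
    split (m₂ ∷ M) = trans (tri-cong (λ l r → bit l m _) N) (tri-+ _ _ N)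

  -- Split the next index at m. Where it exceeds m, its own lower bound m₂ < m holds automatically
  -- by strictness, so it and l₁ are subject to the same condition; the sum is alternating in the
  -- two and vanishes.
  Free≈Int : ∀ M → Strict M → ∀ C → Alt R C → ∀ N → Free N M C ≈ Int (λ _ → true) N M C
  Free≈Int [] st C alt N = refl
  Free≈Int (m ∷ M) st C alt N = begin
    tri (λ l r → (m ℕ.<ᵇ l) ▹ Free r M (λ k → C (l ∷ k))) N
      ≈⟨ tri-cong (λ l r → trans (▹-cong (m ℕ.<ᵇ l) (λ _ → trans (Free≈Int M (tail st) _ (tail-alt l alt) r) (Int-split m M _ r))) (▹-+ (m ℕ.<ᵇ l) _ _)) N ⟩
    tri (λ l r → (m ℕ.<ᵇ l) ▹ Int (λ k → k ℕ.≤ᵇ m) r M (λ k → C (l ∷ k)) + (m ℕ.<ᵇ l) ▹ Int (λ k → m ℕ.<ᵇ k) r M (λ k → C (l ∷ k))) N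
      ≈⟨ tri-+ _ _ N ⟩
    Int (λ _ → true) N (m ∷ M) C + tri (λ l r → (m ℕ.<ᵇ l) ▹ Int (λ k → m ℕ.<ᵇ k) r M (λ k → C (l ∷ k))) N
      ≈⟨ trans (+-congˡ (vanish M st)) (+-identityʳ _) ⟩
    Int (λ _ → true) N (m ∷ M) C ∎
    where
    ▹-+ : ∀ b x y → b ▹ (x + y) ≈ b ▹ x + b ▹ y
    ▹-+ true x y = refl
    ▹-+ false x y = sym (+-identityˡ _)
    tail : ∀ {M} → Strict (m ∷ M) → Strict M
    tail [ _ ] = []
    tail (lt ∷ st) = st
    Int-0 : ∀ u M N → Int u N M (λ _ → 0#) ≈ 0#
    Int-0 u [] N = ▹-0 (u N) (λ _ → refl)
    Int-0 u (m ∷ M) N = tri-0′ N (λ l r _ → ▹-0 (u l) (λ _ → ▹-0 (m ℕ.<ᵇ l) (λ _ → Int-0 _ M r)))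
    vanish : ∀ M → Strict (m ∷ M) → tri (λ l r → (m ℕ.<ᵇ l) ▹ Int (λ k → m ℕ.<ᵇ k) r M (λ k → C (l ∷ k))) N ≈ 0#
    vanish [] st = begin
      tri (λ l r → (m ℕ.<ᵇ l) ▹ (m ℕ.<ᵇ r) ▹ C (l ∷ r ∷ [])) N
        ≈⟨ tri-anti _ (λ i j → trans (▹-cong (m ℕ.<ᵇ i) (λ _ → trans (▹-cong (m ℕ.<ᵇ j) (λ _ → Alt.swap alt [] i j [])) (sym (▹-neg (m ℕ.<ᵇ j) _))))
             (trans (sym (▹-neg (m ℕ.<ᵇ i) _)) (-‿cong (▹-comm (m ℕ.<ᵇ i) (m ℕ.<ᵇ j) _))))
             (λ i → ▹-0 (m ℕ.<ᵇ i) (λ _ → ▹-0 (m ℕ.<ᵇ i) (λ _ → Alt.diag alt [] i []))) N ⟩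
      0# ∎
    vanish (m₂ ∷ M) (lt ∷ st) = trans (tri-cong (λ l r → ▹-cong (m ℕ.<ᵇ l) (λ _ → tri-cong (λ l₂ r₂ →
        ▹-cong (m ℕ.<ᵇ l₂) (λ e → reflexive (≡.cong (_▹ Int (λ k → k ℕ.≤ᵇ m₂) r₂ M (λ k → C (l ∷ l₂ ∷ k))) (Equivalence.to Boolₚ.T-≡ (ℕₚ.<⇒<ᵇ (ℕₚ.<-trans lt (<ᵇ-true {m} {l₂} e))))))) r)) N)
      (two-antisymmetric (m ℕ.<ᵇ_) (λ l l₂ r₂ → Int (λ k → k ℕ.≤ᵇ m₂) r₂ M (λ k → C (l ∷ l₂ ∷ k)))
        (λ i j r → trans (Int-cong _ M (λ k → Alt.swap alt [] i j k) r) (Int-neg _ M _ r))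
        (λ i r → trans (Int-cong _ M (λ k → Alt.diag alt [] i k) r) (Int-0 _ M r)) N)

module Bialternant (R : Ring₀) where
  open FreeSums R
  open Variables R using (Car; v; toCar; toCar-cong; toCar-neg; V)
  private
    module K = Kit R
    module M (n : ℕ) = Kit (MPS R n)

  skip-second : ∀ (B : Ring₀) (P : ℕ → CommutativeRing.Carrier B) (G : ℕ → ℕ → CommutativeRing.Carrier B) a m →
    CommutativeRing._≈_ B (CommutativeRing._*_ (PS (PS B)) (ap (mapPS (constHom B)) P) G a m) (CommutativeRing._*_ (PS B) P (λ i → G i m) a)
  skip-second B P G a m = L′.trans (go (λ i j → const B (P i) Q.* G j) a) (L′.tri-cong (λ i j → const-* B (P i) (G j) m) a)
    where
    module L′ = Kit B
    module Q = Kit (PS B)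
    go : ∀ (h : ℕ → ℕ → ℕ → L′.A) a → Q.tri h a m L′.≈ L′.tri (λ i j → h i j m) a
    go h zero = L′.refl
    go h (suc a) = L′.+-congˡ (go (h ∘ suc) a)

  xprod : ∀ n → Car (suc n)
  xprod n = M.prodL (suc n) (λ j → M._-_ (suc n) (X (MPS R n)) (const (MPS R n) (v j))) (fins n)

  -- Each factor x_0 - x_j removes one summation. The one with x_1 turns `U a C` into minus the
  -- corresponding sum for C(m ∷ ...), where m is the exponent of x_1, and the induction treats the
  -- others. The sign is absorbed by interchanging a and m.
  xprod-U : ∀ n C → Alt R C → M._≈_ (suc n) (M._*_ (suc n) (xprod n) (λ a → toCar n (U a C))) (toCar (suc n) C)
  xprod-U zero C alt a = K.trans (M.*-identityˡ 1 (λ a → C (a ℕ.+ 0 ∷ [])) a) (K.reflexive (≡.cong (λ b → C (b ∷ [])) (ℕₚ.+-identityʳ a)))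
  xprod-U (suc n) C alt a m = begin
    (xprod (suc n) N.* G) a m
      ≈⟨ N.trans (N.*-congʳ {G} (N.*-congˡ {d} rest)) (N.solve 3 (λ d p g → (d N.:* p) N.:* g N.:= p N.:* (d N.:* g)) N.refl d P′ G) a m ⟩
    (P′ N.* (d N.* G)) a m
      ≈⟨ skip-second B (xprod n) (d N.* G) a m ⟩
    (xprod n Q.* (λ i → (d N.* G) i m)) a
      ≈⟨ Q.*-congˡ {xprod n} {λ i → (d N.* G) i m} {λ i → - toCar n (U i (λ k → C (m ∷ k)))} (λ i → divide i m) a ⟩
    (xprod n Q.* (Q.- H)) a
      ≈⟨ Q.-‿distribʳ-* (xprod n) H a ⟨
    - (xprod n Q.* H) a
      ≈⟨ -‿cong (xprod-U n (λ k → C (m ∷ k)) (tail-alt m alt) a) ⟩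
    - toCar n (λ k → C (m ∷ a ∷ k))
      ≈⟨ toCar-neg n _ ⟨
    toCar n (λ k → K.- C (m ∷ a ∷ k))
      ≈⟨ toCar-cong n (λ k _ → Alt.swap alt [] a m k) ⟨
    toCar n (λ k → C (a ∷ m ∷ k)) ∎
    where
    B = MPS R n
    open Kit B
    module Q = Kit (PS B)
    module N = Kit (PS (PS B))
    G : N.A
    G a = toCar (suc n) (U a C)
    H : Q.A
    H i = toCar n (U i (λ k → C (m ∷ k)))
    d P′ : N.A
    d = X (PS B) N.- const (PS B) (X B)
    P′ = ap (mapPS (constHom B)) (xprod n)
    rest : N.prodL (λ j → X (PS B) N.- const (PS B) (v j)) (map suc (fins n)) N.≈ P′
    rest = N.trans (N.reflexive (N.prodL-map _ suc (fins n))) (N.trans (N.prodL-cong (λ j → N.sym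
      (N.trans (Hom.ap-- (mapPS (constHom B)) (X B) (const B (v j))) (N.+-cong (Variables.mapPS-X R (constHom B)) (N.-‿cong (Variables.mapPS-const R (constHom B) (v j)))))) (fins n))
      (N.sym (Hom.ap-prodL (mapPS (constHom B)) _ (fins n))))
    shift : ∀ i m s → i ℕ.+ (suc m ℕ.+ s) ≡ m ℕ.+ (suc i ℕ.+ s)
    shift i m s = ≡.trans (ℕₚ.+-suc i (m ℕ.+ s)) (≡.trans (≡.cong suc (≡.trans (≡.sym (ℕₚ.+-assoc i m s)) (≡.trans (≡.cong (ℕ._+ s) (ℕₚ.+-comm i m)) (ℕₚ.+-assoc m i s)))) (≡.sym (ℕₚ.+-suc m (i ℕ.+ s))))
    shift′ : ∀ i m s → i ℕ.+ (suc m ℕ.+ s) ≡ suc m ℕ.+ (i ℕ.+ s)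
    shift′ i m s = ≡.trans (shift i m s) (ℕₚ.+-suc m (i ℕ.+ s))
    -- The coefficients of x_0 G and of x_1 G. Their boundary values 0 agree with the sums in
    -- `division-at` for two different reasons: below the least degree nothing is summed
    -- (`Free-small`), and with l₁ unbounded everything cancels (`Free-total`).
    Tf Wf : ℕ → ℕ → List ℕ → K.A
    Tf zero m M = K.0#
    Tf (suc i) m M = U i C (m ∷ M)
    Wf i zero M = K.0#
    Wf i (suc m) M = U i C (m ∷ M)
    Tf-eq : ∀ i m M → Tf i m M K.≈ K.tri (λ l r → (m ℕ.<ᵇ l) K.▹ Free r M (λ k → C (l ∷ k))) (m ℕ.+ (i ℕ.+ msum M))
    Tf-eq zero m M = K.sym (Free-small (m ∷ M) C (m ℕ.+ msum M) ℕₚ.≤-refl)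
    Tf-eq (suc i) m M = K.reflexive (≡.cong (K.tri (λ l r → (m ℕ.<ᵇ l) K.▹ Free r M (λ k → C (l ∷ k)))) (shift i m (msum M)))
    Wf-eq : ∀ i m M → Wf i m M K.≈ K.tri (λ l r → (m ℕ.≤ᵇ l) K.▹ Free r M (λ k → C (l ∷ k))) (m ℕ.+ (i ℕ.+ msum M))
    Wf-eq i zero M = K.sym (Free-total M C alt (i ℕ.+ msum M))
    Wf-eq i (suc m) M = K.reflexive (≡.cong (K.tri (λ l r → (m ℕ.<ᵇ l) K.▹ Free r M (λ k → C (l ∷ k)))) (shift′ i m (msum M)))
    toCar-0 : ∀ n → CommutativeRing._≈_ (MPS R n) (M.0# n) (toCar n (λ _ → K.0#))
    toCar-0 zero = K.refl
    toCar-0 (suc n) a = toCar-0 n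
    X-part : ∀ i m → (X (PS B) N.* G) i m ≈ toCar n (Tf i m)
    X-part zero m = trans (X-*-zero (PS B) G m) (toCar-0 n)
    X-part (suc i) m = X-*-suc (PS B) G i m
    c-part : ∀ i m → (const (PS B) (X B) N.* G) i m ≈ toCar n (Wf i m)
    c-part i zero = trans (const-* (PS B) (X B) G i zero) (trans (X-*-zero B (G i)) (toCar-0 n))
    c-part i (suc m) = trans (const-* (PS B) (X B) G i (suc m)) (X-*-suc B (G i) m)
    divide : ∀ i m → (d N.* G) i m ≈ - toCar n (U i (λ k → C (m ∷ k)))
    divide i m = trans (N.solve 3 (λ x c g → (x N.:- c) N.:* g N.:= x N.:* g N.:- c N.:* g) N.refl (X (PS B)) (const (PS B) (X B)) G i m)
      (trans (+-cong (X-part i m) (-‿cong (c-part i m))) (division-at C alt n i m (Tf i m) (Wf i m) (Tf-eq i m) (Wf-eq i m)))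

  bialternant : ∀ n C → Alt R C → M._≈_ n (M._*_ n (V n (fins n)) (F n C)) (toCar n C)
  bialternant zero C alt = K.*-identityˡ _
  bialternant (suc n) C alt = N.trans (N.*-congʳ (N.*-cong
        (N.reflexive (N.prodL-map (λ y → X B N.- v y) suc (fins n)))
        (Variables.Naturality.V-nat R (constHom B) suc (λ i → N.refl) (fins n))))
      (N.trans (N.*-assoc (xprod n) _ (F (suc n) C))
      (N.trans (N.*-congˡ {xprod n} (λ a → Q.trans (const-* B (V n (fins n)) (F (suc n) C) a) (bialternant n (U a C) (U-alt a alt))))
      (xprod-U n C alt)))
    where
    B = MPS R n
    module Q = Kit B
    module N = Kit (PS B)

-- Cancelling the Vandermonde product

module Littlewood (R : Ring₀) where
  open Variables R
  private
    module K = Kit R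
    module M (n : ℕ) = Kit (MPS R n)

  Regular : ∀ n → Car n → Set
  Regular n r = ∀ h → M._≈_ n (M._*_ n r h) (M.0# n) → M._≈_ n h (M.0# n)

  regular-* : ∀ n {r s} → Regular n r → Regular n s → Regular n (M._*_ n r s)
  regular-* n rr rs h e = rs h (rr _ (M.trans n (M.sym n (M.*-assoc n _ _ _)) e))

  regular-const : ∀ n {r} → Regular n r → Regular (suc n) (const (MPS R n) r)
  regular-const n {r} rr h e a = rr (h a) (M.trans n (M.sym n (const-* (MPS R n) r h a)) (e a))

  regular-v : ∀ {n} (i : Fin n) → Regular n (v i)
  regular-v {suc n} zero h e a = M.trans n (M.sym n (X-*-suc (MPS R n) h a)) (e (suc a))
  regular-v {suc n} (suc i) = regular-const n (regular-v i)

  -- Coefficients are compared from the lowest one on: c h_0 = 0, and then c h_(a+1) = h_a = 0.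
  regular-X- : ∀ n {c} → Regular n c → Regular (suc n) (M._-_ (suc n) (X (MPS R n)) (const (MPS R n) c))
  regular-X- n {c} rc h e = go
    where
    B = MPS R n
    open Kit B
    module N = Kit (PS B)
    eq : ∀ a → (X B N.* h) a - c * h a ≈ 0#
    eq a = trans (+-congˡ (-‿cong (sym (const-* B c h a)))) (trans (N.solve 3 (λ x c h → x N.:* h N.:- c N.:* h N.:= (x N.:- c) N.:* h) N.refl (X B) (const B c) h a) (e a))
    go : ∀ a → h a ≈ 0#
    go zero = rc (h 0) (sym (x-y≈0⇒x≈y (trans (+-congʳ (sym (X-*-zero B h))) (eq 0))))
    go (suc a) = rc (h (suc a)) (sym (x-y≈0⇒x≈y (trans (+-congʳ (sym (trans (X-*-suc B h a) (go a)))) (eq (suc a)))))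

  regular-1 : ∀ n → Regular n (M.1# n)
  regular-1 n h e = M.trans n (M.sym n (M.*-identityˡ n h)) e

  regular-V : ∀ n → Regular n (V n (fins n))
  regular-V zero = regular-1 0
  regular-V (suc n) = regular-* (suc n) (go (fins n))
      (λ h e → regular-const n (regular-V n) h (M.trans (suc n) (M.*-congʳ (suc n) {h} (M.sym (suc n) (Naturality.V-nat (constHom (MPS R n)) suc (λ i → M.refl (suc n)) (fins n)))) e))
    where
    go : ∀ xs → Regular (suc n) (M.prodL (suc n) (λ y → M._-_ (suc n) (X (MPS R n)) (v y)) (map suc xs))
    go [] = regular-1 (suc n)
    go (x ∷ xs) = regular-* (suc n) (regular-X- n (regular-v x)) (go xs)

  product : ∀ n → (ℕ → K.A) → Car n
  product n f = M._*_ n (M.prodL n (ser f) (fins n)) (geoProd n (fins n))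

  module _ (dat : Coeffs R) where
    open Coeffs dat using (C; C-alt; f)
    open FreeSums R using (F)

    littlewood : ∀ k → M._≈_ (dbl k) (F (dbl k) C) (product (dbl k) f)
    littlewood k = x-y≈0⇒x≈y (regular-V n (F n C - product n f) (begin
      V n (fins n) * (F n C - product n f)
        ≈⟨ solve 4 (λ v x p g → v :* (x :- p :* g) := v :* x :- p :* (v :* g)) refl _ _ _ _ ⟩
      V n (fins n) * F n C - S f (fins n)
        ≈⟨ +-cong (Bialternant.bialternant R n C C-alt) (-‿cong (PfaffianCoefficients.S-coefficients R dat k)) ⟩
      toCar n C - toCar n C
        ≈⟨ -‿inverseʳ _ ⟩
      0# ∎))
      where
      n = dbl k
      open Kit (MPS R n)

  at : ∀ n → Car n → Vec ℕ n → K.A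
  at zero c [] = c
  at (suc n) c (a ∷ e) = at n (c a) e

  at-cong : ∀ n {c d} → M._≈_ n c d → ∀ e → at n c e K.≈ at n d e
  at-cong zero p [] = p
  at-cong (suc n) p (a ∷ e) = at-cong n (p a) e

  -- The outermost variable is set to zero; this is how an odd number of variables is reduced to an
  -- even one.
  product-zero : ∀ n f → f 0 K.≈ K.1# → M._≈_ n (product (suc n) f 0) (product n f)
  product-zero n f f0 = begin
    product (suc n) f 0
      ≈⟨ *-cong (begin
           ap (cstʰ n) (f 0) * M.prodL (suc n) (ser f) (map suc (fins n)) 0
             ≈⟨ *-cong (trans (Hom.ap-cong (cstʰ n) f0) (Hom.ap-1 (cstʰ n))) (Naturality.prodL-nat (constHom B) suc (ser f) (ser f) (λ i → M.refl (suc n)) (fins n) 0) ⟩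
           1# * prodL (ser f) (fins n) ≈⟨ *-identityˡ _ ⟩
           prodL (ser f) (fins n) ∎)
         (begin
           M.prodL (suc n) (geo {suc n} zero) (map suc (fins n)) 0 * geoProd (suc n) (map suc (fins n)) 0
             ≈⟨ *-cong (trans (reflexive (≡.cong (λ t → t 0) (M.prodL-map (suc n) (geo {suc n} zero) suc (fins n))))
                  (trans (Hom.ap-prodL (ev₀ B) (λ j → geo {suc n} zero (suc j)) (fins n)) (prodL-1 (λ j → refl) (fins n))))
                  (Naturality.pairProd-nat (constHom B) suc geo geo (λ i j → M.refl (suc n)) (fins n) 0) ⟩
           1# * geoProd n (fins n) ≈⟨ *-identityˡ _ ⟩
           geoProd n (fins n) ∎) ⟩
    product n f ∎
    where
    B = MPS R n
    open Kit B

-- Shapes as lists: decreasing lists, interlacing and the shift by δ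

bool-iff : ∀ {b c} → (b ≡ true → c ≡ true) → (c ≡ true → b ≡ true) → b ≡ c
bool-iff {true} {true} f g = ≡.refl
bool-iff {true} {false} f g = ≡.sym (f ≡.refl)
bool-iff {false} {true} f g = g ≡.refl
bool-iff {false} {false} f g = ≡.refl

≤ᵇ-true : ∀ m n → (m ℕ.≤ᵇ n) ≡ true → m ≤ n
≤ᵇ-true m n e = ℕₚ.≤ᵇ⇒≤ m n (Equivalence.from Boolₚ.T-≡ e)

true-≤ᵇ : ∀ {m n} → m ≤ n → (m ℕ.≤ᵇ n) ≡ true
true-≤ᵇ le = Equivalence.to Boolₚ.T-≡ (ℕₚ.≤⇒≤ᵇ le)

≡ᵇ-true : ∀ m n → (m ℕ.≡ᵇ n) ≡ true → m ≡ n
≡ᵇ-true m n e = ℕₚ.≡ᵇ⇒≡ m n (Equivalence.from Boolₚ.T-≡ e)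

true-≡ᵇ : ∀ {m n} → m ≡ n → (m ℕ.≡ᵇ n) ≡ true
true-≡ᵇ {m} {n} e = Equivalence.to Boolₚ.T-≡ (ℕₚ.≡⇒≡ᵇ m n e)

≡ᵇ-iff : ∀ {m n m′ n′} → (m ≡ n → m′ ≡ n′) → (m′ ≡ n′ → m ≡ n) → (m ℕ.≡ᵇ n) ≡ (m′ ℕ.≡ᵇ n′)
≡ᵇ-iff {m} {n} {m′} {n′} f g = bool-iff (λ e → true-≡ᵇ (f (≡ᵇ-true m n e))) (λ e → true-≡ᵇ (g (≡ᵇ-true m′ n′ e)))

≤ᵇ-iff : ∀ {m n m′ n′} → (m ≤ n → m′ ≤ n′) → (m′ ≤ n′ → m ≤ n) → (m ℕ.≤ᵇ n) ≡ (m′ ℕ.≤ᵇ n′)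
≤ᵇ-iff {m} {n} {m′} {n′} f g = bool-iff (λ e → true-≤ᵇ (f (≤ᵇ-true m n e))) (λ e → true-≤ᵇ (g (≤ᵇ-true m′ n′ e)))

∧-true : ∀ b c → b ∧ c ≡ true → b ≡ true × c ≡ true
∧-true true true e = ≡.refl , ≡.refl

tot : List ℕ → ℕ
tot [] = 0
tot (a ∷ p) = a ℕ.+ tot p

-- λ + δ
lam : List ℕ → List ℕ
lam [] = []
lam (a ∷ p) = (a ℕ.+ length p) ∷ lam p

decFrom : ℕ → List ℕ → Bool
decFrom m [] = true
decFrom m (a ∷ p) = (a ℕ.≤ᵇ m) ∧ decFrom a p

dec : List ℕ → Bool
dec [] = true
dec (a ∷ p) = decFrom a p

-- λ₁ ≥ μ₁ ≥ λ₂ ≥ … ≥ μ_n ≥ λ_{n+1}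
il : List ℕ → List ℕ → Bool
il (a ∷ []) [] = true
il (a ∷ b ∷ p) (c ∷ μ) = (c ℕ.≤ᵇ a) ∧ (b ℕ.≤ᵇ c) ∧ il (b ∷ p) μ
il _ _ = false

il-cons : ∀ a b p c μ → il (a ∷ b ∷ p) (c ∷ μ) ≡ true → c ≤ a × b ≤ c × il (b ∷ p) μ ≡ true
il-cons a b p c μ e with ∧-true (c ℕ.≤ᵇ a) _ e
... | ca , e′ with ∧-true (b ℕ.≤ᵇ c) _ e′
... | bc , e″ = ≤ᵇ-true c a ca , ≤ᵇ-true b c bc , e″

il⇒decˡ : ∀ p μ → il p μ ≡ true → dec p ≡ true
il⇒decˡ (a ∷ []) μ e = ≡.refl
il⇒decˡ (a ∷ b ∷ p) (c ∷ μ) e = let (ca , bc , e′) = il-cons a b p c μ e in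
  ≡.cong₂ _∧_ (true-≤ᵇ {b} {a} (ℕₚ.≤-trans bc ca)) (il⇒decˡ (b ∷ p) μ e′)

il⇒decʳ : ∀ p μ → il p μ ≡ true → dec μ ≡ true
il⇒decʳ (a ∷ []) [] e = ≡.refl
il⇒decʳ (a ∷ b ∷ p) (c ∷ []) e = ≡.refl
il⇒decʳ (a ∷ b ∷ []) (c ∷ d ∷ μ) e with proj₂ (proj₂ (il-cons a b [] c (d ∷ μ) e))
... | ()
il⇒decʳ (a ∷ b ∷ b′ ∷ p) (c ∷ d ∷ μ) e = let (ca , bc , e′) = il-cons a b (b′ ∷ p) c (d ∷ μ) e in
  ≡.cong₂ _∧_ (true-≤ᵇ {d} {c} (ℕₚ.≤-trans (proj₁ (il-cons b b′ p d μ e′)) bc)) (il⇒decʳ (b ∷ b′ ∷ p) (d ∷ μ) e′)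

triangle : ℕ → ℕ
triangle zero = 0
triangle (suc n) = suc n ℕ.+ triangle n

swap-mid : ∀ a b c d → (a ℕ.+ b) ℕ.+ (c ℕ.+ d) ≡ (a ℕ.+ c) ℕ.+ (b ℕ.+ d)
swap-mid a b c d = ≡.trans (ℕₚ.+-assoc a b _) (≡.trans (≡.cong (a ℕ.+_) (≡.trans (≡.sym (ℕₚ.+-assoc b c d))
  (≡.trans (≡.cong (ℕ._+ d) (ℕₚ.+-comm b c)) (ℕₚ.+-assoc c b d)))) (≡.sym (ℕₚ.+-assoc a c _)))

msum-lam : ∀ p → msum (lam p) ≡ tot p ℕ.+ triangle (length p)
msum-lam [] = ≡.refl
msum-lam (a ∷ p) = ≡.trans (≡.cong₂ ℕ._+_ (≡.sym (ℕₚ.+-suc a (length p))) (msum-lam p)) (swap-mid a (suc (length p)) (tot p) _)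

tot-lam : ∀ p {n} → length p ≡ suc n → tot (lam p) ≡ tot p ℕ.+ triangle n
tot-lam (a ∷ []) ≡.refl = ≡.trans (ℕₚ.+-identityʳ _) (≡.sym (ℕₚ.+-identityʳ _))
tot-lam (a ∷ b ∷ p) ≡.refl = ≡.trans (≡.cong (a ℕ.+ suc (length p) ℕ.+_) (tot-lam (b ∷ p) ≡.refl)) (swap-mid a _ (tot (b ∷ p)) _)

lam-strict : ∀ p → dec p ≡ true → Strict (lam p)
lam-strict [] e = []
lam-strict (a ∷ []) e = [ _ ]
lam-strict (a ∷ b ∷ p) e = let (ba , e′) = ∧-true (b ℕ.≤ᵇ a) _ e in
  ℕₚ.+-mono-≤-< (≤ᵇ-true b a ba) (ℕₚ.n<1+n (length p)) ∷ lam-strict (b ∷ p) e′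

-- Sums over shapes as sums over boxes of lists

module BoxSums (R : Ring₀) where
  open Kit R

  sumTo : ℕ → (ℕ → A) → A
  sumTo zero g = 0#
  sumTo (suc B) g = g 0 + sumTo B (g ∘ suc)

  sumTo-cong : ∀ B {g h} → (∀ k → k < B → g k ≈ h k) → sumTo B g ≈ sumTo B h
  sumTo-cong zero p = refl
  sumTo-cong (suc B) p = +-cong (p 0 (s≤s z≤n)) (sumTo-cong B (λ k lt → p (suc k) (s≤s lt)))

  sumTo-0 : ∀ B {g} → (∀ k → k < B → g k ≈ 0#) → sumTo B g ≈ 0#
  sumTo-0 zero p = refl
  sumTo-0 (suc B) p = 0+0 (p 0 (s≤s z≤n)) (sumTo-0 B (λ k lt → p (suc k) (s≤s lt)))

  sumTo-+ : ∀ B g h → sumTo B (λ k → g k + h k) ≈ sumTo B g + sumTo B h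
  sumTo-+ zero g h = sym (+-identityˡ _)
  sumTo-+ (suc B) g h = trans (+-congˡ (sumTo-+ B (g ∘ suc) (h ∘ suc))) (solve 4 (λ a b c d → (a :+ b) :+ (c :+ d) := (a :+ c) :+ (b :+ d)) refl _ _ _ _)

  sumTo-*ʳ : ∀ B g c → sumTo B g * c ≈ sumTo B (λ k → g k * c)
  sumTo-*ʳ zero g c = zeroˡ c
  sumTo-*ʳ (suc B) g c = trans (distribʳ _ _ _) (+-congˡ (sumTo-*ʳ B (g ∘ suc) c))

  sumTo-swap : ∀ B D (g : ℕ → ℕ → A) → sumTo B (λ i → sumTo D (g i)) ≈ sumTo D (λ j → sumTo B (λ i → g i j))
  sumTo-swap zero D g = sym (sumTo-0 D (λ _ _ → refl))
  sumTo-swap (suc B) D g = trans (+-congˡ (sumTo-swap B D (g ∘ suc))) (sym (sumTo-+ D (g 0) _))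

  sumTo-point : ∀ B n (g : ℕ → A) → n < B → sumTo B (λ k → (k ℕ.≡ᵇ n) ▹ g k) ≈ g n
  sumTo-point (suc B) zero g lt = trans (+-congˡ (sumTo-0 B (λ _ _ → refl))) (+-identityʳ _)
  sumTo-point (suc B) (suc n) g (s≤s lt) = trans (+-identityˡ _) (sumTo-point B n (g ∘ suc) lt)

  ▹-sumTo : ∀ b B g → b ▹ sumTo B g ≈ sumTo B (λ k → b ▹ g k)
  ▹-sumTo true B g = refl
  ▹-sumTo false B g = sym (sumTo-0 B (λ _ _ → refl))

  -- Σ over the lists of length n with entries < B
  bsum : ℕ → ℕ → (List ℕ → A) → A
  bsum B zero φ = φ []
  bsum B (suc n) φ = sumTo B (λ k → bsum B n (λ l → φ (k ∷ l)))

  bsum-cong : ∀ B n {φ ψ} → (∀ l → length l ≡ n → All (_< B) l → φ l ≈ ψ l) → bsum B n φ ≈ bsum B n ψ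
  bsum-cong B zero p = p [] ≡.refl []
  bsum-cong B (suc n) p = sumTo-cong B (λ k lt → bsum-cong B n (λ l e a → p (k ∷ l) (≡.cong suc e) (lt ∷ a)))

  bsum-0 : ∀ B n {φ} → (∀ l → length l ≡ n → All (_< B) l → φ l ≈ 0#) → bsum B n φ ≈ 0#
  bsum-0 B zero p = p [] ≡.refl []
  bsum-0 B (suc n) p = sumTo-0 B (λ k lt → bsum-0 B n (λ l e a → p (k ∷ l) (≡.cong suc e) (lt ∷ a)))

  bsum-*ʳ : ∀ B n φ c → bsum B n φ * c ≈ bsum B n (λ l → φ l * c)
  bsum-*ʳ B zero φ c = refl
  bsum-*ʳ B (suc n) φ c = trans (sumTo-*ʳ B _ c) (sumTo-cong B (λ k _ → bsum-*ʳ B n _ c))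

  bsum-*ˡ : ∀ B n φ c → c * bsum B n φ ≈ bsum B n (λ l → c * φ l)
  bsum-*ˡ B n φ c = trans (*-comm _ _) (trans (bsum-*ʳ B n φ c) (bsum-cong B n (λ _ _ _ → *-comm _ _)))

  ▹-bsum : ∀ b B n φ → b ▹ bsum B n φ ≈ bsum B n (λ l → b ▹ φ l)
  ▹-bsum true B n φ = refl
  ▹-bsum false B n φ = sym (bsum-0 B n (λ _ _ _ → refl))

  bsum-sumTo : ∀ B n D (g : List ℕ → ℕ → A) → bsum B n (λ l → sumTo D (g l)) ≈ sumTo D (λ k → bsum B n (λ l → g l k))
  bsum-sumTo B zero D g = refl
  bsum-sumTo B (suc n) D g = trans (sumTo-cong B (λ k _ → bsum-sumTo B n D (λ l → g (k ∷ l)))) (sumTo-swap B D _)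

  bsum-swap : ∀ B n D m (g : List ℕ → List ℕ → A) → bsum B n (λ l → bsum D m (g l)) ≈ bsum D m (λ k → bsum B n (λ l → g l k))
  bsum-swap B n D zero g = refl
  bsum-swap B n D (suc m) g = trans (bsum-sumTo B n D _) (sumTo-cong D (λ k _ → bsum-swap B n D m (λ l l′ → g l (k ∷ l′))))

  tri⇒sumTo : ∀ B N (g : ℕ → ℕ → A) → N < B → tri g N ≈ sumTo B (λ x → (x ℕ.≤ᵇ N) ▹ g x (N ∸ x))
  tri⇒sumTo (suc B) zero g lt = sym (trans (+-congˡ (sumTo-0 B (λ _ _ → refl))) (+-identityʳ _))
  tri⇒sumTo (suc B) (suc N) g (s≤s lt) = +-congˡ (trans (tri⇒sumTo B N (g ∘ suc) lt)
    (sumTo-cong B (λ x _ → reflexive (≡.cong (_▹ g (suc x) (N ∸ x)) (≤ᵇ-iff {x} {N} {suc x} {suc N} s≤s ℕₚ.≤-pred)))))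

  sumTo-shift : ∀ d B (g : ℕ → A) → (∀ x → x < d → g x ≈ 0#) → sumTo (d ℕ.+ B) g ≈ sumTo B (λ x → g (d ℕ.+ x))
  sumTo-shift zero B g p = refl
  sumTo-shift (suc d) B g p = trans (+-congʳ (p 0 (s≤s z≤n))) (trans (+-identityˡ _) (sumTo-shift d B (g ∘ suc) (λ x lt → p (suc x) (s≤s lt))))

module ShapeSums (R : Ring₀) where
  open Kit R
  open BoxSums R
  open FreeSums R

  head₀ : List ℕ → ℕ
  head₀ [] = 0
  head₀ (a ∷ _) = a

  -- The substitution l = λ + δ. Bounds on l become interlacing of λ with μ, and `u′` is the
  -- condition `u` in terms of the first part. Any box with N < B is large enough, because no part
  -- exceeds N.
  Int⇒bsum : ∀ B μ {n} → length μ ≡ n → ∀ (u u′ : ℕ → Bool) → (∀ x → u (x ℕ.+ n) ≡ u′ x) → ∀ N C → N < B →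
    Int u N (lam μ) C ≈ bsum B (suc n) (λ p → u′ (head₀ p) ▹ il p μ ▹ (tot (lam p) ℕ.≡ᵇ N) ▹ C (lam p))
  Int⇒bsum B [] ≡.refl u u′ uu N C lt = sym (begin
    sumTo B (λ x → u′ x ▹ ((x ℕ.+ 0) ℕ.+ 0 ℕ.≡ᵇ N) ▹ C (x ℕ.+ 0 ∷ []))
      ≈⟨ sumTo-cong B (λ x _ → trans (reflexive (≡.cong₂ (λ y z → u′ x ▹ (z ℕ.≡ᵇ N) ▹ C (y ∷ [])) (ℕₚ.+-identityʳ x) (≡.trans (ℕₚ.+-identityʳ _) (ℕₚ.+-identityʳ x))))
           (▹-comm (u′ x) (x ℕ.≡ᵇ N) _)) ⟩
    sumTo B (λ x → (x ℕ.≡ᵇ N) ▹ u′ x ▹ C (x ∷ []))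
      ≈⟨ sumTo-point B N _ lt ⟩
    u′ N ▹ C (N ∷ [])
      ≡⟨ ≡.cong (_▹ C (N ∷ [])) (≡.trans (≡.sym (uu N)) (≡.cong u (ℕₚ.+-identityʳ N))) ⟩
    u N ▹ C (N ∷ []) ∎)
  Int⇒bsum B (c ∷ μ) {suc n} ≡.refl u u′ uu N C lt = begin
    tri (λ l r → h l r) N
      -- The range is chosen longer by n + 1; the initial values up to n violate the lower bound on
      -- l and are cut off, which leaves l = n + 1 + x with x in the box.
      ≈⟨ tri⇒sumTo (suc n ℕ.+ B) N h (ℕₚ.≤-trans lt (ℕₚ.m≤n+m B (suc n))) ⟩
    sumTo (suc n ℕ.+ B) (λ l → (l ℕ.≤ᵇ N) ▹ h l (N ∸ l))
      ≈⟨ sumTo-shift (suc n) B _ (λ l l<n → ▹-0 (l ℕ.≤ᵇ N) (λ _ → ▹-0 (u l) (λ _ → ▹-0 (c ℕ.+ n ℕ.<ᵇ l) {Int (λ k → k ℕ.≤ᵇ c ℕ.+ n) (N ∸ l) (lam μ) (λ k → C (l ∷ k))} (λ e → ⊥-elim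
           (ℕₚ.<⇒≱ (<ᵇ-true {c ℕ.+ n} {l} e) (ℕₚ.≤-trans (ℕₚ.≤-pred l<n) (ℕₚ.m≤n+m n c))))))) ⟩
    sumTo B (λ x → (suc n ℕ.+ x ℕ.≤ᵇ N) ▹ h (suc n ℕ.+ x) (N ∸ (suc n ℕ.+ x)))
      ≈⟨ sumTo-cong B (λ x _ → row-sum x) ⟩
    sumTo B (λ x → bsum B (suc n) (λ p → u′ x ▹ il (x ∷ p) (c ∷ μ) ▹ (tot (lam (x ∷ p)) ℕ.≡ᵇ N) ▹ C (lam (x ∷ p)))) ∎
    where
    h : ℕ → ℕ → A
    h l r = u l ▹ (c ℕ.+ n ℕ.<ᵇ l) ▹ Int (λ k → k ℕ.≤ᵇ c ℕ.+ n) r (lam μ) (λ k → C (l ∷ k))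
    row-sum : ∀ x → (suc n ℕ.+ x ℕ.≤ᵇ N) ▹ h (suc n ℕ.+ x) (N ∸ (suc n ℕ.+ x)) ≈
      bsum B (suc n) (λ p → u′ x ▹ il (x ∷ p) (c ∷ μ) ▹ (tot (lam (x ∷ p)) ℕ.≡ᵇ N) ▹ C (lam (x ∷ p)))
    row-sum x = begin
      (l ℕ.≤ᵇ N) ▹ u l ▹ (c ℕ.+ n ℕ.<ᵇ l) ▹ Int (λ k → k ℕ.≤ᵇ c ℕ.+ n) (N ∸ l) (lam μ) (λ k → C (l ∷ k))
        ≈⟨ ▹-cong (l ℕ.≤ᵇ N) (λ _ → ▹-cong (u l) (λ _ → ▹-cong (c ℕ.+ n ℕ.<ᵇ l) (λ _ →
             Int⇒bsum B μ ≡.refl (λ k → k ℕ.≤ᵇ c ℕ.+ n) (λ b → b ℕ.≤ᵇ c) (λ y → ≤ᵇ-iff {y ℕ.+ n} {c ℕ.+ n} {y} {c} (ℕₚ.+-cancelʳ-≤ n y c) (ℕₚ.+-monoˡ-≤ n)) (N ∸ l) (λ k → C (l ∷ k)) (ℕₚ.≤-<-trans (ℕₚ.m∸n≤m N l) lt)))) ⟩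
      (l ℕ.≤ᵇ N) ▹ u l ▹ (c ℕ.+ n ℕ.<ᵇ l) ▹ bsum B (suc n) ψ
        ≈⟨ trans (▹-cong (l ℕ.≤ᵇ N) (λ _ → trans (▹-cong (u l) (λ _ → ▹-bsum (c ℕ.+ n ℕ.<ᵇ l) B (suc n) ψ))
             (▹-bsum (u l) B (suc n) (λ p → (c ℕ.+ n ℕ.<ᵇ l) ▹ ψ p)))) (▹-bsum (l ℕ.≤ᵇ N) B (suc n) (λ p → u l ▹ (c ℕ.+ n ℕ.<ᵇ l) ▹ ψ p)) ⟩
      bsum B (suc n) (λ p → (l ℕ.≤ᵇ N) ▹ u l ▹ (c ℕ.+ n ℕ.<ᵇ l) ▹ ψ p)
        ≈⟨ bsum-cong B (suc n) (λ p e _ → term p e) ⟩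
      bsum B (suc n) (λ p → u′ x ▹ il (x ∷ p) (c ∷ μ) ▹ (tot (lam (x ∷ p)) ℕ.≡ᵇ N) ▹ C (lam (x ∷ p))) ∎
      where
      l = suc n ℕ.+ x
      ψ : List ℕ → A
      ψ p = (head₀ p ℕ.≤ᵇ c) ▹ il p μ ▹ (tot (lam p) ℕ.≡ᵇ N ∸ l) ▹ C (l ∷ lam p)
      l≡ : l ≡ x ℕ.+ suc n
      l≡ = ℕₚ.+-comm (suc n) x
      term : ∀ p → length p ≡ suc n → (l ℕ.≤ᵇ N) ▹ u l ▹ (c ℕ.+ n ℕ.<ᵇ l) ▹ ψ p ≈
        u′ x ▹ il (x ∷ p) (c ∷ μ) ▹ (tot (lam (x ∷ p)) ℕ.≡ᵇ N) ▹ C (lam (x ∷ p))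
      term (b ∷ p) e = begin
        (l ℕ.≤ᵇ N) ▹ u l ▹ (c ℕ.+ n ℕ.<ᵇ l) ▹ ψ (b ∷ p)
          ≡⟨ ≡.cong₂ (λ s t → (l ℕ.≤ᵇ N) ▹ s ▹ t ▹ ψ (b ∷ p)) (≡.trans (≡.cong u l≡) (uu x))
               (≡.trans (≡.cong (λ y → suc (c ℕ.+ n) ℕ.≤ᵇ y) l≡) (≡.trans (≡.cong (ℕ._≤ᵇ x ℕ.+ suc n) (≡.sym (ℕₚ.+-suc c n))) (≤ᵇ-iff {c ℕ.+ suc n} {x ℕ.+ suc n} {c} {x} (ℕₚ.+-cancelʳ-≤ (suc n) c x) (ℕₚ.+-monoˡ-≤ (suc n))))) ⟩
        (l ℕ.≤ᵇ N) ▹ u′ x ▹ (c ℕ.≤ᵇ x) ▹ (b ℕ.≤ᵇ c) ▹ il (b ∷ p) μ ▹ (tot (lam (b ∷ p)) ℕ.≡ᵇ N ∸ l) ▹ C (l ∷ lam (b ∷ p))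
          ≈⟨ trans (▹-comm (l ℕ.≤ᵇ N) (u′ x) _) (▹-cong (u′ x) (λ _ → trans (▹-comm (l ℕ.≤ᵇ N) (c ℕ.≤ᵇ x) _) (trans (▹-cong (c ℕ.≤ᵇ x) (λ _ →
               trans (▹-comm (l ℕ.≤ᵇ N) (b ℕ.≤ᵇ c) _) (trans (▹-cong (b ℕ.≤ᵇ c) (λ _ → ▹-comm (l ℕ.≤ᵇ N) (il (b ∷ p) μ) _)) (sym (▹-∧ (b ℕ.≤ᵇ c) _)))))
               (sym (▹-∧ (c ℕ.≤ᵇ x) _))))) ⟩
        u′ x ▹ il (x ∷ b ∷ p) (c ∷ μ) ▹ (l ℕ.≤ᵇ N) ▹ (tot (lam (b ∷ p)) ℕ.≡ᵇ N ∸ l) ▹ C (l ∷ lam (b ∷ p))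
          ≈⟨ ▹-cong (u′ x) (λ _ → ▹-cong (il (x ∷ b ∷ p) (c ∷ μ)) (λ _ → trans (sym (▹-∧ (l ℕ.≤ᵇ N) (tot (lam (b ∷ p)) ℕ.≡ᵇ N ∸ l)))
               (reflexive (≡.cong₂ (λ t y → t ▹ C (y ∷ lam (b ∷ p))) total l≡′)))) ⟩
        u′ x ▹ il (x ∷ b ∷ p) (c ∷ μ) ▹ (tot (lam (x ∷ b ∷ p)) ℕ.≡ᵇ N) ▹ C (lam (x ∷ b ∷ p)) ∎
        where
        l≡′ : l ≡ x ℕ.+ suc (length p)
        l≡′ = ≡.trans l≡ (≡.cong (x ℕ.+_) (≡.sym e))
        s = tot (lam (b ∷ p))
        total : ((l ℕ.≤ᵇ N) ∧ (s ℕ.≡ᵇ N ∸ l)) ≡ (tot (lam (x ∷ b ∷ p)) ℕ.≡ᵇ N)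
        total = bool-iff
          (λ e → let (p₁ , p₂) = ∧-true (l ℕ.≤ᵇ N) _ e in true-≡ᵇ {tot (lam (x ∷ b ∷ p))} (≡.trans (≡.cong₂ ℕ._+_ (≡.sym l≡′) (≡ᵇ-true s (N ∸ l) p₂)) (ℕₚ.m+[n∸m]≡n (≤ᵇ-true l N p₁))))
          (λ e → let q = ≡.trans (≡.cong (ℕ._+ s) l≡′) (≡ᵇ-true (tot (lam (x ∷ b ∷ p))) N e) in
            ≡.cong₂ _∧_ (true-≤ᵇ {l} {N} (≡.subst (l ≤_) q (ℕₚ.m≤m+n l s))) (true-≡ᵇ {s} {N ∸ l} (≡.trans (≡.sym (ℕₚ.m+n∸m≡n l s)) (≡.cong (_∸ l) q))))

  -- The properties of Kostka numbers that are used. Tableaux enter only where these are verified.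
  module _ (kos : ∀ n → List ℕ → Vec ℕ n → A)
    (kos-zero : kos 0 [] [] ≈ 1#)
    (kos-suc : ∀ n B p a e → length p ≡ suc n → All (_< B) p → dec p ≡ true →
      kos (suc n) p (a ∷ e) ≈ bsum B n (λ μ → il p μ ▹ (tot p ℕ.≡ᵇ a ℕ.+ tot μ) ▹ kos n μ e))
    (kos-size : ∀ n p e → ¬ tot p ≡ Vec.sum e → kos n p e ≈ 0#) where

    private module LR = Littlewood R

    -- Both sides follow the same branching rule, `F` by definition and the right-hand side by
    -- `kos-suc`. One `B` serves all levels of the induction, as removing a variable only lowers the
    -- required bound.
    F⇒bsum : ∀ n B e C → Alt R C → Vec.sum e ℕ.+ triangle n < B →
      LR.at n (F n C) e ≈ bsum B n (λ p → dec p ▹ (kos n p e * C (lam p)))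
    F⇒bsum zero B [] C alt lt = sym (trans (*-congʳ kos-zero) (*-identityˡ _))
    F⇒bsum (suc n) B (a ∷ e) C alt lt = begin
      LR.at n (F n (U a C)) e
        ≈⟨ F⇒bsum n B e (U a C) (U-alt a alt) (ℕₚ.≤-<-trans (ℕₚ.+-mono-≤ (ℕₚ.m≤n+m (Vec.sum e) a) (ℕₚ.m≤n+m (triangle n) (suc n))) lt) ⟩
      bsum B n (λ μ → dec μ ▹ (kos n μ e * U a C (lam μ)))
        ≈⟨ bsum-cong B n (λ μ len _ → inner μ len) ⟩
      bsum B n (λ μ → bsum B (suc n) (λ p → dec μ ▹ (kos n μ e * il p μ ▹ (tot p ℕ.≡ᵇ a ℕ.+ tot μ) ▹ C (lam p))))
        ≈⟨ bsum-swap B n B (suc n) (λ μ p → dec μ ▹ (kos n μ e * il p μ ▹ (tot p ℕ.≡ᵇ a ℕ.+ tot μ) ▹ C (lam p))) ⟩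
      bsum B (suc n) (λ p → bsum B n (λ μ → dec μ ▹ (kos n μ e * il p μ ▹ (tot p ℕ.≡ᵇ a ℕ.+ tot μ) ▹ C (lam p))))
        ≈⟨ bsum-cong B (suc n) (λ p len all → outer p len all) ⟩
      bsum B (suc n) (λ p → dec p ▹ (kos (suc n) p (a ∷ e) * C (lam p))) ∎
      where
      expand : ∀ μ → length μ ≡ n → dec μ ≡ true → tot μ ≡ Vec.sum e →
        U a C (lam μ) ≈ bsum B (suc n) (λ p → il p μ ▹ (tot p ℕ.≡ᵇ a ℕ.+ tot μ) ▹ C (lam p))
      expand μ len d s = trans (Free≈Int (lam μ) (lam-strict μ d) C alt _) (trans
        (Int⇒bsum B μ len (λ _ → true) (λ _ → true) (λ _ → ≡.refl) (a ℕ.+ msum (lam μ)) C bound)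
        (bsum-cong B (suc n) (λ p len′ _ → ▹-cong (il p μ) (λ _ → reflexive (≡.cong (_▹ C (lam p)) (≡ᵇ-iff {tot (lam p)} {a ℕ.+ msum (lam μ)} {tot p} {a ℕ.+ tot μ}
          (λ q → ℕₚ.+-cancelʳ-≡ (triangle n) _ _ (≡.trans (≡.sym (tot-lam p len′)) (≡.trans q total)))
          (λ q → ≡.trans (tot-lam p len′) (≡.trans (≡.cong (ℕ._+ triangle n) q) (≡.sym total)))))))))
        where
        total : a ℕ.+ msum (lam μ) ≡ (a ℕ.+ tot μ) ℕ.+ triangle n
        total = ≡.trans (≡.cong (a ℕ.+_) (≡.trans (msum-lam μ) (≡.cong (λ k → tot μ ℕ.+ triangle k) len))) (≡.sym (ℕₚ.+-assoc a _ _))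
        bound : a ℕ.+ msum (lam μ) < B
        bound = ℕₚ.≤-<-trans (ℕₚ.≤-trans (ℕₚ.≤-reflexive (≡.trans total (≡.cong (λ k → a ℕ.+ k ℕ.+ triangle n) s))) (ℕₚ.+-monoʳ-≤ (a ℕ.+ Vec.sum e) (ℕₚ.m≤n+m (triangle n) (suc n)))) lt
      inner : ∀ μ → length μ ≡ n → dec μ ▹ (kos n μ e * U a C (lam μ)) ≈
        bsum B (suc n) (λ p → dec μ ▹ (kos n μ e * il p μ ▹ (tot p ℕ.≡ᵇ a ℕ.+ tot μ) ▹ C (lam p)))
      -- The box is only known to be large enough for shapes of the right size; for all others the
      -- Kostka number vanishes.
      inner μ len with tot μ ℕ.≟ Vec.sum e
      ... | no ne = trans (▹-0 (dec μ) (λ _ → zeroˡ′ (kos-size n μ e ne))) (sym (bsum-0 B (suc n) (λ p _ _ → ▹-0 (dec μ) {kos n μ e * g p} (λ _ → zeroˡ′ (kos-size n μ e ne)))))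
        where
        g : List ℕ → A
        g p = il p μ ▹ (tot p ℕ.≡ᵇ a ℕ.+ tot μ) ▹ C (lam p)
      ... | yes s = trans (▹-cong (dec μ) (λ d → trans (*-congˡ (expand μ len d s)) (bsum-*ˡ B (suc n) g _))) (▹-bsum (dec μ) B (suc n) (λ p → kos n μ e * g p))
        where
        g : List ℕ → A
        g p = il p μ ▹ (tot p ℕ.≡ᵇ a ℕ.+ tot μ) ▹ C (lam p)
      outer : ∀ p → length p ≡ suc n → All (_< B) p → bsum B n (λ μ → dec μ ▹ (kos n μ e * il p μ ▹ (tot p ℕ.≡ᵇ a ℕ.+ tot μ) ▹ C (lam p))) ≈
        dec p ▹ (kos (suc n) p (a ∷ e) * C (lam p))
      outer p len all = trans (bsum-cong B n {ψ = λ μ → dec p ▹ ((il p μ ▹ (tot p ℕ.≡ᵇ a ℕ.+ tot μ) ▹ kos n μ e) * C (lam p))} (λ μ _ _ → term μ (il p μ) ≡.refl))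
        (trans (sym (▹-bsum (dec p) B n _)) (▹-cong (dec p) (λ d → trans (sym (bsum-*ʳ B n _ _)) (*-congʳ (sym (kos-suc n B p a e len all d))))))
        where
        term : ∀ μ b → il p μ ≡ b → dec μ ▹ (kos n μ e * b ▹ (tot p ℕ.≡ᵇ a ℕ.+ tot μ) ▹ C (lam p)) ≈ dec p ▹ ((b ▹ (tot p ℕ.≡ᵇ a ℕ.+ tot μ) ▹ kos n μ e) * C (lam p))
        term μ false _ = trans (▹-0 (dec μ) (λ _ → zeroʳ _)) (sym (▹-0 (dec p) (λ _ → zeroˡ _)))
        term μ true i = trans (reflexive (≡.cong (_▹ (kos n μ e * ((tot p ℕ.≡ᵇ a ℕ.+ tot μ) ▹ C (lam p)))) (≡.trans (il⇒decʳ p μ i) (≡.sym (il⇒decˡ p μ i)))))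
          (▹-cong (dec p) (λ _ → trans (▹-*ˡ (tot p ℕ.≡ᵇ a ℕ.+ tot μ) _ _) (sym (▹-*ʳ (tot p ℕ.≡ᵇ a ℕ.+ tot μ) _ _))))

rep : ℕ → ℕ → List ℕ
rep k x = L.replicate k x

incFrom : ℕ → List ℕ → Bool
incFrom x [] = true
incFrom x (y ∷ w) = (x ℕ.≤ᵇ y) ∧ incFrom y w

-- Semistandard tableaux

-- w fits strictly below u
cs : List ℕ → List ℕ → Bool
cs u [] = true
cs [] (y ∷ w) = false
cs (x ∷ u) (y ∷ w) = (x ℕ.<ᵇ y) ∧ cs u w

-- The tableau condition checked row by row, with `u` as the row above the first one.
chkFrom : List ℕ → List (List ℕ) → Bool
chkFrom u [] = true
chkFrom u (w ∷ T) = incFrom 0 w ∧ cs u w ∧ chkFrom w T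

occ : ℕ → List ℕ → ℕ
occ a w = length (L.filter (λ x → x ℕ.≟ a) w)

-- The largest letter comes first, because branching removes it first.
cont : ∀ n → List ℕ → Vec ℕ n
cont zero w = []
cont (suc n) w = occ (suc n) w ∷ cont n w

Letters : ℕ → List ℕ → Set
Letters n = All (λ x → 1 ≤ x × x ≤ n)

ShapeT : ℕ → List ℕ → List (List ℕ) → Set
ShapeT n [] [] = ⊤
ShapeT n (a ∷ p) (w ∷ T) = (length w ≡ a × Letters n w) × ShapeT n p T
ShapeT n _ _ = ⊥

range1-∷ʳ : ∀ n → range1 (suc n) ≡ range1 n ++ (suc n ∷ [])
range1-∷ʳ n = ≡.trans (≡.cong (map suc) (≡.sym (Lₚ.applyUpTo-∷ʳ id n))) (Lₚ.map-++ suc (upTo n) (n ∷ []))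

range1-letters : ∀ n → Letters n (range1 n)
range1-letters n = Allₚ.map⁺ (Allₚ.applyUpTo⁺₁ id n (λ lt → s≤s z≤n , lt))

words-letters : ∀ a n → All (λ w → length w ≡ a × Letters n w) (words a n)
words-letters zero n = (≡.refl , []) ∷ []
words-letters (suc a) n = Allₚ.concat⁺ (Allₚ.map⁺ (All.map (λ {c} lc → Allₚ.map⁺ (All.map (λ { (e , lw) → ≡.cong suc e , lc ∷ lw }) (words-letters a n))) (range1-letters n)))

fillings-shape : ∀ p n → All (ShapeT n p) (fillings p n)
fillings-shape [] n = tt ∷ []
fillings-shape (a ∷ p) n = Allₚ.concat⁺ (Allₚ.map⁺ (All.map (λ {w} lw → Allₚ.map⁺ (All.map (λ s → lw , s) (fillings-shape p n))) (words-letters a n)))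

_≤ₚ_ : List ℕ → List ℕ → Set
[] ≤ₚ [] = ⊤
(m ∷ μ) ≤ₚ (a ∷ p) = m ≤ a × μ ≤ₚ p
_ ≤ₚ _ = ⊥

tot-mono : ∀ μ p → μ ≤ₚ p → tot μ ≤ tot p
tot-mono [] [] _ = z≤n
tot-mono (m ∷ μ) (a ∷ p) (l , ls) = ℕₚ.+-mono-≤ l (tot-mono μ p ls)

-- Only the bounds p_(i+1) ≤ μ_i; the other half μ_i ≤ p_i of interlacing comes with the range of
-- `dsum`. In contrast to `il`, μ has as many rows as p.
il′ : ℕ → List ℕ → List ℕ → Bool
il′ k [] [] = true
il′ k (a ∷ p) (m ∷ μ) = (a ℕ.≤ᵇ k) ∧ il′ m p μ
il′ k _ _ = false

-- Inverse to removing the letter N, where μ is the shape filled by the smaller letters.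
ext : ℕ → List ℕ → List ℕ → List (List ℕ) → List (List ℕ)
ext N (a ∷ p) (m ∷ μ) (w ∷ T) = (w ++ rep (a ∸ m) N) ∷ ext N p μ T
ext N _ _ _ = []

data Long : ℕ → List ℕ → Set where
  here : ∀ {a p} → 0 < a → Long 0 (a ∷ p)
  there : ∀ {j a p} → Long j p → Long (suc j) (a ∷ p)

∧-swap : ∀ a b c → a ∧ b ∧ c ≡ b ∧ a ∧ c
∧-swap true b c = ≡.refl
∧-swap false true c = ≡.refl
∧-swap false false c = ≡.refl

false-<ᵇ : ∀ {m n} → ¬ m < n → (m ℕ.<ᵇ n) ≡ false
false-<ᵇ {m} {n} ne with m ℕ.<ᵇ n in e
... | true = ⊥-elim (ne (ℕₚ.<ᵇ⇒< m n (Equivalence.from Boolₚ.T-≡ e)))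
... | false = ≡.refl

module _ (n : ℕ) where
  private N = suc n

  cs-rep : ∀ u b c → All (_≤ n) u → cs (u ++ rep b N) (rep c N) ≡ (c ℕ.≤ᵇ length u)
  cs-rep u b zero all = ≡.refl
  cs-rep [] zero (suc c) all = ≡.refl
  cs-rep [] (suc b) (suc c) all = ≡.cong (_∧ cs (rep b N) (rep c N)) (false-<ᵇ {N} {N} (ℕₚ.<-irrefl ≡.refl))
  cs-rep (x ∷ u) b (suc c) (le ∷ all) = ≡.trans (≡.cong (_∧ cs (u ++ rep b N) (rep c N)) (true-≤ᵇ (s≤s le)))
    (≡.trans (cs-rep u b c all) (≤ᵇ-iff {c} {length u} {suc c} {suc (length u)} s≤s ℕₚ.≤-pred))

  -- Nothing in the lower row may stand under an N, so the whole lower row has to fit under `u`.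
  -- This is the horizontal strip condition.
  cs-ext : ∀ u w b c → All (_≤ n) u → All (_≤ n) w →
    cs (u ++ rep b N) (w ++ rep c N) ≡ (length w ℕ.+ c ℕ.≤ᵇ length u) ∧ cs u w
  cs-ext u [] b c au aw = ≡.trans (cs-rep u b c au) (≡.sym (Boolₚ.∧-identityʳ _))
  cs-ext [] (y ∷ w) zero c au aw = ≡.refl
  cs-ext [] (y ∷ w) (suc b) c au (le ∷ aw) = ≡.cong (_∧ cs (rep b N) (w ++ rep c N)) (false-<ᵇ {N} {y} (λ lt → ℕₚ.<⇒≱ lt (ℕₚ.m≤n⇒m≤1+n le)))
  cs-ext (x ∷ u) (y ∷ w) b c (_ ∷ au) (_ ∷ aw) = ≡.trans (≡.cong ((x ℕ.<ᵇ y) ∧_) (cs-ext u w b c au aw))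
    (≡.trans (∧-swap (x ℕ.<ᵇ y) _ (cs u w)) (≡.cong (_∧ (x ℕ.<ᵇ y) ∧ cs u w) (≤ᵇ-iff {length w ℕ.+ c} {length u} {suc (length w ℕ.+ c)} {suc (length u)} s≤s ℕₚ.≤-pred)))

cs-zero : ∀ k w → length w ≤ k → All (1 ≤_) w → cs (rep k 0) w ≡ true
cs-zero k [] le all = ≡.refl
cs-zero (suc k) (suc y ∷ w) (s≤s le) (_ ∷ all) = cs-zero k w le all

cs-grow : ∀ k u w → All (k ≤_) u → cs u w ≡ true → All (suc k ≤_) w
cs-grow k u [] au e = []
cs-grow k (x ∷ u) (y ∷ w) (kx ∷ au) e with ∧-true (x ℕ.<ᵇ y) _ e
... | xy , e′ = ℕₚ.≤-<-trans kx (ℕₚ.<ᵇ⇒< x y (Equivalence.from Boolₚ.T-≡ xy)) ∷ cs-grow k u w au e′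

-- Entries grow by at least one from row to row, so row j, counted from 0, would need letters of at
-- least k + j + 1 > n.
chk-long : ∀ n k j p u T → Long j p → n ≤ k ℕ.+ j → All (k ≤_) u → ShapeT n p T → chkFrom u T ≡ false
chk-long n k zero (a ∷ p) u ([] ∷ T) (here ()) le au ((≡.refl , lw) , s)
chk-long n k zero (a ∷ p) u ((y ∷ w) ∷ T) (here lt) le au ((len , (_ , yn) ∷ lw) , s) with cs u (y ∷ w) in e
... | false = Boolₚ.∧-zeroʳ _
... | true = ⊥-elim (ℕₚ.<⇒≱ (All.head (cs-grow k u (y ∷ w) au e)) (ℕₚ.≤-trans yn (ℕₚ.≤-trans le (ℕₚ.≤-reflexive (ℕₚ.+-identityʳ k)))))
chk-long n k (suc j) (a ∷ p) u (w ∷ T) (there lg) le au ((len , lw) , s) with cs u w in e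
... | false = Boolₚ.∧-zeroʳ _
... | true = ≡.trans (≡.cong (incFrom 0 w ∧_) (chk-long n (suc k) j p w T lg (ℕₚ.≤-trans le (ℕₚ.≤-reflexive (ℕₚ.+-suc k j))) (cs-grow k u w au e) s)) (Boolₚ.∧-zeroʳ _)

occ-++ : ∀ a u w → occ a (u ++ w) ≡ occ a u ℕ.+ occ a w
occ-++ a u w = ≡.trans (≡.cong length (Lₚ.filter-++ (λ x → x ℕ.≟ a) u w)) (Lₚ.length-++ (L.filter (λ x → x ℕ.≟ a) u))

occ-rep : ∀ a k → occ a (rep k a) ≡ k
occ-rep a k = ≡.trans (≡.cong length (Lₚ.filter-all (λ x → x ℕ.≟ a) (Allₚ.replicate⁺ k ≡.refl))) (Lₚ.length-replicate k)

occ-none : ∀ a w → All (λ x → ¬ x ≡ a) w → occ a w ≡ 0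
occ-none a w all = ≡.cong length (Lₚ.filter-none (λ x → x ℕ.≟ a) all)

occ-ext : ∀ n p μ T → μ ≤ₚ p → ShapeT n μ T → occ (suc n) (L.concat (ext (suc n) p μ T)) ℕ.+ tot μ ≡ tot p
occ-ext n [] [] [] _ _ = ≡.refl
occ-ext n (a ∷ p) (m ∷ μ) (w ∷ T) (le , les) ((_ , lw) , s) =
  ≡.trans (≡.cong (ℕ._+ (m ℕ.+ tot μ)) (≡.trans (occ-++ N (w ++ rep (a ∸ m) N) _)
    (≡.cong (ℕ._+ rest) (≡.trans (occ-++ N w _) (≡.cong₂ ℕ._+_ (occ-none N w (All.map (λ { (_ , xn) e → ℕₚ.<-irrefl e (s≤s xn) }) lw)) (occ-rep N (a ∸ m)))))))
  (≡.trans (swap-mid (a ∸ m) rest m (tot μ)) (≡.cong₂ ℕ._+_ (ℕₚ.m∸n+n≡m le) (occ-ext n p μ T les s)))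
  where
  N = suc n
  rest = occ N (L.concat (ext N p μ T))

occ-ext-small : ∀ N k p μ T → ¬ N ≡ k → μ ≤ₚ p → ∀ {n} → ShapeT n μ T → occ k (L.concat (ext N p μ T)) ≡ occ k (L.concat T)
occ-ext-small N k [] [] [] ne _ _ = ≡.refl
occ-ext-small N k (a ∷ p) (m ∷ μ) (w ∷ T) ne (_ , les) (_ , s) =
  ≡.trans (occ-++ k (w ++ rep (a ∸ m) N) _) (≡.trans (≡.cong₂ ℕ._+_ (≡.trans (occ-++ k w _)
    (≡.trans (≡.cong (occ k w ℕ.+_) (occ-none k (rep (a ∸ m) N) (Allₚ.replicate⁺ (a ∸ m) ne))) (ℕₚ.+-identityʳ _))) (occ-ext-small N k p μ T ne les s)) (≡.sym (occ-++ k w _)))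

cont-ext : ∀ N j p μ T → j < N → μ ≤ₚ p → ∀ {n} → ShapeT n μ T → cont j (L.concat (ext N p μ T)) ≡ cont j (L.concat T)
cont-ext N zero p μ T lt le s = ≡.refl
cont-ext N (suc j) p μ T lt le s = ≡.cong₂ _∷_ (occ-ext-small N (suc j) p μ T (λ e → ℕₚ.<-irrefl (≡.sym e) lt) le s) (cont-ext N j p μ T (ℕₚ.<-trans (ℕₚ.n<1+n j) lt) le s)

_≡ᵛ_ : ∀ {n} → Vec ℕ n → Vec ℕ n → Bool
[] ≡ᵛ [] = true
(a ∷ e) ≡ᵛ (b ∷ f) = (a ℕ.≡ᵇ b) ∧ (e ≡ᵛ f)

head-or-0 : List ℕ → ℕ
head-or-0 [] = 0
head-or-0 (a ∷ _) = a

-- Kostka numbers and their branching rule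

module Kostka (R : Ring₀) where
  open Kit R
  open BoxSums R

  sumL-cong : ∀ {I : Set} {P : I → Set} {φ ψ : I → A} {xs} → All P xs → (∀ x → P x → φ x ≈ ψ x) → sumL φ xs ≈ sumL ψ xs
  sumL-cong [] e = refl
  sumL-cong (px ∷ ps) e = +-cong (e _ px) (sumL-cong ps e)

  sumL-cong′ : ∀ {I : Set} {φ ψ : I → A} → (∀ x → φ x ≈ ψ x) → ∀ xs → sumL φ xs ≈ sumL ψ xs
  sumL-cong′ e [] = refl
  sumL-cong′ e (x ∷ xs) = +-cong (e x) (sumL-cong′ e xs)

  sumL-0 : ∀ {I : Set} {P : I → Set} {φ : I → A} {xs} → All P xs → (∀ x → P x → φ x ≈ 0#) → sumL φ xs ≈ 0#
  sumL-0 [] e = refl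
  sumL-0 (px ∷ ps) e = 0+0 (e _ px) (sumL-0 ps e)

  sumL-++ : ∀ {I : Set} (φ : I → A) xs ys → sumL φ (xs ++ ys) ≈ sumL φ xs + sumL φ ys
  sumL-++ φ [] ys = sym (+-identityˡ _)
  sumL-++ φ (x ∷ xs) ys = trans (+-congˡ (sumL-++ φ xs ys)) (sym (+-assoc _ _ _))

  sumL-map : ∀ {I J : Set} (φ : J → A) (h : I → J) xs → sumL φ (map h xs) ≡ sumL (φ ∘ h) xs
  sumL-map φ h [] = ≡.refl
  sumL-map φ h (x ∷ xs) = ≡.cong (φ (h x) +_) (sumL-map φ h xs)

  sumL-concatMap : ∀ {I J : Set} (φ : J → A) (h : I → List J) xs → sumL φ (concatMap h xs) ≈ sumL (λ x → sumL φ (h x)) xs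
  sumL-concatMap φ h [] = refl
  sumL-concatMap φ h (x ∷ xs) = trans (sumL-++ φ (h x) _) (+-congˡ (sumL-concatMap φ h xs))

  sumL-prefix : ∀ {I : Set} (φ : List I → A) (cs : List I) (ws : List (List I)) →
    sumL φ (concatMap (λ c → map (c ∷_) ws) cs) ≈ sumL (λ c → sumL (λ w → φ (c ∷ w)) ws) cs
  sumL-prefix φ cs ws = trans (sumL-concatMap φ _ cs) (sumL-cong′ (λ c → reflexive (sumL-map φ (c ∷_) ws)) cs)

  ▹-sumL : ∀ {I : Set} b (φ : I → A) xs → b ▹ sumL φ xs ≈ sumL (λ x → b ▹ φ x) xs
  ▹-sumL true φ xs = refl
  ▹-sumL false φ [] = refl
  ▹-sumL false φ (x ∷ xs) = sym (0+0 refl (sym (▹-sumL false φ xs)))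

  sumL-sumTo : ∀ {I : Set} B (φ : I → ℕ → A) xs → sumL (λ x → sumTo B (φ x)) xs ≈ sumTo B (λ k → sumL (λ x → φ x k) xs)
  sumL-sumTo B φ [] = sym (sumTo-0 B (λ _ _ → refl))
  sumL-sumTo B φ (x ∷ xs) = trans (+-congˡ (sumL-sumTo B φ xs)) (sym (sumTo-+ B (φ x) _))

  -- Σ over μ ≤ p, componentwise
  dsum : List ℕ → (List ℕ → A) → A
  dsum [] φ = φ []
  dsum (a ∷ p) φ = sumTo (suc a) (λ m → dsum p (λ μ → φ (m ∷ μ)))

  dsum-cong : ∀ p {φ ψ} → (∀ μ → μ ≤ₚ p → φ μ ≈ ψ μ) → dsum p φ ≈ dsum p ψ
  dsum-cong [] e = e [] tt
  dsum-cong (a ∷ p) e = sumTo-cong (suc a) (λ m lt → dsum-cong p (λ μ le → e (m ∷ μ) (ℕₚ.≤-pred lt , le)))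

  dsum-0 : ∀ p {φ} → (∀ μ → μ ≤ₚ p → φ μ ≈ 0#) → dsum p φ ≈ 0#
  dsum-0 [] e = e [] tt
  dsum-0 (a ∷ p) e = sumTo-0 (suc a) (λ m lt → dsum-0 p (λ μ le → e (m ∷ μ) (ℕₚ.≤-pred lt , le)))

  sumL-dsum : ∀ {I : Set} p (φ : I → List ℕ → A) xs → sumL (λ x → dsum p (φ x)) xs ≈ dsum p (λ μ → sumL (λ x → φ x μ) xs)
  sumL-dsum [] φ xs = refl
  sumL-dsum (a ∷ p) φ xs = trans (sumL-sumTo (suc a) (λ x m → dsum p (λ μ → φ x (m ∷ μ))) xs) (sumTo-cong (suc a) (λ m _ → sumL-dsum p (λ x μ → φ x (m ∷ μ)) xs))

  ▹-dsum : ∀ b p φ → b ▹ dsum p φ ≈ dsum p (λ μ → b ▹ φ μ)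
  ▹-dsum true p φ = refl
  ▹-dsum false p φ = sym (dsum-0 p (λ _ _ → refl))

  module _ (n : ℕ) where
    private N = suc n

    -- A weakly increasing word in the letters ≤ n + 1 is such a word in the letters ≤ n, followed by letters n + 1.
    words-split : ∀ a x (φ : List ℕ → A) → x ≤ N → sumL (λ w → incFrom x w ▹ φ w) (words a N) ≈
      sumTo (suc a) (λ m → sumL (λ w → incFrom x w ▹ φ (w ++ rep (a ∸ m) N)) (words m n))
    words-split zero x φ le = sym (+-identityʳ _)
    words-split (suc a) x φ le = begin
      sumL (λ w → incFrom x w ▹ φ w) (words (suc a) N)
        ≈⟨ sumL-prefix _ (range1 N) (words a N) ⟩
      sumL g (range1 N)
        ≡⟨ ≡.cong (sumL g) (range1-∷ʳ n) ⟩
      sumL g (range1 n ++ N ∷ [])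
        ≈⟨ trans (sumL-++ g (range1 n) (N ∷ [])) (trans (+-cong small large) (+-comm _ _)) ⟩
      (φ (rep (suc a) N) + 0#) + sumTo (suc a) (λ m → sumL (λ w → incFrom x w ▹ φ (w ++ rep (a ∸ m) N)) (words (suc m) n)) ∎
      where
      g : ℕ → A
      g c = sumL (λ w → ((x ℕ.≤ᵇ c) ∧ incFrom c w) ▹ φ (c ∷ w)) (words a N)
      g-eq : ∀ c → c ≤ N → g c ≈ (x ℕ.≤ᵇ c) ▹ sumTo (suc a) (λ m → sumL (λ w → incFrom c w ▹ φ (c ∷ w ++ rep (a ∸ m) N)) (words m n))
      g-eq c cN = trans (sumL-cong′ (λ w → ▹-∧ (x ℕ.≤ᵇ c) (incFrom c w)) (words a N)) (trans (sym (▹-sumL (x ℕ.≤ᵇ c) _ (words a N)))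
        (▹-cong (x ℕ.≤ᵇ c) (λ _ → words-split a c (λ w → φ (c ∷ w)) cN)))
      t : ℕ → ℕ → A
      t c m = sumL (λ w → incFrom c w ▹ φ (c ∷ w ++ rep (a ∸ m) N)) (words m n)
      small : sumL g (range1 n) ≈ sumTo (suc a) (λ m → sumL (λ w → incFrom x w ▹ φ (w ++ rep (a ∸ m) N)) (words (suc m) n))
      small = begin
        sumL g (range1 n)
          ≈⟨ sumL-cong (range1-letters n) (λ c (_ , cn) → trans (g-eq c (ℕₚ.m≤n⇒m≤1+n cn)) (▹-sumTo (x ℕ.≤ᵇ c) (suc a) (t c))) ⟩
        sumL (λ c → sumTo (suc a) (λ m → (x ℕ.≤ᵇ c) ▹ sumL (λ w → incFrom c w ▹ φ (c ∷ w ++ rep (a ∸ m) N)) (words m n))) (range1 n)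
          ≈⟨ sumL-sumTo (suc a) (λ c m → (x ℕ.≤ᵇ c) ▹ t c m) (range1 n) ⟩
        sumTo (suc a) (λ m → sumL (λ c → (x ℕ.≤ᵇ c) ▹ sumL (λ w → incFrom c w ▹ φ (c ∷ w ++ rep (a ∸ m) N)) (words m n)) (range1 n))
          ≈⟨ sumTo-cong (suc a) (λ m _ → trans (sumL-cong′ (λ c → trans (▹-sumL (x ℕ.≤ᵇ c) _ (words m n)) (sumL-cong′ (λ w → sym (▹-∧ (x ℕ.≤ᵇ c) (incFrom c w))) (words m n))) (range1 n))
               (sym (sumL-prefix (λ w → incFrom x w ▹ φ (w ++ rep (a ∸ m) N)) (range1 n) (words m n)))) ⟩
        sumTo (suc a) (λ m → sumL (λ w → incFrom x w ▹ φ (w ++ rep (a ∸ m) N)) (words (suc m) n)) ∎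
      large : sumL g (N ∷ []) ≈ φ (rep (suc a) N) + 0#
      large = +-congʳ (trans (g-eq N ℕₚ.≤-refl) (trans (reflexive (≡.cong (_▹ _) (true-≤ᵇ le))) (trans (+-cong (+-identityʳ _)
        (sumTo-0 a (λ m _ → trans (sumL-prefix (λ w → incFrom N w ▹ φ (N ∷ w ++ rep (a ∸ suc m) N)) (range1 n) (words m n))
          (sumL-0 (range1-letters n) (λ c (_ , cn) → sumL-0 (words-letters m n) (λ w _ → reflexive (≡.cong (λ b → (b ∧ incFrom c w) ▹ φ (N ∷ (c ∷ w) ++ rep (a ∸ suc m) N)) (false-<ᵇ {n} {c} (ℕₚ.≤⇒≯ cn)))))))))
        (+-identityʳ _))))

    -- The letters n + 1 stand at the ends of the rows, by `words-split`, and form a horizontal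
    -- strip, by `cs-ext`. The row above is carried along already divided into its letters up to n
    -- and its b letters n + 1.
    branching : ∀ p u b (ψ : List (List ℕ) → A) → All (_≤ n) u →
      sumL (λ T → chkFrom (u ++ rep b N) T ▹ ψ T) (fillings p N) ≈
      dsum p (λ μ → il′ (length u) p μ ▹ sumL (λ T → chkFrom u T ▹ ψ (ext N p μ T)) (fillings μ n))
    branching [] u b ψ au = refl
    branching (a ∷ p) u b ψ au = begin
      sumL (λ T → chkFrom (u ++ rep b N) T ▹ ψ T) (fillings (a ∷ p) N)
        ≈⟨ sumL-prefix _ (words a N) (fillings p N) ⟩
      sumL (λ w → sumL (λ T → (incFrom 0 w ∧ cs (u ++ rep b N) w ∧ chkFrom w T) ▹ ψ (w ∷ T)) (fillings p N)) (words a N)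
        ≈⟨ sumL-cong′ (λ w → trans (sumL-cong′ (λ T → trans (▹-∧ (incFrom 0 w) _) (▹-cong (incFrom 0 w) (λ _ → ▹-∧ (cs (u ++ rep b N) w) _))) (fillings p N))
             (trans (sym (▹-sumL (incFrom 0 w) _ (fillings p N))) (▹-cong (incFrom 0 w) (λ _ → sym (▹-sumL (cs (u ++ rep b N) w) _ (fillings p N)))))) (words a N) ⟩
      sumL (λ w → incFrom 0 w ▹ cs (u ++ rep b N) w ▹ sumL (λ T → chkFrom w T ▹ ψ (w ∷ T)) (fillings p N)) (words a N)
        ≈⟨ words-split a 0 _ z≤n ⟩
      sumTo (suc a) (λ m → sumL (λ w → incFrom 0 w ▹ cs (u ++ rep b N) (w ++ rep (a ∸ m) N) ▹ sumL (λ T → chkFrom (w ++ rep (a ∸ m) N) T ▹ ψ ((w ++ rep (a ∸ m) N) ∷ T)) (fillings p N)) (words m n))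
        ≈⟨ sumTo-cong (suc a) (λ m lt → level m (ℕₚ.≤-pred lt)) ⟩
      sumTo (suc a) (λ m → dsum p (λ μ → ((a ℕ.≤ᵇ length u) ∧ il′ m p μ) ▹ sumL (λ T → chkFrom u T ▹ ψ (ext N (a ∷ p) (m ∷ μ) T)) (fillings (m ∷ μ) n))) ∎
      where
      module _ (m : ℕ) (le : m ≤ a) where
        h : List ℕ → List ℕ → A
        h w μ = sumL (λ T → (incFrom 0 w ∧ cs u w ∧ chkFrom w T) ▹ ψ ((w ++ rep (a ∸ m) N) ∷ ext N p μ T)) (fillings μ n)
        word : ∀ w → length w ≡ m × Letters n w →
          incFrom 0 w ▹ cs (u ++ rep b N) (w ++ rep (a ∸ m) N) ▹ sumL (λ T → chkFrom (w ++ rep (a ∸ m) N) T ▹ ψ ((w ++ rep (a ∸ m) N) ∷ T)) (fillings p N)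
          ≈ dsum p (λ μ → ((a ℕ.≤ᵇ length u) ∧ il′ m p μ) ▹ h w μ)
        word w (len , lw) = begin
          incFrom 0 w ▹ cs (u ++ rep b N) (w ++ rep (a ∸ m) N) ▹ sumL (λ T → chkFrom (w ++ rep (a ∸ m) N) T ▹ ψ ((w ++ rep (a ∸ m) N) ∷ T)) (fillings p N)
            ≈⟨ ▹-cong (incFrom 0 w) (λ _ → trans (reflexive (≡.cong (_▹ _) (≡.trans (cs-ext n u w b (a ∸ m) au aw)
                 (≡.cong (λ k → (k ℕ.≤ᵇ length u) ∧ cs u w) (≡.trans (≡.cong (ℕ._+ (a ∸ m)) len) (ℕₚ.m+[n∸m]≡n le))))))
                 (▹-cong ((a ℕ.≤ᵇ length u) ∧ cs u w) (λ _ → branching p w (a ∸ m) (λ T → ψ ((w ++ rep (a ∸ m) N) ∷ T)) aw))) ⟩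
          incFrom 0 w ▹ ((a ℕ.≤ᵇ length u) ∧ cs u w) ▹ dsum p (λ μ → il′ (length w) p μ ▹ sumL (λ T → chkFrom w T ▹ ψ ((w ++ rep (a ∸ m) N) ∷ ext N p μ T)) (fillings μ n))
            ≈⟨ trans (▹-cong (incFrom 0 w) (λ _ → ▹-dsum ((a ℕ.≤ᵇ length u) ∧ cs u w) p _)) (▹-dsum (incFrom 0 w) p _) ⟩
          dsum p (λ μ → incFrom 0 w ▹ ((a ℕ.≤ᵇ length u) ∧ cs u w) ▹ il′ (length w) p μ ▹ sumL (λ T → chkFrom w T ▹ ψ ((w ++ rep (a ∸ m) N) ∷ ext N p μ T)) (fillings μ n))
            ≈⟨ dsum-cong p (λ μ _ → trans (reflexive (≡.cong (λ k → incFrom 0 w ▹ ((a ℕ.≤ᵇ length u) ∧ cs u w) ▹ il′ k p μ ▹ sumL (λ T → chkFrom w T ▹ ψ ((w ++ rep (a ∸ m) N) ∷ ext N p μ T)) (fillings μ n)) len))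
                 (trans (shuffle (incFrom 0 w) (a ℕ.≤ᵇ length u) (cs u w) (il′ m p μ) _) (▹-cong ((a ℕ.≤ᵇ length u) ∧ il′ m p μ) (λ _ →
                   trans (▹-cong (incFrom 0 w) (λ _ → ▹-sumL (cs u w) _ (fillings μ n))) (trans (▹-sumL (incFrom 0 w) _ (fillings μ n))
                     (sumL-cong′ (λ T → sym (trans (▹-∧ (incFrom 0 w) _) (▹-cong (incFrom 0 w) (λ _ → ▹-∧ (cs u w) _)))) (fillings μ n))))))) ⟩
          dsum p (λ μ → ((a ℕ.≤ᵇ length u) ∧ il′ m p μ) ▹ h w μ) ∎
          where
          aw : All (_≤ n) w
          aw = All.map proj₂ lw
          shuffle : ∀ i l c k x → i ▹ (l ∧ c) ▹ k ▹ x ≈ (l ∧ k) ▹ i ▹ c ▹ x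
          shuffle i true c k x = trans (▹-cong i (λ _ → ▹-comm c k x)) (▹-comm i k _)
          shuffle i false c k x = ▹-0 i (λ _ → refl)
        level : sumL (λ w → incFrom 0 w ▹ cs (u ++ rep b N) (w ++ rep (a ∸ m) N) ▹ sumL (λ T → chkFrom (w ++ rep (a ∸ m) N) T ▹ ψ ((w ++ rep (a ∸ m) N) ∷ T)) (fillings p N)) (words m n)
          ≈ dsum p (λ μ → ((a ℕ.≤ᵇ length u) ∧ il′ m p μ) ▹ sumL (λ T → chkFrom u T ▹ ψ (ext N (a ∷ p) (m ∷ μ) T)) (fillings (m ∷ μ) n))
        level = begin
          _ ≈⟨ sumL-cong (words-letters m n) word ⟩
          sumL (λ w → dsum p (λ μ → ((a ℕ.≤ᵇ length u) ∧ il′ m p μ) ▹ h w μ)) (words m n)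
            ≈⟨ sumL-dsum p _ (words m n) ⟩
          dsum p (λ μ → sumL (λ w → ((a ℕ.≤ᵇ length u) ∧ il′ m p μ) ▹ h w μ) (words m n))
            ≈⟨ dsum-cong p (λ μ _ → trans (sym (▹-sumL ((a ℕ.≤ᵇ length u) ∧ il′ m p μ) (λ w → h w μ) (words m n)))
                 (▹-cong ((a ℕ.≤ᵇ length u) ∧ il′ m p μ) (λ _ → sym (sumL-prefix (λ T → chkFrom u T ▹ ψ (ext N (a ∷ p) (m ∷ μ) T)) (words m n) (fillings μ n))))) ⟩
          dsum p (λ μ → ((a ℕ.≤ᵇ length u) ∧ il′ m p μ) ▹ sumL (λ T → chkFrom u T ▹ ψ (ext N (a ∷ p) (m ∷ μ) T)) (fillings (m ∷ μ) n)) ∎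

  -- The Kostka number of shape p and content e as a ring element. The row of zeros on top imposes
  -- no condition, since letters are positive.
  kos : ∀ n → List ℕ → Vec ℕ n → A
  kos n p e = sumL (λ T → chkFrom (rep (head-or-0 p) 0) T ▹ (cont n (L.concat T) ≡ᵛ e) ▹ 1#) (fillings p n)

  chk-head : ∀ n μ T h → ShapeT n μ T → head-or-0 μ ≤ h → chkFrom (rep h 0) T ≡ chkFrom (rep (head-or-0 μ) 0) T
  chk-head n [] [] h s le = ≡.refl
  chk-head n (m ∷ μ) (w ∷ T) h ((≡.refl , lw) , s) le = ≡.cong (λ b → incFrom 0 w ∧ b ∧ chkFrom w T)
    (≡.trans (cs-zero h w le (All.map proj₁ lw)) (≡.sym (cs-zero (length w) w ℕₚ.≤-refl (All.map proj₁ lw))))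

  head-mono : ∀ μ p → μ ≤ₚ p → head-or-0 μ ≤ head-or-0 p
  head-mono [] [] _ = z≤n
  head-mono (m ∷ μ) (a ∷ p) (le , _) = le

  kos-branch : ∀ n p a e → kos (suc n) p (a ∷ e) ≈ dsum p (λ μ → il′ (head-or-0 p) p μ ▹ (tot p ℕ.≡ᵇ a ℕ.+ tot μ) ▹ kos n μ e)
  kos-branch n p a e = begin
    kos (suc n) p (a ∷ e)
      ≡⟨ ≡.cong (λ u → sumL (λ T → chkFrom u T ▹ ψ T) (fillings p (suc n))) (≡.sym (Lₚ.++-identityʳ (rep h 0))) ⟩
    sumL (λ T → chkFrom (rep h 0 ++ rep 0 (suc n)) T ▹ ψ T) (fillings p (suc n))
      ≈⟨ branching n p (rep h 0) 0 ψ (Allₚ.replicate⁺ h z≤n) ⟩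
    dsum p (λ μ → il′ (length (rep h 0)) p μ ▹ sumL (λ T → chkFrom (rep h 0) T ▹ ψ (ext (suc n) p μ T)) (fillings μ n))
      ≈⟨ dsum-cong p (λ μ le → trans (reflexive (≡.cong (λ k → il′ k p μ ▹ sumL (λ T → chkFrom (rep h 0) T ▹ ψ (ext (suc n) p μ T)) (fillings μ n)) (Lₚ.length-replicate h)))
           (▹-cong (il′ h p μ) (λ _ → trans (sumL-cong (fillings-shape μ n) (tableau μ le)) (sym (▹-sumL (tot p ℕ.≡ᵇ a ℕ.+ tot μ) _ (fillings μ n)))))) ⟩
    dsum p (λ μ → il′ h p μ ▹ (tot p ℕ.≡ᵇ a ℕ.+ tot μ) ▹ kos n μ e) ∎
    where
    h = head-or-0 p
    ψ : List (List ℕ) → A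
    ψ T = (cont (suc n) (L.concat T) ≡ᵛ (a ∷ e)) ▹ 1#
    tableau : ∀ μ → μ ≤ₚ p → ∀ T → ShapeT n μ T → chkFrom (rep h 0) T ▹ ψ (ext (suc n) p μ T) ≈
      (tot p ℕ.≡ᵇ a ℕ.+ tot μ) ▹ chkFrom (rep (head-or-0 μ) 0) T ▹ (cont n (L.concat T) ≡ᵛ e) ▹ 1#
    tableau μ le T s = trans (reflexive (≡.cong₂ _▹_ (chk-head n μ T h s (head-mono μ p le))
        (≡.cong₂ (λ b c → (b ∧ (c ≡ᵛ e)) ▹ 1#) (≡ᵇ-iff {occ (suc n) (L.concat (ext (suc n) p μ T))} {a} {tot p} {a ℕ.+ tot μ}
          (λ q → ≡.trans (≡.sym (occ-ext n p μ T le s)) (≡.cong (ℕ._+ tot μ) q))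
          (λ q → ℕₚ.+-cancelʳ-≡ (tot μ) _ _ (≡.trans (occ-ext n p μ T le s) q)))
        (cont-ext (suc n) n p μ T ℕₚ.≤-refl le s))))
      (trans (▹-cong (chkFrom (rep (head-or-0 μ) 0) T) (λ _ → ▹-∧ (tot p ℕ.≡ᵇ a ℕ.+ tot μ) _)) (▹-comm (chkFrom (rep (head-or-0 μ) 0) T) (tot p ℕ.≡ᵇ a ℕ.+ tot μ) _))

  kos-size : ∀ n p e → ¬ tot p ≡ Vec.sum e → kos n p e ≈ 0#
  kos-size zero p [] ne = sumL-0 (fillings-shape p 0) (λ T s → ⊥-elim (ne (empty p T s)))
    where
    empty : ∀ p T → ShapeT 0 p T → tot p ≡ 0
    empty [] [] s = ≡.refl
    empty (a ∷ p) ([] ∷ T) ((≡.refl , _) , s) = empty p T s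
    empty (a ∷ p) ((suc x ∷ w) ∷ T) ((_ , (_ , ()) ∷ _) , s)
  kos-size (suc n) p (a ∷ e) ne = trans (kos-branch n p a e) (dsum-0 p (λ μ _ → ▹-0 (il′ (head-or-0 p) p μ) (λ _ →
    ▹-0 (tot p ℕ.≡ᵇ a ℕ.+ tot μ) (λ q → kos-size n μ e (λ r → ne (≡.trans (≡ᵇ-true (tot p) _ q) (≡.cong (a ℕ.+_) r)))))))

  kos-long : ∀ n p e → Long n p → kos n p e ≈ 0#
  kos-long n p e lg = sumL-0 (fillings-shape p n) (λ T s → reflexive (≡.cong (_▹ ((cont n (L.concat T) ≡ᵛ e) ▹ 1#))
    (chk-long n 0 n p _ T lg ℕₚ.≤-refl (Allₚ.replicate⁺ (head-or-0 p) z≤n) s)))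

  fillings-∷ʳ : ∀ n p (φ : List (List ℕ) → A) → sumL φ (fillings (p ++ 0 ∷ []) n) ≈ sumL (λ T → φ (T ++ [] ∷ [])) (fillings p n)
  fillings-∷ʳ n [] φ = refl
  fillings-∷ʳ n (a ∷ p) φ = trans (sumL-prefix φ (words a n) (fillings (p ++ 0 ∷ []) n))
    (trans (sumL-cong′ (λ w → fillings-∷ʳ n p (λ T → φ (w ∷ T))) (words a n)) (sym (sumL-prefix (λ T → φ (T ++ [] ∷ [])) (words a n) (fillings p n))))

  kos-∷ʳ : ∀ n p e → kos n (p ++ 0 ∷ []) e ≈ kos n p e
  kos-∷ʳ n p e = trans (fillings-∷ʳ n p _) (sumL-cong′ (λ T → reflexive (≡.cong₂ (λ b c → b ▹ (cont n c ≡ᵛ e) ▹ 1#)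
      (≡.trans (≡.cong (λ k → chkFrom (rep k 0) (T ++ [] ∷ [])) (head-∷ʳ p)) (chk-∷ʳ _ T))
      (≡.trans (≡.sym (Lₚ.concat-++ T ([] ∷ []))) (Lₚ.++-identityʳ (L.concat T))))) (fillings p n))
    where
    head-∷ʳ : ∀ p → head-or-0 (p ++ 0 ∷ []) ≡ head-or-0 p
    head-∷ʳ [] = ≡.refl
    head-∷ʳ (a ∷ p) = ≡.refl
    chk-∷ʳ : ∀ u T → chkFrom u (T ++ [] ∷ []) ≡ chkFrom u T
    chk-∷ʳ u [] = ≡.refl
    chk-∷ʳ u (w ∷ T) = ≡.cong (λ b → incFrom 0 w ∧ cs u w ∧ b) (chk-∷ʳ w T)

  tot-∷ʳ : ∀ μ → tot (μ ++ 0 ∷ []) ≡ tot μ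
  tot-∷ʳ [] = ≡.refl
  tot-∷ʳ (m ∷ μ) = ≡.cong (m ℕ.+_) (tot-∷ʳ μ)

  sumTo-extend : ∀ a B (g : ℕ → A) → a < B → sumTo (suc a) g ≈ sumTo B (λ m → (m ℕ.≤ᵇ a) ▹ g m)
  sumTo-extend zero (suc B) g lt = +-congˡ (sym (sumTo-0 B (λ _ _ → refl)))
  sumTo-extend (suc a) (suc B) g (s≤s lt) = +-congˡ (trans (sumTo-extend a B (g ∘ suc) lt)
    (sumTo-cong B (λ m _ → reflexive (≡.cong (_▹ g (suc m)) (≤ᵇ-iff {m} {a} {suc m} {suc a} s≤s ℕₚ.≤-pred)))))

  -- The last row of μ has to be empty, because `g` vanishes otherwise; dropping it turns `il′` into
  -- `il`.
  dsum⇒bsum : ∀ B a p k (g : List ℕ → A) → All (_< B) (a ∷ p) → (∀ μ → Long (length p) μ → g μ ≈ 0#) →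
    dsum (a ∷ p) (λ μ → il′ k (a ∷ p) μ ▹ g μ) ≈ (a ℕ.≤ᵇ k) ▹ bsum B (length p) (λ μ → il (a ∷ p) μ ▹ g (μ ++ 0 ∷ []))
  dsum⇒bsum B a [] k g all gl = trans (+-congˡ (sumTo-0 a (λ m _ → ▹-0 ((a ℕ.≤ᵇ k) ∧ true) (λ _ → gl (suc m ∷ []) (here (s≤s z≤n))))))
    (trans (+-identityʳ _) (▹-∧ (a ℕ.≤ᵇ k) true))
  dsum⇒bsum B a (b ∷ p) k g (aB ∷ all) gl = begin
    sumTo (suc a) (λ m → dsum (b ∷ p) (λ μ → ((a ℕ.≤ᵇ k) ∧ il′ m (b ∷ p) μ) ▹ g (m ∷ μ)))
      ≈⟨ sumTo-cong (suc a) {λ m → dsum (b ∷ p) (λ μ → ((a ℕ.≤ᵇ k) ∧ il′ m (b ∷ p) μ) ▹ g (m ∷ μ))} {h = λ m → (a ℕ.≤ᵇ k) ▹ (b ℕ.≤ᵇ m) ▹ G m} (λ m _ → trans (dsum-cong (b ∷ p) {λ μ → ((a ℕ.≤ᵇ k) ∧ il′ m (b ∷ p) μ) ▹ g (m ∷ μ)} {ψ = λ μ → (a ℕ.≤ᵇ k) ▹ il′ m (b ∷ p) μ ▹ g (m ∷ μ)} (λ μ _ → ▹-∧ (a ℕ.≤ᵇ k) (il′ m (b ∷ p) μ))) (trans (sym (▹-dsum (a ℕ.≤ᵇ k) (b ∷ p) (λ μ → il′ m (b ∷ p) μ ▹ g (m ∷ μ))))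
           (▹-cong (a ℕ.≤ᵇ k) (λ _ → dsum⇒bsum B b p m (λ μ → g (m ∷ μ)) all (λ μ lg → gl (m ∷ μ) (there lg)))))) ⟩
    sumTo (suc a) (λ m → (a ℕ.≤ᵇ k) ▹ (b ℕ.≤ᵇ m) ▹ G m)
      ≈⟨ ▹-sumTo (a ℕ.≤ᵇ k) (suc a) (λ m → (b ℕ.≤ᵇ m) ▹ G m) ⟨
    (a ℕ.≤ᵇ k) ▹ sumTo (suc a) (λ m → (b ℕ.≤ᵇ m) ▹ G m)
      ≈⟨ ▹-cong (a ℕ.≤ᵇ k) (λ _ → trans (sumTo-extend a B (λ m → (b ℕ.≤ᵇ m) ▹ G m) aB) (sumTo-cong B (λ m _ → trans
           (▹-cong (m ℕ.≤ᵇ a) (λ _ → ▹-bsum (b ℕ.≤ᵇ m) B (length p) (λ μ → il (b ∷ p) μ ▹ g (m ∷ μ ++ 0 ∷ [])))) (trans (▹-bsum (m ℕ.≤ᵇ a) B (length p) _)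
           (bsum-cong B (length p) (λ μ _ _ → sym (trans (▹-∧ (m ℕ.≤ᵇ a) _) (▹-cong (m ℕ.≤ᵇ a) (λ _ → ▹-∧ (b ℕ.≤ᵇ m) _))))))))) ⟩
    (a ℕ.≤ᵇ k) ▹ bsum B (suc (length p)) (λ μ → il (a ∷ b ∷ p) μ ▹ g (μ ++ 0 ∷ [])) ∎
    where
    G : ℕ → A
    G m = bsum B (length p) (λ μ → il (b ∷ p) μ ▹ g (m ∷ μ ++ 0 ∷ []))

  kos-suc : ∀ n B p a e → length p ≡ suc n → All (_< B) p → dec p ≡ true →
    kos (suc n) p (a ∷ e) ≈ bsum B n (λ μ → il p μ ▹ (tot p ℕ.≡ᵇ a ℕ.+ tot μ) ▹ kos n μ e)
  kos-suc n B (x ∷ p) a e ≡.refl all _ = begin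
    kos (suc n) (x ∷ p) (a ∷ e)
      ≈⟨ kos-branch n (x ∷ p) a e ⟩
    dsum (x ∷ p) (λ μ → il′ x (x ∷ p) μ ▹ g μ)
      ≈⟨ dsum⇒bsum B x p x g all (λ μ lg → ▹-0 (tot (x ∷ p) ℕ.≡ᵇ a ℕ.+ tot μ) (λ _ → kos-long n μ e lg)) ⟩
    (x ℕ.≤ᵇ x) ▹ bsum B n (λ μ → il (x ∷ p) μ ▹ g (μ ++ 0 ∷ []))
      ≡⟨ ≡.cong (_▹ bsum B n (λ μ → il (x ∷ p) μ ▹ g (μ ++ 0 ∷ []))) (true-≤ᵇ {x} ℕₚ.≤-refl) ⟩
    bsum B n (λ μ → il (x ∷ p) μ ▹ g (μ ++ 0 ∷ []))
      ≈⟨ bsum-cong B n (λ μ _ _ → ▹-cong (il (x ∷ p) μ) (λ _ → trans (reflexive (≡.cong (λ t → (tot (x ∷ p) ℕ.≡ᵇ a ℕ.+ t) ▹ kos n (μ ++ 0 ∷ []) e) (tot-∷ʳ μ)))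
           (▹-cong (tot (x ∷ p) ℕ.≡ᵇ a ℕ.+ tot μ) (λ _ → kos-∷ʳ n μ e)))) ⟩
    bsum B n (λ μ → il (x ∷ p) μ ▹ (tot (x ∷ p) ℕ.≡ᵇ a ℕ.+ tot μ) ▹ kos n μ e) ∎
    where
    g : List ℕ → A
    g μ = (tot (x ∷ p) ℕ.≡ᵇ a ℕ.+ tot μ) ▹ kos n μ e

  dsum-top : ∀ p (g : List ℕ → A) → dsum p (λ μ → (tot p ℕ.≡ᵇ tot μ) ▹ g μ) ≈ g p
  dsum-top [] g = refl
  dsum-top (a ∷ p) g = trans (sumTo-cong (suc a) {h = λ m → (m ℕ.≡ᵇ a) ▹ dsum p (λ μ → (tot p ℕ.≡ᵇ tot μ) ▹ g (m ∷ μ))} term)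
    (trans (sumTo-point (suc a) a (λ m → dsum p (λ μ → (tot p ℕ.≡ᵇ tot μ) ▹ g (m ∷ μ))) ℕₚ.≤-refl) (dsum-top p (λ μ → g (a ∷ μ))))
    where
    term : ∀ m → m < suc a → dsum p (λ μ → (a ℕ.+ tot p ℕ.≡ᵇ m ℕ.+ tot μ) ▹ g (m ∷ μ)) ≈ (m ℕ.≡ᵇ a) ▹ dsum p (λ μ → (tot p ℕ.≡ᵇ tot μ) ▹ g (m ∷ μ))
    term m (s≤s le) = trans (dsum-cong p (λ μ μp → trans (reflexive (≡.cong (_▹ g (m ∷ μ)) (split μ μp))) (▹-∧ (m ℕ.≡ᵇ a) _))) (sym (▹-dsum (m ℕ.≡ᵇ a) p _))
      where
      split : ∀ μ → μ ≤ₚ p → (a ℕ.+ tot p ℕ.≡ᵇ m ℕ.+ tot μ) ≡ (m ℕ.≡ᵇ a) ∧ (tot p ℕ.≡ᵇ tot μ)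
      split μ μp = bool-iff forward
        (λ q → let (q₁ , q₂) = ∧-true (m ℕ.≡ᵇ a) _ q in true-≡ᵇ {a ℕ.+ tot p} {m ℕ.+ tot μ} (≡.cong₂ ℕ._+_ (≡.sym (≡ᵇ-true m a q₁)) (≡ᵇ-true (tot p) (tot μ) q₂)))
        where
        forward : (a ℕ.+ tot p ℕ.≡ᵇ m ℕ.+ tot μ) ≡ true → (m ℕ.≡ᵇ a) ∧ (tot p ℕ.≡ᵇ tot μ) ≡ true
        forward q = ≡.cong₂ _∧_ (true-≡ᵇ {m} {a} m≡a) (true-≡ᵇ {tot p} {tot μ} (ℕₚ.+-cancelˡ-≡ a _ _ (≡.trans r (≡.cong (ℕ._+ tot μ) m≡a))))
          where
          r = ≡ᵇ-true (a ℕ.+ tot p) (m ℕ.+ tot μ) q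
          m≡a : m ≡ a
          m≡a = ℕₚ.≤-antisym le (ℕₚ.+-cancelʳ-≤ (tot p) a m (ℕₚ.≤-trans (ℕₚ.≤-reflexive r) (ℕₚ.+-monoʳ-≤ m (tot-mono μ p μp))))

  -- Without the letter n + 1, μ has the size of p and so is p. Together with `product-zero` this
  -- permits an additional vanishing variable.
  kos-zero-letter : ∀ n p e → dec p ≡ true → kos (suc n) p (0 ∷ e) ≈ kos n p e
  kos-zero-letter n p e d = trans (kos-branch n p 0 e) (trans
    (dsum-cong p (λ μ _ → ▹-comm (il′ (head-or-0 p) p μ) (tot p ℕ.≡ᵇ tot μ) _))
    (trans (dsum-top p (λ μ → il′ (head-or-0 p) p μ ▹ kos n μ e)) (reflexive (≡.cong (_▹ kos n p e) (il′-self p d)))))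
    where
    go : ∀ k p → decFrom k p ≡ true → il′ k p p ≡ true
    go k [] e = ≡.refl
    go k (a ∷ p) e = let (e₁ , e₂) = ∧-true (a ℕ.≤ᵇ k) _ e in ≡.cong₂ _∧_ e₁ (go a p e₂)
    il′-self : ∀ p → dec p ≡ true → il′ (head-or-0 p) p p ≡ true
    il′-self [] d = ≡.refl
    il′-self (a ∷ p) d = ≡.cong₂ _∧_ (true-≤ᵇ {a} ℕₚ.≤-refl) (go a p d)

  kos-zero : kos 0 [] [] ≈ 1#
  kos-zero = +-identityʳ _

-- The tableau condition by cells and by rows

upTo-suc : ∀ n → upTo (suc n) ≡ 0 ∷ map suc (upTo n)
upTo-suc n = ≡.cong (0 ∷_) (≡.sym (Lₚ.map-upTo suc n))

range1-suc : ∀ n → range1 (suc n) ≡ 1 ∷ map suc (range1 n)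
range1-suc n = ≡.cong (map suc) (upTo-suc n)

shiftCell : Cell → Cell
shiftCell (i , j) = (suc i , j)

cellRow : ℕ → ℕ → List Cell
cellRow i a = map (λ j → (i , j)) (range1 a)

cells-∷ : ∀ a p → cells (a ∷ p) ≡ cellRow 1 a ++ map shiftCell (cells p)
cells-∷ a p = ≡.trans (≡.cong (concatMap g) (range1-suc (length p))) (≡.cong (cellRow 1 a ++_) (≡.trans (Lₚ.concatMap-map g suc (range1 (length p)))
    (≡.trans (≡.cong L.concat (≡.trans (≡.sym (Lₚ.map-∘ (upTo (length p)))) (≡.trans (Lₚ.map-cong same (upTo (length p))) (Lₚ.map-∘ (upTo (length p))))))
    (≡.sym (Lₚ.map-concatMap shiftCell (λ i → cellRow i (row p i)) (range1 (length p)))))))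
  where
  g : ℕ → List Cell
  g i = cellRow i (row (a ∷ p) i)
  same : ∀ i → g (suc (suc i)) ≡ map shiftCell (cellRow (suc i) (row p (suc i)))
  same i = Lₚ.map-∘ (range1 (row p (suc i)))

Inside : List ℕ → Cell → Set
Inside p (i , j) = Σ ℕ (λ i′ → i ≡ suc i′) × 1 ≤ j × j ≤ row p i

cells-inside : ∀ p → All (Inside p) (cells p)
cells-inside [] = []
cells-inside (a ∷ p) = ≡.subst (All (Inside (a ∷ p))) (≡.sym (cells-∷ a p)) (Allₚ.++⁺
  (Allₚ.map⁺ (All.map (λ { (l , u) → (0 , ≡.refl) , l , u }) (range1-letters a)))
  (Allₚ.map⁺ (All.map (λ { {i , j} ((i′ , ≡.refl) , l , u) → (suc i′ , ≡.refl) , l , u }) (cells-inside p))))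

col-∷ : ∀ a p j → col (a ∷ p) j ≡ (if j ℕ.≤ᵇ a then suc (col p j) else col p j)
col-∷ a p j with j ℕ.≤ᵇ a
... | true = ≡.refl
... | false = ≡.refl

col-∷-≤ : ∀ a p j → j ≤ a → col (a ∷ p) j ≡ suc (col p j)
col-∷-≤ a p j le = ≡.trans (col-∷ a p j) (≡.cong (λ b → if b then suc (col p j) else col p j) (true-≤ᵇ {j} {a} le))

col-∷-> : ∀ a p j → a < j → col (a ∷ p) j ≡ col p j
col-∷-> a p j lt = ≡.trans (col-∷ a p j) (≡.cong (λ b → if b then suc (col p j) else col p j) (false-≤ᵇ lt))
  where
  false-≤ᵇ : ∀ {m n} → n < m → (m ℕ.≤ᵇ n) ≡ false
  false-≤ᵇ {m} {n} lt with m ℕ.≤ᵇ n in e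
  ... | true = ⊥-elim (ℕₚ.<⇒≱ lt (≤ᵇ-true m n e))
  ... | false = ≡.refl

col-beyond : ∀ k p j → decFrom k p ≡ true → k < j → col p j ≡ 0
col-beyond k [] j d lt = ≡.refl
col-beyond k (a ∷ p) j d lt = let (ak , d′) = ∧-true (a ℕ.≤ᵇ k) _ d in let aj = ℕₚ.≤-<-trans (≤ᵇ-true a k ak) lt in
  ≡.trans (col-∷-> a p j aj) (col-beyond a p j d′ aj)

row-bounded : ∀ k p i → decFrom k p ≡ true → row p i ≤ k
row-bounded k [] i d = z≤n
row-bounded k (a ∷ p) zero d = z≤n
row-bounded k (a ∷ p) (suc zero) d = ≤ᵇ-true a k (proj₁ (∧-true (a ℕ.≤ᵇ k) _ d))
row-bounded k (a ∷ p) (suc (suc i)) d = let (ak , d′) = ∧-true (a ℕ.≤ᵇ k) _ d in ℕₚ.≤-trans (row-bounded a p (suc i) d′) (≤ᵇ-true a k ak)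

all-cong : ∀ {I : Set} {P : I → Set} {f g : I → Bool} {xs} → All P xs → (∀ x → P x → f x ≡ g x) → all f xs ≡ all g xs
all-cong [] e = ≡.refl
all-cong (px ∷ ps) e = ≡.cong₂ _∧_ (e _ px) (all-cong ps e)

all-++ : ∀ {I : Set} (f : I → Bool) xs ys → all f (xs ++ ys) ≡ all f xs ∧ all f ys
all-++ f [] ys = ≡.refl
all-++ f (x ∷ xs) ys = ≡.trans (≡.cong (f x ∧_) (all-++ f xs ys)) (≡.sym (Boolₚ.∧-assoc (f x) _ _))

all-map : ∀ {I J : Set} (f : J → Bool) (h : I → J) xs → all f (map h xs) ≡ all (f ∘ h) xs
all-map f h [] = ≡.refl
all-map f h (x ∷ xs) = ≡.cong (f (h x) ∧_) (all-map f h xs)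

all-∧ : ∀ {I : Set} (f g : I → Bool) xs → all (λ x → f x ∧ g x) xs ≡ all f xs ∧ all g xs
all-∧ f g [] = ≡.refl
all-∧ f g (x ∷ xs) = ≡.trans (≡.cong ((f x ∧ g x) ∧_) (all-∧ f g xs)) (inter (f x) (g x) (all f xs) (all g xs))
  where
  inter : ∀ a b c d → (a ∧ b) ∧ (c ∧ d) ≡ (a ∧ c) ∧ (b ∧ d)
  inter true true c d = ≡.refl
  inter true false true d = ≡.refl
  inter true false false d = ≡.refl
  inter false b c d = ≡.refl

all-range1-suc : ∀ f a → all f (range1 (suc a)) ≡ f 1 ∧ all (f ∘ suc) (range1 a)
all-range1-suc f a = ≡.trans (≡.cong (all f) (range1-suc a)) (≡.cong (f 1 ∧_) (all-map f suc (range1 a)))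

all-range1-cong : ∀ {f g : ℕ → Bool} a → (∀ j → suc j ≤ a → f (suc j) ≡ g (suc j)) → all f (range1 a) ≡ all g (range1 a)
all-range1-cong {f} {g} a e = all-cong (range1-letters a) λ { (suc j) (_ , le) → e j le }

rowOK : List ℕ → ℕ → ℕ → Bool
rowOK w a j = if j ℕ.<ᵇ a then row w j ℕ.≤ᵇ row w (suc j) else true

rows-increasing : ∀ w → all (rowOK w (length w)) (range1 (length w)) ≡ incFrom 0 w
rows-increasing [] = ≡.refl
rows-increasing (x ∷ []) = ≡.refl
rows-increasing (x ∷ y ∷ w) = ≡.trans (all-range1-suc (rowOK (x ∷ y ∷ w) (2 ℕ.+ length w)) (suc (length w)))
  (≡.cong ((x ℕ.≤ᵇ y) ∧_) (≡.trans (all-range1-cong {rowOK (x ∷ y ∷ w) (2 ℕ.+ length w) ∘ suc} {rowOK (y ∷ w) (suc (length w))} (suc (length w)) (λ j _ → ≡.refl)) (rows-increasing (y ∷ w))))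

colOK : List ℕ → List ℕ → ℕ → Bool
colOK w w′ j = if j ℕ.≤ᵇ length w′ then row w j ℕ.<ᵇ row w′ j else true

columns-strict : ∀ w w′ → length w′ ≤ length w → all (colOK w w′) (range1 (length w)) ≡ cs w w′
columns-strict w [] le = go (length w)
  where
  go : ∀ a → all (colOK w []) (range1 a) ≡ true
  go a = ≡.trans (all-range1-cong {colOK w []} {λ _ → true} a (λ j _ → ≡.refl)) (const-true (range1 a))
    where
    const-true : ∀ (xs : List ℕ) → all (λ _ → true) xs ≡ true
    const-true [] = ≡.refl
    const-true (x ∷ xs) = const-true xs
columns-strict (x ∷ w) (y ∷ w′) (s≤s le) = ≡.trans (all-range1-suc (colOK (x ∷ w) (y ∷ w′)) (length w))
  (≡.cong ((x ℕ.<ᵇ y) ∧_) (≡.trans (all-range1-cong {colOK (x ∷ w) (y ∷ w′) ∘ suc} {colOK w w′} (length w) (λ j _ → ≡.refl)) (columns-strict w w′ le)))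

cellOK : List ℕ → List (List ℕ) → Cell → Bool
cellOK p T (i , j) =
  (if j ℕ.<ᵇ row p i then entry T (i , j) ℕ.≤ᵇ entry T (i , suc j) else true)
  ∧ (if i ℕ.<ᵇ col p j then entry T (i , j) ℕ.<ᵇ entry T (suc i , j) else true)

isSSYT-cellOK : ∀ p T → isSSYT p T ≡ all (cellOK p T) (cells p)
isSSYT-cellOK p T = all-cong (cells-inside p) (λ { (i , j) _ → ≡.refl })

-- Induction on the rows. For the cells below the first row every column loses exactly one cell,
-- because the first row is the longest; the column condition between the first two rows becomes
-- `cs`.
isSSYT-chk : ∀ n p T → dec p ≡ true → ShapeT n p T → isSSYT p T ≡ chkFrom (rep (head-or-0 p) 0) T
isSSYT-chk n p T d s = ≡.trans (isSSYT-cellOK p T) (go p T d s)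
  where
  shift-row : ∀ a p w T → decFrom a p ≡ true → all (cellOK (a ∷ p) (w ∷ T) ∘ shiftCell) (cells p) ≡ all (cellOK p T) (cells p)
  shift-row a p w T d = all-cong (cells-inside p) λ { (suc i , j) (_ , l , u) →
    ≡.cong (λ c → (if j ℕ.<ᵇ row p (suc i) then entry T (suc i , j) ℕ.≤ᵇ entry T (suc i , suc j) else true)
                ∧ (if 2 ℕ.+ i ℕ.<ᵇ c then entry T (suc i , j) ℕ.<ᵇ entry T (2 ℕ.+ i , j) else true))
      (col-∷-≤ a p j (ℕₚ.≤-trans u (row-bounded a p (suc i) d))) ; (zero , j) ((_ , ()) , _) }

  unfold : ∀ a p w T → length w ≡ a → decFrom a p ≡ true → all (cellOK (a ∷ p) (w ∷ T)) (cells (a ∷ p)) ≡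
    (incFrom 0 w ∧ all (λ j → if 1 ℕ.<ᵇ col (a ∷ p) j then row w j ℕ.<ᵇ entry T (1 , j) else true) (range1 a)) ∧ all (cellOK p T) (cells p)
  unfold a p w T ≡.refl d = ≡.trans (≡.cong (all (cellOK (a ∷ p) (w ∷ T))) (cells-∷ a p)) (≡.trans (all-++ _ (cellRow 1 a) (map shiftCell (cells p)))
    (≡.cong₂ _∧_ (≡.trans (all-map (cellOK (a ∷ p) (w ∷ T)) (λ j → (1 , j)) (range1 a)) (≡.trans (all-∧ (rowOK w a) colPart (range1 a)) (≡.cong (_∧ all colPart (range1 a)) (rows-increasing w))))
      (≡.trans (all-map (cellOK (a ∷ p) (w ∷ T)) shiftCell (cells p)) (shift-row a p w T d))))
    where
    colPart : ℕ → Bool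
    colPart j = if 1 ℕ.<ᵇ col (a ∷ p) j then row w j ℕ.<ᵇ entry T (1 , j) else true

  second-row : ∀ a b p j → decFrom b p ≡ true → b ≤ a → j ≤ a → (1 ℕ.<ᵇ col (a ∷ b ∷ p) j) ≡ (j ℕ.≤ᵇ b)
  second-row a b p j d ba ja = ≡.trans (≡.cong (1 ℕ.<ᵇ_) (col-∷-≤ a (b ∷ p) j ja)) (bool-iff
    (λ e → true-≤ᵇ {j} {b} (ℕₚ.≮⇒≥ (λ lt → absurd (≡.trans (≡.sym e) (≡.cong (0 ℕ.<ᵇ_) (≡.trans (col-∷-> b p j lt) (col-beyond b p j d lt)))))))
    (λ e → ≡.cong (0 ℕ.<ᵇ_) (col-∷-≤ b p j (≤ᵇ-true j b e))))
    where
    absurd : true ≡ false → ⊥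
    absurd ()

  go : ∀ p T → dec p ≡ true → ShapeT n p T → all (cellOK p T) (cells p) ≡ chkFrom (rep (head-or-0 p) 0) T
  go [] [] d s = ≡.refl
  go (a ∷ []) (w ∷ []) d ((≡.refl , lw) , s) = ≡.trans (unfold a [] w [] ≡.refl d) (≡.trans (Boolₚ.∧-identityʳ _)
    (≡.cong (incFrom 0 w ∧_) (≡.trans (all-range1-cong {g = λ _ → true} a (λ j ja → ≡.cong (λ c → if 1 ℕ.<ᵇ c then row w (suc j) ℕ.<ᵇ entry [] (1 , suc j) else true) (col-∷-≤ a [] (suc j) ja)))
      (≡.trans (const-true (range1 a)) (≡.sym (≡.trans (Boolₚ.∧-identityʳ _) (cs-zero a w ℕₚ.≤-refl (All.map proj₁ lw))))))))
    where
    const-true : ∀ (xs : List ℕ) → all (λ _ → true) xs ≡ true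
    const-true [] = ≡.refl
    const-true (x ∷ xs) = const-true xs
  go (a ∷ b ∷ p) (w ∷ w′ ∷ T) d ((≡.refl , lw) , (≡.refl , lw′) , s) = let (ba , d′) = ∧-true (b ℕ.≤ᵇ a) _ d in let le = ≤ᵇ-true b a ba in
    ≡.trans (unfold a (b ∷ p) w (w′ ∷ T) ≡.refl d)
    (≡.trans (≡.cong₂ (λ x y → (incFrom 0 w ∧ x) ∧ y)
        (≡.trans (all-range1-cong {g = colOK w w′} a (λ j ja → ≡.cong (λ c → if c then row w (suc j) ℕ.<ᵇ row w′ (suc j) else true) (second-row a b p (suc j) d′ le ja)))
           (columns-strict w w′ le))
        (≡.trans (go (b ∷ p) (w′ ∷ T) d′ ((≡.refl , lw′) , s)) (≡.cong (λ x → incFrom 0 w′ ∧ x ∧ chkFrom w′ T) (cs-zero b w′ ℕₚ.≤-refl (All.map proj₁ lw′)))))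
    (≡.trans (shuffle (incFrom 0 w) (cs w w′) (incFrom 0 w′) (chkFrom w′ T))
      (≡.cong (λ x → incFrom 0 w ∧ x ∧ chkFrom w (w′ ∷ T)) (≡.sym (cs-zero a w ℕₚ.≤-refl (All.map proj₁ lw))))))
    where
    shuffle : ∀ i c k r → (i ∧ c) ∧ (k ∧ r) ≡ i ∧ (k ∧ c ∧ r)
    shuffle true true k r = ≡.refl
    shuffle true false true r = ≡.refl
    shuffle true false false r = ≡.refl
    shuffle false c k r = ≡.refl

-- Hook lengths

-- λ + δ, for λ padded with zeros to N rows
lamN : ℕ → List ℕ → List ℕ
lamN zero p = []
lamN (suc N) [] = N ∷ lamN N []
lamN (suc N) (a ∷ p) = (a ℕ.+ N) ∷ lamN N p

lamN-bounded : ∀ N a q → decFrom a q ≡ true → All (_≤ a ℕ.+ N) (lamN N q)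
lamN-bounded zero a q d = []
lamN-bounded (suc N) a [] d = ℕₚ.≤-trans (ℕₚ.n≤1+n N) (ℕₚ.m≤n+m (suc N) a) ∷ All.map (λ le → ℕₚ.≤-trans le (ℕₚ.+-monoʳ-≤ a (ℕₚ.n≤1+n N))) (lamN-bounded N a [] ≡.refl)
lamN-bounded (suc N) a (b ∷ q) d = let (ba , d′) = ∧-true (b ℕ.≤ᵇ a) _ d in let le = ≤ᵇ-true b a ba in
  ℕₚ.+-mono-≤ le (ℕₚ.n≤1+n N) ∷ All.map (λ l → ℕₚ.≤-trans l (ℕₚ.+-mono-≤ le (ℕₚ.n≤1+n N))) (lamN-bounded N b q d′)

lamN-<head : ∀ N a q → decFrom a q ≡ true → All (_< a ℕ.+ N) (lamN N q)
lamN-<head zero a q d = []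
lamN-<head (suc N) a [] d = ≡.subst (suc N ≤_) (≡.sym (ℕₚ.+-suc a N)) (s≤s (ℕₚ.m≤n+m N a))
  ∷ All.map (λ {x} le → ≡.subst (x <_) (≡.sym (ℕₚ.+-suc a N)) (s≤s le)) (lamN-bounded N a [] ≡.refl)
lamN-<head (suc N) a (b ∷ q) d = let (ba , d′) = ∧-true (b ℕ.≤ᵇ a) _ d in let le = ≤ᵇ-true b a ba in
  ≡.subst (b ℕ.+ N <_) (≡.sym (ℕₚ.+-suc a N)) (s≤s (ℕₚ.+-monoˡ-≤ N le))
  ∷ All.map (λ {x} l → ≡.subst (x <_) (≡.sym (ℕₚ.+-suc a N)) (s≤s (ℕₚ.≤-trans l (ℕₚ.+-monoˡ-≤ N le)))) (lamN-bounded N b q d′)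

dec-tail : ∀ {a} p → decFrom a p ≡ true → dec p ≡ true
dec-tail [] d = ≡.refl
dec-tail (b ∷ p) d = proj₂ (∧-true (b ℕ.≤ᵇ _) _ d)

col-row : ∀ p i j → dec p ≡ true → 1 ≤ j → j ≤ row p (suc i) → suc i ≤ col p j
col-row [] i j d () z≤n
col-row (a ∷ p) zero j d l u = ≡.subst (1 ≤_) (≡.sym (col-∷-≤ a p j u)) (s≤s z≤n)
col-row (a ∷ p) (suc i) j d l u = ≡.subst (2 ℕ.+ i ≤_) (≡.sym (col-∷-≤ a p j (ℕₚ.≤-trans u (row-bounded a p (suc i) d)))) (s≤s (col-row p i j (dec-tail p d) l u))

-- An arbitrary commutative monoid, because everything is used twice: in a ring under multiplication
-- for the hook factors, and in ℤ under addition for the exponent of q.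
module HookProducts (M : CommutativeMonoid 0ℓ 0ℓ) where
  open CommutativeMonoid M
  open SetoidR setoid

  prod : ∀ {I : Set} → (I → Carrier) → List I → Carrier
  prod g [] = ε
  prod g (x ∷ xs) = g x ∙ prod g xs

  prod-cong : ∀ {I : Set} {P : I → Set} {g h : I → Carrier} {xs} → All P xs → (∀ x → P x → g x ≈ h x) → prod g xs ≈ prod h xs
  prod-cong [] e = refl
  prod-cong (px ∷ ps) e = ∙-cong (e _ px) (prod-cong ps e)

  prod-cong′ : ∀ {I : Set} {g h : I → Carrier} → (∀ x → g x ≈ h x) → ∀ xs → prod g xs ≈ prod h xs
  prod-cong′ e [] = refl
  prod-cong′ e (x ∷ xs) = ∙-cong (e x) (prod-cong′ e xs)

  prod-map : ∀ {I J : Set} (g : J → Carrier) (f : I → J) xs → prod g (map f xs) ≡ prod (g ∘ f) xs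
  prod-map g f [] = ≡.refl
  prod-map g f (x ∷ xs) = ≡.cong (g (f x) ∙_) (prod-map g f xs)

  prod-++ : ∀ {I : Set} (g : I → Carrier) xs ys → prod g (xs ++ ys) ≈ prod g xs ∙ prod g ys
  prod-++ g [] ys = sym (identityˡ _)
  prod-++ g (x ∷ xs) ys = trans (∙-congˡ (prod-++ g xs ys)) (sym (assoc _ _ _))

  exchange : ∀ a b c d → (a ∙ b) ∙ (c ∙ d) ≈ (a ∙ c) ∙ (b ∙ d)
  exchange a b c d = begin
    (a ∙ b) ∙ (c ∙ d) ≈⟨ assoc a b (c ∙ d) ⟩
    a ∙ (b ∙ (c ∙ d)) ≈⟨ ∙-congˡ (trans (sym (assoc b c d)) (trans (∙-congʳ (comm b c)) (assoc c b d))) ⟩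
    a ∙ (c ∙ (b ∙ d)) ≈⟨ assoc a c (b ∙ d) ⟨
    (a ∙ c) ∙ (b ∙ d) ∎

  range1-front : ∀ g a → prod g (range1 (suc a)) ≈ g 1 ∙ prod (g ∘ suc) (range1 a)
  range1-front g a = trans (reflexive (≡.cong (prod g) (range1-suc a))) (∙-congˡ (reflexive (prod-map g suc (range1 a))))

  range1-back : ∀ (g : ℕ → Carrier) a → prod g (range1 (suc a)) ≈ prod g (range1 a) ∙ g (suc a)
  range1-back g a = trans (reflexive (≡.cong (prod g) (range1-∷ʳ a))) (trans (prod-++ g (range1 a) (suc a ∷ [])) (∙-congˡ (identityʳ _)))

  rowProd : ℕ → List ℕ → (ℕ → Carrier) → Carrier
  rowProd a q g = prod (λ j → g ((a ∸ j) ℕ.+ col q j ℕ.+ 1)) (range1 a)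

  -- The hook lengths of a row together with the differences l₁ - l_i are 1, …, l₁.
  row-hooks : ∀ N q a g → length q ≤ N → decFrom a q ≡ true →
    rowProd a q g ∙ prod (λ x → g (a ℕ.+ N ∸ x)) (lamN N q) ≈ prod g (range1 (a ℕ.+ N))

  -- When the row is longer than the next one, its last cell has hook length 1. Removing this cell
  -- lowers all other hook lengths of the row and all differences by one.
  row-hooks-suc : ∀ N q a g → length q ≤ N → decFrom a q ≡ true →
    rowProd (suc a) q g ∙ prod (λ x → g (suc a ℕ.+ N ∸ x)) (lamN N q) ≈ prod g (range1 (suc a ℕ.+ N))
  row-hooks-suc N q a g len d = begin
    rowProd (suc a) q g ∙ prod (λ x → g (suc a ℕ.+ N ∸ x)) (lamN N q)
      ≈⟨ ∙-cong (trans (range1-back _ a) (∙-cong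
           (prod-cong (range1-letters a) (λ j (_ , le) → reflexive (≡.cong (λ t → g (t ℕ.+ col q j ℕ.+ 1)) (ℕₚ.+-∸-assoc 1 le))))
           (reflexive (≡.cong g (≡.cong₂ (λ t c → t ℕ.+ c ℕ.+ 1) (ℕₚ.n∸n≡0 a) (col-beyond a q (suc a) d ℕₚ.≤-refl))))))
         (prod-cong (lamN-bounded N a q d) (λ x le → reflexive (≡.cong g (ℕₚ.+-∸-assoc 1 le)))) ⟩
    (rowProd a q (g ∘ suc) ∙ g 1) ∙ prod (λ x → (g ∘ suc) (a ℕ.+ N ∸ x)) (lamN N q)
      ≈⟨ trans (∙-congʳ (comm _ _)) (assoc _ _ _) ⟩
    g 1 ∙ (rowProd a q (g ∘ suc) ∙ prod (λ x → (g ∘ suc) (a ℕ.+ N ∸ x)) (lamN N q))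
      ≈⟨ ∙-congˡ (row-hooks N q a (g ∘ suc) len d) ⟩
    g 1 ∙ prod (g ∘ suc) (range1 (a ℕ.+ N))
      ≈⟨ range1-front g (a ℕ.+ N) ⟨
    prod g (range1 (suc a ℕ.+ N)) ∎

  row-hooks zero [] zero g len d = identityˡ ε
  row-hooks (suc N) [] zero g len d = begin
    ε ∙ (g (suc N ∸ N) ∙ prod (λ x → g (suc N ∸ x)) (lamN N []))
      ≈⟨ ∙-congˡ (∙-cong (reflexive (≡.cong g (ℕₚ.m+n∸n≡m 1 N))) (prod-cong (lamN-bounded N 0 [] ≡.refl) (λ x le → reflexive (≡.cong g (ℕₚ.+-∸-assoc 1 le))))) ⟩
    ε ∙ (g 1 ∙ prod (λ x → g (suc (N ∸ x))) (lamN N []))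
      ≈⟨ trans (identityˡ _) (∙-congˡ (trans (sym (identityˡ _)) (row-hooks N [] 0 (g ∘ suc) z≤n ≡.refl))) ⟩
    g 1 ∙ prod (g ∘ suc) (range1 N)
      ≈⟨ range1-front g N ⟨
    prod g (range1 (suc N)) ∎
  row-hooks N [] (suc a) g len d = row-hooks-suc N [] a g len ≡.refl
  -- When the next row is equally long, the value 1 is the difference to that row. Leaving that row
  -- out lowers all hook lengths and all other differences by one.
  row-hooks (suc N) (b ∷ q) a g (s≤s len) d with a ℕ.≟ b
  row-hooks (suc N) (b ∷ q) a g (s≤s len) d | yes ≡.refl = begin
    rowProd a (a ∷ q) g ∙ (g (a ℕ.+ suc N ∸ (a ℕ.+ N)) ∙ prod (λ x → g (a ℕ.+ suc N ∸ x)) (lamN N q))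
      ≈⟨ ∙-cong (prod-cong (range1-letters a) (λ j (_ , le) → reflexive (≡.cong g (≡.trans (≡.cong (λ c → a ∸ j ℕ.+ c ℕ.+ 1) (col-∷-≤ a q j le)) (≡.cong (ℕ._+ 1) (ℕₚ.+-suc (a ∸ j) _))))))
           (∙-cong (reflexive (≡.cong g (≡.trans (≡.cong (_∸ (a ℕ.+ N)) (ℕₚ.+-suc a N)) (ℕₚ.m+n∸n≡m 1 (a ℕ.+ N)))))
             (prod-cong (lamN-bounded N a q d′) (λ x le → reflexive (≡.cong g (≡.trans (≡.cong (_∸ x) (ℕₚ.+-suc a N)) (ℕₚ.+-∸-assoc 1 le)))))) ⟩
    rowProd a q (g ∘ suc) ∙ (g 1 ∙ prod (λ x → (g ∘ suc) (a ℕ.+ N ∸ x)) (lamN N q))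
      ≈⟨ trans (sym (assoc _ _ _)) (trans (∙-congʳ (comm _ _)) (assoc _ _ _)) ⟩
    g 1 ∙ (rowProd a q (g ∘ suc) ∙ prod (λ x → (g ∘ suc) (a ℕ.+ N ∸ x)) (lamN N q))
      ≈⟨ ∙-congˡ (row-hooks N q a (g ∘ suc) len d′) ⟩
    g 1 ∙ prod (g ∘ suc) (range1 (a ℕ.+ N))
      ≈⟨ range1-front g (a ℕ.+ N) ⟨
    prod g (range1 (suc (a ℕ.+ N)))
      ≡⟨ ≡.cong (prod g ∘ range1) (≡.sym (ℕₚ.+-suc a N)) ⟩
    prod g (range1 (a ℕ.+ suc N)) ∎
    where
    d′ : decFrom a q ≡ true
    d′ = proj₂ (∧-true (a ℕ.≤ᵇ a) _ d)
  row-hooks (suc N) (b ∷ q) zero g (s≤s len) d | no ne = ⊥-elim (ne (≡.sym (ℕₚ.n≤0⇒n≡0 (≤ᵇ-true b 0 (proj₁ (∧-true (b ℕ.≤ᵇ 0) _ d))))))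
  row-hooks (suc N) (b ∷ q) (suc a) g (s≤s len) d | no ne = row-hooks-suc (suc N) (b ∷ q) a g (s≤s len)
    (let (ba , d′) = ∧-true (b ℕ.≤ᵇ suc a) _ d in ≡.cong₂ _∧_ (true-≤ᵇ {b} {a} (ℕₚ.≤-pred (ℕₚ.≤∧≢⇒< (≤ᵇ-true b (suc a) ba) (λ e → ne (≡.sym e))))) d′)

  HP : ℕ → List ℕ → (ℕ → ℕ → Carrier) → Carrier
  HP zero p γ = ε
  HP (suc N) [] γ = ε
  HP (suc N) (a ∷ p) γ = rowProd a p (γ (a ℕ.+ N)) ∙ HP N p γ

  diffs : List ℕ → (ℕ → ℕ → Carrier) → Carrier
  diffs [] γ = ε
  diffs (l ∷ ls) γ = prod (λ x → γ l (l ∸ x)) ls ∙ diffs ls γ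

  diag : List ℕ → (ℕ → ℕ → Carrier) → Carrier
  diag [] γ = ε
  diag (l ∷ ls) γ = prod (γ l) (range1 l) ∙ diag ls γ

  -- `row-hooks` for every row. The quotient is written as a product, since a monoid has no
  -- division.
  hook-formula : ∀ N p γ → length p ≤ N → dec p ≡ true → HP N p γ ∙ diffs (lamN N p) γ ≈ diag (lamN N p) γ
  hook-formula zero [] γ len d = identityˡ ε
  hook-formula (suc N) [] γ len d = begin
    ε ∙ (prod (λ x → γ N (N ∸ x)) (lamN N []) ∙ diffs (lamN N []) γ)
      ≈⟨ identityˡ _ ⟩
    prod (λ x → γ N (N ∸ x)) (lamN N []) ∙ diffs (lamN N []) γ
      ≈⟨ ∙-cong (trans (sym (identityˡ _)) (row-hooks N [] 0 (γ N) z≤n ≡.refl))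
           (trans (sym (identityˡ _)) (trans (∙-congʳ (HP-[] N)) (hook-formula N [] γ z≤n ≡.refl))) ⟩
    prod (γ N) (range1 N) ∙ diag (lamN N []) γ ∎
    where
    HP-[] : ∀ N → ε ≈ HP N [] γ
    HP-[] zero = refl
    HP-[] (suc N) = refl
  hook-formula (suc N) (a ∷ p) γ (s≤s len) d = begin
    (rowProd a p (γ (a ℕ.+ N)) ∙ HP N p γ) ∙ (prod (λ x → γ (a ℕ.+ N) (a ℕ.+ N ∸ x)) (lamN N p) ∙ diffs (lamN N p) γ)
      ≈⟨ exchange _ _ _ _ ⟩
    (rowProd a p (γ (a ℕ.+ N)) ∙ prod (λ x → γ (a ℕ.+ N) (a ℕ.+ N ∸ x)) (lamN N p)) ∙ (HP N p γ ∙ diffs (lamN N p) γ)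
      ≈⟨ ∙-cong (row-hooks N p a (γ (a ℕ.+ N)) len d) (hook-formula N p γ len (dec-tail p d)) ⟩
    prod (γ (a ℕ.+ N)) (range1 (a ℕ.+ N)) ∙ diag (lamN N p) γ ∎

  cellProd : ∀ p → (ℕ → ℕ → ℕ → Carrier) → Carrier
  cellProd p ω = prod (λ c → ω (proj₁ c) (row p (proj₁ c)) (hook p c)) (cells p)

  cellProd-HP : ∀ N p γ ω → length p ≤ N → dec p ≡ true → (∀ i r h → suc i ≤ length p → ω (suc i) r h ≈ γ (r ℕ.+ N ∸ suc i) h) →
    cellProd p ω ≈ HP N p γ
  cellProd-HP zero [] γ ω len d e = refl
  cellProd-HP (suc N) [] γ ω len d e = refl
  cellProd-HP (suc N) (a ∷ p) γ ω (s≤s len) d e = begin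
    prod F (cells (a ∷ p))
      ≡⟨ ≡.cong (prod F) (cells-∷ a p) ⟩
    prod F (cellRow 1 a ++ map shiftCell (cells p))
      ≈⟨ trans (prod-++ F (cellRow 1 a) _) (∙-cong (reflexive (prod-map F _ (range1 a))) (reflexive (prod-map F shiftCell (cells p)))) ⟩
    prod (λ j → ω 1 a (hook (a ∷ p) (1 , j))) (range1 a) ∙ prod (F ∘ shiftCell) (cells p)
      ≈⟨ ∙-cong (prod-cong (range1-letters a) (λ j (_ , le) → trans (e 0 a _ (s≤s z≤n)) (reflexive (≡.cong₂ γ (≡.cong (_∸ 1) (ℕₚ.+-suc a N)) (≡.cong (λ c → a ∸ j ℕ.+ (c ∸ 1) ℕ.+ 1) (col-∷-≤ a p j le))))))
           (prod-cong (cells-inside p) (λ { (suc i , j) (_ , l , u) → reflexive (≡.cong (λ c → ω (2 ℕ.+ i) (row p (suc i)) (row p (suc i) ∸ j ℕ.+ (c ∸ (2 ℕ.+ i)) ℕ.+ 1)) (col-∷-≤ a p j (ℕₚ.≤-trans u (row-bounded a p (suc i) d)))) ; (zero , j) ((_ , ()) , _) })) ⟩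
    rowProd a p (γ (a ℕ.+ N)) ∙ cellProd p (λ i r h → ω (suc i) r h)
      ≈⟨ ∙-congˡ (cellProd-HP N p γ (λ i r h → ω (suc i) r h) len (dec-tail p d) (λ i r h le → trans (e (suc i) r h (s≤s le)) (reflexive (≡.cong (λ t → γ (t ∸ (2 ℕ.+ i)) h) (ℕₚ.+-suc r N))))) ⟩
    rowProd a p (γ (a ℕ.+ N)) ∙ HP N p γ ∎
    where
    F : Cell → Carrier
    F c = ω (proj₁ c) (row (a ∷ p) (proj₁ c)) (hook (a ∷ p) c)

-- The Cauchy coefficients as hook products

sgn : ℕ → ℤ
sgn h = if par h then ℤ.+ 1 else ℤ.- ℤ.+ 1

module HPℤ = HookProducts ℤₚ.+-0-commutativeMonoid

-- What is used of the Laurent series in q when the coefficients C are computed.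
record QRing : Set₁ where
  field
    R : Ring₀
  open Kit R public
  field
    qz : ℤ → A
    qz-0 : qz (ℤ.+ 0) ≈ 1#
    qz-+ : ∀ i j → qz (i ℤ.+ j) ≈ qz i * qz j
    iD : ℕ → A
    iD-inv : ∀ k → (1# - qz (ℤ.+ suc k)) * iD k ≈ 1#

  qz-neg : ∀ i → qz i * qz (ℤ.- i) ≈ 1#
  qz-neg i = trans (sym (qz-+ i (ℤ.- i))) (trans (reflexive (≡.cong qz (ℤₚ.+-inverseʳ i))) qz-0)

  -- `iv` inverts `D` from 1 on. Its value at 0 is a mere default, as hook lengths are positive.
  D iv : ℕ → A
  D h = 1# - qz (ℤ.+ h)
  iv zero = 0#
  iv (suc k) = iD k

  w w⁻¹ : ℕ → A
  w h = if par h then iv h else D h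
  w⁻¹ h = if par h then D h else iv h

  w-inv : ∀ h → 1 ≤ h → w h * w⁻¹ h ≈ 1#
  w-inv (suc k) _ with par (suc k)
  ... | true = trans (*-comm _ _) (iD-inv k)
  ... | false = iD-inv k

-- A hook of length h in a row with λ_i + N - i = l contributes γ l h to the exponent of q.
record Exponents (Q : QRing) : Set where
  open QRing Q
  field
    β : ℕ → ℕ → ℤ
    z : ℕ → A
    t : ℤ
  γ : ℕ → ℕ → ℤ
  γ l h = sgn h ℤ.* β l h
  Γ : ℕ → ℤ
  Γ l = HPℤ.prod (γ l) (range1 l)
  field
    z-suc : ∀ l → z (suc l) ≈ qz t * z l
    z-diff : ∀ b h → z (suc h ℕ.+ b) - z b ≈ qz (ℤ.- β (suc h ℕ.+ b) (suc h)) * D (suc h)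
    Γ-even : ∀ l → par l ≡ true → Γ (suc l) ≡ Γ l ℤ.- β (suc l) (suc l)
    Γ-odd : ∀ l → par l ≡ false → t ℤ.+ Γ l ≡ Γ (suc l) ℤ.- β (suc l) (suc l)

module FromExponents (Q : QRing) (ex : Exponents Q) where
  open QRing Q
  open Exponents ex
  private module HR = HookProducts *-commutativeMonoid

  prod≡prodL : ∀ {I : Set} (g : I → A) xs → HR.prod g xs ≡ prodL g xs
  prod≡prodL g [] = ≡.refl
  prod≡prodL g (x ∷ xs) = ≡.cong (g x *_) (prod≡prodL g xs)

  W G f : ℕ → A
  W l = HR.prod w (range1 l)
  G l = W l * qz (Γ l)
  f l = par l ▹ G l

  -- `hook-formula` divides by the contribution of the difference h = a - b; this is the inverse of
  -- q^γ `w h`. For even h it equals q^(-β) (1 - q^h), which is z_a - z_b by `z-diff`. For odd h the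
  -- sign in γ and the inversion in `w` together produce the inverse of z_a - z_b.
  κ⁺ : ℕ → ℕ → A
  κ⁺ a h = qz (ℤ.- γ a h) * w⁻¹ h

  κ : ℕ → ℕ → A
  κ a b = if b ℕ.<ᵇ a then κ⁺ a (a ∸ b) else (if a ℕ.<ᵇ b then - κ⁺ b (b ∸ a) else 0#)

  κ-> : ∀ h b → κ (suc h ℕ.+ b) b ≡ κ⁺ (suc h ℕ.+ b) (suc h)
  κ-> h b = ≡.trans (≡.cong (λ t → if t then κ⁺ a (a ∸ b) else (if a ℕ.<ᵇ b then - κ⁺ b (b ∸ a) else 0#)) (true-≤ᵇ {suc b} {a} (s≤s (ℕₚ.m≤n+m b h))))
                     (≡.cong (κ⁺ a) (ℕₚ.m+n∸n≡m (suc h) b))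
    where a = suc h ℕ.+ b

  κ-< : ∀ h b → κ b (suc h ℕ.+ b) ≡ - κ⁺ (suc h ℕ.+ b) (suc h)
  κ-< h b = ≡.trans (≡.cong (λ t → if t then κ⁺ b (b ∸ a) else (if b ℕ.<ᵇ a then - κ⁺ a (a ∸ b) else 0#)) (false-<ᵇ {a} {b} (ℕₚ.<⇒≯ (s≤s (ℕₚ.m≤n+m b h)))))
    (≡.trans (≡.cong (λ t → if t then - κ⁺ a (a ∸ b) else 0#) (true-≤ᵇ {suc b} {a} (s≤s (ℕₚ.m≤n+m b h)))) (≡.cong (-_ ∘ κ⁺ a) (ℕₚ.m+n∸n≡m (suc h) b)))
    where a = suc h ℕ.+ b

  κ-≡ : ∀ b → κ b b ≡ 0#
  κ-≡ b = ≡.cong₂ (λ s t → if s then κ⁺ b (b ∸ b) else (if t then - κ⁺ b (b ∸ b) else 0#)) irr irr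
    where
    irr : (b ℕ.<ᵇ b) ≡ false
    irr = false-<ᵇ {b} {b} (ℕₚ.<-irrefl ≡.refl)

  data Compare : ℕ → ℕ → Set where
    greater : ∀ h b → Compare (suc h ℕ.+ b) b
    equal : ∀ b → Compare b b
    less : ∀ h b → Compare b (suc h ℕ.+ b)

  cmp : ∀ a b → Compare a b
  cmp zero zero = equal 0
  cmp zero (suc b) = ≡.subst (Compare 0) (≡.cong suc (ℕₚ.+-identityʳ b)) (less b 0)
  cmp (suc a) zero = ≡.subst (λ x → Compare x 0) (≡.cong suc (ℕₚ.+-identityʳ a)) (greater a 0)
  cmp (suc a) (suc b) with cmp a b
  ... | greater h b = ≡.subst (λ x → Compare x (suc b)) (≡.cong suc (ℕₚ.+-suc h b)) (greater h (suc b))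
  ... | equal b = equal (suc b)
  ... | less h b = ≡.subst (Compare (suc b)) (≡.cong suc (ℕₚ.+-suc h b)) (less h (suc b))

  par-+ : ∀ a b → par (a ℕ.+ b) ≡ (if par a then par b else not (par b))
  par-+ zero b = ≡.refl
  par-+ (suc a) b = ≡.trans (≡.cong not (par-+ a b)) (go (par a))
    where
    go : ∀ p → not (if p then par b else not (par b)) ≡ (if not p then par b else not (par b))
    go true = ≡.refl
    go false = Boolₚ.not-involutive _

  par-same : ∀ h b → par (h ℕ.+ b) ≡ par b → par h ≡ true
  par-same h b e with par h | par-+ h b
  ... | true | _ = ≡.refl
  ... | false | e′ = ⊥-elim (Boolₚ.not-¬ ≡.refl (≡.trans (≡.sym e) e′))

  par-opp : ∀ h b → par (h ℕ.+ b) ≡ not (par b) → par h ≡ false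
  par-opp h b e with par h | par-+ h b
  ... | false | _ = ≡.refl
  ... | true | e′ = ⊥-elim (Boolₚ.not-¬ ≡.refl (≡.trans (≡.sym e′) e))

  κ⁺-same : ∀ h b → par (suc h) ≡ true → κ⁺ (suc h ℕ.+ b) (suc h) ≈ z (suc h ℕ.+ b) - z b
  κ⁺-same h b e = trans (*-cong (reflexive (≡.cong (qz ∘ ℤ.-_) (≡.trans (≡.cong (λ p → (if p then ℤ.+ 1 else ℤ.- ℤ.+ 1) ℤ.* β (suc h ℕ.+ b) (suc h)) e) (ℤₚ.*-identityˡ (β (suc h ℕ.+ b) (suc h))))))
      (reflexive (≡.cong (λ p → if p then D (suc h) else iv (suc h)) e))) (sym (z-diff b h))

  κ⁺-opp : ∀ h b → par (suc h) ≡ false → (z (suc h ℕ.+ b) - z b) * κ⁺ (suc h ℕ.+ b) (suc h) ≈ 1#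
  κ⁺-opp h b e = begin
    (z a - z b) * (qz (ℤ.- γ a (suc h)) * w⁻¹ (suc h))
      ≈⟨ *-cong (z-diff b h) (*-cong (reflexive (≡.cong (qz ∘ ℤ.-_) (≡.trans (≡.cong (λ p → (if p then ℤ.+ 1 else ℤ.- ℤ.+ 1) ℤ.* β a (suc h)) e) (ℤₚ.-1*i≡-i (β a (suc h))))))
           (reflexive (≡.cong (λ p → if p then D (suc h) else iv (suc h)) e))) ⟩
    (qz (ℤ.- β a (suc h)) * D (suc h)) * (qz (ℤ.- (ℤ.- β a (suc h))) * iD h)
      ≈⟨ solve 4 (λ a b c d → (a :* b) :* (c :* d) := (a :* c) :* (b :* d)) refl _ _ _ _ ⟩
    (qz (ℤ.- β a (suc h)) * qz (ℤ.- (ℤ.- β a (suc h)))) * (D (suc h) * iD h)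
      ≈⟨ trans (*-cong (qz-neg (ℤ.- β a (suc h))) (iD-inv h)) (*-identityˡ _) ⟩
    1# ∎
    where a = suc h ℕ.+ b

  κ-same : ∀ a b → par a ≡ par b → κ a b ≈ z a - z b
  κ-same a b e with cmp a b
  ... | greater h b = trans (reflexive (κ-> h b)) (κ⁺-same h b (par-same (suc h) b e))
  ... | equal b = trans (reflexive (κ-≡ b)) (sym (-‿inverseʳ _))
  ... | less h b = trans (reflexive (κ-< h b)) (trans (-‿cong (κ⁺-same h b (par-same (suc h) b (≡.sym e)))) (solve 2 (λ x y → :- (x :- y) := y :- x) refl _ _))

  κ-opp : ∀ a b → par a ≡ not (par b) → (z a - z b) * κ a b ≈ 1#
  κ-opp a b e with cmp a b
  ... | greater h b = trans (*-congˡ (reflexive (κ-> h b))) (κ⁺-opp h b (par-opp (suc h) b e))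
  ... | equal b = ⊥-elim (Boolₚ.not-¬ ≡.refl e)
  ... | less h b = trans (*-congˡ (reflexive (κ-< h b))) (trans (solve 3 (λ x y k → (y :- x) :* (:- k) := (x :- y) :* k) refl _ _ _)
                     (κ⁺-opp h b (par-opp (suc h) b (≡.trans (≡.sym (Boolₚ.not-involutive _)) (≡.cong not (≡.sym e))))))

  z-diff₀ : ∀ l → z (suc l) - z 0 ≈ qz (ℤ.- β (suc l) (suc l)) * D (suc l)
  z-diff₀ l = ≡.subst (λ x → z (suc x) - z 0 ≈ qz (ℤ.- β (suc x) (suc l)) * D (suc l)) (ℕₚ.+-identityʳ l) (z-diff 0 l)

  -- From `W l` to the next one the new factor is 1 - q^(l+1), and `Γ-even` says that the power of q
  -- changes as in z_(l+1) - z_0.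
  G-odd : ∀ l → par l ≡ true → G (suc l) ≈ f l * (z (suc l) - z 0)
  G-odd l e = begin
    W (suc l) * qz (Γ (suc l))
      ≈⟨ *-cong (trans (HR.range1-back w l) (*-congˡ (reflexive (≡.cong (λ p → if not p then iv (suc l) else D (suc l)) e))))
           (trans (reflexive (≡.cong qz (Γ-even l e))) (qz-+ (Γ l) (ℤ.- β (suc l) (suc l)))) ⟩
    (W l * D (suc l)) * (qz (Γ l) * qz (ℤ.- β (suc l) (suc l)))
      ≈⟨ solve 4 (λ a b c d → (a :* b) :* (c :* d) := (a :* c) :* (d :* b)) refl _ _ _ _ ⟩
    G l * (qz (ℤ.- β (suc l) (suc l)) * D (suc l))
      ≈⟨ *-cong (reflexive (≡.cong (_▹ G l) e)) (z-diff₀ l) ⟨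
    f l * (z (suc l) - z 0) ∎

  G-step : ∀ l → par l ≡ false → qz t * G l ≈ f (suc l) * (z (suc l) - z 0)
  G-step l e = sym (begin
    f (suc l) * (z (suc l) - z 0)
      ≈⟨ *-cong (reflexive (≡.cong (λ p → not p ▹ G (suc l)) e)) (z-diff₀ l) ⟩
    (W (suc l) * qz (Γ (suc l))) * (qz (ℤ.- β (suc l) (suc l)) * D (suc l))
      ≈⟨ *-congʳ (*-congʳ (trans (HR.range1-back w l) (*-congˡ (reflexive (≡.cong (λ p → if not p then iv (suc l) else D (suc l)) e))))) ⟩
    ((W l * iD l) * qz (Γ (suc l))) * (qz (ℤ.- β (suc l) (suc l)) * D (suc l))
      ≈⟨ solve 5 (λ a i g b d → ((a :* i) :* g) :* (b :* d) := (a :* (g :* b)) :* (d :* i)) refl _ _ _ _ _ ⟩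
    (W l * (qz (Γ (suc l)) * qz (ℤ.- β (suc l) (suc l)))) * (D (suc l) * iD l)
      ≈⟨ trans (*-cong (*-congˡ (trans (sym (qz-+ (Γ (suc l)) (ℤ.- β (suc l) (suc l)))) (trans (reflexive (≡.cong qz (≡.sym (Γ-odd l e)))) (qz-+ t (Γ l))))) (iD-inv l)) (*-identityʳ _) ⟩
    W l * (qz t * qz (Γ l))
      ≈⟨ solve 3 (λ a b c → a :* (b :* c) := b :* (a :* c)) refl _ _ _ ⟩
    qz t * G l ∎)

  coeffs : Coeffs R
  coeffs = record
    { z = z ; G = G ; f = f ; κ = κ ; τ = qz t
    ; κ-same = κ-same ; κ-opp = κ-opp ; z-suc = z-suc
    ; f-odd = λ l e → reflexive (≡.cong (_▹ G l) e)
    ; f-0 = trans (*-identityˡ _) qz-0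
    ; G-even = λ l e → reflexive (≡.sym (≡.cong (_▹ G l) e))
    ; G-odd = G-odd ; G-step = G-step }

  open Coeffs coeffs using (C; Cc; bal)

  data Desc : List ℕ → Set where
    [] : Desc []
    _∷_ : ∀ {l ls} → All (_< l) ls → Desc ls → Desc (l ∷ ls)

  lamN-desc : ∀ N p → dec p ≡ true → Desc (lamN N p)
  lamN-desc zero p d = []
  lamN-desc (suc N) [] d = lamN-<head N 0 [] ≡.refl ∷ lamN-desc N [] ≡.refl
  lamN-desc (suc N) (a ∷ p) d = lamN-<head N a p d ∷ lamN-desc N p (dec-tail p d)

  κ-w : ∀ l x → x < l → κ l x * w (l ∸ x) ≈ qz (ℤ.- γ l (l ∸ x))
  κ-w l x lt with ℕₚ.m<n⇒0<n∸m lt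
  ... | pos = trans (*-congʳ (reflexive (≡.cong (λ t → if t then κ⁺ l (l ∸ x) else (if l ℕ.<ᵇ x then - κ⁺ x (x ∸ l) else 0#)) (true-≤ᵇ {suc x} {l} lt))))
    (trans (*-assoc _ _ _) (trans (*-congˡ (trans (*-comm _ _) (w-inv (l ∸ x) pos))) (*-identityʳ _)))

  row-κ : ∀ l ls → All (_< l) ls → prodL (κ l) ls * HR.prod (λ x → w (l ∸ x)) ls ≈ qz (ℤ.- HPℤ.prod (λ x → γ l (l ∸ x)) ls)
  row-κ l [] [] = trans (*-identityˡ _) (sym qz-0)
  row-κ l (x ∷ ls) (lt ∷ lts) = trans (solve 4 (λ a b c d → (a :* b) :* (c :* d) := (a :* c) :* (b :* d)) refl _ _ _ _)
    (trans (*-cong (κ-w l x lt) (row-κ l ls lts)) (trans (sym (qz-+ (ℤ.- γ l (l ∸ x)) _)) (reflexive (≡.cong qz (≡.sym (ℤₚ.neg-distrib-+ (γ l (l ∸ x)) _))))))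

  Cc-diffs : ∀ ls → Desc ls → Cc ls * HR.diffs ls (λ _ → w) ≈ qz (ℤ.- HPℤ.diffs ls γ)
  Cc-diffs [] [] = trans (*-identityˡ _) (sym qz-0)
  Cc-diffs (l ∷ ls) (lts ∷ d) = trans (solve 4 (λ a b c d → (a :* b) :* (c :* d) := (a :* c) :* (b :* d)) refl _ _ _ _)
    (trans (*-cong (row-κ l ls lts) (Cc-diffs ls d)) (trans (sym (qz-+ (ℤ.- HPℤ.prod (λ x → γ l (l ∸ x)) ls) _)) (reflexive (≡.cong qz (≡.sym (ℤₚ.neg-distrib-+ (HPℤ.prod (λ x → γ l (l ∸ x)) ls) _))))))

  diffs-unit : ∀ ls → Desc ls → HR.diffs ls (λ _ → w) * HR.diffs ls (λ _ → w⁻¹) ≈ 1#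
  diffs-unit [] [] = *-identityˡ _
  diffs-unit (l ∷ ls) (lts ∷ d) = trans (solve 4 (λ a b c d → (a :* b) :* (c :* d) := (a :* c) :* (b :* d)) refl _ _ _ _)
    (trans (*-cong (go ls lts) (diffs-unit ls d)) (*-identityˡ _))
    where
    go : ∀ ls → All (_< l) ls → HR.prod (λ x → w (l ∸ x)) ls * HR.prod (λ x → w⁻¹ (l ∸ x)) ls ≈ 1#
    go [] [] = *-identityˡ _
    go (x ∷ ls) (lt ∷ lts) = trans (solve 4 (λ a b c d → (a :* b) :* (c :* d) := (a :* c) :* (b :* d)) refl _ _ _ _)
      (trans (*-cong (w-inv (l ∸ x) (ℕₚ.m<n⇒0<n∸m lt)) (go ls lts)) (*-identityˡ _))

  G-diag : ∀ ls → prodL G ls ≈ HR.diag ls (λ _ → w) * qz (HPℤ.diag ls γ)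
  G-diag [] = sym (trans (*-identityˡ _) qz-0)
  G-diag (l ∷ ls) = trans (*-congˡ (G-diag ls)) (trans (solve 4 (λ a b c d → (a :* b) :* (c :* d) := (a :* c) :* (b :* d)) refl _ _ _ _)
    (*-congˡ (sym (qz-+ (Γ l) (HPℤ.diag ls γ)))))

  -- `diag` comes from G and the inverse of `diffs` from κ. The hook formula, multiplicatively for
  -- `w` and additively for γ, turns the quotient into the product over all hooks.
  C-hooks : ∀ N p → length p ≤ N → dec p ≡ true → bal (lamN N p) ≡ true →
    C (lamN N p) ≈ qz (HPℤ.HP N p γ) * HR.HP N p (λ _ → w)
  C-hooks N p len d b = trans (reflexive (≡.cong (_▹ (prodL G ls * Cc ls)) b)) (unit-cancel (diffs-unit ls ds) (begin
    dw * (prodL G ls * Cc ls)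
      ≈⟨ solve 3 (λ d g c → d :* (g :* c) := g :* (c :* d)) refl _ _ _ ⟩
    prodL G ls * (Cc ls * dw)
      ≈⟨ *-cong (G-diag ls) (Cc-diffs ls ds) ⟩
    (HR.diag ls (λ _ → w) * qz (HPℤ.diag ls γ)) * qz (ℤ.- HPℤ.diffs ls γ)
      ≈⟨ trans (*-assoc _ _ _) (*-cong (sym (HR.hook-formula N p (λ _ → w) len d)) (trans (sym (qz-+ (HPℤ.diag ls γ) _)) (reflexive (≡.cong qz exponent)))) ⟩
    (HR.HP N p (λ _ → w) * dw) * qz (HPℤ.HP N p γ)
      ≈⟨ solve 3 (λ h d q → (h :* d) :* q := d :* (q :* h)) refl _ _ _ ⟩
    dw * (qz (HPℤ.HP N p γ) * HR.HP N p (λ _ → w)) ∎))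
    where
    ls = lamN N p
    ds = lamN-desc N p d
    dw = HR.diffs ls (λ _ → w)
    exponent : HPℤ.diag ls γ ℤ.+ ℤ.- HPℤ.diffs ls γ ≡ HPℤ.HP N p γ
    exponent = ≡.trans (≡.cong (ℤ._+ ℤ.- HPℤ.diffs ls γ) (≡.sym (HPℤ.hook-formula N p γ len d)))
      (≡.trans (ℤₚ.+-assoc (HPℤ.HP N p γ) _ _) (≡.trans (≡.cong (λ k → HPℤ.HP N p γ ℤ.+ k) (ℤₚ.+-inverseʳ (HPℤ.diffs ls γ))) (ℤₚ.+-identityʳ _)))

-- The statistic b in terms of hook lengths and λ + δ

module Z = Kit ℤₚ.+-*-commutativeRing

par-%2 : ∀ h → does (h ℕ.% 2 ℕ.≟ 0) ≡ par h
par-%2 zero = ≡.refl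
par-%2 (suc zero) = ≡.refl
par-%2 (suc (suc h)) = ≡.trans (≡.cong (λ r → does (r ℕ.≟ 0)) (≡.trans (≡.cong (ℕ._% 2) (ℕₚ.+-comm 2 h)) (DM.[m+n]%n≡m%n h 2)))
  (≡.trans (par-%2 h) (≡.sym (Boolₚ.not-involutive (par h))))

signPow-sgn : ∀ h → signPow (ℤ.+ h) ≡ sgn h
signPow-sgn h = ≡.cong (λ b → if b then ℤ.+ 1 else ℤ.- ℤ.+ 1) (par-%2 h)

pos-∸ : ∀ {m n} → n ≤ m → ℤ.+ (m ∸ n) ≡ ℤ.+ m ℤ.- ℤ.+ n
pos-∸ {m} {n} le = ≡.trans (≡.sym (ℤₚ.⊖-≥ le)) (≡.sym (ℤₚ.m-n≡m⊖n m n))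

sum-prod : ∀ {I : Set} {P : I → Set} {f g : I → ℤ} {xs} → All P xs → (∀ x → P x → f x ≡ g x) → sumℤ (map f xs) ≡ HPℤ.prod g xs
sum-prod [] e = ≡.refl
sum-prod (px ∷ ps) e = ≡.cong₂ ℤ._+_ (e _ px) (sum-prod ps e)

hook-int : ∀ r c i j → j ≤ r → i ≤ c → ℤ.+ r ℤ.+ ℤ.+ c ℤ.- ℤ.+ i ℤ.- ℤ.+ j ℤ.+ ℤ.+ 1 ≡ ℤ.+ ((r ∸ j) ℕ.+ (c ∸ i) ℕ.+ 1)
hook-int r c i j jr ic = ≡.sym (≡.trans (ℤₚ.pos-+ ((r ∸ j) ℕ.+ (c ∸ i)) 1) (≡.trans (≡.cong (ℤ._+ ℤ.+ 1) (≡.trans (ℤₚ.pos-+ (r ∸ j) (c ∸ i)) (≡.cong₂ ℤ._+_ (pos-∸ jr) (pos-∸ ic))))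
  (Z.solve 4 (λ r c i j → ((r Z.:- j) Z.:+ (c Z.:- i)) Z.:+ Z.:1 Z.:= r Z.:+ c Z.:- i Z.:- j Z.:+ Z.:1) ≡.refl (ℤ.+ r) (ℤ.+ c) (ℤ.+ i) (ℤ.+ j))))

bstat-cells : ∀ p → dec p ≡ true → bstat p ≡ HPℤ.cellProd p (λ i r h → sgn h ℤ.* (ℤ.+ r ℤ.- ℤ.+ i))
bstat-cells p d = sum-prod (cells-inside p) (λ { (suc i , j) (_ , l , u) →
  ≡.cong (ℤ._* (ℤ.+ row p (suc i) ℤ.- ℤ.+ suc i)) (≡.trans (≡.cong signPow (hook-int (row p (suc i)) (col p j) (suc i) j u (col-row p i j d l u))) (signPow-sgn (hook p (suc i , j)))) ; (zero , j) ((_ , ()) , _) })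

prod-+ : ∀ {I : Set} (f g : I → ℤ) xs → HPℤ.prod (λ x → f x ℤ.+ g x) xs ≡ HPℤ.prod f xs ℤ.+ HPℤ.prod g xs
prod-+ f g [] = ≡.refl
prod-+ f g (x ∷ xs) = ≡.trans (≡.cong (λ k → (f x ℤ.+ g x) ℤ.+ k) (prod-+ f g xs)) (HPℤ.exchange (f x) (g x) _ _)

prod-* : ∀ {I : Set} c (f : I → ℤ) xs → HPℤ.prod (λ x → c ℤ.* f x) xs ≡ c ℤ.* HPℤ.prod f xs
prod-* c f [] = ≡.sym (ℤₚ.*-zeroʳ c)
prod-* c f (x ∷ xs) = ≡.trans (≡.cong (λ k → c ℤ.* f x ℤ.+ k) (prod-* c f xs)) (≡.sym (ℤₚ.*-distribˡ-+ c (f x) _))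

HP-linear : ∀ N p (f g : ℕ → ℕ → ℤ) c → HPℤ.HP N p (λ l h → f l h ℤ.+ c ℤ.* g l h) ≡ HPℤ.HP N p f ℤ.+ c ℤ.* HPℤ.HP N p g
HP-linear zero p f g c = ≡.sym (≡.trans (ℤₚ.+-identityˡ _) (ℤₚ.*-zeroʳ c))
HP-linear (suc N) [] f g c = ≡.sym (≡.trans (ℤₚ.+-identityˡ _) (ℤₚ.*-zeroʳ c))
HP-linear (suc N) (a ∷ p) f g c = ≡.trans (≡.cong₂ ℤ._+_ (≡.trans (prod-+ _ _ (range1 a)) (≡.cong (λ k → HPℤ.rowProd a p (f (a ℕ.+ N)) ℤ.+ k) (prod-* c _ (range1 a)))) (HP-linear N p f g c))
  (Z.solve 5 (λ x y u v c → (x Z.:+ c Z.:* y) Z.:+ (u Z.:+ c Z.:* v) Z.:= (x Z.:+ u) Z.:+ c Z.:* (y Z.:+ v)) ≡.refl (HPℤ.rowProd a p (f (a ℕ.+ N))) (HPℤ.rowProd a p (g (a ℕ.+ N))) (HPℤ.HP N p f) (HPℤ.HP N p g) c)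

Ssgn : ℕ → ℤ
Ssgn l = HPℤ.prod sgn (range1 l)

Ssgn-value : ∀ l → Ssgn l ≡ (if par l then ℤ.+ 0 else ℤ.- ℤ.+ 1)
Ssgn-value zero = ≡.refl
Ssgn-value (suc l) = ≡.trans (HPℤ.range1-back sgn l) (≡.trans (≡.cong (ℤ._+ sgn (suc l)) (Ssgn-value l)) (go (par l)))
  where
  go : ∀ b → (if b then ℤ.+ 0 else ℤ.- ℤ.+ 1) ℤ.+ (if not b then ℤ.+ 1 else ℤ.- ℤ.+ 1) ≡ (if not b then ℤ.+ 0 else ℤ.- ℤ.+ 1)
  go true = ≡.refl
  go false = ≡.refl

sgn-∸ : ∀ {l x} → x ≤ l → sgn (l ∸ x) ≡ sgn l ℤ.* sgn x
sgn-∸ {l} {zero} z≤n = ≡.sym (ℤₚ.*-identityʳ _)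
sgn-∸ {suc l} {suc x} (s≤s le) = ≡.trans (sgn-∸ le) (go (par l) (par x))
  where
  s : Bool → ℤ
  s b = if b then ℤ.+ 1 else ℤ.- ℤ.+ 1
  go : ∀ a b → s a ℤ.* s b ≡ s (not a) ℤ.* s (not b)
  go true true = ≡.refl
  go true false = ≡.refl
  go false true = ≡.refl
  go false false = ≡.refl

module SignedHooks (Q : QRing) (ex : Exponents Q) where
  open FromExponents Q ex
  open Coeffs coeffs using (cnt; bal)

  wt : List ℕ → ℤ
  wt = HPℤ.prod sgn

  wt-cnt : ∀ ls → wt ls ≡ ℤ.+ cnt true ls ℤ.- ℤ.+ cnt false ls
  wt-cnt [] = ≡.refl
  wt-cnt (l ∷ ls) = ≡.trans (≡.cong₂ ℤ._+_ (s-δ (par l)) (wt-cnt ls))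
    (≡.trans (Z.solve 4 (λ a b c d → (a Z.:- b) Z.:+ (c Z.:- d) Z.:= (a Z.:+ c) Z.:- (b Z.:+ d)) ≡.refl (ℤ.+ δ (par l) true) (ℤ.+ δ (par l) false) (ℤ.+ cnt true ls) (ℤ.+ cnt false ls))
      (≡.cong₂ ℤ._-_ (≡.sym (ℤₚ.pos-+ (δ (par l) true) _)) (≡.sym (ℤₚ.pos-+ (δ (par l) false) _))))
    where
    s-δ : ∀ b → (if b then ℤ.+ 1 else ℤ.- ℤ.+ 1) ≡ ℤ.+ δ b true ℤ.- ℤ.+ δ b false
    s-δ true = ≡.refl
    s-δ false = ≡.refl

  wt-bal : ∀ ls → bal ls ≡ true → wt ls ≡ ℤ.+ 0
  wt-bal ls b = ≡.trans (wt-cnt ls) (≡.trans (≡.cong (λ k → ℤ.+ k ℤ.- ℤ.+ cnt false ls) (≡ᵇ-true (cnt true ls) (cnt false ls) b)) (ℤₚ.+-inverseʳ (ℤ.+ cnt false ls)))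

  bal-wt : ∀ ls → wt ls ≡ ℤ.+ 0 → bal ls ≡ true
  bal-wt ls e = true-≡ᵇ {cnt true ls} {cnt false ls} (ℤₚ.+-injective (Z.x-y≈0⇒x≈y (≡.trans (≡.sym (wt-cnt ls)) e)))

  -- Put s_i = (-1)^(l_i) and S = Σ s_i for N letters. The first sum is Σ (s_i - 1) / 2 = (S - N) /
  -- 2 and the second is Σ s_i s_j over i < j, that is (S² - N) / 2. The factor 2 avoids the
  -- fractions.
  twice : ∀ ls → Desc ls → ℤ.+ 2 ℤ.* (HPℤ.diag ls (λ _ → sgn) ℤ.- HPℤ.diffs ls (λ _ → sgn)) ≡ wt ls ℤ.- wt ls ℤ.* wt ls
  twice [] [] = ≡.refl
  twice (l ∷ ls) (lts ∷ ds) = ≡.trans (≡.cong₂ (λ x y → ℤ.+ 2 ℤ.* ((x ℤ.+ dg) ℤ.- (y ℤ.+ df))) (Ssgn-value l) (≡.trans (HPℤ.prod-cong lts (λ x lt → sgn-∸ (ℕₚ.<⇒≤ lt))) (prod-* (sgn l) sgn ls)))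
    (go (par l) (twice ls ds))
    where
    dg = HPℤ.diag ls (λ _ → sgn)
    df = HPℤ.diffs ls (λ _ → sgn)
    S = wt ls
    two : ∀ {m} → Z.Polynomial m
    two = Z.con (ℤ.+ 2)
    go : ∀ b → ℤ.+ 2 ℤ.* (dg ℤ.- df) ≡ S ℤ.- S ℤ.* S →
      ℤ.+ 2 ℤ.* (((if b then ℤ.+ 0 else ℤ.- ℤ.+ 1) ℤ.+ dg) ℤ.- ((if b then ℤ.+ 1 else ℤ.- ℤ.+ 1) ℤ.* S ℤ.+ df))
      ≡ ((if b then ℤ.+ 1 else ℤ.- ℤ.+ 1) ℤ.+ S) ℤ.- ((if b then ℤ.+ 1 else ℤ.- ℤ.+ 1) ℤ.+ S) ℤ.* ((if b then ℤ.+ 1 else ℤ.- ℤ.+ 1) ℤ.+ S)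
    go true ih = ≡.trans (Z.solve 3 (λ g f S → two Z.:* ((Z.:0 Z.:+ g) Z.:- (Z.:1 Z.:* S Z.:+ f)) Z.:= two Z.:* (g Z.:- f) Z.:- two Z.:* S) ≡.refl dg df S)
      (≡.trans (≡.cong (ℤ._- ℤ.+ 2 ℤ.* S) ih) (Z.solve 1 (λ S → (S Z.:- S Z.:* S) Z.:- two Z.:* S Z.:= (Z.:1 Z.:+ S) Z.:- (Z.:1 Z.:+ S) Z.:* (Z.:1 Z.:+ S)) ≡.refl S))
    go false ih = ≡.trans (Z.solve 3 (λ g f S → two Z.:* ((Z.:- Z.:1 Z.:+ g) Z.:- (Z.:- Z.:1 Z.:* S Z.:+ f)) Z.:= two Z.:* (g Z.:- f) Z.:+ (two Z.:* S Z.:- two)) ≡.refl dg df S)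
      (≡.trans (≡.cong (ℤ._+ (ℤ.+ 2 ℤ.* S ℤ.- ℤ.+ 2)) ih) (Z.solve 1 (λ S → (S Z.:- S Z.:* S) Z.:+ (two Z.:* S Z.:- two) Z.:= (Z.:- Z.:1 Z.:+ S) Z.:- (Z.:- Z.:1 Z.:+ S) Z.:* (Z.:- Z.:1 Z.:+ S)) ≡.refl S))

  -- This is why the shifts by N in the exponents of q cancel.
  signed-hooks : ∀ N p → length p ≤ N → dec p ≡ true → bal (lamN N p) ≡ true → HPℤ.HP N p (λ _ → sgn) ≡ ℤ.+ 0
  signed-hooks N p len d b = ℤₚ.*-cancelˡ-≡ (ℤ.+ 2) _ _ (≡.trans (≡.cong (λ k → ℤ.+ 2 ℤ.* k)
      (≡.trans (Z.solve 2 (λ h f → h Z.:= (h Z.:+ f) Z.:- f) ≡.refl (HPℤ.HP N p (λ _ → sgn)) (HPℤ.diffs ls (λ _ → sgn)))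
        (≡.cong (ℤ._- HPℤ.diffs ls (λ _ → sgn)) (HPℤ.hook-formula N p (λ _ → sgn) len d))))
      (≡.trans (twice ls (lamN-desc N p d)) (≡.trans (≡.cong (λ s → s ℤ.- s ℤ.* s) (wt-bal ls b)) ≡.refl)))
    where
    ls = lamN N p

  -- Since λ_i - i = l_i - N, replacing λ_i - i by l_i changes the sum by N times the signed number
  -- of hooks, which is zero.
  bstat-HP : ∀ N p → length p ≤ N → dec p ≡ true → bal (lamN N p) ≡ true → bstat p ≡ HPℤ.HP N p (λ l h → sgn h ℤ.* ℤ.+ l)
  bstat-HP N p len d b = ≡.trans (bstat-cells p d) (≡.trans
    (HPℤ.cellProd-HP N p (λ l h → sgn h ℤ.* ℤ.+ l ℤ.+ (ℤ.- ℤ.+ N) ℤ.* sgn h) (λ i r h → sgn h ℤ.* (ℤ.+ r ℤ.- ℤ.+ i)) len d (λ i r h le →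
      ≡.trans (Z.solve 4 (λ s r i n → s Z.:* (r Z.:- i) Z.:= s Z.:* ((r Z.:+ n) Z.:- i) Z.:+ Z.:- n Z.:* s) ≡.refl (sgn h) (ℤ.+ r) (ℤ.+ suc i) (ℤ.+ N))
        (≡.cong (λ k → sgn h ℤ.* k ℤ.+ (ℤ.- ℤ.+ N) ℤ.* sgn h) (≡.trans (≡.cong (ℤ._- ℤ.+ suc i) (≡.sym (ℤₚ.pos-+ r N))) (≡.sym (pos-∸ (ℕₚ.≤-trans (ℕₚ.≤-trans le len) (ℕₚ.m≤n+m N r))))))))
    (≡.trans (HP-linear N p _ (λ _ → sgn) (ℤ.- ℤ.+ N)) (≡.trans (≡.cong (λ k → HPℤ.HP N p (λ l h → sgn h ℤ.* ℤ.+ l) ℤ.+ (ℤ.- ℤ.+ N) ℤ.* k) (signed-hooks N p len d b))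
      (≡.trans (≡.cong (λ k → HPℤ.HP N p (λ l h → sgn h ℤ.* ℤ.+ l) ℤ.+ k) (ℤₚ.*-zeroʳ (ℤ.- ℤ.+ N))) (ℤₚ.+-identityʳ _)))))

module _ (Q : QRing) where
  open QRing Q

  private
    Γ-value : ∀ l (c : ℤ) → HPℤ.prod (λ h → sgn h ℤ.* c) (range1 l) ≡ c ℤ.* Ssgn l
    Γ-value l c = ≡.trans (HPℤ.prod-cong′ (λ h → ℤₚ.*-comm (sgn h) c) (range1 l)) (prod-* c sgn (range1 l))

    Ssgn-even : ∀ l → par l ≡ true → Ssgn l ≡ ℤ.+ 0
    Ssgn-even l e = ≡.trans (Ssgn-value l) (≡.cong (λ b → if b then ℤ.+ 0 else ℤ.- ℤ.+ 1) e)

    Ssgn-odd : ∀ l → par l ≡ false → Ssgn l ≡ ℤ.- ℤ.+ 1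
    Ssgn-odd l e = ≡.trans (Ssgn-value l) (≡.cong (λ b → if b then ℤ.+ 0 else ℤ.- ℤ.+ 1) e)

    q-diff : ∀ i h → qz i - qz (ℤ.+ h ℤ.+ i) ≈ qz i * D h
    q-diff i h = trans (+-congˡ (-‿cong (qz-+ (ℤ.+ h) i))) (solve 2 (λ a b → a :- b :* a := a :* (:1 :- b)) refl _ _)

  -- β is λ_i - i up to the shift by N. The requirement `z-diff` then determines z_l = q^(-l) up to
  -- an additive constant.
  exponents₁ : Exponents Q
  exponents₁ = record
    { β = λ l h → ℤ.+ l
    ; z = λ l → qz (ℤ.- ℤ.+ l)
    ; t = ℤ.- ℤ.+ 1
    ; z-suc = λ l → trans (reflexive (≡.cong qz (ℤₚ.neg-distrib-+ (ℤ.+ 1) (ℤ.+ l)))) (qz-+ (ℤ.- ℤ.+ 1) (ℤ.- ℤ.+ l))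
    ; z-diff = λ b h → trans (+-congˡ (-‿cong (reflexive (≡.cong qz (Z.trans (Z.solve 2 (λ b h → Z.:- b Z.:= h Z.:+ Z.:- (h Z.:+ b)) ≡.refl (ℤ.+ b) (ℤ.+ suc h)) ≡.refl)))))
        (q-diff (ℤ.- ℤ.+ (suc h ℕ.+ b)) (suc h))
    ; Γ-even = λ l e → ≡.trans (Γ-value (suc l) (ℤ.+ suc l)) (≡.trans (≡.cong (λ k → ℤ.+ suc l ℤ.* k) (Ssgn-odd (suc l) (≡.cong not e)))
        (≡.trans (Z.solve 1 (λ x → x Z.:* (Z.:- Z.:1) Z.:= Z.:0 Z.:- x) ≡.refl (ℤ.+ suc l))
          (≡.cong (ℤ._- ℤ.+ suc l) (≡.sym (≡.trans (Γ-value l (ℤ.+ l)) (≡.trans (≡.cong (λ k → ℤ.+ l ℤ.* k) (Ssgn-even l e)) (ℤₚ.*-zeroʳ (ℤ.+ l))))))))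
    ; Γ-odd = λ l e → ≡.trans (≡.cong (λ k → ℤ.- ℤ.+ 1 ℤ.+ k) (≡.trans (Γ-value l (ℤ.+ l)) (≡.cong (λ k → ℤ.+ l ℤ.* k) (Ssgn-odd l e))))
        (≡.trans (Z.solve 1 (λ x → Z.:- Z.:1 Z.:+ x Z.:* (Z.:- Z.:1) Z.:= Z.:0 Z.:- (Z.:1 Z.:+ x)) ≡.refl (ℤ.+ l))
          (≡.cong (ℤ._- ℤ.+ suc l) (≡.sym (≡.trans (Γ-value (suc l) (ℤ.+ suc l)) (≡.trans (≡.cong (λ k → ℤ.+ suc l ℤ.* k) (Ssgn-even (suc l) (≡.cong not e))) (ℤₚ.*-zeroʳ (ℤ.+ suc l))))))) }

  -- For the conjugate the weight is λ'_j - j, which is h - l up to the shift by N - 1. The sign in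
  -- z is forced by q^(l-h) (1 - q^h) = q^(l-h) - q^l.
  exponents₂ : Exponents Q
  exponents₂ = record
    { β = λ l h → ℤ.+ h ℤ.- ℤ.+ l
    ; z = λ l → - qz (ℤ.+ l)
    ; t = ℤ.+ 1
    ; z-suc = λ l → trans (-‿cong (qz-+ (ℤ.+ 1) (ℤ.+ l))) (-‿distribʳ-* _ _)
    ; z-diff = λ b h → trans (solve 2 (λ x y → :- x :- :- y := y :- x) refl _ _) (trans (q-diff (ℤ.+ b) (suc h))
        (*-congʳ (reflexive (≡.cong qz (Z.solve 2 (λ b h → b Z.:= Z.:- (h Z.:- (h Z.:+ b))) ≡.refl (ℤ.+ b) (ℤ.+ suc h))))))
    ; Γ-even = λ l e → ≡.trans (Γ₂-suc l) (≡.cong (λ k → Γ₂ l ℤ.- k) (≡.trans (Ssgn-even l e) (≡.sym (ℤₚ.+-inverseʳ (ℤ.+ suc l)))))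
    ; Γ-odd = λ l e → ≡.trans (ℤₚ.+-comm (ℤ.+ 1) (Γ₂ l)) (≡.trans (≡.trans (≡.cong (λ k → Γ₂ l ℤ.- k) (≡.sym (Ssgn-odd l e))) (≡.sym (Γ₂-suc l)))
        (≡.trans (≡.sym (ℤₚ.+-identityʳ (Γ₂ (suc l)))) (≡.cong (λ k → Γ₂ (suc l) ℤ.- k) (≡.sym (ℤₚ.+-inverseʳ (ℤ.+ suc l)))))) }
    where
    Γ₂ : ℕ → ℤ
    Γ₂ l = HPℤ.prod (λ h → sgn h ℤ.* (ℤ.+ h ℤ.- ℤ.+ l)) (range1 l)
    -- Raising l lowers each h - l by one, and the additional summand has h - l = 0.
    Γ₂-suc : ∀ l → Γ₂ (suc l) ≡ Γ₂ l ℤ.- Ssgn l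
    Γ₂-suc l = ≡.trans (HPℤ.range1-back _ l) (≡.trans (≡.cong₂ ℤ._+_
        (≡.trans (HPℤ.prod-cong′ (λ h → Z.solve 3 (λ s h l → s Z.:* (h Z.:- (Z.:1 Z.:+ l)) Z.:= s Z.:* (h Z.:- l) Z.:+ Z.:- Z.:1 Z.:* s) ≡.refl (sgn h) (ℤ.+ h) (ℤ.+ l)) (range1 l))
          (≡.trans (prod-+ _ _ (range1 l)) (≡.cong (λ k → Γ₂ l ℤ.+ k) (prod-* (ℤ.- ℤ.+ 1) sgn (range1 l)))))
        (≡.trans (≡.cong (λ k → sgn (suc l) ℤ.* k) (ℤₚ.+-inverseʳ (ℤ.+ suc l))) (ℤₚ.*-zeroʳ (sgn (suc l)))))
      (Z.solve 2 (λ g s → (g Z.:+ Z.:- Z.:1 Z.:* s) Z.:+ Z.:0 Z.:= g Z.:- s) ≡.refl (Γ₂ l) (Ssgn l)))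

-- The conjugate partition

row-col : ∀ p i j → dec p ≡ true → suc i ≤ col p j → j ≤ row p (suc i)
row-col (a ∷ p) i j d le with j ℕ.≤? a
row-col (a ∷ p) zero j d le | yes ja = ja
row-col (a ∷ p) (suc i) j d le | yes ja = row-col p i j (dec-tail p d) (ℕₚ.≤-pred (≡.subst (2 ℕ.+ i ≤_) (col-∷-≤ a p j ja) le))
row-col (a ∷ p) i j d le | no ja = ⊥-elim (ℕₚ.<⇒≱ (ℕₚ.n<1+n i) (ℕₚ.≤-trans le (ℕₚ.≤-trans (ℕₚ.≤-reflexive (≡.trans (col-∷-> a p j (ℕₚ.≰⇒> ja)) (col-beyond a p j d (ℕₚ.≰⇒> ja)))) z≤n)))

row-map : ∀ (g : ℕ → ℕ) a i → 1 ≤ i → i ≤ a → row (map g (range1 a)) i ≡ g i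
row-map g (suc a) (suc i) _ (s≤s le) = ≡.trans (≡.cong (λ l → row (map g l) (suc i)) (range1-suc a))
  (go i le)
  where
  go : ∀ i → i ≤ a → row (g 1 ∷ map g (map suc (range1 a))) (suc i) ≡ g (suc i)
  go zero le = ≡.refl
  go (suc i) le = ≡.trans (≡.cong (λ l → row l (suc i)) (≡.sym (Lₚ.map-∘ (range1 a)))) (row-map (g ∘ suc) a (suc i) (s≤s z≤n) le)

length-range1 : ∀ a → length (range1 a) ≡ a
length-range1 a = ≡.trans (Lₚ.length-map suc (upTo a)) (Lₚ.length-upTo a)

conj-row : ∀ p i → 1 ≤ i → i ≤ row p 1 → row (conj p) i ≡ col p i
conj-row p = row-map (col p) (row p 1)

conj-length : ∀ p → length (conj p) ≡ row p 1
conj-length p = ≡.trans (Lₚ.length-map (col p) (range1 (row p 1))) (length-range1 (row p 1))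

count : (ℕ → Bool) → List ℕ → ℕ
count f [] = 0
count f (x ∷ xs) = if f x then suc (count f xs) else count f xs

filter-count : ∀ j (g : ℕ → ℕ) xs → length (L.filter (λ a → j ℕ.≤? a) (map g xs)) ≡ count (λ i → j ℕ.≤ᵇ g i) xs
filter-count j g [] = ≡.refl
filter-count j g (x ∷ xs) with j ℕ.≤ᵇ g x
... | true = ≡.cong suc (filter-count j g xs)
... | false = filter-count j g xs

count-cong : ∀ {P : ℕ → Set} {f g : ℕ → Bool} {xs} → All P xs → (∀ x → P x → f x ≡ g x) → count f xs ≡ count g xs
count-cong [] e = ≡.refl
count-cong {f = f} {g} {x ∷ xs} (px ∷ ps) e = ≡.cong₂ (λ b k → if b then suc k else k) (e x px) (count-cong ps e)

count-map : ∀ f xs → count f (map suc xs) ≡ count (f ∘ suc) xs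
count-map f [] = ≡.refl
count-map f (x ∷ xs) = ≡.cong (λ k → if f (suc x) then suc k else k) (count-map f xs)

count-range1 : ∀ a r → r ≤ a → count (λ i → i ℕ.≤ᵇ r) (range1 a) ≡ r
count-range1 a zero le = ≡.trans (count-cong (range1-letters a) (λ { (suc i) _ → ≡.refl })) (zero-count (range1 a))
  where
  zero-count : ∀ xs → count (λ _ → false) xs ≡ 0
  zero-count [] = ≡.refl
  zero-count (x ∷ xs) = zero-count xs
count-range1 (suc a) (suc r) (s≤s le) = ≡.trans (≡.cong (count (λ i → i ℕ.≤ᵇ suc r)) (range1-suc a))
  (≡.cong suc (≡.trans (count-map (λ i → i ℕ.≤ᵇ suc r) (range1 a)) (≡.trans (count-cong (range1-letters a) (λ { (suc i) _ → ≡.refl })) (count-range1 a r le))))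

row-≤-first : ∀ p i → dec p ≡ true → row p i ≤ row p 1
row-≤-first [] i d = z≤n
row-≤-first (a ∷ p) zero d = z≤n
row-≤-first (a ∷ p) (suc zero) d = ℕₚ.≤-refl
row-≤-first (a ∷ p) (suc (suc i)) d = row-bounded a p (suc i) d

conj-col : ∀ p j → dec p ≡ true → col (conj p) (suc j) ≡ row p (suc j)
conj-col p j d = ≡.trans (filter-count (suc j) (col p) (range1 (row p 1))) (≡.trans
  (count-cong (range1-letters (row p 1)) (λ { (suc i) (l , u) → ≤ᵇ-iff {suc j} {col p (suc i)} {suc i} {row p (suc j)} (row-col p j (suc i) d) (col-row p j (suc i) d l) }))
  (count-range1 (row p 1) (row p (suc j)) (row-≤-first p (suc j) d)))

sum-concatMap : ∀ {I J : Set} (g : J → ℤ) (f : I → List J) xs → HPℤ.prod g (concatMap f xs) ≡ HPℤ.prod (λ x → HPℤ.prod g (f x)) xs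
sum-concatMap g f [] = ≡.refl
sum-concatMap g f (x ∷ xs) = ≡.trans (HPℤ.prod-++ g (f x) _) (≡.cong (λ k → HPℤ.prod g (f x) ℤ.+ k) (sum-concatMap g f xs))

-- The same cells by columns and by rows. In the induction the first row supplies the top cells of
-- the columns i ≤ b.
transpose-sum : ∀ a p (F : ℕ → ℕ → ℤ) → decFrom a p ≡ true →
  HPℤ.prod (λ i → HPℤ.prod (F i) (range1 (col p i))) (range1 a) ≡ HPℤ.prod (λ c → F (proj₂ c) (proj₁ c)) (cells p)
transpose-sum a [] F d = zeros (range1 a)
  where
  zeros : ∀ (xs : List ℕ) → HPℤ.prod (λ _ → ℤ.+ 0) xs ≡ ℤ.+ 0
  zeros [] = ≡.refl
  zeros (x ∷ xs) = ≡.trans (ℤₚ.+-identityˡ _) (zeros xs)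
transpose-sum a (b ∷ p) F d = ≡.trans (HPℤ.prod-cong (range1-letters a) (λ i (l , u) → split i))
  (≡.trans (prod-+ _ _ (range1 a)) (≡.trans (≡.cong₂ ℤ._+_ (first a b ba) (transpose-sum a p (λ i j → F i (suc j)) (weaken p d′)))
    (≡.sym (≡.trans (≡.cong (HPℤ.prod _) (cells-∷ b p)) (≡.trans (HPℤ.prod-++ flipF (cellRow 1 b) _) (≡.cong₂ ℤ._+_ (HPℤ.prod-map flipF (λ (j : ℕ) → (1 , j)) (range1 b)) (HPℤ.prod-map flipF shiftCell (cells p))))))))
  where
  flipF : Cell → ℤ
  flipF c = F (proj₂ c) (proj₁ c)
  ba : b ≤ a
  ba = ≤ᵇ-true b a (proj₁ (∧-true (b ℕ.≤ᵇ a) _ d))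
  d′ : decFrom b p ≡ true
  d′ = proj₂ (∧-true (b ℕ.≤ᵇ a) _ d)
  weaken : ∀ p → decFrom b p ≡ true → decFrom a p ≡ true
  weaken [] d = ≡.refl
  weaken (c ∷ p) d = let (cb , d″) = ∧-true (c ℕ.≤ᵇ b) _ d in ≡.cong₂ _∧_ (true-≤ᵇ {c} {a} (ℕₚ.≤-trans (≤ᵇ-true c b cb) ba)) d″
  split : ∀ i → HPℤ.prod (F i) (range1 (col (b ∷ p) i)) ≡ (if i ℕ.≤ᵇ b then F i 1 else ℤ.+ 0) ℤ.+ HPℤ.prod (λ j → F i (suc j)) (range1 (col p i))
  split i with i ℕ.≤ᵇ b in e
  ... | true = HPℤ.range1-front (F i) (col p i)
  ... | false = ≡.trans (≡.cong (HPℤ.prod (F i) ∘ range1) beyond) (≡.sym (≡.trans (ℤₚ.+-identityˡ _) (≡.cong (HPℤ.prod (λ j → F i (suc j)) ∘ range1) beyond)))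
    where
    beyond : col p i ≡ 0
    beyond = col-beyond b p i d′ (ℕₚ.≰⇒> (λ le → absurd (≡.trans (≡.sym (true-≤ᵇ le)) e)))
      where
      absurd : true ≡ false → ⊥
      absurd ()
  first : ∀ a b → b ≤ a → HPℤ.prod (λ i → if i ℕ.≤ᵇ b then F i 1 else ℤ.+ 0) (range1 a) ≡ HPℤ.prod (λ i → F i 1) (range1 b)
  first a b le = go (λ i → F i 1) a b le
    where
    zeros : ∀ (xs : List ℕ) → HPℤ.prod (λ _ → ℤ.+ 0) xs ≡ ℤ.+ 0
    zeros [] = ≡.refl
    zeros (x ∷ xs) = ≡.trans (ℤₚ.+-identityˡ _) (zeros xs)
    go : ∀ (G : ℕ → ℤ) a b → b ≤ a → HPℤ.prod (λ i → if i ℕ.≤ᵇ b then G i else ℤ.+ 0) (range1 a) ≡ HPℤ.prod G (range1 b)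
    go G a zero le = ≡.trans (HPℤ.prod-cong (range1-letters a) (λ { (suc i) _ → ≡.refl })) (zeros (range1 a))
    go G (suc a) (suc b) (s≤s le) = ≡.trans (HPℤ.range1-front (λ i → if i ℕ.≤ᵇ suc b then G i else ℤ.+ 0) a) (≡.trans (≡.cong (λ k → G 1 ℤ.+ k)
      (≡.trans (HPℤ.prod-cong {h = λ i → if i ℕ.≤ᵇ b then G (suc i) else ℤ.+ 0} (range1-letters a) (λ { (suc i) _ → ≡.refl })) (go (G ∘ suc) a b le))) (≡.sym (HPℤ.range1-front G b)))

-- Conjugation preserves hook lengths, and a hook of length h at (i, j) has λ'_j - j = h - 1 - (λ_i
-- - i).
bstat-conj-cells : ∀ p → dec p ≡ true → bstat (conj p) ≡ HPℤ.cellProd p (λ i r h → sgn h ℤ.* (ℤ.+ h ℤ.- ℤ.+ 1 ℤ.- (ℤ.+ r ℤ.- ℤ.+ i)))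
bstat-conj-cells p d = ≡.trans (sum-prod {P = λ _ → ⊤} {g = term} (All.universal (λ _ → tt) (cells (conj p))) (λ { (i , j) _ → ≡.refl }))
  (≡.trans (sum-concatMap term (λ i → cellRow i (row (conj p) i)) (range1 (length (conj p))))
  (≡.trans (≡.cong (HPℤ.prod (λ i → HPℤ.prod term (cellRow i (row (conj p) i))) ∘ range1) (conj-length p))
  (≡.trans (HPℤ.prod-cong (range1-letters (row p 1)) (λ { (suc i) (l , u) → ≡.trans (HPℤ.prod-map term (λ j → (suc i , j)) (range1 (row (conj p) (suc i))))
      (≡.trans (≡.cong (HPℤ.prod (λ j → term (suc i , j)) ∘ range1) (conj-row p (suc i) l u))
        (HPℤ.prod-cong (range1-letters (col p (suc i))) (λ { (suc j) (l′ , u′) → term-eq i j u u′ }))) }))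
  (≡.trans (transpose-sum (row p 1) p F (first-dec p d))
    (HPℤ.prod-cong (cells-inside p) (λ { (suc i , suc j) (_ , l , u) → ≡.cong (λ k → sgn (hook p (suc i , suc j)) ℤ.* k) (rewrite-col i j l u) ; (zero , j) ((_ , ()) , _) ; (suc i , zero) (_ , () , _) }))))))
  where
  term : Cell → ℤ
  term (i , j) = signPow (ℤ.+ row (conj p) i ℤ.+ ℤ.+ col (conj p) j ℤ.- ℤ.+ i ℤ.- ℤ.+ j ℤ.+ ℤ.+ 1) ℤ.* (ℤ.+ row (conj p) i ℤ.- ℤ.+ i)
  F : ℕ → ℕ → ℤ
  F i j = sgn (hook p (j , i)) ℤ.* (ℤ.+ col p i ℤ.- ℤ.+ i)
  first-dec : ∀ p → dec p ≡ true → decFrom (row p 1) p ≡ true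
  first-dec [] d = ≡.refl
  first-dec (a ∷ p) d = ≡.cong₂ _∧_ (true-≤ᵇ {a} {a} ℕₚ.≤-refl) d
  term-eq : ∀ i j → suc i ≤ row p 1 → suc j ≤ col p (suc i) → term (suc i , suc j) ≡ F (suc i) (suc j)
  term-eq i j u u′ = ≡.trans (≡.cong₂ (λ r c → signPow (ℤ.+ r ℤ.+ ℤ.+ c ℤ.- ℤ.+ suc i ℤ.- ℤ.+ suc j ℤ.+ ℤ.+ 1) ℤ.* (ℤ.+ r ℤ.- ℤ.+ suc i)) (conj-row p (suc i) (s≤s z≤n) u) (conj-col p j d))
    (≡.cong (ℤ._* (ℤ.+ col p (suc i) ℤ.- ℤ.+ suc i)) (≡.trans (≡.cong signPow (≡.trans
      (Z.solve 4 (λ c r i j → c Z.:+ r Z.:- i Z.:- j Z.:+ Z.:1 Z.:= r Z.:+ c Z.:- j Z.:- i Z.:+ Z.:1) ≡.refl (ℤ.+ col p (suc i)) (ℤ.+ row p (suc j)) (ℤ.+ suc i) (ℤ.+ suc j))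
      (hook-int (row p (suc j)) (col p (suc i)) (suc j) (suc i) (row-col p j (suc i) d u′) u′))) (signPow-sgn (hook p (suc j , suc i)))))
  rewrite-col : ∀ i j → 1 ≤ suc j → suc j ≤ row p (suc i) → ℤ.+ col p (suc j) ℤ.- ℤ.+ suc j ≡ ℤ.+ hook p (suc i , suc j) ℤ.- ℤ.+ 1 ℤ.- (ℤ.+ row p (suc i) ℤ.- ℤ.+ suc i)
  rewrite-col i j l u = ≡.trans (Z.solve 4 (λ c r i j → c Z.:- j Z.:= ((r Z.:+ c Z.:- i Z.:- j Z.:+ Z.:1) Z.:- Z.:1) Z.:- (r Z.:- i)) ≡.refl (ℤ.+ col p (suc j)) (ℤ.+ row p (suc i)) (ℤ.+ suc i) (ℤ.+ suc j))
    (≡.cong (λ k → k ℤ.- ℤ.+ 1 ℤ.- (ℤ.+ row p (suc i) ℤ.- ℤ.+ suc i)) (hook-int (row p (suc i)) (col p (suc j)) (suc i) (suc j) u (col-row p i (suc j) d l u)))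

module _ (Q : QRing) (ex : Exponents Q) where
  open FromExponents Q ex
  open Coeffs coeffs using (bal)
  open SignedHooks Q ex

  bstat-conj-HP : ∀ N p → length p ≤ N → dec p ≡ true → bal (lamN N p) ≡ true →
    bstat (conj p) ≡ HPℤ.HP N p (λ l h → sgn h ℤ.* (ℤ.+ h ℤ.- ℤ.+ l))
  bstat-conj-HP N p len d b = ≡.trans (bstat-conj-cells p d) (≡.trans
    (HPℤ.cellProd-HP N p (λ l h → sgn h ℤ.* (ℤ.+ h ℤ.- ℤ.+ l) ℤ.+ (ℤ.+ N ℤ.- ℤ.+ 1) ℤ.* sgn h) (λ i r h → sgn h ℤ.* (ℤ.+ h ℤ.- ℤ.+ 1 ℤ.- (ℤ.+ r ℤ.- ℤ.+ i))) len d (λ i r h le →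
      ≡.trans (Z.solve 5 (λ s h r i n → s Z.:* (h Z.:- Z.:1 Z.:- (r Z.:- i)) Z.:= s Z.:* (h Z.:- ((r Z.:+ n) Z.:- i)) Z.:+ (n Z.:- Z.:1) Z.:* s) ≡.refl (sgn h) (ℤ.+ h) (ℤ.+ r) (ℤ.+ suc i) (ℤ.+ N))
        (≡.cong (λ k → sgn h ℤ.* (ℤ.+ h ℤ.- k) ℤ.+ (ℤ.+ N ℤ.- ℤ.+ 1) ℤ.* sgn h) (≡.trans (≡.cong (ℤ._- ℤ.+ suc i) (≡.sym (ℤₚ.pos-+ r N))) (≡.sym (pos-∸ (ℕₚ.≤-trans (ℕₚ.≤-trans le len) (ℕₚ.m≤n+m N r))))))))
    (≡.trans (HP-linear N p _ (λ _ → sgn) (ℤ.+ N ℤ.- ℤ.+ 1)) (≡.trans (≡.cong (λ k → HPℤ.HP N p (λ l h → sgn h ℤ.* (ℤ.+ h ℤ.- ℤ.+ l)) ℤ.+ (ℤ.+ N ℤ.- ℤ.+ 1) ℤ.* k) (signed-hooks N p len d b))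
      (≡.trans (≡.cong (λ k → HPℤ.HP N p (λ l h → sgn h ℤ.* (ℤ.+ h ℤ.- ℤ.+ l)) ℤ.+ k) (ℤₚ.*-zeroʳ (ℤ.+ N ℤ.- ℤ.+ 1))) (ℤₚ.+-identityʳ _)))))

-- Domino tilings and the chessboard colouring

prod-↭ : ∀ {I : Set} (g : I → ℤ) {xs ys} → xs ↭ ys → HPℤ.prod g xs ≡ HPℤ.prod g ys
prod-↭ g Perm.refl = ≡.refl
prod-↭ g (Perm.prep x p) = ≡.cong (λ k → g x ℤ.+ k) (prod-↭ g p)
prod-↭ g (Perm.swap x y p) = ≡.trans (≡.cong (λ k → g x ℤ.+ (g y ℤ.+ k)) (prod-↭ g p))
  (Z.solve 3 (λ x y k → x Z.:+ (y Z.:+ k) Z.:= y Z.:+ (x Z.:+ k)) ≡.refl (g x) (g y) _)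
prod-↭ g (Perm.trans p r) = ≡.trans (prod-↭ g p) (prod-↭ g r)

chess : Cell → ℤ
chess (i , j) = sgn (i ℕ.+ j)

sgn-suc : ∀ n → sgn (suc n) ≡ ℤ.- sgn n
sgn-suc n with par n
... | true = ≡.refl
... | false = ≡.refl

colour : List ℕ → ℤ
colour p = HPℤ.prod chess (cells p)

domino-chess : ∀ d → HPℤ.prod chess (dominoCells d) ≡ ℤ.+ 0
domino-chess (horiz i j) = ≡.trans (≡.cong (λ k → sgn (i ℕ.+ j) ℤ.+ (k ℤ.+ ℤ.+ 0)) (≡.trans (≡.cong sgn (ℕₚ.+-suc i j)) (sgn-suc (i ℕ.+ j))))
  (Z.solve 1 (λ x → x Z.:+ (Z.:- x Z.:+ Z.:0) Z.:= Z.:0) ≡.refl (sgn (i ℕ.+ j)))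
domino-chess (vert i j) = ≡.trans (≡.cong (λ k → sgn (i ℕ.+ j) ℤ.+ (k ℤ.+ ℤ.+ 0)) (sgn-suc (i ℕ.+ j)))
  (Z.solve 1 (λ x → x Z.:+ (Z.:- x Z.:+ Z.:0) Z.:= Z.:0) ≡.refl (sgn (i ℕ.+ j)))

tileable⇒colour : ∀ p → Tileable p → colour p ≡ ℤ.+ 0
tileable⇒colour p (ds , perm) = ≡.trans (≡.sym (prod-↭ chess perm)) (go ds)
  where
  go : ∀ ds → HPℤ.prod chess (concatMap dominoCells ds) ≡ ℤ.+ 0
  go [] = ≡.refl
  go (d ∷ ds) = ≡.trans (HPℤ.prod-++ chess (dominoCells d) _) (≡.cong₂ ℤ._+_ (domino-chess d) (go ds))

colour-∷ : ∀ a p → colour (a ∷ p) ≡ ℤ.- Ssgn a ℤ.- colour p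
colour-∷ a p = ≡.trans (≡.cong (HPℤ.prod chess) (cells-∷ a p)) (≡.trans (HPℤ.prod-++ chess (cellRow 1 a) _) (≡.cong₂ ℤ._+_
  (≡.trans (HPℤ.prod-map chess (λ (j : ℕ) → (1 , j)) (range1 a)) (neg sgn-suc (range1 a)))
  (≡.trans (HPℤ.prod-map chess shiftCell (cells p)) (neg (λ { (i , j) → sgn-suc (i ℕ.+ j) }) (cells p)))))
  where
  neg : ∀ {I : Set} {f g : I → ℤ} → (∀ x → f x ≡ ℤ.- g x) → ∀ xs → HPℤ.prod f xs ≡ ℤ.- HPℤ.prod g xs
  neg e [] = ≡.refl
  neg {g = g} e (x ∷ xs) = ≡.trans (≡.cong₂ ℤ._+_ (e x) (neg e xs)) (≡.sym (ℤₚ.neg-distrib-+ (g x) _))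

sgn-+ : ∀ a b → sgn (a ℕ.+ b) ≡ sgn a ℤ.* sgn b
sgn-+ zero b = ≡.sym (ℤₚ.*-identityˡ (sgn b))
sgn-+ (suc a) b = ≡.trans (sgn-suc (a ℕ.+ b)) (≡.trans (≡.cong ℤ.-_ (sgn-+ a b)) (≡.trans (ℤₚ.neg-distribˡ-* (sgn a) (sgn b)) (≡.cong (ℤ._* sgn b) (≡.sym (sgn-suc a)))))

-- The contribution of a row of length a to the colouring depends only on the parity of a, and
-- (-1)^a = 1 + 2 `Ssgn a` links it to the sign of the corresponding l_i.
wt-colour : ∀ N p → length p ≤ N → HPℤ.prod sgn (lamN N p) ≡ (if par N then ℤ.+ 0 else ℤ.+ 1) ℤ.+ ℤ.+ 2 ℤ.* (sgn N ℤ.* colour p)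
wt-colour zero [] len = ≡.refl
wt-colour (suc N) [] len = ≡.trans (≡.cong (λ k → sgn N ℤ.+ k) (wt-colour N [] z≤n)) (go (par N))
  where
  go : ∀ b → (if b then ℤ.+ 1 else ℤ.- ℤ.+ 1) ℤ.+ ((if b then ℤ.+ 0 else ℤ.+ 1) ℤ.+ ℤ.+ 2 ℤ.* ((if b then ℤ.+ 1 else ℤ.- ℤ.+ 1) ℤ.* ℤ.+ 0))
    ≡ (if not b then ℤ.+ 0 else ℤ.+ 1) ℤ.+ ℤ.+ 2 ℤ.* ((if not b then ℤ.+ 1 else ℤ.- ℤ.+ 1) ℤ.* ℤ.+ 0)
  go true = ≡.refl
  go false = ≡.refl
wt-colour (suc N) (a ∷ p) (s≤s len) = ≡.trans (≡.cong₂ ℤ._+_ (≡.trans (sgn-+ a N) (≡.cong (ℤ._* sgn N) (sgn-Ssgn a))) (wt-colour N p len))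
  (≡.trans (go (par N)) (≡.cong (λ k → (if not (par N) then ℤ.+ 0 else ℤ.+ 1) ℤ.+ ℤ.+ 2 ℤ.* (sgn (suc N) ℤ.* k)) (≡.sym (colour-∷ a p))))
  where
  two : ∀ {m} → Z.Polynomial m
  two = Z.con (ℤ.+ 2)
  sgn-Ssgn : ∀ a → sgn a ≡ ℤ.+ 1 ℤ.+ ℤ.+ 2 ℤ.* Ssgn a
  sgn-Ssgn a = ≡.sym (≡.trans (≡.cong (λ k → ℤ.+ 1 ℤ.+ ℤ.+ 2 ℤ.* k) (Ssgn-value a)) (bool (par a)))
    where
    bool : ∀ b → ℤ.+ 1 ℤ.+ ℤ.+ 2 ℤ.* (if b then ℤ.+ 0 else ℤ.- ℤ.+ 1) ≡ (if b then ℤ.+ 1 else ℤ.- ℤ.+ 1)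
    bool true = ≡.refl
    bool false = ≡.refl
  go : ∀ b → (ℤ.+ 1 ℤ.+ ℤ.+ 2 ℤ.* Ssgn a) ℤ.* (if b then ℤ.+ 1 else ℤ.- ℤ.+ 1) ℤ.+ ((if b then ℤ.+ 0 else ℤ.+ 1) ℤ.+ ℤ.+ 2 ℤ.* ((if b then ℤ.+ 1 else ℤ.- ℤ.+ 1) ℤ.* colour p))
    ≡ (if not b then ℤ.+ 0 else ℤ.+ 1) ℤ.+ ℤ.+ 2 ℤ.* ((if not b then ℤ.+ 1 else ℤ.- ℤ.+ 1) ℤ.* (ℤ.- Ssgn a ℤ.- colour p))
  go true = Z.solve 2 (λ s c → (Z.:1 Z.:+ two Z.:* s) Z.:* Z.:1 Z.:+ (Z.:0 Z.:+ two Z.:* (Z.:1 Z.:* c)) Z.:= Z.:1 Z.:+ two Z.:* (Z.:- Z.:1 Z.:* (Z.:- s Z.:- c))) ≡.refl (Ssgn a) (colour p)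
  go false = Z.solve 2 (λ s c → (Z.:1 Z.:+ two Z.:* s) Z.:* (Z.:- Z.:1) Z.:+ (Z.:1 Z.:+ two Z.:* (Z.:- Z.:1 Z.:* c)) Z.:= Z.:0 Z.:+ two Z.:* (Z.:1 Z.:* (Z.:- s Z.:- c))) ≡.refl (Ssgn a) (colour p)

-- Removing rim dominoes from a shape ends in a staircase k, k - 1, …, 1, followed by zeros.
data Stair : ℕ → List ℕ → Set where
  nil  : Stair 0 []
  trail : ∀ {p} → Stair 0 p → Stair 0 (0 ∷ p)
  stair : ∀ {k p} → Stair k p → Stair (suc k) (suc k ∷ p)

-- `rest-dec` is asked for every bound a, so that a removal remains possible below a further row
-- (`remove-below`).
record Removal (p : List ℕ) : Set where
  field
    rest : List ℕ
    domino : Domino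
    perm : dominoCells domino ++ cells rest ↭ cells p
    rest-dec : ∀ a → decFrom a p ≡ true → decFrom a rest ≡ true
    smaller : tot p ≡ 2 ℕ.+ tot rest

shiftDomino : Domino → Domino
shiftDomino (horiz i j) = horiz (suc i) j
shiftDomino (vert i j) = vert (suc i) j

shiftDomino-cells : ∀ d → dominoCells (shiftDomino d) ≡ map shiftCell (dominoCells d)
shiftDomino-cells (horiz i j) = ≡.refl
shiftDomino-cells (vert i j) = ≡.refl

cellRow-suc : ∀ i a → cellRow i (suc a) ≡ cellRow i a ++ (i , suc a) ∷ []
cellRow-suc i a = ≡.trans (≡.cong (map (λ j → (i , j))) (range1-∷ʳ a)) (Lₚ.map-++ (λ j → (i , j)) (range1 a) (suc a ∷ []))

stair-≤ : ∀ a {k p} → Stair k p → decFrom a p ≡ true → k ≤ a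
stair-≤ a nil d = z≤n
stair-≤ a (trail s) d = z≤n
stair-≤ a (stair {k} s) d = ≤ᵇ-true (suc k) a (proj₁ (∧-true (suc k ℕ.≤ᵇ a) _ d))

stair-dec : ∀ {k p} → Stair k p → decFrom k p ≡ true
stair-dec nil = ≡.refl
stair-dec (trail s) = stair-dec s
stair-dec (stair {k} {p} s) = ≡.cong₂ _∧_ (true-≤ᵇ {suc k} {suc k} ℕₚ.≤-refl) (weaken p (stair-dec s))
  where
  weaken : ∀ p → decFrom k p ≡ true → decFrom (suc k) p ≡ true
  weaken [] d = ≡.refl
  weaken (c ∷ p) d = let (ck , d′) = ∧-true (c ℕ.≤ᵇ k) _ d in ≡.cong₂ _∧_ (true-≤ᵇ {c} {suc k} (ℕₚ.m≤n⇒m≤1+n (≤ᵇ-true c k ck))) d′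

remove-horizontal : ∀ a p → decFrom a p ≡ true → Removal ((2 ℕ.+ a) ∷ p)
remove-horizontal a p d = record
  { rest = a ∷ p ; domino = horiz 1 (suc a)
  ; perm = ≡.subst₂ _↭_ (≡.cong (dominoCells (horiz 1 (suc a)) ++_) (≡.sym (cells-∷ a p))) (≡.sym (≡.trans (cells-∷ (2 ℕ.+ a) p)
      (≡.trans (≡.cong (_++ map shiftCell (cells p)) (≡.trans (cellRow-suc 1 (suc a)) (≡.trans (≡.cong (_++ (1 , 2 ℕ.+ a) ∷ []) (cellRow-suc 1 a)) (Lₚ.++-assoc (cellRow 1 a) _ _))))
        (Lₚ.++-assoc (cellRow 1 a) _ _))))
      (Permₚ.shifts (dominoCells (horiz 1 (suc a))) (cellRow 1 a))
  ; rest-dec = λ b d′ → ≡.cong₂ _∧_ (true-≤ᵇ {a} {b} (ℕₚ.≤-trans (ℕₚ.m≤n+m a 2) (≤ᵇ-true (2 ℕ.+ a) b (proj₁ (∧-true (2 ℕ.+ a ℕ.≤ᵇ b) _ d′))))) d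
  ; smaller = ≡.refl }

remove-vertical : ∀ k p → decFrom k p ≡ true → Removal (suc k ∷ suc k ∷ p)
remove-vertical k p d = record
  { rest = k ∷ k ∷ p ; domino = vert 1 (suc k)
  ; perm = ≡.subst₂ _↭_ (≡.cong (dominoCells (vert 1 (suc k)) ++_) (≡.sym (two-rows k))) (≡.sym (≡.trans (two-rows (suc k))
      (≡.cong₂ (λ x y → x ++ y ++ rest) (cellRow-suc 1 k) (cellRow-suc 2 k))))
      (Perm.trans (Perm.prep c₁ (Perm.trans (Perm.↭-sym (Permₚ.shift c₂ (cellRow 1 k) (cellRow 2 k ++ rest)))
        (Permₚ.++⁺ˡ (cellRow 1 k) (Perm.↭-sym (≡.subst (_↭ c₂ ∷ cellRow 2 k ++ rest) (≡.sym (Lₚ.++-assoc (cellRow 2 k) (c₂ ∷ []) rest)) (Permₚ.shift c₂ (cellRow 2 k) rest))))))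
        (Perm.↭-sym (≡.subst (_↭ c₁ ∷ cellRow 1 k ++ (cellRow 2 k ++ c₂ ∷ []) ++ rest) (≡.sym (Lₚ.++-assoc (cellRow 1 k) (c₁ ∷ []) _)) (Permₚ.shift c₁ (cellRow 1 k) ((cellRow 2 k ++ c₂ ∷ []) ++ rest)))))
  ; rest-dec = λ b d′ → ≡.cong₂ _∧_ (true-≤ᵇ {k} {b} (ℕₚ.≤-trans (ℕₚ.n≤1+n k) (≤ᵇ-true (suc k) b (proj₁ (∧-true (suc k ℕ.≤ᵇ b) _ d′))))) (≡.cong₂ _∧_ (true-≤ᵇ {k} {k} ℕₚ.≤-refl) d)
  ; smaller = ≡.cong suc (ℕₚ.+-suc k (k ℕ.+ tot p)) }
  where
  c₁ c₂ : Cell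
  c₁ = (1 , suc k)
  c₂ = (2 , suc k)
  rest = map shiftCell (map shiftCell (cells p))
  two-rows : ∀ a → cells (a ∷ a ∷ p) ≡ cellRow 1 a ++ cellRow 2 a ++ rest
  two-rows a = ≡.trans (cells-∷ a (a ∷ p)) (≡.cong (cellRow 1 a ++_) (≡.trans (≡.cong (map shiftCell) (cells-∷ a p))
    (≡.trans (Lₚ.map-++ shiftCell (cellRow 1 a) _) (≡.cong (_++ rest) (≡.sym (Lₚ.map-∘ (range1 a)))))))

remove-below : ∀ a p → Removal p → decFrom a p ≡ true → Removal (a ∷ p)
remove-below a p r d = record
  { rest = a ∷ rest ; domino = shiftDomino domino
  ; perm = ≡.subst₂ _↭_ (≡.cong₂ _++_ (≡.sym (shiftDomino-cells domino)) (≡.sym (cells-∷ a rest))) (≡.sym (cells-∷ a p))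
      (Perm.trans (Permₚ.shifts (map shiftCell (dominoCells domino)) (cellRow 1 a))
        (Permₚ.++⁺ˡ (cellRow 1 a) (≡.subst (_↭ map shiftCell (cells p)) (Lₚ.map-++ shiftCell (dominoCells domino) (cells rest)) (Permₚ.map⁺ shiftCell perm))))
  ; rest-dec = λ b d′ → ≡.cong₂ _∧_ (proj₁ (∧-true (a ℕ.≤ᵇ b) _ d′)) (rest-dec a d)
  ; smaller = ≡.trans (≡.cong (a ℕ.+_) smaller) (≡.trans (ℕₚ.+-suc a _) (≡.cong suc (ℕₚ.+-suc a _))) }
  where open Removal r

-- If the rows below form the staircase from k, the row a on top decides: a = k ends in a vertical
-- domino (or, for k = 0, in another zero row), a = k + 1 prolongs the staircase, and a ≥ k + 2 ends
-- in a horizontal domino.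
stair-or-removal : ∀ p → dec p ≡ true → Σ ℕ (λ k → Stair k p) ⊎ Removal p
stair-or-removal [] d = inj₁ (0 , nil)
stair-or-removal (a ∷ p) d with stair-or-removal p (dec-tail p d)
... | inj₂ r = inj₂ (remove-below a p r d)
... | inj₁ (k , s) with ℕₚ.m≤n⇒∃[o]m+o≡n (stair-≤ a s d)
... | zero , e = top a k s (≡.trans (≡.sym e) (ℕₚ.+-identityʳ k))
  where
  top : ∀ a k {p} → Stair k p → a ≡ k → Σ ℕ (λ k → Stair k (a ∷ p)) ⊎ Removal (a ∷ p)
  top a zero s ≡.refl = inj₁ (0 , trail s)
  top a (suc k) (stair {p = p} s) ≡.refl = inj₂ (remove-vertical k p (stair-dec s))
... | suc zero , e = inj₁ (suc k , ≡.subst (λ x → Stair (suc k) (x ∷ p)) (≡.trans (≡.sym (ℕₚ.+-comm k 1)) e) (stair s))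
... | suc (suc o) , e = inj₂ (≡.subst (λ x → Removal (x ∷ p)) (≡.trans (≡.sym (≡.trans (ℕₚ.+-suc k (suc o)) (≡.cong suc (ℕₚ.+-suc k o)))) e) (remove-horizontal (k ℕ.+ o) p (raise p (stair-dec s))))
  where
  raise : ∀ p → decFrom k p ≡ true → decFrom (k ℕ.+ o) p ≡ true
  raise [] d = ≡.refl
  raise (c ∷ p) d = let (ck , d′) = ∧-true (c ℕ.≤ᵇ k) _ d in ≡.cong₂ _∧_ (true-≤ᵇ {c} {k ℕ.+ o} (ℕₚ.≤-trans (≤ᵇ-true c k ck) (ℕₚ.m≤m+n k o))) d′

-- The diagonals of a staircase alternate in colour and grow in length, so one colour prevails
-- unless k = 0; this is used in `stair-zero`.
stair-colour : ∀ {k p} → Stair k p → ℤ.+ 2 ℤ.* colour p ≡ (if par k then ℤ.- ℤ.+ k else ℤ.+ suc k)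
stair-colour nil = ≡.refl
stair-colour (trail {p} s) = ≡.trans (≡.cong (λ c → ℤ.+ 2 ℤ.* c) (colour-∷ 0 p)) (≡.trans (Z.solve 1 (λ c → Z.con (ℤ.+ 2) Z.:* (Z.:- Z.:0 Z.:- c) Z.:= Z.:- (Z.con (ℤ.+ 2) Z.:* c)) ≡.refl (colour p)) (≡.cong ℤ.-_ (stair-colour s)))
stair-colour (stair {k} {p} s) = ≡.trans (≡.cong (λ c → ℤ.+ 2 ℤ.* c) (≡.trans (colour-∷ (suc k) p) (≡.cong (λ t → ℤ.- t ℤ.- colour p) (Ssgn-value (suc k)))))
  (go (par k) (stair-colour s))
  where
  two : ∀ {m} → Z.Polynomial m
  two = Z.con (ℤ.+ 2)
  go : ∀ b → ℤ.+ 2 ℤ.* colour p ≡ (if b then ℤ.- ℤ.+ k else ℤ.+ suc k) →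
    ℤ.+ 2 ℤ.* (ℤ.- (if not b then ℤ.+ 0 else ℤ.- ℤ.+ 1) ℤ.- colour p) ≡ (if not b then ℤ.- ℤ.+ suc k else ℤ.+ suc (suc k))
  go true e = ≡.trans (Z.solve 1 (λ c → two Z.:* (Z.:- (Z.:- Z.:1) Z.:- c) Z.:= two Z.:- two Z.:* c) ≡.refl (colour p))
    (≡.trans (≡.cong (λ x → ℤ.+ 2 ℤ.- x) e) (Z.solve 1 (λ k → two Z.:- (Z.:- k) Z.:= two Z.:+ k) ≡.refl (ℤ.+ k)))
  go false e = ≡.trans (Z.solve 1 (λ c → two Z.:* (Z.:- Z.:0 Z.:- c) Z.:= Z.:- (two Z.:* c)) ≡.refl (colour p)) (≡.cong ℤ.-_ e)

stair-zero : ∀ k {p} → Stair k p → colour p ≡ ℤ.+ 0 → cells p ≡ []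
stair-zero zero s c = empty s
  where
  empty : ∀ {p} → Stair 0 p → cells p ≡ []
  empty nil = ≡.refl
  empty (trail {p} s) = ≡.trans (cells-∷ 0 p) (≡.cong (map shiftCell) (empty s))
stair-zero (suc k) {p} s c = ⊥-elim (go (not (par k)) (≡.trans (≡.sym (≡.cong (λ x → ℤ.+ 2 ℤ.* x) c)) (stair-colour s)))
  where
  go : ∀ b → ℤ.+ 2 ℤ.* ℤ.+ 0 ≡ (if b then ℤ.- ℤ.+ suc k else ℤ.+ suc (suc k)) → ⊥
  go true ()
  go false ()

-- Removing a domino keeps the colours balanced, so the staircase reached in the end is empty. `n`
-- is fuel for the recursion.
colour⇒tileable : ∀ n p → tot p ≤ n → dec p ≡ true → colour p ≡ ℤ.+ 0 → Tileable p
colour⇒tileable n p le d c with stair-or-removal p d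
... | inj₁ (k , s) = [] , ≡.subst ([] ↭_) (≡.sym (stair-zero k s c)) Perm.refl
colour⇒tileable zero p le d c | inj₂ r = ⊥-elim (absurd (≡.subst (_≤ 0) (Removal.smaller r) le))
  where
  absurd : ∀ {m} → suc m ≤ 0 → ⊥
  absurd ()
colour⇒tileable (suc n) p le d c | inj₂ r = (domino ∷ proj₁ t) , Perm.trans (Permₚ.++⁺ˡ (dominoCells domino) (proj₂ t)) perm
  where
  open Removal r
  dec-rest : dec rest ≡ true
  dec-rest = dec-tail rest (rest-dec (head-or-0 p) (first-dec p d))
    where
    first-dec : ∀ p → dec p ≡ true → decFrom (head-or-0 p) p ≡ true
    first-dec [] d = ≡.refl
    first-dec (a ∷ p) d = ≡.cong₂ _∧_ (true-≤ᵇ {a} {a} ℕₚ.≤-refl) d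
  t : Tileable rest
  t = colour⇒tileable n rest (ℕₚ.≤-pred (ℕₚ.≤-trans (ℕₚ.≤-trans (ℕₚ.n≤1+n _) (ℕₚ.≤-reflexive (≡.sym smaller))) le)) dec-rest
    (≡.trans (≡.sym (≡.trans (≡.cong (ℤ._+ colour rest) (domino-chess domino)) (ℤₚ.+-identityˡ _))) (≡.trans (≡.sym (HPℤ.prod-++ chess (dominoCells domino) (cells rest))) (≡.trans (prod-↭ chess perm) c)))

-- This is where N has to be even: only then the constant in `wt-colour` vanishes.
tileable⇔wt : ∀ N p → par N ≡ true → length p ≤ N → dec p ≡ true →
  (Tileable p → HPℤ.prod sgn (lamN N p) ≡ ℤ.+ 0) × (HPℤ.prod sgn (lamN N p) ≡ ℤ.+ 0 → Tileable p)
tileable⇔wt N p e len d = (λ t → ≡.trans value (≡.cong (λ c → ℤ.+ 2 ℤ.* c) (tileable⇒colour p t)))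
  , (λ w → colour⇒tileable (tot p) p ℕₚ.≤-refl d (ℤₚ.*-cancelˡ-≡ (ℤ.+ 2) _ _ (≡.trans (≡.sym value) w)))
  where
  value : HPℤ.prod sgn (lamN N p) ≡ ℤ.+ 2 ℤ.* colour p
  value = ≡.trans (wt-colour N p len) (≡.trans (≡.cong (λ b → (if b then ℤ.+ 0 else ℤ.+ 1) ℤ.+ ℤ.+ 2 ℤ.* ((if b then ℤ.+ 1 else ℤ.- ℤ.+ 1) ℤ.* colour p)) e)
    (≡.trans (ℤₚ.+-identityˡ _) (≡.cong (λ c → ℤ.+ 2 ℤ.* c) (ℤₚ.*-identityˡ (colour p)))))

-- Laurent series in q as fractions

module Localisation (R : Ring₀) (q : CommutativeRing.Carrier R)
  (cancel : ∀ x y → CommutativeRing._≈_ R (CommutativeRing._*_ R q x) (CommutativeRing._*_ R q y) → CommutativeRing._≈_ R x y) where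
  open Kit R

  pow-cancel : ∀ n x y → pow q n * x ≈ pow q n * y → x ≈ y
  pow-cancel zero x y e = trans (sym (*-identityˡ x)) (trans e (*-identityˡ y))
  pow-cancel (suc n) x y e = pow-cancel n x y (cancel _ _ (trans (sym (*-assoc q (pow q n) x)) (trans e (*-assoc q (pow q n) y))))

  -- The denominator is an element in its own right and `ex` only certifies that it is a power of q.
  -- Denominators of sums and products are then literal products, and the ring laws are polynomial
  -- identities for the solver.
  record Frac : Set where
    constructor frac
    field
      num den : A
      ex : ℕ
      den-pow : den ≈ pow q ex
  open Frac

  den-cancel : ∀ a x y → den a * x ≈ den a * y → x ≈ y
  den-cancel a x y e = pow-cancel (ex a) x y (trans (*-congʳ (sym (den-pow a))) (trans e (*-congʳ (den-pow a))))

  _≋_ : Frac → Frac → Set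
  a ≋ b = den b * num a ≈ den a * num b

  ι : A → Frac
  ι x = frac x 1# 0 refl

  _⊕_ _⊗_ : Frac → Frac → Frac
  a ⊕ b = frac (den b * num a + den a * num b) (den a * den b) (ex a ℕ.+ ex b) (trans (*-cong (den-pow a) (den-pow b)) (sym (pow-+ q (ex a) (ex b))))
  a ⊗ b = frac (num a * num b) (den a * den b) (ex a ℕ.+ ex b) (trans (*-cong (den-pow a) (den-pow b)) (sym (pow-+ q (ex a) (ex b))))

  ⊖_ : Frac → Frac
  ⊖ a = frac (- num a) (den a) (ex a) (den-pow a)

  private
    -- Here the denominator of the middle fraction has to be cancelled, for which q must be
    -- cancellable.
    ≋-trans : ∀ {a b c} → a ≋ b → b ≋ c → a ≋ c
    ≋-trans {a} {b} {c} p r = den-cancel b _ _ (begin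
      den b * (den c * num a) ≈⟨ solve 3 (λ x y z → x :* (y :* z) := y :* (x :* z)) refl _ _ _ ⟩
      den c * (den b * num a) ≈⟨ *-congˡ p ⟩
      den c * (den a * num b) ≈⟨ solve 3 (λ x y z → x :* (y :* z) := y :* (x :* z)) refl _ _ _ ⟩
      den a * (den c * num b) ≈⟨ *-congˡ r ⟩
      den a * (den b * num c) ≈⟨ solve 3 (λ x y z → x :* (y :* z) := y :* (x :* z)) refl _ _ _ ⟩
      den b * (den a * num c) ∎)

    ⊕-cong : ∀ {a a′ b b′} → a ≋ a′ → b ≋ b′ → (a ⊕ b) ≋ (a′ ⊕ b′)
    ⊕-cong {a} {a′} {b} {b′} p r = begin
      (den a′ * den b′) * (den b * num a + den a * num b)
        ≈⟨ solve 6 (λ d d′ e e′ f g → (d′ :* e′) :* (e :* f :+ d :* g) := (e :* e′) :* (d′ :* f) :+ (d :* d′) :* (e′ :* g)) refl _ _ _ _ _ _ ⟩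
      (den b * den b′) * (den a′ * num a) + (den a * den a′) * (den b′ * num b)
        ≈⟨ +-cong (*-congˡ p) (*-congˡ r) ⟩
      (den b * den b′) * (den a * num a′) + (den a * den a′) * (den b * num b′)
        ≈⟨ solve 6 (λ d d′ e e′ f g → (e :* e′) :* (d :* f) :+ (d :* d′) :* (e :* g) := (d :* e) :* (e′ :* f :+ d′ :* g)) refl _ _ _ _ _ _ ⟩
      (den a * den b) * (den b′ * num a′ + den a′ * num b′) ∎

    ⊗-cong : ∀ {a a′ b b′} → a ≋ a′ → b ≋ b′ → (a ⊗ b) ≋ (a′ ⊗ b′)
    ⊗-cong {a} {a′} {b} {b′} p r = trans (solve 4 (λ d e f g → (d :* e) :* (f :* g) := (d :* f) :* (e :* g)) refl _ _ _ _)
      (trans (*-cong p r) (solve 4 (λ d e f g → (d :* f) :* (e :* g) := (d :* e) :* (f :* g)) refl _ _ _ _))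

  loc : Ring₀
  loc = record
    { Carrier = Frac ; _≈_ = _≋_ ; _+_ = _⊕_ ; _*_ = _⊗_ ; -_ = ⊖_ ; 0# = ι 0# ; 1# = ι 1#
    ; isCommutativeRing = record
      { isRing = record
        { +-isAbelianGroup = record
          { isGroup = record
            { isMonoid = record
              { isSemigroup = record
                { isMagma = record
                  { isEquivalence = record { refl = refl ; sym = sym ; trans = λ {a} {b} {c} → ≋-trans {a} {b} {c} }
                  ; ∙-cong = λ {a} {a′} {b} {b′} → ⊕-cong {a} {a′} {b} {b′} }
                ; assoc = λ a b c → solve 6 (λ f d g e h k → (d :* (e :* k)) :* (k :* (e :* f :+ d :* g) :+ (d :* e) :* h)
                    := ((d :* e) :* k) :* ((e :* k) :* f :+ d :* (k :* g :+ e :* h))) refl (num a) (den a) (num b) (den b) (num c) (den c) }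
              ; identity = (λ a → solve 2 (λ f d → d :* (d :* :0 :+ :1 :* f) := (:1 :* d) :* f) refl (num a) (den a))
                         , (λ a → solve 2 (λ f d → d :* (:1 :* f :+ d :* :0) := (d :* :1) :* f) refl (num a) (den a)) }
            ; inverse = (λ a → solve 2 (λ f d → :1 :* (d :* :- f :+ d :* f) := (d :* d) :* :0) refl (num a) (den a))
                      , (λ a → solve 2 (λ f d → :1 :* (d :* f :+ d :* :- f) := (d :* d) :* :0) refl (num a) (den a))
            ; ⁻¹-cong = λ {a} {b} p → trans (sym (-‿distribʳ-* _ _)) (trans (-‿cong p) (-‿distribʳ-* _ _)) }
          ; comm = λ a b → solve 4 (λ f d g e → (e :* d) :* (e :* f :+ d :* g) := (d :* e) :* (d :* g :+ e :* f)) refl (num a) (den a) (num b) (den b) }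
        ; *-cong = λ {a} {a′} {b} {b′} → ⊗-cong {a} {a′} {b} {b′}
        ; *-assoc = λ a b c → solve 6 (λ f d g e h k → (d :* (e :* k)) :* ((f :* g) :* h) := ((d :* e) :* k) :* (f :* (g :* h))) refl (num a) (den a) (num b) (den b) (num c) (den c)
        ; *-identity = (λ a → solve 2 (λ f d → d :* (:1 :* f) := (:1 :* d) :* f) refl (num a) (den a))
                     , (λ a → solve 2 (λ f d → d :* (f :* :1) := (d :* :1) :* f) refl (num a) (den a))
        ; distrib = (λ a b c → solve 6 (λ f d g e h k → ((d :* e) :* (d :* k)) :* (f :* (k :* g :+ e :* h))
                      := (d :* (e :* k)) :* ((d :* k) :* (f :* g) :+ (d :* e) :* (f :* h))) refl (num a) (den a) (num b) (den b) (num c) (den c))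
                  , (λ a b c → solve 6 (λ f d g e h k → ((e :* d) :* (k :* d)) :* ((k :* g :+ e :* h) :* f)
                      := ((e :* k) :* d) :* ((k :* d) :* (g :* f) :+ (e :* d) :* (h :* f))) refl (num a) (den a) (num b) (den b) (num c) (den c)) }
      ; *-comm = λ a b → solve 4 (λ f d g e → (e :* d) :* (f :* g) := (d :* e) :* (g :* f)) refl (num a) (den a) (num b) (den b) } }

  ιʰ : Hom R loc
  ιʰ = record
    { ap = ι
    ; ap-cong = λ p → *-congˡ p
    ; ap-+ = λ x y → solve 2 (λ x y → (:1 :* :1) :* (x :+ y) := :1 :* (:1 :* x :+ :1 :* y)) refl x y
    ; ap-* = λ x y → solve 2 (λ x y → (:1 :* :1) :* (x :* y) := :1 :* (x :* y)) refl x y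
    ; ap-1 = refl ; ap-neg = λ x → refl ; ap-0 = refl }

  qz : ℤ → Frac
  qz (ℤ.+ n) = ι (pow q n)
  qz -[1+ n ] = frac 1# (pow q (suc n)) (suc n) refl

  qz-⊖ : ∀ m n → pow q n * num (qz (m ℤ.⊖ n)) ≈ den (qz (m ℤ.⊖ n)) * pow q m
  qz-⊖ zero zero = refl
  qz-⊖ zero (suc n) = refl
  qz-⊖ (suc m) zero = refl
  qz-⊖ (suc m) (suc n) = ≡.subst (λ k → pow q (suc n) * num (qz k) ≈ den (qz k) * pow q (suc m)) (≡.sym (ℤₚ.[1+m]⊖[1+n]≡m⊖n m n))
    (trans (*-assoc _ _ _) (trans (*-congˡ (qz-⊖ m n)) (solve 3 (λ q d p → q :* (d :* p) := d :* (q :* p)) refl _ _ _)))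

  qz-+ : ∀ i j → qz (i ℤ.+ j) ≋ (qz i ⊗ qz j)
  qz-+ (ℤ.+ m) (ℤ.+ n) = trans (*-congˡ (pow-+ q m n)) (solve 1 (λ x → (:1 :* :1) :* x := :1 :* x) refl _)
  qz-+ (ℤ.+ m) -[1+ n ] = trans (*-congʳ (*-identityˡ _)) (trans (qz-⊖ m (suc n)) (*-congˡ (sym (*-identityʳ _))))
  qz-+ -[1+ m ] (ℤ.+ n) = trans (*-congʳ (*-identityʳ _)) (trans (qz-⊖ n (suc m)) (*-congˡ (sym (*-identityˡ _))))
  qz-+ -[1+ m ] -[1+ n ] = trans (*-identityʳ _) (trans (sym (pow-+ q (suc m) (suc n))) (trans (reflexive (≡.cong (pow q) (ℕₚ.+-suc (suc m) n))) (sym (trans (*-congˡ (*-identityˡ _)) (*-identityʳ _)))))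

ℤring : Ring₀
ℤring = ℤₚ.+-*-commutativeRing

ℤq : Ring₀
ℤq = PS ℤring

X-cancel : ∀ x y → CommutativeRing._≈_ ℤq (CommutativeRing._*_ ℤq (X ℤring) x) (CommutativeRing._*_ ℤq (X ℤring) y) → CommutativeRing._≈_ ℤq x y
X-cancel x y e n = ≡.trans (≡.sym (X-*-suc ℤring x n)) (≡.trans (e (suc n)) (X-*-suc ℤring y n))

module Lo = Localisation ℤq (X ℤring) X-cancel

-- From coefficient functions to iterated power series

rev : ∀ {n} → Vec ℕ n → Vec ℕ n
rev [] = []
rev (a ∷ e) = rev e Vec.∷ʳ a

rev-∷ʳ : ∀ {n} (e : Vec ℕ n) a → rev (e Vec.∷ʳ a) ≡ a ∷ rev e
rev-∷ʳ [] a = ≡.refl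
rev-∷ʳ (b ∷ e) a = ≡.cong (Vec._∷ʳ b) (rev-∷ʳ e a)

rev-rev : ∀ {n} (e : Vec ℕ n) → rev (rev e) ≡ e
rev-rev [] = ≡.refl
rev-rev (a ∷ e) = ≡.trans (rev-∷ʳ (rev e) a) (≡.cong (a ∷_) (rev-rev e))

module VecConv (R : Ring₀) where
  open Kit R
  private module M (n : ℕ) = Kit (MPS R n)
  open Variables R using (Car)

  -- Σ Θ d r over d + r = e
  Bc : ∀ {n} → Vec ℕ n → (Vec ℕ n → Vec ℕ n → A) → A
  Bc [] Θ = Θ [] []
  Bc (a ∷ e) Θ = tri (λ c c′ → Bc e (λ d r → Θ (c ∷ d) (c′ ∷ r))) a

  Bc-cong : ∀ {n} (e : Vec ℕ n) {Θ Ψ} → (∀ d r → Θ d r ≈ Ψ d r) → Bc e Θ ≈ Bc e Ψ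
  Bc-cong [] p = p [] []
  Bc-cong (a ∷ e) p = tri-cong (λ c c′ → Bc-cong e (λ d r → p (c ∷ d) (c′ ∷ r))) a

  tri-tri : ∀ a b (g : ℕ → ℕ → ℕ → ℕ → A) → tri (λ i j → tri (λ k l → g i j k l) b) a ≈ tri (λ k l → tri (λ i j → g i j k l) a) b
  tri-tri zero b g = refl
  tri-tri (suc a) b g = trans (+-congˡ (tri-tri a b (λ i → g (suc i)))) (sym (tri-+ _ _ b))

  Bc-tri : ∀ {n} (e : Vec ℕ n) a (g : Vec ℕ n → Vec ℕ n → ℕ → ℕ → A) → Bc e (λ d r → tri (g d r) a) ≈ tri (λ i j → Bc e (λ d r → g d r i j)) a
  Bc-tri [] a g = refl
  Bc-tri (b ∷ e) a g = trans (tri-cong (λ c c′ → Bc-tri e a (λ d r → g (c ∷ d) (c′ ∷ r))) b) (tri-tri b a _)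

  Bc-∷ʳ : ∀ {n} (e : Vec ℕ n) a Θ → Bc (e Vec.∷ʳ a) Θ ≈ Bc e (λ d r → tri (λ c c′ → Θ (d Vec.∷ʳ c) (r Vec.∷ʳ c′)) a)
  Bc-∷ʳ [] a Θ = refl
  Bc-∷ʳ (b ∷ e) a Θ = tri-cong (λ c c′ → Bc-∷ʳ e a (λ d r → Θ (c ∷ d) (c′ ∷ r))) b

  Bc-rev : ∀ {n} (e : Vec ℕ n) Θ → Bc (rev e) Θ ≈ Bc e (λ d r → Θ (rev d) (rev r))
  Bc-rev [] Θ = refl
  Bc-rev (a ∷ e) Θ = trans (Bc-∷ʳ (rev e) a Θ) (trans (Bc-rev e _) (Bc-tri e a (λ d r c c′ → Θ (rev d Vec.∷ʳ c) (rev r Vec.∷ʳ c′))))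

  cur : ∀ n → (Vec ℕ n → A) → Car n
  cur zero φ = φ []
  cur (suc n) φ a = cur n (λ e → φ (a ∷ e))

  cur-cong : ∀ n {φ ψ} → (∀ e → φ e ≈ ψ e) → M._≈_ n (cur n φ) (cur n ψ)
  cur-cong zero p = p []
  cur-cong (suc n) p a = cur-cong n (λ e → p (a ∷ e))

  cur-+ : ∀ n φ ψ → M._≈_ n (cur n (λ e → φ e + ψ e)) (M._+_ n (cur n φ) (cur n ψ))
  cur-+ zero φ ψ = refl
  cur-+ (suc n) φ ψ a = cur-+ n (λ e → φ (a ∷ e)) (λ e → ψ (a ∷ e))

  cur-neg : ∀ n φ → M._≈_ n (cur n (λ e → - φ e)) (M.-_ n (cur n φ))
  cur-neg zero φ = refl
  cur-neg (suc n) φ a = cur-neg n (λ e → φ (a ∷ e))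

  cur-tri : ∀ n (φ : ℕ → ℕ → Vec ℕ n → A) a → M._≈_ n (cur n (λ e → tri (λ i j → φ i j e) a)) (M.tri n (λ i j → cur n (φ i j)) a)
  cur-tri n φ zero = M.refl n
  cur-tri n φ (suc a) = M.trans n (cur-+ n _ _) (M.+-congˡ n (cur-tri n (λ i → φ (suc i)) a))

  cur-* : ∀ n φ ψ → M._≈_ n (M._*_ n (cur n φ) (cur n ψ)) (cur n (λ e → Bc e (λ d r → φ d * ψ r)))
  cur-* zero φ ψ = refl
  cur-* (suc n) φ ψ a = M.trans n (M.tri-cong n (λ i j → cur-* n (λ e → φ (i ∷ e)) (λ e → ψ (j ∷ e))) a) (M.sym n (cur-tri n _ a))

  open Littlewood R using (at; at-cong)

  at-cur : ∀ n φ e → at n (cur n φ) e ≡ φ e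
  at-cur zero φ [] = ≡.refl
  at-cur (suc n) φ (a ∷ e) = at-cur n (λ e → φ (a ∷ e)) e

  at-ext : ∀ n {c d} → (∀ e → at n c e ≈ at n d e) → M._≈_ n c d
  at-ext zero p = p []
  at-ext (suc n) p a = at-ext n (λ e → p (a ∷ e))

ap-Bc : ∀ {R S : Ring₀} (h : Hom R S) {n} (e : Vec ℕ n) Θ → CommutativeRing._≈_ S (ap h (VecConv.Bc R e Θ)) (VecConv.Bc S e (λ d r → ap h (Θ d r)))
ap-Bc {S = S} h [] Θ = CommutativeRing.refl S
ap-Bc {R} {S} h (a ∷ e) Θ = Kit.trans S (ap-tri h _ a) (Kit.tri-cong S (λ c c′ → ap-Bc h e _) a)

module Bz = VecConv ℤring

sumℤ-concatMap : ∀ {I J : Set} (φ : J → ℤ) (f : I → List J) xs → sumℤ (map φ (concatMap f xs)) ≡ sumℤ (map (λ x → sumℤ (map φ (f x))) xs)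
sumℤ-concatMap φ f [] = ≡.refl
sumℤ-concatMap φ f (x ∷ xs) = ≡.trans (≡.cong sumℤ (Lₚ.map-++ φ (f x) _)) (≡.trans (go (map φ (f x))) (≡.cong (λ k → sumℤ (map φ (f x)) ℤ.+ k) (sumℤ-concatMap φ f xs)))
  where
  go : ∀ us {vs} → sumℤ (us ++ vs) ≡ sumℤ us ℤ.+ sumℤ vs
  go [] = ≡.sym (ℤₚ.+-identityˡ _)
  go (u ∷ us) = ≡.trans (≡.cong (λ k → u ℤ.+ k) (go us)) (≡.sym (ℤₚ.+-assoc u _ _))

tri-upTo : ∀ (g : ℕ → ℕ → ℤ) a → sumℤ (map (λ c → g c (a ∸ c)) (upTo (suc a))) ≡ Z.tri g a
tri-upTo g zero = ℤₚ.+-identityʳ _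
tri-upTo g (suc a) = ≡.cong (λ k → g 0 (suc a) ℤ.+ k) (≡.trans (≡.cong sumℤ (≡.trans (≡.cong (map (λ c → g c (suc a ∸ c))) (≡.sym (Lₚ.map-upTo suc (suc a)))) (≡.sym (Lₚ.map-∘ (upTo (suc a)))))) (tri-upTo (λ i → g (suc i)) a))

below-Bc : ∀ {n} (e : Vec ℕ n) Θ → sumℤ (map (λ d → Θ d (e ∸ᵥ d)) (below e)) ≡ Bz.Bc e Θ
below-Bc [] Θ = ℤₚ.+-identityʳ _
below-Bc (a ∷ e) Θ = ≡.trans (sumℤ-concatMap (λ d → Θ d ((a ∷ e) ∸ᵥ d)) (λ c → map (c ∷_) (below e)) (upTo (suc a)))
  (≡.trans (≡.cong sumℤ (Lₚ.map-cong (λ c → ≡.trans (≡.cong sumℤ (≡.sym (Lₚ.map-∘ (below e)))) (below-Bc e (λ d r → Θ (c ∷ d) ((a ∸ c) ∷ r)))) (upTo (suc a))))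
    (tri-upTo (λ c c′ → Bz.Bc e (λ d r → Θ (c ∷ d) (c′ ∷ r))) a))

*ₛ-Bc : ∀ {m} (f g : Ser m) e → (f *ₛ g) e ≡ Bz.Bc e (λ d r → f d ℤ.* g r)
*ₛ-Bc f g e = below-Bc e (λ d r → f d ℤ.* g r)

module Hat (ℒ : Ring₀) (ιʰ : Hom ℤq ℒ) (n : ℕ) where
  open Kit (MPS ℒ n)
  private
    module Lk = Kit ℒ
    module P = Kit ℤq
    module VL = VecConv ℒ
    module VP = VecConv ℤq

  -- The exponents are reversed because branching removes the largest letter first, so x_n has to be
  -- the outermost variable. The variable q goes into the coefficient ring.
  coef : Ser (suc n) → Vec ℕ n → P.A
  coef f e k = f (k ∷ rev e)

  -- A series in q, x₁, …, x_n as a series in x_n, …, x₁ over ℒ.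
  hat : Ser (suc n) → A
  hat f = VL.cur n (λ e → ap ιʰ (coef f e))

  hat-cong : ∀ {f g : Ser (suc n)} → (∀ e → f e ≡ g e) → hat f ≈ hat g
  hat-cong p = VL.cur-cong n (λ e → Hom.ap-cong ιʰ (λ k → p (k ∷ rev e)))

  coef-* : ∀ f g e → coef (f *ₛ g) e P.≈ VP.Bc e (λ d r → coef f d P.* coef g r)
  coef-* f g e k = ≡.trans (*ₛ-Bc f g (k ∷ rev e)) (≡.trans (Z.tri-cong (λ c c′ → Bz.Bc-rev e (λ d r → f (c ∷ d) ℤ.* g (c′ ∷ r))) k)
    (≡.trans (≡.sym (Bz.Bc-tri e k (λ d r c c′ → f (c ∷ rev d) ℤ.* g (c′ ∷ rev r)))) (≡.sym (Bc-at e (λ d r → coef f d P.* coef g r) k))))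
    where
    tri-at : ∀ (g : ℕ → ℕ → P.A) a k → P.tri g a k ≡ Z.tri (λ i j → g i j k) a
    tri-at g zero k = ≡.refl
    tri-at g (suc a) k = ≡.cong (λ x → g 0 (suc a) k ℤ.+ x) (tri-at (λ i → g (suc i)) a k)
    Bc-at : ∀ {m} (e : Vec ℕ m) (Θ : Vec ℕ m → Vec ℕ m → P.A) k → VP.Bc e Θ k ≡ Bz.Bc e (λ d r → Θ d r k)
    Bc-at [] Θ k = ≡.refl
    Bc-at (a ∷ e) Θ k = ≡.trans (tri-at _ a k) (Z.tri-cong (λ c c′ → Bc-at e _ k) a)

  hat-* : ∀ f g → hat (f *ₛ g) ≈ hat f * hat g
  hat-* f g = trans (VL.cur-cong n (λ e → Lk.trans (Hom.ap-cong ιʰ (coef-* f g e)) (Lk.trans (ap-Bc ιʰ e _) (VL.Bc-cong e (λ d r → Hom.ap-* ιʰ (coef f d) (coef g r))))))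
    (sym (VL.cur-* n _ _))

  hat-+ : ∀ f g → hat (f +ₛ g) ≈ hat f + hat g
  hat-+ f g = trans (VL.cur-cong n (λ e → Hom.ap-+ ιʰ (coef f e) (coef g e))) (VL.cur-+ n _ _)

  hat-- : ∀ f g → hat (f -ₛ g) ≈ hat f - hat g
  hat-- f g = trans (VL.cur-cong n (λ e → Lk.trans (Hom.ap-+ ιʰ (coef f e) (P.- coef g e)) (Lk.+-congˡ (Hom.ap-neg ιʰ (coef g e))))) (trans (VL.cur-+ n _ _) (+-congˡ (VL.cur-neg n _)))

≡ᵛ-true : ∀ {n} (d e : Vec ℕ n) → (d ≡ᵛ e) ≡ true → d ≡ e
≡ᵛ-true [] [] p = ≡.refl
≡ᵛ-true (a ∷ d) (b ∷ e) p = let (p₁ , p₂) = ∧-true (a ℕ.≡ᵇ b) _ p in ≡.cong₂ _∷_ (≡ᵇ-true a b p₁) (≡ᵛ-true d e p₂)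

true-≡ᵛ : ∀ {n} {d e : Vec ℕ n} → d ≡ e → (d ≡ᵛ e) ≡ true
true-≡ᵛ {d = []} ≡.refl = ≡.refl
true-≡ᵛ {d = a ∷ d} ≡.refl = ≡.cong₂ _∧_ (true-≡ᵇ {a} {a} ≡.refl) (true-≡ᵛ {d = d} ≡.refl)

≡ᵇᵥ-≡ᵛ : ∀ {n} (d e : Vec ℕ n) → (d ≡ᵇᵥ e) ≡ (d ≡ᵛ e)
≡ᵇᵥ-≡ᵛ d e = bool-iff forward (λ p → dec-true (Vecₚ.≡-dec ℕ._≟_ d e) (≡ᵛ-true d e p))
  where
  forward : (d ≡ᵇᵥ e) ≡ true → (d ≡ᵛ e) ≡ true
  forward p with Vecₚ.≡-dec ℕ._≟_ d e
  ... | yes q = true-≡ᵛ q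
  forward () | no _

rev-≡ᵛ : ∀ {n} (d e : Vec ℕ n) → (d ≡ᵛ rev e) ≡ (rev d ≡ᵛ e)
rev-≡ᵛ d e = bool-iff (λ p → true-≡ᵛ (≡.trans (≡.cong rev (≡ᵛ-true d (rev e) p)) (rev-rev e)))
                      (λ p → true-≡ᵛ (≡.trans (≡.sym (rev-rev d)) (≡.cong rev (≡ᵛ-true (rev d) e p))))

zeros : ∀ n → Vec ℕ n
zeros n = Vec.replicate n 0

unit : ∀ {n} → Fin n → Vec ℕ n
unit {suc n} zero = 1 ∷ zeros n
unit {suc n} (suc i) = 0 ∷ unit i

unit-tabulate : ∀ {n} (i : Fin n) → Vec.tabulate (λ j → if does (i Fin.≟ j) then 1 else 0) ≡ unit i
unit-tabulate {suc n} zero = ≡.cong (1 ∷_) (go n)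
  where
  go : ∀ n → Vec.tabulate {n = n} (λ _ → 0) ≡ zeros n
  go zero = ≡.refl
  go (suc n) = ≡.cong (0 ∷_) (go n)
unit-tabulate {suc n} (suc i) = ≡.cong (0 ∷_) (unit-tabulate i)

zeros-∷ʳ : ∀ n → zeros n Vec.∷ʳ 0 ≡ zeros (suc n)
zeros-∷ʳ zero = ≡.refl
zeros-∷ʳ (suc n) = ≡.cong (0 ∷_) (zeros-∷ʳ n)

rev-zeros : ∀ n → rev (zeros n) ≡ zeros n
rev-zeros zero = ≡.refl
rev-zeros (suc n) = ≡.trans (≡.cong (Vec._∷ʳ 0) (rev-zeros n)) (zeros-∷ʳ n)

rev-unit : ∀ {n} (i : Fin n) → rev (unit i) ≡ unit (Fin.opposite i)
rev-unit {suc n} zero = ≡.trans (≡.cong (Vec._∷ʳ 1) (rev-zeros n)) (go n)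
  where
  go : ∀ n → zeros n Vec.∷ʳ 1 ≡ unit (Fin.fromℕ n)
  go zero = ≡.refl
  go (suc n) = ≡.cong (0 ∷_) (go n)
rev-unit {suc n} (suc i) = ≡.trans (≡.cong (Vec._∷ʳ 0) (rev-unit i)) (go (Fin.opposite i))
  where
  go : ∀ {n} (i : Fin n) → unit i Vec.∷ʳ 0 ≡ unit (Fin.inject₁ i)
  go {suc n} zero = ≡.cong (1 ∷_) (zeros-∷ʳ n)
  go {suc n} (suc i) = ≡.cong (0 ∷_) (go i)

module AtVariables (R : Ring₀) where
  open Kit R
  open Variables R
  open Littlewood R using (at; at-cong)
  private module M (n : ℕ) = Kit (MPS R n)

  at-0 : ∀ n e → at n (M.0# n) e ≈ 0#
  at-0 zero [] = refl
  at-0 (suc n) (a ∷ e) = at-0 n e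

  at-cst : ∀ n c e → at n (ap (cstʰ n) c) e ≈ (zeros n ≡ᵛ e) ▹ c
  at-cst zero c [] = refl
  at-cst (suc n) c (zero ∷ e) = at-cst n c e
  at-cst (suc n) c (suc a ∷ e) = at-0 n e

  at-1 : ∀ n e → at n (M.1# n) e ≈ (zeros n ≡ᵛ e) ▹ 1#
  at-1 n e = trans (at-cong n (M.sym n (Hom.ap-1 (cstʰ n))) e) (at-cst n 1# e)

  at-v : ∀ {n} (i : Fin n) e → at n (v i) e ≈ (unit i ≡ᵛ e) ▹ 1#
  at-v {suc n} zero (zero ∷ e) = at-0 n e
  at-v {suc n} zero (suc zero ∷ e) = at-1 n e
  at-v {suc n} zero (suc (suc a) ∷ e) = at-0 n e
  at-v {suc n} (suc i) (zero ∷ e) = at-v i e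
  at-v {suc n} (suc i) (suc a ∷ e) = at-0 n e

  -- the coefficient of x^e in g(x_i)
  sel : ∀ {n} → Fin n → Vec ℕ n → (ℕ → A) → A
  sel {suc n} zero (a ∷ e) g = (zeros n ≡ᵛ e) ▹ g a
  sel {suc n} (suc i) (a ∷ e) g = (0 ℕ.≡ᵇ a) ▹ sel i e g

  at-ser : ∀ {n} g (i : Fin n) e → at n (ser g i) e ≈ sel i e g
  at-ser {suc n} g zero (a ∷ e) = at-cst n (g a) e
  at-ser {suc n} g (suc i) (zero ∷ e) = at-ser g i e
  at-ser {suc n} g (suc i) (suc a ∷ e) = at-0 n e

pow-X : ∀ k₀ k → Kit.pow ℤq (X ℤring) k₀ k ≡ (if k₀ ℕ.≡ᵇ k then ℤ.+ 1 else ℤ.+ 0)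
pow-X zero zero = ≡.refl
pow-X zero (suc k) = ≡.refl
pow-X (suc k₀) zero = X-*-zero ℤring (Kit.pow ℤq (X ℤring) k₀)
pow-X (suc k₀) (suc k) = ≡.trans (X-*-suc ℤring (Kit.pow ℤq (X ℤring) k₀) k) (pow-X k₀ k)

geometric : ∀ (R : Ring₀) → let open Kit R in ∀ g N → (1# - g) * sumL (pow g) (upTo N) ≈ 1# - pow g N
geometric R g N = go N
  where
  open Kit R
  last : ∀ N → sumL (pow g) (upTo (suc N)) ≈ sumL (pow g) (upTo N) + pow g N
  last N = trans (reflexive (≡.cong (sumL (pow g)) (≡.sym (Lₚ.applyUpTo-∷ʳ id N)))) (snoc (upTo N))
    where
    snoc : ∀ xs → sumL (pow g) (xs ++ N ∷ []) ≈ sumL (pow g) xs + pow g N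
    snoc [] = trans (+-identityʳ _) (sym (+-identityˡ _))
    snoc (x ∷ xs) = trans (+-congˡ (snoc xs)) (sym (+-assoc _ _ _))
  go : ∀ N → (1# - g) * sumL (pow g) (upTo N) ≈ 1# - pow g N
  go zero = trans (zeroʳ _) (sym (-‿inverseʳ _))
  go (suc N) = trans (*-congˡ (last N)) (trans (distribˡ _ _ _) (trans (+-congʳ (go N)) (solve 2 (λ g p → (:1 :- p) :+ (:1 :- g) :* p := :1 :- g :* p) refl g (pow g N))))

module Inverse {m : ℕ} where
  private
    module M = Kit (MPS ℤring m)
    module AV = AtVariables ℤring
  open Littlewood ℤring using (at; at-cong)
  open Bz using (Bc; cur)

  c : Ser m → M.A
  c f = cur m f

  c-* : ∀ f g → c (f *ₛ g) M.≈ c f M.* c g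
  c-* f g = M.trans (Bz.cur-cong m (λ e → *ₛ-Bc f g e)) (M.sym (Bz.cur-* m f g))

  c-- : ∀ f g → c (f -ₛ g) M.≈ c f M.- c g
  c-- f g = M.trans (Bz.cur-+ m f (λ e → ℤ.- g e)) (M.+-congˡ (Bz.cur-neg m g))

  c-1 : c 1ₛ M.≈ M.1#
  c-1 = Bz.at-ext m (λ e → ≡.trans (≡.trans (Bz.at-cur m 1ₛ e) (≡.trans (≡.cong (λ b → if b then ℤ.+ 1 else ℤ.+ 0) (≡ᵇᵥ-≡ᵛ (zeros m) e)) (bool (zeros m ≡ᵛ e)))) (≡.sym (AV.at-1 m e)))
    where
    bool : ∀ b → (if b then ℤ.+ 1 else ℤ.+ 0) ≡ Z._▹_ b (ℤ.+ 1)
    bool true = ≡.refl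
    bool false = ≡.refl

  c-^ : ∀ f r → c (f ^ₛ r) M.≈ M.pow (c f) r
  c-^ f zero = c-1
  c-^ f (suc r) = M.trans (c-* f (f ^ₛ r)) (M.*-congˡ (c-^ f r))

  Bc-cong-deg : ∀ {n} (e : Vec ℕ n) {Θ Ψ} → (∀ d r → deg d ℕ.+ deg r ≡ deg e → Θ d r ≡ Ψ d r) → Bc e Θ ≡ Bc e Ψ
  Bc-cong-deg [] p = p [] [] ≡.refl
  Bc-cong-deg (a ∷ e) p = Z.tri-cong′ a (λ i j ij → Bc-cong-deg e (λ d r dr → p (i ∷ d) (j ∷ r) (≡.trans (swap-mid i (deg d) j (deg r)) (≡.cong₂ ℕ._+_ ij dr))))

  Bc-0 : ∀ {n} (e : Vec ℕ n) → Bc e (λ _ _ → ℤ.+ 0) ≡ ℤ.+ 0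
  Bc-0 [] = ≡.refl
  Bc-0 (a ∷ e) = Z.tri-0′ a (λ i j _ → Bc-0 e)

  deg-0 : ∀ {n} (d : Vec ℕ n) → deg d ≡ 0 → d ≡ zeros n
  deg-0 [] e = ≡.refl
  deg-0 (zero ∷ d) e = ≡.cong (0 ∷_) (deg-0 d e)

  -- Every term of g has degree at least 1, so each factor uses up a degree.
  order : ∀ (g : Ser m) → g (zeros m) ≡ ℤ.+ 0 → ∀ r e → deg e < r → (g ^ₛ r) e ≡ ℤ.+ 0
  order g g0 (suc r) e (s≤s lt) = ≡.trans (*ₛ-Bc g (g ^ₛ r) e) (≡.trans (Bc-cong-deg e term) (Bc-0 e))
    where
    term : ∀ d r′ → deg d ℕ.+ deg r′ ≡ deg e → g d ℤ.* (g ^ₛ r) r′ ≡ ℤ.+ 0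
    term d r′ s with deg d ℕ.≟ 0
    ... | yes z = ≡.trans (≡.cong (ℤ._* (g ^ₛ r) r′) (≡.trans (≡.cong g (deg-0 d z)) g0)) (ℤₚ.*-zeroˡ ((g ^ₛ r) r′))
    ... | no nz = ≡.trans (≡.cong (λ k → g d ℤ.* k) (order g g0 r r′ (ℕₚ.<-≤-trans (ℕₚ.m<n+m (deg r′) (ℕₚ.n≢0⇒n>0 nz)) (ℕₚ.≤-trans (ℕₚ.≤-reflexive s) lt)))) (ℤₚ.*-zeroʳ (g d))

  -- The truncation in `invₛ` varies with the exponent. In the convolution at e it may be replaced
  -- by the uniform bound N = deg e + 1, because the further powers of g = 1 - f do not contribute
  -- (`stable`). The geometric sum then telescopes to 1 - g^N, and g^N vanishes at e.
  invₛ-inverse : ∀ (f : Ser m) → f (zeros m) ≡ ℤ.+ 1 → ∀ e → (f *ₛ invₛ f) e ≡ 1ₛ e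
  invₛ-inverse f f1 e = ≡.trans (*ₛ-Bc f (invₛ f) e) (≡.trans (Bc-cong-deg e (λ d r s → ≡.cong (λ k → f d ℤ.* k) (stable r (suc (deg e)) (s≤s (≡.subst (deg r ≤_) s (ℕₚ.m≤n+m (deg r) (deg d)))))))
      (≡.trans (≡.sym (≡.trans (at-cong m (Bz.cur-* m f S) e) (Bz.at-cur m (λ e → Bc e (λ d r → f d ℤ.* S r)) e))) (≡.trans (at-cong m ring e) value)))
    where
    N = suc (deg e)
    g : Ser m
    g = 1ₛ -ₛ f
    g0 : g (zeros m) ≡ ℤ.+ 0
    g0 = ≡.cong₂ ℤ._-_ (≡.cong (λ b → if b then ℤ.+ 1 else ℤ.+ 0) (≡.trans (≡ᵇᵥ-≡ᵛ (zeros m) (zeros m)) (true-≡ᵛ {d = zeros m} ≡.refl))) f1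
    sum : ℕ → Ser m
    sum N e = sumℤ (map (λ r → (g ^ₛ r) e) (upTo N))
    S : Ser m
    S = sum N
    stable : ∀ r N → suc (deg r) ≤ N → invₛ f r ≡ sum N r
    stable r N le with ℕₚ.m≤n⇒∃[o]m+o≡n le
    ... | o , ≡.refl = go o
      where
      go : ∀ o → invₛ f r ≡ sum (suc (deg r) ℕ.+ o) r
      go zero = ≡.cong (λ k → sum k r) (≡.sym (ℕₚ.+-identityʳ (suc (deg r))))
      go (suc o) = ≡.trans (go o) (≡.sym (≡.trans (≡.cong (λ k → sum k r) (ℕₚ.+-suc (suc (deg r)) o)) (≡.trans (snoc (suc (deg r) ℕ.+ o))
        (≡.trans (≡.cong (λ k → sum (suc (deg r) ℕ.+ o) r ℤ.+ k) (order g g0 (suc (deg r) ℕ.+ o) r (s≤s (ℕₚ.m≤m+n (deg r) o)))) (ℤₚ.+-identityʳ _)))))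
        where
        snoc : ∀ k → sum (suc k) r ≡ sum k r ℤ.+ (g ^ₛ k) r
        snoc k = ≡.trans (≡.cong (λ l → sumℤ (map (λ j → (g ^ₛ j) r) l)) (≡.sym (Lₚ.applyUpTo-∷ʳ id k))) (push (upTo k))
          where
          push : ∀ xs → sumℤ (map (λ j → (g ^ₛ j) r) (xs ++ k ∷ [])) ≡ sumℤ (map (λ j → (g ^ₛ j) r) xs) ℤ.+ (g ^ₛ k) r
          push [] = ≡.trans (ℤₚ.+-identityʳ ((g ^ₛ k) r)) (≡.sym (ℤₚ.+-identityˡ ((g ^ₛ k) r)))
          push (x ∷ xs) = ≡.trans (≡.cong (λ t → (g ^ₛ x) r ℤ.+ t) (push xs)) (≡.sym (ℤₚ.+-assoc ((g ^ₛ x) r) _ _))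
    c-sum : ∀ xs → c (λ e → sumℤ (map (λ r → (g ^ₛ r) e) xs)) M.≈ M.sumL (M.pow (c g)) xs
    c-sum [] = Bz.at-ext m (λ e → ≡.trans (Bz.at-cur m _ e) (≡.sym (AV.at-0 m e)))
    c-sum (x ∷ xs) = M.trans (Bz.cur-+ m (g ^ₛ x) (λ e → sumℤ (map (λ r → (g ^ₛ r) e) xs))) (M.+-cong (c-^ g x) (c-sum xs))
    cf : c f M.≈ M.1# M.- c g
    cf = M.trans (M.solve 2 (λ o f → f M.:= o M.:- (o M.:- f)) M.refl M.1# (c f)) (M.+-congˡ (M.-‿cong (M.sym (M.trans (c-- 1ₛ f) (M.+-congʳ c-1)))))
    ring : c f M.* c S M.≈ c 1ₛ M.- c (g ^ₛ N)
    ring = M.trans (M.*-cong cf (c-sum (upTo N))) (M.trans (geometric (MPS ℤring m) (c g) N) (M.+-cong (M.sym c-1) (M.-‿cong (M.sym (c-^ g N)))))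
    value : at m (c 1ₛ M.- c (g ^ₛ N)) e ≡ 1ₛ e
    value = ≡.trans (at-cong m (M.sym (c-- 1ₛ (g ^ₛ N))) e) (≡.trans (Bz.at-cur m (1ₛ -ₛ (g ^ₛ N)) e) (≡.trans (≡.cong (λ k → 1ₛ e ℤ.- k) (order g g0 N e ℕₚ.≤-refl)) (ℤₚ.+-identityʳ _)))

module HatFacts (ℒ : Ring₀) (ιʰ : Hom ℤq ℒ) (n : ℕ) where
  open Kit (MPS ℒ n)
  open Hat ℒ ιʰ n public
  open Variables ℒ using (v; cstʰ)
  private
    module Lk = Kit ℒ
    module VL = VecConv ℒ
    module AV = AtVariables ℒ

  qL : Lk.A
  qL = ap ιʰ (X ℤring)

  hat-monomial : ∀ k₀ d e → Littlewood.at ℒ n (hat (monomial (ℤ.+ 1) (k₀ ∷ d))) e Lk.≈ (rev d ≡ᵛ e) Lk.▹ Lk.pow qL k₀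
  hat-monomial k₀ d e = Lk.trans (Lk.reflexive (VL.at-cur n _ e)) (go (rev d ≡ᵛ e) ≡.refl)
    where
    value : ∀ b → (rev d ≡ᵛ e) ≡ b → ∀ k → coef (monomial (ℤ.+ 1) (k₀ ∷ d)) e k ≡ (if (k₀ ℕ.≡ᵇ k) ∧ b then ℤ.+ 1 else ℤ.+ 0)
    value b p k = ≡.cong (λ t → if t then ℤ.+ 1 else ℤ.+ 0) (≡.trans (≡ᵇᵥ-≡ᵛ (k₀ ∷ d) (k ∷ rev e)) (≡.cong ((k₀ ℕ.≡ᵇ k) ∧_) (≡.trans (rev-≡ᵛ d e) p)))
    go : ∀ b → (rev d ≡ᵛ e) ≡ b → ap ιʰ (coef (monomial (ℤ.+ 1) (k₀ ∷ d)) e) Lk.≈ b Lk.▹ Lk.pow qL k₀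
    go true p = Lk.trans (Hom.ap-cong ιʰ (λ k → ≡.trans (value true p k) (≡.trans (≡.cong (λ t → if t then ℤ.+ 1 else ℤ.+ 0) (Boolₚ.∧-identityʳ _)) (≡.sym (pow-X k₀ k))))) (Hom.ap-pow ιʰ (X ℤring) k₀)
    go false p = Lk.trans (Hom.ap-cong ιʰ (λ k → ≡.trans (value false p k) (≡.cong (λ t → if t then ℤ.+ 1 else ℤ.+ 0) (Boolₚ.∧-zeroʳ (k₀ ℕ.≡ᵇ k))))) (Hom.ap-0 ιʰ)

  hat-1 : hat 1ₛ ≈ 1#
  hat-1 = VL.at-ext n (λ e → Lk.trans (hat-monomial 0 (zeros n) e) (Lk.trans (Lk.reflexive (≡.cong (λ d → (d ≡ᵛ e) Lk.▹ Lk.1#) (rev-zeros n))) (Lk.sym (AV.at-1 n e))))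

  hat-q : hat qv ≈ ap (cstʰ n) qL
  hat-q = VL.at-ext n (λ e → Lk.trans (Lk.reflexive (≡.cong (λ d → Littlewood.at ℒ n (hat (monomial (ℤ.+ 1) d)) e) (unit-tabulate {suc n} zero)))
    (Lk.trans (hat-monomial 1 (zeros n) e) (Lk.trans (Lk.▹-cong (rev (zeros n) ≡ᵛ e) (λ _ → Lk.*-identityʳ qL)) (Lk.trans (Lk.reflexive (≡.cong (λ d → (d ≡ᵛ e) Lk.▹ qL) (rev-zeros n))) (Lk.sym (AV.at-cst n qL e))))))

  hat-x : ∀ i → hat (xv i) ≈ v (Fin.opposite i)
  hat-x i = VL.at-ext n (λ e → Lk.trans (Lk.reflexive (≡.cong (λ d → Littlewood.at ℒ n (hat (monomial (ℤ.+ 1) d)) e) (unit-tabulate (suc i))))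
    (Lk.trans (hat-monomial 0 (unit i) e) (Lk.trans (Lk.reflexive (≡.cong (λ d → (d ≡ᵛ e) Lk.▹ Lk.1#) (rev-unit i))) (Lk.sym (AV.at-v (Fin.opposite i) e)))))

  hat-^ : ∀ f r → hat (f ^ₛ r) ≈ pow (hat f) r
  hat-^ f zero = hat-1
  hat-^ f (suc r) = trans (hat-* f (f ^ₛ r)) (*-congˡ (hat-^ f r))

  hat-Π : ∀ {I : Set} (F : I → Ser (suc n)) xs → hat (Πₛ (map F xs)) ≈ prodL (λ x → hat (F x)) xs
  hat-Π F [] = hat-1
  hat-Π F (x ∷ xs) = trans (hat-* (F x) (Πₛ (map F xs))) (*-congˡ (hat-Π F xs))

  hat-inv : ∀ f → f (zeros (suc n)) ≡ ℤ.+ 1 → hat f * hat (invₛ f) ≈ 1#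
  hat-inv f f1 = trans (sym (hat-* f (invₛ f))) (trans (hat-cong (Inverse.invₛ-inverse f f1)) hat-1)

-- The q-binomial theorem

module QSeries (T : Ring₀) (q : CommutativeRing.Carrier T) (iD : ℕ → CommutativeRing.Carrier T)
  (iD-inv : ∀ k → CommutativeRing._≈_ T (CommutativeRing._*_ T (CommutativeRing._-_ T (CommutativeRing.1# T) (Kit.pow T q (suc k))) (iD k)) (CommutativeRing.1# T)) where
  open Kit T
  private module P = Kit (PS T)

  dil : A → P.A → P.A
  dil c g l = pow c l * g l

  dil-* : ∀ c g h → dil c (g P.* h) P.≈ dil c g P.* dil c h
  dil-* c g h l = trans (tri-*ˡ (pow c l) _ l) (tri-cong′ l (λ i j e → trans (*-congʳ (trans (reflexive (≡.cong (pow c) (≡.sym e))) (pow-+ c i j)))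
    (solve 4 (λ a b x y → (a :* b) :* (x :* y) := (a :* x) :* (b :* y)) refl _ _ _ _)))

  dil-cong : ∀ c {g h} → g P.≈ h → dil c g P.≈ dil c h
  dil-cong c p l = *-congˡ (p l)

  quad : A → P.A
  quad a = P.1# P.- const T a P.* (X T P.* X T)

  quad-eq : ∀ a g → quad a P.* g P.≈ g P.- const T a P.* (X T P.* (X T P.* g))
  quad-eq a g = P.solve 3 (λ a x g → (P.:1 P.:- a P.:* (x P.:* x)) P.:* g P.:= g P.:- a P.:* (x P.:* (x P.:* g))) P.refl (const T a) (X T) g

  quad-0 : ∀ a g → (quad a P.* g) 0 ≈ g 0
  quad-0 a g = trans (quad-eq a g 0) (trans (+-congˡ (trans (-‿cong (trans (const-* T a (X T P.* (X T P.* g)) 0) (zeroʳ′ (X-*-zero T (X T P.* g))))) -0≈0)) (+-identityʳ _))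

  quad-1 : ∀ a g → (quad a P.* g) 1 ≈ g 1
  quad-1 a g = trans (quad-eq a g 1) (trans (+-congˡ (trans (-‿cong (trans (const-* T a (X T P.* (X T P.* g)) 1) (zeroʳ′ (trans (X-*-suc T (X T P.* g) 0) (X-*-zero T g))))) -0≈0)) (+-identityʳ _))

  quad-suc : ∀ a g l → (quad a P.* g) (2 ℕ.+ l) ≈ g (2 ℕ.+ l) - a * g l
  quad-suc a g l = trans (quad-eq a g (2 ℕ.+ l)) (+-congˡ (-‿cong (trans (const-* T a (X T P.* (X T P.* g)) (2 ℕ.+ l)) (*-congˡ (trans (X-*-suc T (X T P.* g) (suc l)) (X-*-suc T g l))))))

  -- (a x²; q²)_∞
  pt : A → ℕ → A
  pt a zero = 1#
  pt a (suc zero) = 0#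
  pt a (suc (suc l)) = - (((a * pow q l) * pt a l) * iD (suc l))

  -- The functional equation p(x) = (1 - a x²) p(q x) of the infinite product, which the
  -- coefficients were chosen to satisfy. That they belong to the product follows from iterating it,
  -- in `pt-finite` and `pfin-low`.
  pt-fixed : ∀ a → pt a P.≈ quad a P.* dil q (pt a)
  pt-fixed a zero = sym (trans (quad-0 a (dil q (pt a))) (*-identityˡ _))
  pt-fixed a (suc zero) = sym (trans (quad-1 a (dil q (pt a))) (zeroʳ _))
  pt-fixed a (suc (suc l)) = sym (trans (quad-suc a (dil q (pt a)) l) (begin
    Q * (- (c * i)) - a * (pow q l * pt a l)
      ≈⟨ solve 5 (λ Q i a p t → Q :* (:- (((a :* p) :* t) :* i)) :- a :* (p :* t) := (((a :* p) :* t) :* ((:1 :- Q) :* i)) :- ((a :* p) :* t) :- (((a :* p) :* t) :* i)) refl Q i a (pow q l) (pt a l) ⟩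
    (c * ((1# - Q) * i)) - c - c * i
      ≈⟨ +-congʳ (+-congʳ (*-congˡ (iD-inv (suc l)))) ⟩
    (c * 1#) - c - c * i
      ≈⟨ solve 2 (λ c i → (c :* :1) :- c :- c :* i := :- (c :* i)) refl c i ⟩
    - (c * i) ∎))
    where
    Q = pow q (2 ℕ.+ l)
    i = iD (suc l)
    c = (a * pow q l) * pt a l

  -- The equation expresses (1 - q^(l+2)) u_(l+2) by u_l. As the recursion has step 2, two
  -- consecutive coefficients are carried along.
  uniqueness : ∀ b u → u P.≈ quad b P.* dil q u → u 0 ≈ 0# → ∀ l → u l ≈ 0# × u (suc l) ≈ 0#
  uniqueness b u e u0 zero = u0 , unit-cancel (iD-inv 0) (trans (trans (solve 2 (λ q u → (:1 :- q) :* u := u :- q :* u) refl _ _)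
    (trans (+-congʳ (trans (e 1) (quad-1 b (dil q u)))) (-‿inverseʳ _))) (sym (zeroʳ _)))
  uniqueness b u e u0 (suc l) with uniqueness b u e u0 l
  ... | ul , ul₁ = ul₁ , unit-cancel (iD-inv (suc l)) (trans (trans (solve 2 (λ q u → (:1 :- q) :* u := u :- q :* u) refl _ _)
    (trans (+-congʳ (trans (e (2 ℕ.+ l)) (trans (quad-suc b (dil q u) l) (+-congˡ (trans (-‿cong (zeroʳ′ (zeroʳ′ ul))) -0≈0)))))
      (solve 1 (λ x → (x :+ :0) :- x := :0) refl _))) (sym (zeroʳ _)))

  -- The recurrence amounts to (1 - a x²) f(x) = (1 - b x²) f(q x). Hence both sides of the
  -- conclusion solve g(x) = (1 - b x²) g(q x) with constant term 1.
  q-binomial : ∀ a b f → f 0 ≈ 1# → f 1 ≈ 0# → (∀ l → (1# - pow q (2 ℕ.+ l)) * f (2 ℕ.+ l) ≈ (a - b * pow q l) * f l) →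
    pt b P.≈ pt a P.* f
  q-binomial a b f f0 f1 rec l = x-y≈0⇒x≈y (proj₁ (uniqueness b (λ l → pt b l - (pt a P.* f) l) fixed (trans (+-congˡ (-‿cong (trans (*-identityˡ _) f0))) (-‿inverseʳ _)) l))
    where
    f-fixed : quad a P.* f P.≈ quad b P.* dil q f
    f-fixed zero = trans (quad-0 a f) (sym (trans (quad-0 b (dil q f)) (*-identityˡ _)))
    f-fixed (suc zero) = trans (quad-1 a f) (trans f1 (sym (trans (quad-1 b (dil q f)) (zeroʳ′ f1))))
    f-fixed (suc (suc l)) = trans (quad-suc a f l) (sym (trans (quad-suc b (dil q f) l) (x-y≈0⇒x≈y (begin
      (Q * F - b * (p * g)) - (F - a * g)
        ≈⟨ solve 6 (λ Q F b p g a → (Q :* F :- b :* (p :* g)) :- (F :- a :* g) := (a :- b :* p) :* g :- (:1 :- Q) :* F) refl Q F b p g a ⟩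
      (a - b * p) * g - (1# - Q) * F
        ≈⟨ +-congˡ (-‿cong (rec l)) ⟩
      (a - b * p) * g - (a - b * p) * g
        ≈⟨ -‿inverseʳ _ ⟩
      0# ∎))))
      where
      Q = pow q (2 ℕ.+ l)
      F = f (2 ℕ.+ l)
      g = f l
      p = pow q l
    h-fixed : pt a P.* f P.≈ quad b P.* dil q (pt a P.* f)
    h-fixed = P.trans (P.*-congʳ {f} (pt-fixed a)) (P.trans (P.solve 3 (λ A p f → (A P.:* p) P.:* f P.:= p P.:* (A P.:* f)) P.refl (quad a) (dil q (pt a)) f)
      (P.trans (P.*-congˡ {dil q (pt a)} f-fixed) (P.trans (P.solve 3 (λ p B d → p P.:* (B P.:* d) P.:= B P.:* (p P.:* d)) P.refl (dil q (pt a)) (quad b) (dil q f))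
        (P.*-congˡ {quad b} (P.sym (dil-* q (pt a) f))))))
    fixed : (λ l → pt b l - (pt a P.* f) l) P.≈ quad b P.* dil q (λ l → pt b l - (pt a P.* f) l)
    fixed l = trans (+-cong (pt-fixed b l) (-‿cong (h-fixed l))) (trans (P.solve 3 (λ B x y → B P.:* x P.:- B P.:* y P.:= B P.:* (x P.:- y)) P.refl (quad b) (dil q (pt b)) (dil q (pt a P.* f)) l)
      (P.*-congˡ {quad b} (λ l → solve 3 (λ c x y → c :* x :- c :* y := c :* (x :- y)) refl _ _ _) l))

  pfac : A → ℕ → P.A
  pfac a k = P.1# P.- (const T a P.* (X T P.* X T)) P.* P.pow (const T (pow q 2)) k

  pfin : A → ℕ → P.A
  pfin a N = P.prodL (pfac a) (upTo N)

  pfac-dil : ∀ a N → pfac a N P.≈ dil (pow q N) (quad a)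
  pfac-dil a N = P.trans (P.+-congˡ (P.-‿cong (P.*-congˡ {const T a P.* (X T P.* X T)} (P.trans (P.sym (Hom.ap-pow (constHom T) (pow q 2) N)) (Hom.ap-cong (constHom T) powsq))))) go
    where
    qN = pow q N
    powsq : pow (pow q 2) N ≈ pow qN 2
    powsq = trans (pow-* q (q * 1#) N) (*-congˡ (trans (pow-cong N (*-identityʳ q)) (sym (*-identityʳ qN))))
    expand : ∀ e → P.1# P.- (const T a P.* (X T P.* X T)) P.* const T e P.≈ P.1# P.- const T (a * e) P.* (X T P.* (X T P.* P.1#))
    expand e = P.trans (P.solve 3 (λ a x e → P.:1 P.:- (a P.:* (x P.:* x)) P.:* e P.:= P.:1 P.:- (a P.:* e) P.:* (x P.:* (x P.:* P.:1))) P.refl (const T a) (X T) (const T e))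
      (P.+-congˡ (P.-‿cong (P.*-congʳ {X T P.* (X T P.* P.1#)} (P.sym (Hom.ap-* (constHom T) a e)))))
    as-quad : P.1# P.- (const T a P.* (X T P.* X T)) P.* const T (pow qN 2) P.≈ quad (a * pow qN 2) P.* P.1#
    as-quad = P.trans (expand (pow qN 2)) (P.sym (quad-eq (a * pow qN 2) P.1#))
    quad1 : quad a P.≈ quad a P.* P.1#
    quad1 = P.sym (P.*-identityʳ (quad a))
    go : P.1# P.- (const T a P.* (X T P.* X T)) P.* const T (pow qN 2) P.≈ dil qN (quad a)
    go zero = trans (as-quad 0) (trans (quad-0 _ P.1#) (sym (trans (*-identityˡ _) (trans (quad1 0) (quad-0 a P.1#)))))
    go (suc zero) = trans (as-quad 1) (trans (quad-1 _ P.1#) (sym (trans (*-congˡ (trans (quad1 1) (quad-1 a P.1#))) (zeroʳ _))))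
    go (suc (suc l)) = trans (as-quad (2 ℕ.+ l)) (trans (quad-suc _ P.1# l) (sym (trans (*-congˡ (trans (quad1 (2 ℕ.+ l)) (quad-suc a P.1# l))) (coefficient l))))
      where
      coefficient : ∀ l → pow qN (2 ℕ.+ l) * (0# - a * P.1# l) ≈ 0# - (a * pow qN 2) * P.1# l
      coefficient zero = solve 2 (λ n a → (n :* (n :* :1)) :* (:0 :- a :* :1) := :0 :- (a :* (n :* (n :* :1))) :* :1) refl qN a
      coefficient (suc l) = solve 3 (λ p n a → p :* (:0 :- a :* :0) := :0 :- (a :* (n :* (n :* :1))) :* :0) refl _ qN a

  pt-finite : ∀ a N → pt a P.≈ pfin a N P.* dil (pow q N) (pt a)
  pt-finite a zero = P.sym (P.trans (P.*-identityˡ _) (λ l → trans (*-congʳ (pow-1 l)) (*-identityˡ _)))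
  pt-finite a (suc N) = P.trans (pt-finite a N) (P.trans (P.*-congˡ {pfin a N} step) (P.trans (P.sym (P.*-assoc (pfin a N) (pfac a N) (dil (pow q (suc N)) (pt a))))
      (P.*-congʳ {dil (pow q (suc N)) (pt a)} (P.sym last))))
    where
    step : dil (pow q N) (pt a) P.≈ pfac a N P.* dil (pow q (suc N)) (pt a)
    step = P.trans (dil-cong (pow q N) (pt-fixed a)) (P.trans (dil-* (pow q N) (quad a) (dil q (pt a))) (P.*-cong (P.sym (pfac-dil a N))
      (λ l → trans (sym (*-assoc _ _ _)) (*-congʳ (trans (sym (pow-* (pow q N) q l)) (pow-cong l (*-comm _ _)))))))
    last : pfin a (suc N) P.≈ pfin a N P.* pfac a N
    last = P.trans (P.reflexive (≡.cong (P.prodL (pfac a)) (≡.sym (Lₚ.applyUpTo-∷ʳ id N)))) (snoc (upTo N))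
      where
      snoc : ∀ xs → P.prodL (pfac a) (xs ++ N ∷ []) P.≈ P.prodL (pfac a) xs P.* pfac a N
      snoc [] = P.*-comm (pfac a N) P.1#
      snoc (x ∷ xs) = P.trans (P.*-congˡ {pfac a x} (snoc xs)) (P.sym (P.*-assoc (pfac a x) (P.prodL (pfac a) xs) (pfac a N)))

-- Constant terms and q-Pochhammer symbols

ct : ∀ {m} → Ser m → ℤ
ct {m} f = f (zeros m)

ct-* : ∀ {m} (f g : Ser m) → ct (f *ₛ g) ≡ ct f ℤ.* ct g
ct-* {m} f g = ≡.trans (*ₛ-Bc f g (zeros m)) (go m (λ d r → f d ℤ.* g r))
  where
  go : ∀ m Θ → Bz.Bc (zeros m) Θ ≡ Θ (zeros m) (zeros m)
  go zero Θ = ≡.refl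
  go (suc m) Θ = go m _

ct-1 : ∀ m → ct (1ₛ {m}) ≡ ℤ.+ 1
ct-1 m = ≡.cong (λ b → if b then ℤ.+ 1 else ℤ.+ 0) (≡.trans (≡ᵇᵥ-≡ᵛ (zeros m) (zeros m)) (true-≡ᵛ {d = zeros m} ≡.refl))

ct-var : ∀ {m} (i : Fin m) → ct (var i) ≡ ℤ.+ 0
ct-var {m} i = ≡.cong (λ b → if b then ℤ.+ 1 else ℤ.+ 0) (≡.trans (≡ᵇᵥ-≡ᵛ (Vec.tabulate (λ j → if does (i Fin.≟ j) then 1 else 0)) (zeros m)) (≡.trans (≡.cong (_≡ᵛ zeros m) (unit-tabulate i)) (go i)))
  where
  go : ∀ {m} (i : Fin m) → (unit i ≡ᵛ zeros m) ≡ false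
  go {suc m} zero = ≡.refl
  go {suc m} (suc i) = go i

ct-*0 : ∀ {m} (f g : Ser m) → ct f ≡ ℤ.+ 0 → ct (f *ₛ g) ≡ ℤ.+ 0
ct-*0 f g e = ≡.trans (ct-* f g) (≡.trans (≡.cong (ℤ._* ct g) e) (ℤₚ.*-zeroˡ (ct g)))

ct-1- : ∀ {m} (f : Ser m) → ct f ≡ ℤ.+ 0 → ct (1ₛ -ₛ f) ≡ ℤ.+ 1
ct-1- {m} f e = ≡.cong₂ ℤ._-_ (ct-1 m) e

ct-Π : ∀ {m} {I : Set} (F : I → Ser m) xs → (∀ x → ct (F x) ≡ ℤ.+ 1) → ct (Πₛ (map F xs)) ≡ ℤ.+ 1
ct-Π {m} F [] e = ct-1 m
ct-Π F (x ∷ xs) e = ≡.trans (ct-* (F x) (Πₛ (map F xs))) (≡.cong₂ ℤ._*_ (e x) (ct-Π F xs e))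

ct-qPoch : ∀ {m} (a t : Ser m) → ct a ≡ ℤ.+ 0 → ct (qPoch a t) ≡ ℤ.+ 1
ct-qPoch {m} a t e = ct-Π (λ k → 1ₛ -ₛ a *ₛ (t ^ₛ k)) (upTo (suc (deg (zeros m)))) (λ k → ct-1- (a *ₛ (t ^ₛ k)) (ct-*0 a (t ^ₛ k) e))

q⁰ : Kit.A ℤq
q⁰ = X ℤring

module H⁰ (n : ℕ) = HatFacts ℤq idʰ n

-- The case of no variables x: `hat` then turns the inverse taken in `Ser 1` into an element of
-- ℤ[[q]].
iDz : ℕ → Kit.A ℤq
iDz k = H⁰.hat 0 (invₛ (1ₛ -ₛ qv ^ₛ suc k))

iDz-inv : ∀ k → CommutativeRing._≈_ ℤq (CommutativeRing._*_ ℤq (CommutativeRing._-_ ℤq (CommutativeRing.1# ℤq) (Kit.pow ℤq q⁰ (suc k))) (iDz k)) (CommutativeRing.1# ℤq)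
iDz-inv k = P.trans (P.*-congʳ {iDz k} (P.sym (P.trans (H⁰.hat-- 0 1ₛ (qv ^ₛ suc k)) (P.+-cong (H⁰.hat-1 0) (P.-‿cong (P.trans (H⁰.hat-^ 0 qv (suc k)) (P.pow-cong (suc k) (H⁰.hat-q 0))))))))
  (H⁰.hat-inv 0 (1ₛ -ₛ qv ^ₛ suc k) (ct-1- {1} (qv ^ₛ suc k) (ct-*0 {1} qv (qv ^ₛ k) (ct-var {1} zero))))
  where module P = Kit ℤq

module Q⁰ = QSeries ℤq q⁰ iDz iDz-inv

low : ∀ N y k → k < N → CommutativeRing._*_ ℤq (Kit.pow ℤq q⁰ N) y k ≡ ℤ.+ 0
low (suc N) y k lt = ≡.trans (P.*-assoc q⁰ (P.pow q⁰ N) y k) (go k lt)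
  where
  module P = Kit ℤq
  go : ∀ k → k < suc N → (q⁰ P.* (P.pow q⁰ N P.* y)) k ≡ ℤ.+ 0
  go zero _ = X-*-zero ℤring (P.pow q⁰ N P.* y)
  go (suc k) (s≤s lt) = ≡.trans (X-*-suc ℤring (P.pow q⁰ N P.* y) k) (low N y k lt)

-- By `pt-finite` the omitted factors amount to p(q^N x), which is 1 plus terms divisible by q^N.
pfin-low : ∀ a N m k → k < N → Q⁰.pfin a N m k ≡ Q⁰.pt a m k
pfin-low a N m k lt = ≡.sym (≡.trans (Q⁰.pt-finite a N m k) (≡.trans (tri-at _ m) (≡.trans (Z.tri-swap (λ i j → (f i P.* (P.pow c j P.* g j)) k) m)
    (≡.trans (Z.tri-head (λ j i → (f i P.* (P.pow c j P.* g j)) k) m (λ j i _ → ≡.trans (P.solve 4 (λ f c p g → f P.:* ((c P.:* p) P.:* g) P.:= c P.:* (f P.:* (p P.:* g))) P.refl (f i) c (P.pow c j) (g (suc j)) k) (low N _ k lt)))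
      (P.solve 1 (λ f → f P.:* (P.:1 P.:* P.:1) P.:= f) P.refl (f m) k)))))
  where
  module P = Kit ℤq
  c = P.pow q⁰ N
  f = Q⁰.pfin a N
  g = Q⁰.pt a
  tri-at : ∀ (h : ℕ → ℕ → P.A) m → P.tri h m k ≡ Z.tri (λ i j → h i j k) m
  tri-at h zero = ≡.refl
  tri-at h (suc m) = ≡.cong (λ x → h 0 (suc m) k ℤ.+ x) (tri-at (λ i → h (suc i)) m)

-- Carried out over ℤ[[q]], because the truncation in `Π∞` depends on the exponent of q and so has
-- to be checked on single coefficients; `hat-qPoch` transports the result to Laurent series.
module QPochCoef (n : ℕ) (j : Fin n) (α : Kit.A ℤq) (a : Ser (suc n))
  (ha : CommutativeRing._≈_ (MPS ℤq n) (H⁰.hat n a) (CommutativeRing._*_ (MPS ℤq n) (ap (Variables.cstʰ ℤq n) α) (CommutativeRing._*_ (MPS ℤq n) (Variables.v ℤq j) (Variables.v ℤq j)))) where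
  open Kit (MPS ℤq n)
  open Variables ℤq using (cstʰ; v; ser; serʰ; ser-X; ser-const)
  open HatFacts ℤq idʰ n
  private
    module P = Kit ℤq
    module PP = Kit (PS ℤq)
    module AV = AtVariables ℤq
    module s = Hom (serʰ j)
    t : Ser (suc n)
    t = qv ^ₛ 2
    F : ℕ → Ser (suc n)
    F k = 1ₛ -ₛ a *ₛ (t ^ₛ k)

  factor : ∀ k → hat (F k) ≈ ser (Q⁰.pfac α k) j
  factor k = begin
    hat (F k)
      ≈⟨ trans (hat-- 1ₛ (a *ₛ (t ^ₛ k))) (+-cong hat-1 (-‿cong (trans (hat-* a (t ^ₛ k)) (*-cong ha (trans (hat-^ t k) (pow-cong k (trans (hat-^ qv 2) (pow-cong 2 hat-q)))))))) ⟩
    1# - (ap (cstʰ n) α * (v j * v j)) * pow (pow (ap (cstʰ n) q⁰) 2) k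
      ≈⟨ +-congˡ (-‿cong (*-cong (trans (s.ap-* _ _) (*-cong (ser-const j α) (trans (s.ap-* _ _) (*-cong (ser-X j) (ser-X j)))))
           (trans (s.ap-pow (const ℤq (P.pow q⁰ 2)) k) (pow-cong k (trans (ser-const j (P.pow q⁰ 2)) (Hom.ap-pow (cstʰ n) q⁰ 2)))))) ⟨
    1# - ser (const ℤq α PP.* (X ℤq PP.* X ℤq)) j * ser (PP.pow (const ℤq (P.pow q⁰ 2)) k) j
      ≈⟨ sym (trans (s.ap-- PP.1# _) (+-cong s.ap-1 (-‿cong (s.ap-* _ _)))) ⟩
    ser (Q⁰.pfac α k) j ∎

  finite : ∀ N → hat (Πₛ (map F (upTo N))) ≈ ser (Q⁰.pfin α N) j
  finite N = trans (hat-Π F (upTo N)) (trans (prodL-cong factor (upTo N)) (sym (s.ap-prodL (Q⁰.pfac α) (upTo N))))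

  qPoch-coef : ∀ e k → coef (qPoch a t) e k ≡ AV.sel j e (Q⁰.pt α) k
  qPoch-coef e k = ≡.trans (≡.sym (≡.cong (λ y → y k) (VecConv.at-cur ℤq n (coef (Πₛ (map F (upTo N)))) e))) (≡.trans (Littlewood.at-cong ℤq n (finite N) e k)
      (≡.trans (AV.at-ser (Q⁰.pfin α N) j e k) (sel-at j e (λ m → pfin-low α N m k (s≤s (ℕₚ.m≤m+n k _))))))
    where
    -- The number of factors kept by `Π∞` at this exponent. It exceeds k, as `pfin-low` requires.
    N = suc (deg (k ∷ rev e))
    ▹-at : ∀ b (x y : P.A) → x k ≡ y k → P._▹_ b x k ≡ P._▹_ b y k
    ▹-at true x y e = e
    ▹-at false x y e = ≡.refl
    sel-at : ∀ {n} (j : Fin n) e {g h : ℕ → P.A} → (∀ m → g m k ≡ h m k) → AV.sel j e g k ≡ AV.sel j e h k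
    sel-at {suc n} zero (a ∷ e) p = ▹-at (zeros n ≡ᵛ e) _ _ (p a)
    sel-at {suc n} (suc j) (a ∷ e) p = ▹-at (0 ℕ.≡ᵇ a) _ _ (sel-at j e p)

prod-∷ʳ-fins : ∀ (R : Ring₀) → let open Kit R in ∀ n (g : Fin (suc n) → A) → prodL g (fins (suc n)) ≈ prodL (g ∘ Fin.inject₁) (fins n) * g (Fin.fromℕ n)
prod-∷ʳ-fins R zero g = Kit.*-comm R _ _
prod-∷ʳ-fins R (suc n) g = trans (*-congˡ (trans (reflexive (prodL-map g suc (fins (suc n)))) (trans (prod-∷ʳ-fins R n (g ∘ suc)) (*-congʳ (reflexive (≡.sym (prodL-map (g ∘ Fin.inject₁) suc (fins n))))))))
  (sym (*-assoc _ _ _))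
  where open Kit R

prod-opposite : ∀ (R : Ring₀) → let open Kit R in ∀ n (g : Fin n → A) → prodL (g ∘ Fin.opposite) (fins n) ≈ prodL g (fins n)
prod-opposite R zero g = Kit.refl R
prod-opposite R (suc n) g = trans (*-congˡ (trans (reflexive (prodL-map (g ∘ Fin.opposite) suc (fins n))) (prod-opposite R n (g ∘ Fin.inject₁)))) (trans (*-comm _ _) (sym (prod-∷ʳ-fins R n g)))
  where open Kit R

allFin≡fins : ∀ n → L.allFin n ≡ fins n
allFin≡fins zero = ≡.refl
allFin≡fins (suc n) = ≡.cong (zero ∷_) (≡.trans (≡.sym (Lₚ.map-tabulate id suc)) (≡.cong (map suc) (allFin≡fins n)))

module DoubleProducts (R : Ring₀) where
  open Kit R

  pick₁ : Bool → A → A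
  pick₁ b x = if b then x else 1#

  prod-swap : ∀ {I J : Set} (g : I → J → A) xs ys → prodL (λ i → prodL (g i) ys) xs ≈ prodL (λ j → prodL (λ i → g i j) xs) ys
  prod-swap g [] ys = sym (prodL-1 (λ _ → refl) ys)
  prod-swap g (x ∷ xs) ys = trans (*-congˡ (prod-swap g xs ys)) (sym (prodL-* _ _ ys))

  lt : ∀ {n} → Fin n → Fin n → Bool
  lt i j = Fin.toℕ i ℕ.<ᵇ Fin.toℕ j

  pairs-prod : ∀ n (g : Fin n → Fin n → A) → prodL (λ { (i , j) → g i j }) (pairs n) ≈ prodL (λ i → prodL (λ j → pick₁ (lt i j) (g i j)) (fins n)) (fins n)
  pairs-prod n g = trans (reflexive (≡.cong (λ l → prodL (λ { (i , j) → g i j }) (concatMap (λ i → map (i ,_) (L.filter (λ j → i Fin.<? j) l)) l)) (allFin≡fins n))) (go (fins n))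
    where
    inner : ∀ i xs → prodL (λ { (i , j) → g i j }) (map (i ,_) (L.filter (λ j → i Fin.<? j) xs)) ≈ prodL (λ j → pick₁ (lt i j) (g i j)) xs
    inner i [] = refl
    inner i (x ∷ xs) with Fin.toℕ i ℕ.<ᵇ Fin.toℕ x
    ... | true = *-congˡ (inner i xs)
    ... | false = trans (inner i xs) (sym (*-identityˡ _))
    split : ∀ (us : List (Fin n × Fin n)) vs → prodL (λ { (i , j) → g i j }) (us ++ vs) ≈ prodL (λ { (i , j) → g i j }) us * prodL (λ { (i , j) → g i j }) vs
    split [] vs = sym (*-identityˡ _)
    split (u ∷ us) vs = trans (*-congˡ (split us vs)) (sym (*-assoc _ _ _))
    go : ∀ xs → prodL (λ { (i , j) → g i j }) (concatMap (λ i → map (i ,_) (L.filter (λ j → i Fin.<? j) (fins n))) xs) ≈ prodL (λ i → prodL (λ j → pick₁ (lt i j) (g i j)) (fins n)) xs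
    go [] = refl
    go (x ∷ xs) = trans (split (map (x ,_) (L.filter (λ j → x Fin.<? j) (fins n))) _) (*-cong (inner x (fins n)) (go xs))

  pairProd-double : ∀ n (g : Fin n → Fin n → A) → Pick.pairProd R g (fins n) ≈ prodL (λ i → prodL (λ j → pick₁ (lt i j) (g i j)) (fins n)) (fins n)
  pairProd-double zero g = refl
  pairProd-double (suc n) g = *-cong (trans (trans (reflexive (prodL-map (g zero) suc (fins n))) (reflexive (≡.sym (prodL-map (λ j → pick₁ (lt zero j) (g zero j)) suc (fins n))))) (sym (*-identityˡ _)))
    (trans (trans (reflexive (pairProd-map (fins n))) (pairProd-double n (λ i j → g (suc i) (suc j)))) (sym (trans (reflexive (prodL-map (λ i → prodL (λ j → pick₁ (lt i j) (g i j)) (fins (suc n))) suc (fins n)))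
      (prodL-cong (λ i → trans (*-identityˡ _) (reflexive (prodL-map (λ j → pick₁ (lt (suc i) j) (g (suc i) j)) suc (fins n)))) (fins n)))))
    where
    pairProd-map : ∀ xs → Pick.pairProd R g (map suc xs) ≡ Pick.pairProd R (λ i j → g (suc i) (suc j)) xs
    pairProd-map [] = ≡.refl
    pairProd-map (x ∷ xs) = ≡.cong₂ _*_ (prodL-map (g (suc x)) suc xs) (pairProd-map xs)

  -- `hat` reverses the order of the variables and so turns i < j into i > j, which does not matter
  -- for symmetric g.
  pairs-opposite : ∀ n (g : Fin n → Fin n → A) → (∀ i j → g i j ≈ g j i) →
    prodL (λ { (i , j) → g (Fin.opposite i) (Fin.opposite j) }) (pairs n) ≈ Pick.pairProd R g (fins n)
  pairs-opposite n g g-sym = begin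
    prodL (λ { (i , j) → g (op i) (op j) }) (pairs n)
      ≈⟨ pairs-prod n (λ i j → g (op i) (op j)) ⟩
    prodL (λ i → prodL (λ j → h i j) (fins n)) (fins n)
      ≈⟨ prod-opposite R n (λ i → prodL (λ j → h i j) (fins n)) ⟨
    prodL (λ i → prodL (λ j → h (op i) j) (fins n)) (fins n)
      ≈⟨ prodL-cong (λ i → prod-opposite R n (λ j → h (op i) j)) (fins n) ⟨
    prodL (λ i → prodL (λ j → h (op i) (op j)) (fins n)) (fins n)
      ≈⟨ prodL-cong (λ i → prodL-cong (λ j → trans (reflexive (≡.cong₂ pick₁ (lt-op i j) (≡.cong₂ g (Finₚ.opposite-involutive i) (Finₚ.opposite-involutive j)))) (pick-cong₁ (lt j i) (g-sym i j))) (fins n)) (fins n) ⟩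
    prodL (λ i → prodL (λ j → pick₁ (lt j i) (g j i)) (fins n)) (fins n)
      ≈⟨ prod-swap (λ i j → pick₁ (lt j i) (g j i)) (fins n) (fins n) ⟩
    prodL (λ j → prodL (λ i → pick₁ (lt j i) (g j i)) (fins n)) (fins n)
      ≈⟨ pairProd-double n g ⟨
    Pick.pairProd R g (fins n) ∎
    where
    op : Fin n → Fin n
    op = Fin.opposite
    h : Fin n → Fin n → A
    h i j = pick₁ (lt i j) (g (op i) (op j))
    pick-cong₁ : ∀ b {x y} → x ≈ y → pick₁ b x ≈ pick₁ b y
    pick-cong₁ true p = p
    pick-cong₁ false p = refl
    lt-op : ∀ i j → lt (op i) (op j) ≡ lt j i
    lt-op i j = bool-iff
      (λ e → true-< (ℕₚ.≰⇒> (λ le → ℕₚ.<⇒≱ (≡.subst₂ _<_ (Finₚ.opposite-prop i) (Finₚ.opposite-prop j) (<-true e)) (ℕₚ.∸-monoʳ-≤ n (s≤s le)))))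
      (λ e → true-< (≡.subst₂ _<_ (≡.sym (Finₚ.opposite-prop i)) (≡.sym (Finₚ.opposite-prop j)) (ℕₚ.∸-monoʳ-< (s≤s (<-true e)) (Finₚ.toℕ<n i))))
      where
      <-true : ∀ {m n} → (m ℕ.<ᵇ n) ≡ true → m < n
      <-true {m} {n} e = ℕₚ.<ᵇ⇒< m n (Equivalence.from Boolₚ.T-≡ e)
      true-< : ∀ {m n} → m < n → (m ℕ.<ᵇ n) ≡ true
      true-< lt = Equivalence.to Boolₚ.T-≡ (ℕₚ.<⇒<ᵇ lt)

-- The right-hand sides as products of one-variable series and geometric series

module RhsHat (ℒ : Ring₀) (ιʰ : Hom ℤq ℒ) (n : ℕ) where
  open Kit (MPS ℒ n)
  open HatFacts ℒ ιʰ n public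
  open Variables ℒ using (v; cstʰ; ser; serʰ; geo; geo-inv; geoProd)
  private
    module Lk = Kit ℒ
    module P = Kit ℤq
    module AV = AtVariables ℒ
    module A⁰ = AtVariables ℤq
    op : Fin n → Fin n
    op = Fin.opposite

  iDL : ℕ → Lk.A
  iDL k = ap ιʰ (iDz k)

  iDL-inv : ∀ k → (Lk.1# Lk.- Lk.pow qL (suc k)) Lk.* iDL k Lk.≈ Lk.1#
  iDL-inv k = Lk.trans (Lk.*-congʳ (Lk.sym (Lk.trans (Hom.ap-- ιʰ P.1# _) (Lk.+-cong (Hom.ap-1 ιʰ) (Lk.-‿cong (Hom.ap-pow ιʰ (X ℤring) (suc k)))))))
    (Lk.trans (Lk.sym (Hom.ap-* ιʰ (P.1# P.- P.pow q⁰ (suc k)) (iDz k))) (Lk.trans (Hom.ap-cong ιʰ (iDz-inv k)) (Hom.ap-1 ιʰ)))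

  module QL = QSeries ℒ qL iDL iDL-inv

  pt-ι : ∀ α l → ap ιʰ (Q⁰.pt α l) Lk.≈ QL.pt (ap ιʰ α) l
  pt-ι α zero = Hom.ap-1 ιʰ
  pt-ι α (suc zero) = Hom.ap-0 ιʰ
  pt-ι α (suc (suc l)) = Lk.trans (Hom.ap-neg ιʰ (((α P.* P.pow q⁰ l) P.* Q⁰.pt α l) P.* iDz (suc l))) (Lk.-‿cong (Lk.trans (Hom.ap-* ιʰ ((α P.* P.pow q⁰ l) P.* Q⁰.pt α l) (iDz (suc l))) (Lk.*-congʳ
    (Lk.trans (Hom.ap-* ιʰ (α P.* P.pow q⁰ l) (Q⁰.pt α l)) (Lk.*-cong (Lk.trans (Hom.ap-* ιʰ α (P.pow q⁰ l)) (Lk.*-congˡ (Hom.ap-pow ιʰ q⁰ l))) (pt-ι α l))))))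

  -- `a` represents α x_i²; the opposite index is the one that `hat` assigns to x_i.
  Quadratic : P.A → Fin n → Ser (suc n) → Set
  Quadratic α i a = CommutativeRing._≈_ (MPS ℤq n) (H⁰.hat n a)
    (CommutativeRing._*_ (MPS ℤq n) (ap (Variables.cstʰ ℤq n) α) (CommutativeRing._*_ (MPS ℤq n) (Variables.v ℤq (op i)) (Variables.v ℤq (op i))))

  hat-qPoch : ∀ α i a → Quadratic α i a → hat (qPoch a (qv ^ₛ 2)) ≈ ser (QL.pt (ap ιʰ α)) (op i)
  hat-qPoch α i a ha = VecConv.at-ext ℒ n (λ e → Lk.trans (Lk.reflexive (VecConv.at-cur ℒ n _ e)) (Lk.trans (Hom.ap-cong ιʰ (λ k → QPochCoef.qPoch-coef n (op i) α a ha e k))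
      (Lk.trans (sel-ι (op i) e) (Lk.sym (AV.at-ser (QL.pt (ap ιʰ α)) (op i) e)))))
    where
    ▹-ι : ∀ b x → ap ιʰ (b P.▹ x) Lk.≈ b Lk.▹ ap ιʰ x
    ▹-ι true x = Lk.refl
    ▹-ι false x = Hom.ap-0 ιʰ
    sel-ι : ∀ {n} (j : Fin n) e → ap ιʰ (A⁰.sel j e (Q⁰.pt α)) Lk.≈ AV.sel j e (QL.pt (ap ιʰ α))
    sel-ι {suc n} zero (a ∷ e) = Lk.trans (▹-ι (zeros n ≡ᵛ e) (Q⁰.pt α a)) (Lk.▹-cong (zeros n ≡ᵛ e) (λ _ → pt-ι α a))
    sel-ι {suc n} (suc j) (a ∷ e) = Lk.trans (▹-ι (0 ℕ.≡ᵇ a) (A⁰.sel j e (Q⁰.pt α))) (Lk.▹-cong (0 ℕ.≡ᵇ a) (λ _ → sel-ι j e))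

  hat-cross : hat (crossProd n) ≈ geoProd n (fins n)
  hat-cross = trans (hat-Π _ (pairs n)) (trans (prodL-cong (λ { (i , j) → inverse-unique (hat-inv (1ₛ -ₛ xv i *ₛ xv j) (ct-1- (xv i *ₛ xv j) (ct-*0 (xv i) (xv j) (ct-var (suc i)))))
      (trans (*-congʳ (trans (hat-- 1ₛ (xv i *ₛ xv j)) (+-cong hat-1 (-‿cong (trans (hat-* (xv i) (xv j)) (*-cong (hat-x i) (hat-x j))))))) (geo-inv (op i) (op j))) }) (pairs n))
    (DoubleProducts.pairs-opposite (MPS ℒ n) n geo geo-sym))
    where
    geo-sym : ∀ i j → geo i j ≈ geo j i
    geo-sym i j = inverse-unique (geo-inv i j) (trans (*-congʳ (+-congˡ (-‿cong (*-comm _ _)))) (geo-inv j i))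

  -- The hypotheses on f are those of `q-binomial`, so each quotient of Pochhammer symbols is f at
  -- its variable. The denominator is invertible since its constant term is 1.
  hat-rhs : ∀ α β (a b : Fin n → Ser (suc n)) → (∀ i → Quadratic α i (a i)) → (∀ i → Quadratic β i (b i)) → (∀ i → ct (a i) ≡ ℤ.+ 0) →
    ∀ f → f 0 Lk.≈ Lk.1# → f 1 Lk.≈ Lk.0# → (∀ l → (Lk.1# Lk.- Lk.pow qL (2 ℕ.+ l)) Lk.* f (2 ℕ.+ l) Lk.≈ (ap ιʰ α Lk.- ap ιʰ β Lk.* Lk.pow qL l) Lk.* f l) →
    hat (Πₛ (map (λ i → qPoch (b i) (qv ^ₛ 2) *ₛ invₛ (qPoch (a i) (qv ^ₛ 2))) (L.allFin n)) *ₛ crossProd n) ≈ Littlewood.product ℒ n f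
  hat-rhs α β a b ha hb ca f f0 f1 rec = trans (hat-* (Πₛ (map G (L.allFin n))) (crossProd n)) (*-cong (trans (hat-Π G (L.allFin n)) (trans (prodL-cong factor (L.allFin n))
      (trans (reflexive (≡.cong (prodL (λ i → ser f (op i))) (allFin≡fins n))) (prod-opposite (MPS ℒ n) n (ser f))))) hat-cross)
    where
    t : Ser (suc n)
    t = qv ^ₛ 2
    G : Fin n → Ser (suc n)
    G i = qPoch (b i) t *ₛ invₛ (qPoch (a i) t)
    factor : ∀ i → hat (qPoch (b i) t *ₛ invₛ (qPoch (a i) t)) ≈ ser f (op i)
    factor i = begin
      hat (qPoch (b i) t *ₛ invₛ (qPoch (a i) t))
        ≈⟨ hat-* (qPoch (b i) t) (invₛ (qPoch (a i) t)) ⟩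
      hat (qPoch (b i) t) * inv
        ≈⟨ *-congʳ (trans (hat-qPoch β i (b i) (hb i)) (trans (Hom.ap-cong (serʰ (op i)) (QL.q-binomial (ap ιʰ α) (ap ιʰ β) f f0 f1 rec)) (Hom.ap-* (serʰ (op i)) _ f))) ⟩
      (ser (QL.pt (ap ιʰ α)) (op i) * ser f (op i)) * inv
        ≈⟨ *-congʳ (*-congʳ (hat-qPoch α i (a i) (ha i))) ⟨
      (hat (qPoch (a i) t) * ser f (op i)) * inv
        ≈⟨ solve 3 (λ p f i → (p :* f) :* i := (p :* i) :* f) refl _ _ _ ⟩
      (hat (qPoch (a i) t) * inv) * ser f (op i)
        ≈⟨ trans (*-congʳ (hat-inv (qPoch (a i) t) (ct-qPoch (a i) t (ca i)))) (*-identityˡ _) ⟩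
      ser f (op i) ∎
      where inv = hat (invₛ (qPoch (a i) t))

module _ (n : ℕ) where
  private
    module H = H⁰ n
    module M = Kit (MPS ℤq n)
    module P = Kit ℤq
    module V = Variables ℤq
    c : Hom ℤq (MPS ℤq n)
    c = V.cstʰ n
    sq : ∀ i → H.hat (xv i ^ₛ 2) M.≈ V.v (Fin.opposite i) M.* V.v (Fin.opposite i)
    sq i = M.trans (H.hat-^ (xv i) 2) (M.*-cong (H.hat-x i) (M.trans (M.*-identityʳ _) (H.hat-x i)))

  quadratic₀ : ∀ i → H.hat (xv i ^ₛ 2) M.≈ ap c P.1# M.* (V.v (Fin.opposite i) M.* V.v (Fin.opposite i))
  quadratic₀ i = M.trans (sq i) (M.trans (M.sym (M.*-identityˡ _)) (M.*-congʳ (M.sym (Hom.ap-1 c))))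

  quadratic₁ : ∀ i → H.hat (qv *ₛ xv i ^ₛ 2) M.≈ ap c q⁰ M.* (V.v (Fin.opposite i) M.* V.v (Fin.opposite i))
  quadratic₁ i = M.trans (H.hat-* qv (xv i ^ₛ 2)) (M.*-cong H.hat-q (sq i))

  quadratic₂ : ∀ i → H.hat (qv ^ₛ 2 *ₛ xv i ^ₛ 2) M.≈ ap c (P.pow q⁰ 2) M.* (V.v (Fin.opposite i) M.* V.v (Fin.opposite i))
  quadratic₂ i = M.trans (H.hat-* (qv ^ₛ 2) (xv i ^ₛ 2)) (M.*-cong (M.trans (H.hat-^ qv 2) (M.trans (M.pow-cong 2 H.hat-q) (M.sym (Hom.ap-pow c q⁰ 2)))) (sq i))

-- Coefficients of Laurent series

lookZ : (ℕ → ℤ) → ℤ → ℤ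
lookZ f (ℤ.+ j) = f j
lookZ f -[1+ j ] = ℤ.+ 0

shiftCoeff-lookZ : ∀ {n} s (f : Ser (suc n)) k e → shiftCoeff s f k e ≡ lookZ (λ j → f (j ∷ e)) (k ℤ.- s)
shiftCoeff-lookZ s f k e with k ℤ.- s
... | ℤ.+ j = ≡.refl
... | -[1+ j ] = ≡.refl

-- The interface through which Laurent series are used from here on; the fractions behind `laurent`
-- stay hidden. `coeffZ` extracts the coefficient of q^k for integral k and so turns an equation in
-- the ring into one between integers.
record Laurent : Set₁ where
  field
    Q : QRing
  open QRing Q
  field
    ιʰ : Hom ℤq R
    qz-ι : ∀ m → qz (ℤ.+ m) ≈ pow (ap ιʰ q⁰) m
    coeffZ : A → ℤ → ℤ
    coeffZ-cong : ∀ {x y} → x ≈ y → ∀ k → coeffZ x k ≡ coeffZ y k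
    coeffZ-+ : ∀ x y k → coeffZ (x + y) k ≡ coeffZ x k ℤ.+ coeffZ y k
    coeffZ-0 : ∀ k → coeffZ 0# k ≡ ℤ.+ 0
    coeffZ-shift : ∀ s f k → coeffZ (qz s * ap ιʰ f) k ≡ lookZ f (k ℤ.- s)

laurent : Laurent
laurent = record
  { Q = record
    { R = Lo.loc ; qz = Lo.qz ; qz-0 = λ _ → ≡.refl ; qz-+ = Lo.qz-+ ; iD = λ k → Lo.ι (iDz k)
    ; iD-inv = λ k → Lk.trans {i = (Lk.1# Lk.- Lo.ι (P.pow q⁰ (suc k))) Lk.* Lo.ι (iDz k)} {j = Lo.ι ((P.1# P.- P.pow q⁰ (suc k)) P.* iDz k)} {k = Lk.1#}
        (Lk.trans {i = (Lk.1# Lk.- Lo.ι (P.pow q⁰ (suc k))) Lk.* Lo.ι (iDz k)} {j = Lo.ι (P.1# P.- P.pow q⁰ (suc k)) Lk.* Lo.ι (iDz k)} {k = Lo.ι ((P.1# P.- P.pow q⁰ (suc k)) P.* iDz k)}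
          (Lk.*-congʳ {Lo.ι (iDz k)} {Lk.1# Lk.- Lo.ι (P.pow q⁰ (suc k))} {Lo.ι (P.1# P.- P.pow q⁰ (suc k))}
            (Lk.sym {Lo.ι (P.1# P.- P.pow q⁰ (suc k))} {Lk.1# Lk.- Lo.ι (P.pow q⁰ (suc k))} (Hom.ap-- Lo.ιʰ P.1# (P.pow q⁰ (suc k)))))
          (Lk.sym {Lo.ι ((P.1# P.- P.pow q⁰ (suc k)) P.* iDz k)} {Lo.ι (P.1# P.- P.pow q⁰ (suc k)) Lk.* Lo.ι (iDz k)} (Hom.ap-* Lo.ιʰ (P.1# P.- P.pow q⁰ (suc k)) (iDz k))))
        (Hom.ap-cong Lo.ιʰ {(P.1# P.- P.pow q⁰ (suc k)) P.* iDz k} {P.1#} (iDz-inv k)) }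
  ; ιʰ = Lo.ιʰ
  ; qz-ι = λ m → Hom.ap-pow Lo.ιʰ q⁰ m
  ; coeffZ = cf
  ; coeffZ-cong = λ {x} {y} e k → cf-cong x y e k
  ; coeffZ-+ = cf-+
  ; coeffZ-0 = λ k → zero-look (k ℤ.+ ℤ.+ 0)
  ; coeffZ-shift = cf-shift }
  where
  module P = Kit ℤq
  module Lk = Kit Lo.loc
  open Localisation.Frac

  -- The denominator q^ex shifts exponents by ex. The result respects equality of fractions, because
  -- multiplying by a denominator and adding its exponent cancel (`look-den`).
  cf : Lo.Frac → ℤ → ℤ
  cf x k = lookZ (num x) (k ℤ.+ ℤ.+ ex x)

  look-cong : ∀ {f g : ℕ → ℤ} → (∀ j → f j ≡ g j) → ∀ i → lookZ f i ≡ lookZ g i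
  look-cong e (ℤ.+ j) = e j
  look-cong e -[1+ j ] = ≡.refl

  zero-look : ∀ i → lookZ (λ _ → ℤ.+ 0) i ≡ ℤ.+ 0
  zero-look (ℤ.+ j) = ≡.refl
  zero-look -[1+ j ] = ≡.refl

  look-+ : ∀ f g i → lookZ (λ j → f j ℤ.+ g j) i ≡ lookZ f i ℤ.+ lookZ g i
  look-+ f g (ℤ.+ j) = ≡.refl
  look-+ f g -[1+ j ] = ≡.refl

  look-X : ∀ f i → lookZ (q⁰ P.* f) (i ℤ.+ ℤ.+ 1) ≡ lookZ f i
  look-X f (ℤ.+ j) = ≡.trans (≡.cong (q⁰ P.* f) (ℕₚ.+-comm j 1)) (X-*-suc ℤring f j)
  look-X f -[1+ zero ] = X-*-zero ℤring f
  look-X f -[1+ suc j ] = ≡.refl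

  look-pow : ∀ s f i → lookZ (P.pow q⁰ s P.* f) (i ℤ.+ ℤ.+ s) ≡ lookZ f i
  look-pow zero f i = ≡.trans (≡.cong (lookZ (P.1# P.* f)) (ℤₚ.+-identityʳ i)) (look-cong (P.*-identityˡ f) i)
  look-pow (suc s) f i = ≡.trans (look-cong (P.*-assoc q⁰ (P.pow q⁰ s) f) (i ℤ.+ ℤ.+ suc s))
    (≡.trans (≡.cong (lookZ (q⁰ P.* (P.pow q⁰ s P.* f))) (≡.trans (≡.cong (λ k → i ℤ.+ ℤ.+ k) (ℕₚ.+-comm 1 s)) (≡.sym (ℤₚ.+-assoc i (ℤ.+ s) (ℤ.+ 1)))))
      (≡.trans (look-X (P.pow q⁰ s P.* f) (i ℤ.+ ℤ.+ s)) (look-pow s f i)))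

  look-den : ∀ (y : Lo.Frac) f i → lookZ (den y P.* f) (i ℤ.+ ℤ.+ ex y) ≡ lookZ f i
  look-den y f i = ≡.trans (look-cong (P.*-congʳ {f} (den-pow y)) (i ℤ.+ ℤ.+ ex y)) (look-pow (ex y) f i)

  swap-ex : ∀ k a b → (k ℤ.+ a) ℤ.+ b ≡ (k ℤ.+ b) ℤ.+ a
  swap-ex k a b = Z.solve 3 (λ k a b → (k Z.:+ a) Z.:+ b Z.:= (k Z.:+ b) Z.:+ a) ≡.refl k a b

  cf-cong : ∀ x y → x Lk.≈ y → ∀ k → cf x k ≡ cf y k
  cf-cong x y e k = ≡.trans (≡.sym (look-den y (num x) (k ℤ.+ ℤ.+ ex x))) (≡.trans (look-cong e ((k ℤ.+ ℤ.+ ex x) ℤ.+ ℤ.+ ex y))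
    (≡.trans (≡.cong (lookZ (den x P.* num y)) (swap-ex k (ℤ.+ ex x) (ℤ.+ ex y))) (look-den x (num y) (k ℤ.+ ℤ.+ ex y))))

  cf-+ : ∀ x y k → cf (x Lk.+ y) k ≡ cf x k ℤ.+ cf y k
  cf-+ x y k = ≡.trans (≡.cong (lookZ (num (x Lk.+ y))) shift) (≡.trans (look-+ (den y P.* num x) (den x P.* num y) ((k ℤ.+ ℤ.+ ex x) ℤ.+ ℤ.+ ex y)) (≡.cong₂ ℤ._+_
      (look-den y (num x) (k ℤ.+ ℤ.+ ex x)) (≡.trans (≡.cong (lookZ (den x P.* num y)) (swap-ex k (ℤ.+ ex x) (ℤ.+ ex y))) (look-den x (num y) (k ℤ.+ ℤ.+ ex y)))))
    where
    shift : k ℤ.+ ℤ.+ (ex x ℕ.+ ex y) ≡ (k ℤ.+ ℤ.+ ex x) ℤ.+ ℤ.+ ex y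
    shift = ≡.trans (≡.cong (λ t → k ℤ.+ t) (ℤₚ.pos-+ (ex x) (ex y))) (≡.sym (ℤₚ.+-assoc k (ℤ.+ ex x) (ℤ.+ ex y)))

  cf-shift : ∀ s f k → cf (Lo.qz s Lk.* Lo.ι f) k ≡ lookZ f (k ℤ.- s)
  cf-shift (ℤ.+ m) f k = ≡.trans (≡.cong (lookZ (P.pow q⁰ m P.* f)) (≡.trans (ℤₚ.+-identityʳ k) (Z.solve 2 (λ k m → k Z.:= (k Z.:- m) Z.:+ m) ≡.refl k (ℤ.+ m)))) (look-pow m f (k ℤ.- ℤ.+ m))
  cf-shift -[1+ m ] f k = ≡.trans (look-cong (P.*-identityˡ f) (k ℤ.+ ℤ.+ (suc m ℕ.+ 0))) (≡.cong (λ t → lookZ f (k ℤ.+ ℤ.+ t)) (ℕₚ.+-identityʳ (suc m)))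

-- Enumerated partitions and shapes padded with zeros

padN : ℕ → List ℕ → List ℕ
padN zero p = []
padN (suc n) [] = 0 ∷ padN n []
padN (suc n) (a ∷ p) = a ∷ padN n p

padN-length : ∀ n p → length (padN n p) ≡ n
padN-length zero p = ≡.refl
padN-length (suc n) [] = ≡.cong suc (padN-length n [])
padN-length (suc n) (a ∷ p) = ≡.cong suc (padN-length n p)

lam-padN : ∀ n p → lam (padN n p) ≡ lamN n p
lam-padN zero p = ≡.refl
lam-padN (suc n) [] = ≡.cong₂ _∷_ (padN-length n []) (lam-padN n [])
lam-padN (suc n) (a ∷ p) = ≡.cong₂ _∷_ (≡.cong (a ℕ.+_) (padN-length n p)) (lam-padN n p)

padN-++ : ∀ n p → length p ≤ n → padN n p ≡ p ++ rep (n ∸ length p) 0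
padN-++ zero [] len = ≡.refl
padN-++ (suc n) [] len = ≡.cong (0 ∷_) (padN-++ n [] z≤n)
padN-++ (suc n) (a ∷ p) (s≤s len) = ≡.cong (a ∷_) (padN-++ n p len)

decFrom-0 : ∀ sh → decFrom 0 sh ≡ true → tot sh ≡ 0
decFrom-0 [] d = ≡.refl
decFrom-0 (zero ∷ sh) d = decFrom-0 sh d

module PartitionSums (R : Ring₀) where
  open Kit R
  open BoxSums R
  open Kostka R

  bsum-zero : ∀ B n mx (g : List ℕ → A) → 0 < B → bsum B n (λ sh → decFrom mx sh ▹ (tot sh ℕ.≡ᵇ 0) ▹ g sh) ≈ g (padN n [])
  bsum-zero B zero mx g pos = refl
  bsum-zero (suc B) (suc n) mx g pos = trans (+-cong
    (bsum-zero (suc B) n 0 (λ sh → g (0 ∷ sh)) pos)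
    (sumTo-0 B (λ k _ → bsum-0 (suc B) n (λ sh _ _ → ▹-0 ((suc k ℕ.≤ᵇ mx) ∧ decFrom (suc k) sh) (λ _ → refl))))) (+-identityʳ _)

  sumTo-< : ∀ M B (g : ℕ → A) → M ≤ B → sumTo M g ≈ sumTo B (λ k → (k ℕ.<ᵇ M) ▹ g k)
  sumTo-< zero B g le = sym (sumTo-0 B (λ _ _ → refl))
  sumTo-< (suc M) (suc B) g (s≤s le) = +-congˡ (sumTo-< M B (g ∘ suc) le)

  sumL-upTo : ∀ M (g : ℕ → A) → sumL g (upTo M) ≈ sumTo M g
  sumL-upTo zero g = refl
  sumL-upTo (suc M) g = +-congˡ (trans (reflexive (≡.trans (≡.cong (sumL g) (≡.sym (Lₚ.map-upTo suc M))) (sumL-map g suc (upTo M)))) (sumL-upTo M (g ∘ suc)))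

  parts-sum : ∀ n B f s mx (φ φ′ : List ℕ → A) → s ≤ f → s < B →
    (∀ p → decFrom mx p ≡ true → length p ≤ n → φ′ (padN n p) ≈ φ p) → (∀ p → n < length p → φ p ≈ 0#) →
    sumL φ (parts f s mx) ≈ bsum B n (λ sh → decFrom mx sh ▹ (tot sh ℕ.≡ᵇ s) ▹ φ′ sh)
  parts-sum n B f zero mx φ φ′ le lt pad long = trans (trans (reflexive (≡.cong (sumL φ) (parts-zero f))) (trans (+-identityʳ _) (sym (pad [] ≡.refl z≤n)))) (sym (bsum-zero B n mx φ′ lt))
    where
    parts-zero : ∀ f → parts f 0 mx ≡ [] ∷ []
    parts-zero zero = ≡.refl
    parts-zero (suc f) = ≡.refl
  parts-sum zero B (suc f) (suc s) mx φ φ′ le lt pad long = trans (sumL-concatMap φ _ (upTo (mx ℕ.⊓ suc s)))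
    (sumL-0 {P = λ _ → ⊤} (All.universal (λ _ → tt) (upTo (mx ℕ.⊓ suc s))) (λ k _ → trans (reflexive (sumL-map φ (suc k ∷_) (parts f (suc s ∸ suc k) (suc k))))
      (sumL-0 {P = λ _ → ⊤} (All.universal (λ _ → tt) (parts f (suc s ∸ suc k) (suc k))) (λ p _ → long (suc k ∷ p) (s≤s z≤n)))))
  parts-sum (suc n) (suc B) (suc f) (suc s) mx φ φ′ (s≤s le) (s≤s lt) pad long = begin
    sumL φ (concatMap (λ k → map (suc k ∷_) (parts f (s ∸ k) (suc k))) (upTo M))
      ≈⟨ trans (sumL-concatMap φ _ (upTo M)) (trans (sumL-cong′ (λ k → reflexive (sumL-map φ (suc k ∷_) (parts f (s ∸ k) (suc k)))) (upTo M)) (sumL-upTo M _)) ⟩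
    sumTo M (λ k → sumL (λ p → φ (suc k ∷ p)) (parts f (s ∸ k) (suc k)))
      ≈⟨ sumTo-cong M (λ k kM → parts-sum n (suc B) f (s ∸ k) (suc k) (λ p → φ (suc k ∷ p)) (λ sh → φ′ (suc k ∷ sh)) (ℕₚ.≤-trans (ℕₚ.m∸n≤m s k) le) (s≤s (ℕₚ.≤-trans (ℕₚ.m∸n≤m s k) (ℕₚ.≤-trans (ℕₚ.n≤1+n s) lt)))
           (λ p d len → pad (suc k ∷ p) (≡.cong₂ _∧_ (true-≤ᵇ {suc k} {mx} (ℕₚ.≤-trans kM (ℕₚ.m⊓n≤m mx (suc s)))) d) (s≤s len)) (λ p len → long (suc k ∷ p) (s≤s len))) ⟩
    sumTo M g
      ≈⟨ sumTo-< M B g (ℕₚ.≤-trans (ℕₚ.m⊓n≤n mx (suc s)) lt) ⟩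
    sumTo B (λ k → (k ℕ.<ᵇ M) ▹ g k)
      ≈⟨ sumTo-cong B (λ k _ → trans (▹-bsum (k ℕ.<ᵇ M) (suc B) n (λ sh → decFrom (suc k) sh ▹ (tot sh ℕ.≡ᵇ s ∸ k) ▹ φ′ (suc k ∷ sh))) (bsum-cong (suc B) n (λ sh _ _ → rearrange k sh (φ′ (suc k ∷ sh))))) ⟩
    sumTo B (λ k → bsum (suc B) n (λ sh → h (suc k) sh))
      ≈⟨ trans (sym (+-identityˡ _)) (+-congʳ (sym (bsum-0 (suc B) n (λ sh _ _ → ▹-0 ((0 ℕ.≤ᵇ mx) ∧ decFrom 0 sh) (λ d → reflexive (≡.cong (λ t → (t ℕ.≡ᵇ suc s) ▹ φ′ (0 ∷ sh)) (decFrom-0 sh d))))))) ⟩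
    bsum (suc B) n (h 0) + sumTo B (λ k → bsum (suc B) n (h (suc k))) ∎
    where
    M = mx ℕ.⊓ suc s
    g : ℕ → A
    g k = bsum (suc B) n (λ sh → decFrom (suc k) sh ▹ (tot sh ℕ.≡ᵇ s ∸ k) ▹ φ′ (suc k ∷ sh))
    h : ℕ → List ℕ → A
    h k sh = ((k ℕ.≤ᵇ mx) ∧ decFrom k sh) ▹ (k ℕ.+ tot sh ℕ.≡ᵇ suc s) ▹ φ′ (k ∷ sh)
    rearrange : ∀ k sh x → (k ℕ.<ᵇ M) ▹ decFrom (suc k) sh ▹ (tot sh ℕ.≡ᵇ s ∸ k) ▹ x ≈ ((suc k ℕ.≤ᵇ mx) ∧ decFrom (suc k) sh) ▹ (suc k ℕ.+ tot sh ℕ.≡ᵇ suc s) ▹ x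
    rearrange k sh x = trans (trans (▹-comm (k ℕ.<ᵇ M) (decFrom (suc k) sh) _) (▹-cong (decFrom (suc k) sh) (λ _ → trans (sym (▹-∧ (k ℕ.<ᵇ M) (tot sh ℕ.≡ᵇ s ∸ k))) (trans (reflexive (≡.cong (_▹ x) bools)) (▹-∧ (suc k ℕ.≤ᵇ mx) _)))))
      (trans (▹-comm (decFrom (suc k) sh) (suc k ℕ.≤ᵇ mx) _) (sym (▹-∧ (suc k ℕ.≤ᵇ mx) (decFrom (suc k) sh))))
      where
      bools : (k ℕ.<ᵇ M) ∧ (tot sh ℕ.≡ᵇ s ∸ k) ≡ (suc k ℕ.≤ᵇ mx) ∧ (suc k ℕ.+ tot sh ℕ.≡ᵇ suc s)
      bools = bool-iff
        (λ e → let (e₁ , e₂) = ∧-true (k ℕ.<ᵇ M) _ e in let kM = ≤ᵇ-true (suc k) M e₁ in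
          ≡.cong₂ _∧_ (true-≤ᵇ {suc k} {mx} (ℕₚ.≤-trans kM (ℕₚ.m⊓n≤m mx (suc s))))
            (true-≡ᵇ {k ℕ.+ tot sh} {s} (≡.trans (≡.cong (k ℕ.+_) (≡ᵇ-true (tot sh) (s ∸ k) e₂)) (ℕₚ.m+[n∸m]≡n (ℕₚ.≤-pred (ℕₚ.≤-trans kM (ℕₚ.m⊓n≤n mx (suc s))))))))
        (λ e → let (e₁ , e₂) = ∧-true (suc k ℕ.≤ᵇ mx) _ e in let q = ≡ᵇ-true (k ℕ.+ tot sh) s e₂ in
          ≡.cong₂ _∧_ (true-≤ᵇ {suc k} {M} (ℕₚ.⊓-glb (≤ᵇ-true (suc k) mx e₁) (s≤s (≡.subst (k ≤_) q (ℕₚ.m≤m+n k (tot sh))))))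
            (true-≡ᵇ {tot sh} {s ∸ k} (≡.trans (≡.sym (ℕₚ.m+n∸m≡n k (tot sh))) (≡.cong (_∸ k) q))))

  decFrom-tot : ∀ sh → decFrom (tot sh) sh ≡ dec sh
  decFrom-tot [] = ≡.refl
  decFrom-tot (a ∷ sh) = ≡.cong (_∧ decFrom a sh) (true-≤ᵇ {a} {a ℕ.+ tot sh} (ℕₚ.m≤m+n a (tot sh)))

  partitions-sum : ∀ n B D (φ φ′ : List ℕ → A) → D < B →
    (∀ p → dec p ≡ true → length p ≤ n → φ′ (padN n p) ≈ φ p) → (∀ p → n < length p → φ p ≈ 0#) → (∀ sh → ¬ tot sh ≡ D → φ′ sh ≈ 0#) →
    sumL φ (partitionsUpTo D) ≈ bsum B n (λ sh → dec sh ▹ φ′ sh)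
  partitions-sum n B D φ φ′ lt pad long size = begin
    sumL φ (concatMap partitionsOf (upTo (suc D)))
      ≈⟨ trans (sumL-concatMap φ partitionsOf (upTo (suc D))) (sumL-upTo (suc D) _) ⟩
    sumTo (suc D) (λ s → sumL φ (parts s s s))
      ≈⟨ sumTo-cong (suc D) (λ s sD → parts-sum n B s s s φ φ′ ℕₚ.≤-refl (ℕₚ.≤-trans sD lt) (λ p d → pad p (dec-tail p d)) long) ⟩
    sumTo (suc D) (λ s → bsum B n (λ sh → decFrom s sh ▹ (tot sh ℕ.≡ᵇ s) ▹ φ′ sh))
      ≈⟨ bsum-sumTo B n (suc D) (λ sh s → decFrom s sh ▹ (tot sh ℕ.≡ᵇ s) ▹ φ′ sh) ⟨
    bsum B n (λ sh → sumTo (suc D) (λ s → decFrom s sh ▹ (tot sh ℕ.≡ᵇ s) ▹ φ′ sh))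
      ≈⟨ bsum-cong B n (λ sh _ _ → collapse sh) ⟩
    bsum B n (λ sh → dec sh ▹ φ′ sh) ∎
    where
    collapse : ∀ sh → sumTo (suc D) (λ s → decFrom s sh ▹ (tot sh ℕ.≡ᵇ s) ▹ φ′ sh) ≈ dec sh ▹ φ′ sh
    collapse sh with tot sh ℕ.≟ D
    ... | no ne = trans (sumTo-0 (suc D) (λ s _ → ▹-0 (decFrom s sh) (λ _ → ▹-0 (tot sh ℕ.≡ᵇ s) (λ _ → size sh ne)))) (sym (▹-0 (dec sh) (λ _ → size sh ne)))
    ... | yes e = trans (sumTo-cong (suc D) (λ s _ → trans (▹-comm (decFrom s sh) (tot sh ℕ.≡ᵇ s) _) (reflexive (≡.cong (_▹ (decFrom s sh ▹ φ′ sh)) (≡ᵇ-iff {tot sh} {s} {s} {D} (λ q → ≡.trans (≡.sym q) e) (λ q → ≡.trans e (≡.sym q)))))))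
      (trans (sumTo-point (suc D) D (λ s → decFrom s sh ▹ φ′ sh) ℕₚ.≤-refl) (reflexive (≡.cong (_▹ φ′ sh) (≡.trans (≡.cong (λ t → decFrom t sh) (≡.sym e)) (decFrom-tot sh)))))

  kos-pad : ∀ n N p e → length p ≤ N → kos n (padN N p) e ≈ kos n p e
  kos-pad n N p e len = trans (reflexive (≡.cong (λ q → kos n q e) (padN-++ N p len))) (go (N ∸ length p) p)
    where
    go : ∀ k p → kos n (p ++ rep k 0) e ≈ kos n p e
    go zero p = reflexive (≡.cong (λ q → kos n q e) (Lₚ.++-identityʳ p))
    go (suc k) p = trans (reflexive (≡.cong (λ q → kos n q e) (≡.sym (Lₚ.++-assoc p (0 ∷ []) (rep k 0))))) (trans (go k (p ++ 0 ∷ [])) (kos-∷ʳ n p e))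

-- Assembling both sides

par-%2-odd : ∀ h → does (h ℕ.% 2 ℕ.≟ 1) ≡ not (par h)
par-%2-odd zero = ≡.refl
par-%2-odd (suc zero) = ≡.refl
par-%2-odd (suc (suc h)) = ≡.trans (≡.cong (λ r → does (r ℕ.≟ 1)) (≡.trans (≡.cong (ℕ._% 2) (ℕₚ.+-comm 2 h)) (DM.[m+n]%n≡m%n h 2)))
  (≡.trans (par-%2-odd h) (≡.cong not (≡.sym (Boolₚ.not-involutive (par h)))))

tabulate-∷ʳ : ∀ {n} (h : Fin (suc n) → ℕ) → Vec.tabulate h ≡ Vec.tabulate (h ∘ Fin.inject₁) Vec.∷ʳ h (Fin.fromℕ n)
tabulate-∷ʳ {zero} h = ≡.refl
tabulate-∷ʳ {suc n} h = ≡.cong (h zero ∷_) (tabulate-∷ʳ (h ∘ suc))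

rev-content : ∀ n T → rev (content n T) ≡ cont n (L.concat T)
rev-content zero T = ≡.refl
rev-content (suc n) T = ≡.trans (≡.cong rev (tabulate-∷ʳ (λ k → occ (suc (Fin.toℕ k)) w))) (≡.trans (rev-∷ʳ (Vec.tabulate {n = n} (λ k → occ (suc (Fin.toℕ (Fin.inject₁ k))) w)) _)
  (≡.cong₂ _∷_ (≡.cong (λ k → occ (suc k) w) (Finₚ.toℕ-fromℕ n)) (≡.trans (≡.cong rev (Vecₚ.tabulate-cong (λ k → ≡.cong (λ t → occ (suc t) w) (Finₚ.toℕ-inject₁ k)))) (rev-content n T))))
  where
  w = L.concat T

sum-∷ʳ : ∀ {n} (e : Vec ℕ n) a → Vec.sum (e Vec.∷ʳ a) ≡ a ℕ.+ Vec.sum e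
sum-∷ʳ [] a = ≡.refl
sum-∷ʳ (b ∷ e) a = ≡.trans (≡.cong (b ℕ.+_) (sum-∷ʳ e a)) (≡.trans (≡.sym (ℕₚ.+-assoc b a _)) (≡.trans (≡.cong (ℕ._+ Vec.sum e) (ℕₚ.+-comm b a)) (ℕₚ.+-assoc a b _)))

sum-rev : ∀ {n} (e : Vec ℕ n) → Vec.sum (rev e) ≡ Vec.sum e
sum-rev [] = ≡.refl
sum-rev (a ∷ e) = ≡.trans (sum-∷ʳ (rev e) a) (≡.cong (a ℕ.+_) (sum-rev e))

lookZ-cong : ∀ {f g : ℕ → ℤ} → (∀ j → f j ≡ g j) → ∀ i → lookZ f i ≡ lookZ g i
lookZ-cong e (ℤ.+ j) = e j
lookZ-cong e -[1+ j ] = ≡.refl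

IsPartition : List ℕ → Set
IsPartition p = dec p ≡ true × All (1 ≤_) p

parts-partition : ∀ f s mx → All (λ p → decFrom mx p ≡ true × All (1 ≤_) p) (parts f s mx)
parts-partition zero zero mx = (≡.refl , []) ∷ []
parts-partition (suc f) zero mx = (≡.refl , []) ∷ []
parts-partition zero (suc s) mx = []
parts-partition (suc f) (suc s) mx = Allₚ.concat⁺ (Allₚ.map⁺ (Allₚ.applyUpTo⁺₁ id (mx ℕ.⊓ suc s) (λ {k} lt → Allₚ.map⁺ (All.map (λ { (d , pos) →
  ≡.cong₂ _∧_ (true-≤ᵇ {suc k} {mx} (ℕₚ.≤-trans lt (ℕₚ.m⊓n≤m mx (suc s)))) d , s≤s z≤n ∷ pos }) (parts-partition f (suc s ∸ suc k) (suc k))))))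

partitions-partition : ∀ D → All IsPartition (partitionsUpTo D)
partitions-partition D = Allₚ.concat⁺ (Allₚ.map⁺ (All.universal (λ s → All.map (λ { {p} (d , pos) → dec-tail p d , pos }) (parts-partition s s s)) (upTo (suc D))))

positive-long : ∀ n p → All (1 ≤_) p → n < length p → Long n p
positive-long zero (a ∷ p) (pos ∷ _) lt = here pos
positive-long (suc n) (a ∷ p) (_ ∷ ps) (s≤s lt) = there (positive-long n p ps lt)

even-or-odd : ∀ n → Σ ℕ (λ m → n ≡ dbl m) ⊎ Σ ℕ (λ m → suc n ≡ dbl m)
even-or-odd zero = inj₁ (0 , ≡.refl)
even-or-odd (suc n) with even-or-odd n
... | inj₁ (m , e) = inj₂ (suc m , ≡.cong (λ k → suc (suc k)) e)
... | inj₂ (m , e) = inj₁ (m , e)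

par-dbl : ∀ m → par (dbl m) ≡ true
par-dbl zero = ≡.refl
par-dbl (suc m) = ≡.trans (Boolₚ.not-involutive _) (par-dbl m)

module Assembly (La : Laurent) where
  open Laurent La
  open QRing Q
  open Kostka R
  open Littlewood R using (at; at-cong; product; product-zero)

  module _ (n : ℕ) where
    open RhsHat R ιʰ n
    open Variables R using (cstʰ)
    private
      module M = Kit (MPS R n)
      module VL = VecConv R
      module AV = AtVariables R

    at-+ : ∀ n x y e → at n (CommutativeRing._+_ (MPS R n) x y) e ≡ at n x e + at n y e
    at-+ zero x y [] = ≡.refl
    at-+ (suc n) x y (a ∷ e) = at-+ n (x a) (y a) e

    at-cst-* : ∀ n c x e → at n (CommutativeRing._*_ (MPS R n) (ap (cstʰ n) c) x) e ≈ c * at n x e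
    at-cst-* zero c x [] = refl
    at-cst-* (suc n) c x (a ∷ e) = trans (at-cong n (const-* (MPS R n) (ap (cstʰ n) c) x a) e) (at-cst-* n c (x a) e)

    hat-Σ : ∀ {I : Set} (F : I → Ser (suc n)) xs e → at n (hat (Σₛ (map F xs))) e ≈ sumL (λ x → at n (hat (F x)) e) xs
    hat-Σ F [] e = trans (reflexive (VL.at-cur n _ e)) (Hom.ap-0 ιʰ)
    hat-Σ F (x ∷ xs) e = trans (at-cong n (hat-+ (F x) (Σₛ (map F xs))) e) (trans (reflexive (at-+ n _ _ e)) (+-congˡ (hat-Σ F xs e)))

    sumL-filter : ∀ {I : Set} (b : I → Bool) (φ : I → A) xs → sumL φ (L.filter (λ x → T? (b x)) xs) ≈ sumL (λ x → b x ▹ φ x) xs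
    sumL-filter b φ [] = refl
    sumL-filter b φ (x ∷ xs) with b x
    ... | true = +-congˡ (sumL-filter b φ xs)
    ... | false = trans (sumL-filter b φ xs) (sym (+-identityˡ _))

    hat-schur : ∀ p e → dec p ≡ true → at n (hat (schur n p)) e ≈ kos n p e
    hat-schur p e d = trans (hat-Σ (λ T → monomial (ℤ.+ 1) (0 ∷ content n T)) (L.filter (λ T → T? (isSSYT p T)) (fillings p n)) e)
      (trans (sumL-filter (isSSYT p) (λ T → at n (hat (monomial (ℤ.+ 1) (0 ∷ content n T))) e) (fillings p n))
        (sumL-cong (fillings-shape p n) (λ T s → trans (reflexive (≡.cong (_▹ at n (hat (monomial (ℤ.+ 1) (0 ∷ content n T))) e) (isSSYT-chk n p T d s)))
          (▹-cong (chkFrom (rep (head-or-0 p) 0) T) (λ _ → trans (hat-monomial 0 (content n T) e) (reflexive (≡.cong (λ c → (c ≡ᵛ e) ▹ 1#) (rev-content n T))))))))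

    hat-D : ∀ h → hat (1ₛ -ₛ qv ^ₛ h) M.≈ ap (cstʰ n) (D h)
    hat-D h = M.trans (hat-- 1ₛ (qv ^ₛ h)) (M.sym (M.trans (Hom.ap-- (cstʰ n) 1# (qz (ℤ.+ h))) (M.+-cong (M.trans (Hom.ap-1 (cstʰ n)) (M.sym hat-1))
      (M.-‿cong (M.trans (Hom.ap-cong (cstʰ n) (qz-ι h)) (M.trans (Hom.ap-pow (cstʰ n) qL h) (M.sym (M.trans (hat-^ qv h) (M.pow-cong h hat-q)))))))))

    hat-ΠD : ∀ hs → hat (Πₛ (map (λ h → 1ₛ -ₛ qv ^ₛ h) hs)) M.≈ ap (cstʰ n) (prodL D hs)
    hat-ΠD hs = M.trans (hat-Π (λ h → 1ₛ -ₛ qv ^ₛ h) hs) (M.trans (M.prodL-cong hat-D hs) (M.sym (Hom.ap-prodL (cstʰ n) D hs)))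

    ct-ΠD : ∀ hs → All (1 ≤_) hs → ct {suc n} (Πₛ (map (λ h → 1ₛ -ₛ qv ^ₛ h) hs)) ≡ ℤ.+ 1
    ct-ΠD [] [] = ct-1 (suc n)
    ct-ΠD (suc h ∷ hs) (_ ∷ pos) = ≡.trans (ct-* {suc n} (1ₛ -ₛ qv ^ₛ suc h) (Πₛ (map (λ h → 1ₛ -ₛ qv ^ₛ h) hs)))
      (≡.cong₂ ℤ._*_ (ct-1- {suc n} (qv ^ₛ suc h) (ct-*0 {suc n} qv (qv ^ₛ h) (ct-var {suc n} zero))) (ct-ΠD hs pos))

    prod-iv : ∀ hs → All (1 ≤_) hs → prodL D hs * prodL iv hs ≈ 1#
    prod-iv [] [] = *-identityˡ _
    prod-iv (suc h ∷ hs) (_ ∷ pos) = trans (solve 4 (λ a b c d → (a :* b) :* (c :* d) := (a :* c) :* (b :* d)) refl _ _ _ _) (trans (*-cong (iD-inv h) (prod-iv hs pos)) (*-identityˡ _))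

    split-hooks : ∀ hs → prodL D (L.filter (λ h → h ℕ.% 2 ℕ.≟ 1) hs) * prodL iv (L.filter (λ h → h ℕ.% 2 ℕ.≟ 0) hs) ≈ prodL w hs
    split-hooks [] = *-identityˡ _
    split-hooks (h ∷ hs) = trans (reflexive (≡.cong₂ _*_ (unfold (λ h → h ℕ.% 2 ℕ.≟ 1) D (par-%2-odd h)) (unfold (λ h → h ℕ.% 2 ℕ.≟ 0) iv (par-%2 h)))) (go (par h) (split-hooks hs))
      where
      unfold : ∀ {P : ℕ → Set} (P? : ∀ h → Dec (P h)) (g : ℕ → A) {b} → does (P? h) ≡ b →
        prodL g (L.filter P? (h ∷ hs)) ≡ (if b then g h * prodL g (L.filter P? hs) else prodL g (L.filter P? hs))
      unfold P? g e with does (P? h)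
      unfold P? g ≡.refl | true = ≡.refl
      unfold P? g ≡.refl | false = ≡.refl
      go : ∀ b {x y z} → x * y ≈ z → (if not b then D h * x else x) * (if b then iv h * y else y) ≈ (if b then iv h else D h) * z
      go true e = trans (solve 3 (λ i x y → x :* (i :* y) := i :* (x :* y)) refl _ _ _) (*-congˡ e)
      go false e = trans (*-assoc _ _ _) (*-congˡ e)

    hooks-positive : ∀ p → All (1 ≤_) (hooks p)
    hooks-positive p = Allₚ.map⁺ (All.universal (λ { (i , j) → ℕₚ.m≤n+m 1 _ }) (cells p))

    hat-hookFactor : ∀ p → hat (hookFactor n p) M.≈ ap (cstʰ n) (prodL w (hooks p))
    hat-hookFactor p = M.trans (hat-* odds (invₛ evens)) (M.trans (M.*-cong (hat-ΠD (hooksOdd p)) inverse) (M.trans (M.sym (Hom.ap-* (cstʰ n) (prodL D (hooksOdd p)) (prodL iv (hooksEven p)))) (Hom.ap-cong (cstʰ n) (split-hooks (hooks p)))))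
      where
      odds evens : Ser (suc n)
      odds = Πₛ (map (λ h → 1ₛ -ₛ qv ^ₛ h) (hooksOdd p))
      evens = Πₛ (map (λ h → 1ₛ -ₛ qv ^ₛ h) (hooksEven p))
      pos : All (1 ≤_) (hooksEven p)
      pos = Allₚ.filter⁺ (λ h → h ℕ.% 2 ℕ.≟ 0) (hooks-positive p)
      inverse : hat (invₛ evens) M.≈ ap (cstʰ n) (prodL iv (hooksEven p))
      inverse = M.inverse-unique (hat-inv evens (ct-ΠD (hooksEven p) pos)) (M.trans (M.*-congʳ (hat-ΠD (hooksEven p))) (M.trans (M.sym (Hom.ap-* (cstʰ n) (prodL D (hooksEven p)) (prodL iv (hooksEven p))))
        (M.trans (Hom.ap-cong (cstʰ n) (prod-iv (hooksEven p) pos)) (Hom.ap-1 (cstʰ n)))))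

    at-hat : ∀ f e → at n (hat f) e ≈ ap ιʰ (coef f e)
    at-hat f e = reflexive (VL.at-cur n _ e)

    summand : ∀ p e → dec p ≡ true → ap ιʰ (coef (hookFactor n p *ₛ schur n p) e) ≈ prodL w (hooks p) * kos n p e
    summand p e d = trans (sym (at-hat (hookFactor n p *ₛ schur n p) e)) (trans (at-cong n (M.trans (hat-* (hookFactor n p) (schur n p)) (M.*-congʳ (hat-hookFactor p))) e)
      (trans (at-cst-* n (prodL w (hooks p)) (hat (schur n p)) e) (*-congˡ (hat-schur p e d))))

  module Identity (ex : Exponents Q) (β : Partition → ℤ)
    (β-HP : ∀ N p → length p ≤ N → dec p ≡ true → Coeffs.bal (FromExponents.coeffs Q ex) (lamN N p) ≡ true → β p ≡ HPℤ.HP N p (Exponents.γ ex)) where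
    open FromExponents Q ex using (coeffs; C-hooks; prod≡prodL; z-diff₀; G-odd; G-step)
    open Coeffs coeffs using (C; C-alt; bal; f; f-0; f-odd; z; G)
    open Exponents ex using (γ; t) renaming (β to βe)
    open SignedHooks Q ex using (wt-bal; bal-wt)
    private module HR = HookProducts *-commutativeMonoid

    hooks-HP : ∀ N p → length p ≤ N → dec p ≡ true → HR.HP N p (λ _ → w) ≈ prodL w (hooks p)
    hooks-HP N p len d = trans (sym (HR.cellProd-HP N p (λ _ → w) (λ _ _ h → w h) len d (λ _ _ _ _ → refl)))
      (reflexive (≡.trans (prod≡prodL (λ c → w (hook p c)) (cells p)) (≡.sym (prodL-map w (hook p) (cells p)))))

    module _ (N : ℕ) (N-even : par N ≡ true) where

      C-tileable : ∀ p → length p ≤ N → dec p ≡ true → Tileable p → C (lamN N p) ≈ qz (β p) * prodL w (hooks p)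
      C-tileable p len d t = trans (C-hooks N p len d b) (*-cong (reflexive (≡.cong qz (≡.sym (β-HP N p len d b)))) (hooks-HP N p len d))
        where
        b : bal (lamN N p) ≡ true
        b = bal-wt (lamN N p) (proj₁ (tileable⇔wt N p N-even len d) t)

      C-not-tileable : ∀ p → length p ≤ N → dec p ≡ true → ¬ Tileable p → C (lamN N p) ≈ 0#
      C-not-tileable p len d nt with bal (lamN N p) in b
      ... | false = refl
      ... | true = ⊥-elim (nt (proj₂ (tileable⇔wt N p N-even len d) (wt-bal (lamN N p) b)))

    module _ (tile? : (p : Partition) → Dec (Tileable p)) (n : ℕ) (N : ℕ) (N-even : par N ≡ true) (n≤N : n ≤ N) (e : Vec ℕ n) where

      -- The contribution of p. A shape with more than N rows has no λ + δ of length N and is cut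
      -- off; its Schur function in n ≤ N variables vanishes.
      φ : List ℕ → A
      φ p = (length p ℕ.≤ᵇ N) ▹ (kos n p (rev e) * C (lamN N p))

      term : ℤ → Partition → ℤ
      term k p = shiftCoeff (β p) (hookFactor n p *ₛ schur n p) k e

      term-coeffZ : ∀ k p → dec p ≡ true → term k p ≡ coeffZ (qz (β p) * (prodL w (hooks p) * kos n p (rev e))) k
      term-coeffZ k p d = ≡.trans (shiftCoeff-lookZ (β p) S k e) (≡.trans (lookZ-cong (λ j → ≡.cong (λ v → S (j ∷ v)) (≡.sym (rev-rev e))) (k ℤ.- β p))
        (≡.trans (≡.sym (coeffZ-shift (β p) (Hat.coef R ιʰ n S (rev e)) k)) (coeffZ-cong (*-congˡ (summand n p (rev e) d)) k)))
        where
        S : Ser (suc n)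
        S = hookFactor n p *ₛ schur n p

      φ-short : ∀ p → length p ≤ N → φ p ≡ kos n p (rev e) * C (lamN N p)
      φ-short p len = ≡.cong (_▹ (kos n p (rev e) * C (lamN N p))) (true-≤ᵇ {length p} {N} len)

      φ-long : ∀ p → N < length p → φ p ≡ 0#
      φ-long p lt = ≡.cong (_▹ (kos n p (rev e) * C (lamN N p))) (not-le (length p ℕ.≤ᵇ N) ≡.refl)
        where
        not-le : ∀ b → (length p ℕ.≤ᵇ N) ≡ b → b ≡ false
        not-le true q = ⊥-elim (ℕₚ.<⇒≱ lt (≤ᵇ-true (length p) N q))
        not-le false q = ≡.refl

      φ-yes : ∀ p → IsPartition p → Tileable p → qz (β p) * (prodL w (hooks p) * kos n p (rev e)) ≈ φ p
      φ-yes p (d , pos) t with ℕₚ.≤-<-connex (length p) N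
      ... | inj₁ len = sym (trans (reflexive (φ-short p len)) (trans (*-congˡ (C-tileable N N-even p len d t)) (solve 3 (λ k q h → k :* (q :* h) := q :* (h :* k)) refl _ _ _)))
      ... | inj₂ lt = trans (zeroʳ′ (zeroʳ′ (kos-long n p (rev e) (positive-long n p pos (ℕₚ.≤-<-trans n≤N lt))))) (sym (reflexive (φ-long p lt)))

      φ-no : ∀ p → IsPartition p → ¬ Tileable p → φ p ≈ 0#
      φ-no p (d , pos) nt with ℕₚ.≤-<-connex (length p) N
      ... | inj₁ len = trans (reflexive (φ-short p len)) (zeroʳ′ (C-not-tileable N N-even p len d nt))
      ... | inj₂ lt = reflexive (φ-long p lt)

      lhs-sum : ∀ k ps → All IsPartition ps → sumℤ (map (term k) (L.filter tile? ps)) ≡ coeffZ (sumL φ ps) k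
      lhs-sum k [] [] = ≡.sym (coeffZ-0 k)
      lhs-sum k (p ∷ ps) (part ∷ rest) with tile? p
      ... | yes t = ≡.trans (≡.cong₂ ℤ._+_ (≡.trans (term-coeffZ k p (proj₁ part)) (coeffZ-cong (φ-yes p part t) k)) (lhs-sum k ps rest)) (≡.sym (coeffZ-+ (φ p) (sumL φ ps) k))
      ... | no nt = ≡.trans (lhs-sum k ps rest) (≡.sym (coeffZ-cong (trans (+-congʳ (φ-no p part nt)) (+-identityˡ _)) k))

    -- `e″` will be the reversed exponent, with a 0 in front if n is odd; the hypothesis on `kos`
    -- covers both cases.
    partition-total : ∀ n m (e : Vec ℕ n) (e″ : Vec ℕ (dbl m)) → Vec.sum e″ ≡ deg e →
      (∀ p → dec p ≡ true → kos (dbl m) p e″ ≈ kos n p (rev e)) →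
      sumL (λ p → (length p ℕ.≤ᵇ dbl m) ▹ (kos n p (rev e) * C (lamN (dbl m) p))) (partitionsUpTo (deg e)) ≈ at (dbl m) (product (dbl m) f) e″
    partition-total n m e e″ s letters = begin
      sumL ψ (partitionsUpTo (deg e))
        ≈⟨ PartitionSums.partitions-sum R N B (deg e) ψ ψ′ (s≤s (ℕₚ.m≤m+n (deg e) (triangle N)))
             (λ p d len → trans (*-cong (trans (PartitionSums.kos-pad R N N p e″ len) (letters p d)) (reflexive (≡.cong C (lam-padN N p)))) (sym (reflexive (≡.cong (_▹ (kos n p (rev e) * C (lamN N p))) (true-≤ᵇ {length p} {N} len)))))
             (λ p lt → ▹-0 (length p ℕ.≤ᵇ N) (λ q → ⊥-elim (ℕₚ.<⇒≱ lt (≤ᵇ-true (length p) N q))))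
             (λ sh ne → zeroˡ′ (kos-size N sh e″ (λ q → ne (≡.trans q s)))) ⟩
      BoxSums.bsum R B N (λ sh → dec sh ▹ ψ′ sh)
        ≈⟨ ShapeSums.F⇒bsum R kos kos-zero kos-suc kos-size N B e″ C C-alt (≡.subst (λ x → x ℕ.+ triangle N < B) (≡.sym s) ℕₚ.≤-refl) ⟨
      at N (FreeSums.F R N C) e″
        ≈⟨ at-cong N (Littlewood.littlewood R coeffs m) e″ ⟩
      at N (product N f) e″ ∎
      where
      N = dbl m
      B = suc (deg e ℕ.+ triangle N)
      ψ ψ′ : List ℕ → A
      ψ p = (length p ℕ.≤ᵇ N) ▹ (kos n p (rev e) * C (lamN N p))
      ψ′ sh = kos N sh e″ * C (lam sh)

    -- An odd n is replaced by n + 1, with the new outermost variable set to zero.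
    left-hand-side : ∀ tile? n k e → lhsCoeff tile? β n k e ≡ coeffZ (at n (product n f) (rev e)) k
    left-hand-side tile? n k e with even-or-odd n
    ... | inj₁ (m , ≡.refl) = ≡.trans (lhs-sum tile? n n (par-dbl m) ℕₚ.≤-refl e k (partitionsUpTo (deg e)) (partitions-partition (deg e)))
          (coeffZ-cong (partition-total n m e (rev e) (sum-rev e) (λ p d → refl)) k)
    ... | inj₂ (m , eq) = ≡.trans (lhs-sum tile? n (suc n) (≡.trans (≡.cong par eq) (par-dbl m)) (ℕₚ.n≤1+n n) e k (partitionsUpTo (deg e)) (partitions-partition (deg e)))
          (coeffZ-cong (trans (go (suc n) eq (0 ∷ rev e) (sum-rev e) (λ p d → kos-zero-letter n p (rev e) d)) (at-cong n (product-zero n f f-0) (rev e))) k)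
      where
      -- N is a variable here so that the equation with `dbl m` can be matched.
      go : ∀ N → N ≡ dbl m → (e″ : Vec ℕ N) → Vec.sum e″ ≡ deg e → (∀ p → dec p ≡ true → kos N p e″ ≈ kos n p (rev e)) →
        sumL (λ p → (length p ℕ.≤ᵇ N) ▹ (kos n p (rev e) * C (lamN N p))) (partitionsUpTo (deg e)) ≈ at N (product N f) e″
      go N ≡.refl e″ s letters = partition-total n m e e″ s letters

    -- `G-step` and `G-odd` lead from f_l over G_(l+1) to f_(l+2) and give f_(l+2) (z_(l+2) - z_0) =
    -- τ f_l (z_(l+1) - z_0); u collects the powers of q.
    f-recurrence : ∀ u → (∀ l → t ℤ.- βe (suc l) (suc l) ℤ.+ βe (2 ℕ.+ l) (2 ℕ.+ l) ≡ u) →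
      ∀ l → D (2 ℕ.+ l) * f (2 ℕ.+ l) ≈ (qz u * D (suc l)) * f l
    f-recurrence u hu l = go (par l) ≡.refl
      where
      b₁ = βe (suc l) (suc l)
      b₂ = βe (2 ℕ.+ l) (2 ℕ.+ l)
      go : ∀ p → par l ≡ p → D (2 ℕ.+ l) * f (2 ℕ.+ l) ≈ (qz u * D (suc l)) * f l
      go false e = trans (zeroʳ′ (f-odd (2 ℕ.+ l) (≡.trans (Boolₚ.not-involutive (par l)) e))) (sym (zeroʳ′ (f-odd l e)))
      go true e = begin
        D (2 ℕ.+ l) * f (2 ℕ.+ l)
          ≈⟨ trans (sym (*-identityˡ _)) (*-congʳ (sym (qz-neg b₂))) ⟩
        (qz b₂ * qz (ℤ.- b₂)) * (D (2 ℕ.+ l) * f (2 ℕ.+ l))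
          ≈⟨ solve 4 (λ q r d f → (q :* r) :* (d :* f) := q :* (f :* (r :* d))) refl _ _ _ _ ⟩
        qz b₂ * (f (2 ℕ.+ l) * (qz (ℤ.- b₂) * D (2 ℕ.+ l)))
          ≈⟨ *-congˡ (trans (*-congˡ (sym (z-diff₀ (suc l)))) (trans (sym (G-step (suc l) (≡.cong not e))) (*-congˡ (trans (G-odd l e) (*-congˡ (z-diff₀ l)))))) ⟩
        qz b₂ * (qz t * (f l * (qz (ℤ.- b₁) * D (suc l))))
          ≈⟨ solve 5 (λ q t f r d → q :* (t :* (f :* (r :* d))) := (((t :* r) :* q) :* d) :* f) refl _ _ _ _ _ ⟩
        (((qz t * qz (ℤ.- b₁)) * qz b₂) * D (suc l)) * f l
          ≈⟨ *-congʳ (*-congʳ (trans (*-congʳ (sym (qz-+ t (ℤ.- b₁)))) (trans (sym (qz-+ (t ℤ.- b₁) b₂)) (reflexive (≡.cong qz (hu l)))))) ⟩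
        (qz u * D (suc l)) * f l ∎

    -- Once q^u (1 - q^(l+1)) is written as α - β₀ q^l, `f-recurrence` is the recurrence of
    -- `q-binomial`, and α and β₀ are the parameters of the two Pochhammer symbols.
    right-hand-side : ∀ α β₀ u n (a b : Fin n → Ser (suc n)) → (∀ i → RhsHat.Quadratic R ιʰ n α i (a i)) → (∀ i → RhsHat.Quadratic R ιʰ n β₀ i (b i)) → (∀ i → ct (a i) ≡ ℤ.+ 0) →
      (∀ l → t ℤ.- βe (suc l) (suc l) ℤ.+ βe (2 ℕ.+ l) (2 ℕ.+ l) ≡ u) →
      (∀ l → qz u * D (suc l) ≈ ap ιʰ α - ap ιʰ β₀ * pow (ap ιʰ q⁰) l) → ∀ k e →
      coeffZ (at n (product n f) (rev e)) k ≡
        shiftCoeff (ℤ.+ 0) (Πₛ (map (λ i → qPoch (b i) (qv ^ₛ 2) *ₛ invₛ (qPoch (a i) (qv ^ₛ 2))) (L.allFin n)) *ₛ crossProd n) k e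
    right-hand-side α β₀ u n a b ha hb ca hu hα k e = ≡.trans (coeffZ-cong (trans (sym (at-cong n (RhsHat.hat-rhs R ιʰ n α β₀ a b ha hb ca f f-0 (f-odd 1 ≡.refl)
            (λ l → trans (*-congʳ (+-congˡ (-‿cong (sym (qz-ι (2 ℕ.+ l)))))) (trans (f-recurrence u hu l) (*-congʳ (hα l))))) (rev e)))
          (trans (at-hat n S (rev e)) (sym (trans (*-congʳ qz-0) (*-identityˡ _))))) k)
      (≡.trans (coeffZ-shift (ℤ.+ 0) (Hat.coef R ιʰ n S (rev e)) k) (≡.trans (lookZ-cong (λ j → ≡.cong (λ v → S (j ∷ v)) (rev-rev e)) (k ℤ.- ℤ.+ 0)) (≡.sym (shiftCoeff-lookZ (ℤ.+ 0) S k e))))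
      where
      S : Ser (suc n)
      S = Πₛ (map (λ i → qPoch (b i) (qv ^ₛ 2) *ₛ invₛ (qPoch (a i) (qv ^ₛ 2))) (L.allFin n)) *ₛ crossProd n

module Specialisations (La : Laurent) where
  open Laurent La
  open QRing Q
  private
    module P = Kit ℤq
    module As = Assembly La

  identity₁ : ∀ tile? n k e → lhsCoeff tile? bstat n k e ≡ shiftCoeff (ℤ.+ 0) (rhs₁ n) k e
  identity₁ tile? n k e = ≡.trans (I.left-hand-side tile? n k e)
    -- Here u = 0 and 1 - q^(l+1) = 1 - q q^l, so the parameters are 1 and q.
    (I.right-hand-side P.1# q⁰ (ℤ.+ 0) n (λ i → xv i ^ₛ 2) (λ i → qv *ₛ xv i ^ₛ 2)
      (quadratic₀ n) (quadratic₁ n) (λ i → ct-*0 (xv i) (xv i ^ₛ 1) (ct-var (suc i)))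
      (λ l → Z.solve 1 (λ l → (Z.:- Z.:1 Z.:- (Z.:1 Z.:+ l)) Z.:+ (Z.:1 Z.:+ (Z.:1 Z.:+ l)) Z.:= Z.:1 Z.:- Z.:1) ≡.refl (ℤ.+ l))
      (λ l → trans (*-congʳ qz-0) (trans (*-identityˡ _) (+-cong (sym (Hom.ap-1 ιʰ)) (-‿cong (qz-ι (suc l)))))) k e)
    where module I = As.Identity (exponents₁ Q) bstat (SignedHooks.bstat-HP Q (exponents₁ Q))

  identity₂ : ∀ tile? n k e → lhsCoeff tile? (λ p → bstat (conj p)) n k e ≡ shiftCoeff (ℤ.+ 0) (rhs₂ n) k e
  identity₂ tile? n k e = ≡.trans (I.left-hand-side tile? n k e)
    -- Here u = 1 and q (1 - q^(l+1)) = q - q² q^l, so the parameters are q and q².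
    (I.right-hand-side q⁰ (P.pow q⁰ 2) (ℤ.+ 1) n (λ i → qv *ₛ xv i ^ₛ 2) (λ i → qv ^ₛ 2 *ₛ xv i ^ₛ 2)
      (quadratic₁ n) (quadratic₂ n) (λ i → ct-*0 qv (xv i ^ₛ 2) (ct-var {suc n} zero))
      (λ l → Z.solve 2 (λ x y → (Z.:1 Z.:- (x Z.:- x)) Z.:+ (y Z.:- y) Z.:= Z.:1) ≡.refl (ℤ.+ suc l) (ℤ.+ (2 ℕ.+ l)))
      (λ l → trans (*-cong (trans (qz-ι 1) (*-identityʳ _)) (+-congˡ (-‿cong (qz-ι (suc l)))))
        (trans (solve 2 (λ q r → q :* (:1 :- (q :* r)) := q :- ((q :* (q :* :1)) :* r)) refl _ _)
          (+-congˡ (-‿cong (*-congʳ (sym (Hom.ap-pow ιʰ q⁰ 2))))))) k e)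
    where module I = As.Identity (exponents₂ Q) (λ p → bstat (conj p)) (bstat-conj-HP Q (exponents₂ Q))

-- Opened only here, since +_ would make the sections (x +_) of ring addition ambiguous.
open import Data.Integer using (+_)

theorem1p1 : (tile? : (p : Partition) → Dec (Tileable p)) →
    (n : ℕ) (k : ℤ) (e : Vec ℕ n) →
    (lhsCoeff tile? bstat n k e ≡ shiftCoeff (+ 0) (rhs₁ n) k e)
    × (lhsCoeff tile? (λ p → bstat (conj p)) n k e ≡ shiftCoeff (+ 0) (rhs₂ n) k e)
theorem1p1 tile? n k e = identity₁ tile? n k e , identity₂ tile? n k e
  where open Specialisations laurent
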